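{- Let $p$ be an odd prime and let $H$ be a non-abelian metacyclic $p$-group. Let $\Gamma$ be a finite, connected, simple, undirected cubic (3-valent) edge-transitive graph which is a bi-Cayley graph over $H$. Then $p=3$, and either $\Gamma$ is isomorphic to the Gray graph, or $\Gamma$ is a normal bi-Cayley graph over $H$.
   Context: A graph $\Gamma$ is a bi-Cayley graph over a group $H$ if $\mathrm{Aut}(\Gamma)$ contains a subgroup isomorphic to $H$ acting semiregularly (all point stabilizers trivial) on $V(\Gamma)$ with exactly two orbits. Equivalently $\Gamma\cong \mathrm{BiCay}(H,R,L,S)$ for subsets $R=R^{ -1}$, $L=L^{ -1}$, $S$ of $H$ with $1\notin R\cup L$: vertex set $H_0\cup H_1$ with $H_i=\{h_i: h\in H\}$, edges $\{h_0,g_0\}$ for $gh^{ -1}\in R$, $\{h_1,g_1\}$ for $gh^{ -1}\in L$, and $\{h_0,g_1\}$ for $gh^{ -1}\in S$; here $H$ acts by $R(g): h_i\mapsto (hg)_i$, giving a semiregular subgroup $R(H)\cong H$ of $\mathrm{Aut}(\Gamma)$ with orbits $H_0,H_1$. The bi-Cayley graph is called normal over $H$ if $R(H)$ is a normal subgroup of $\mathrm{Aut}(\Gamma)$. A group is metacyclic if it has a cyclic normal subgroup with cyclic quotient. A graph is edge-transitive if its automorphism group is transitive on its edges. The Gray graph is the cubic semisymmetric graph on 54 vertices (the smallest cubic semisymmetric graph). -}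

module Defs where

open import Data.Nat using (ℕ; zero; suc; _+_; _*_; _^_; _<ᵇ_; _≡ᵇ_; _/_; _%_)
open import Data.Bool using (Bool; true; false; if_then_else_; _∧_; _∨_)
open import Data.Fin using (Fin; toℕ)
open import Data.List using (List; map; allFin)
open import Data.Nat.ListAction using (sum)
open import Data.Product using (Σ; ∃; ∃-syntax; _×_; _,_)
open import Data.Sum using (_⊎_)
open import Relation.Nullary using (¬_)
open import Relation.Binary.PropositionalEquality using (_≡_; _≢_; refl)
open import Algebra.Structures using (IsGroup)

record FiniteGroup : Set where
  field
    order   : ℕ
    _∙_     : Fin order → Fin order → Fin order
    ε       : Fin order
    _⁻¹     : Fin order → Fin order
    isGroup : IsGroup _≡_ _∙_ ε _⁻¹

  Carrier : Set
  Carrier = Fin order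

  pow : Carrier → ℕ → Carrier
  pow g zero    = ε
  pow g (suc i) = g ∙ pow g i

open FiniteGroup public

IsPGroup : ℕ → FiniteGroup → Set
IsPGroup p H = ∃[ k ] order H ≡ p ^ k

NonAbelian : FiniteGroup → Set
NonAbelian H = ∃[ a ] ∃[ b ] _∙_ H a b ≢ _∙_ H b a

-- H is metacyclic: there is a cyclic normal subgroup N = ⟨g⟩ with H/N
-- cyclic, H/N = ⟨aN⟩, i.e. every element of H lies in a coset a^i N.
Metacyclic : FiniteGroup → Set
Metacyclic H =
  ∃[ g ] ∃[ a ]
    ( (∀ (x : Carrier H) (j : ℕ) → ∃[ j' ]
         _∙_ H (_∙_ H x (pow H g j)) (_⁻¹ H x) ≡ pow H g j')
    × (∀ (h : Carrier H) → ∃[ i ] ∃[ j ] h ≡ _∙_ H (pow H a i) (pow H g j)) )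

record Graph : Set where
  field
    n       : ℕ
    adj     : Fin n → Fin n → Bool
    adj-sym : ∀ x y → adj x y ≡ adj y x
    loopless : ∀ x → adj x x ≡ false

open Graph public

degree : (Γ : Graph) → Fin (n Γ) → ℕ
degree Γ x = sum (map (λ y → if adj Γ x y then 1 else 0) (allFin (n Γ)))

Cubic : Graph → Set
Cubic Γ = ∀ x → degree Γ x ≡ 3

data Walk (Γ : Graph) : Fin (n Γ) → Fin (n Γ) → Set where
  here : ∀ {x} → Walk Γ x x
  step : ∀ {x y z} → adj Γ x y ≡ true → Walk Γ y z → Walk Γ x z

Connected : Graph → Set
Connected Γ = ∀ x y → Walk Γ x y

record Iso (Γ Δ : Graph) : Set where
  field
    to      : Fin (n Γ) → Fin (n Δ)
    from    : Fin (n Δ) → Fin (n Γ)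
    from∘to : ∀ x → from (to x) ≡ x
    to∘from : ∀ y → to (from y) ≡ y
    adj-pres : ∀ x y → adj Δ (to x) (to y) ≡ adj Γ x y

Aut : Graph → Set
Aut Γ = Iso Γ Γ

EdgeTransitive : Graph → Set
EdgeTransitive Γ =
  ∀ u v u' v' → adj Γ u v ≡ true → adj Γ u' v' ≡ true →
    ∃[ σ ] ((Iso.to {Γ} {Γ} σ u ≡ u' × Iso.to σ v ≡ v')
          ⊎ (Iso.to σ u ≡ v' × Iso.to σ v ≡ u'))

-- Bi-Cayley structure: a (right) action ρ of H on V(Γ) by automorphisms,
-- i.e. an (anti)homomorphism H → Aut Γ, which is semiregular with exactly
-- two orbits.  (R(g) : h_i ↦ (hg)_i gives ρ (h ∙ k) = ρ k ∘ ρ h.)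

record BiCayleyAction (H : FiniteGroup) (Γ : Graph) : Set where
  field
    ρ        : Carrier H → Fin (n Γ) → Fin (n Γ)
    ρ-ε      : ∀ v → ρ (ε H) v ≡ v
    ρ-hom    : ∀ h k v → ρ (_∙_ H h k) v ≡ ρ k (ρ h v)
    ρ-adj    : ∀ h u v → adj Γ (ρ h u) (ρ h v) ≡ adj Γ u v
    semiregular : ∀ h v → ρ h v ≡ v → h ≡ ε H
    two-orbits  : ∃[ u₀ ] ∃[ u₁ ]
                    ( (∀ h → ρ h u₀ ≢ u₁)
                    × (∀ v → ∃[ h ] (ρ h u₀ ≡ v ⊎ ρ h u₁ ≡ v)) )

open BiCayleyAction public

NormalBiCayley : {H : FiniteGroup} {Γ : Graph} → BiCayleyAction H Γ → Set
NormalBiCayley {H} {Γ} A =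
  ∀ (σ : Aut Γ) (h : Carrier H) → ∃[ h' ] ∀ v →
    Iso.to σ (ρ A h v) ≡ ρ A h' (Iso.to σ v)

-- The Gray graph: the incidence (Levi) graph of the 27 points of the
-- 3×3×3 grid and the 27 axis-parallel lines (each containing 3 points).
-- Vertex k < 27 is the point (x,y,z) with k = 9x+3y+z; vertex 27+k is the
-- line with (axis,a,b) = (x,y,z) decoded from k in the same way:
-- axis 0: {(t,a,b)}, axis 1: {(a,t,b)}, axis 2: {(a,b,t)}.

private
  c₀ c₁ c₂ : ℕ → ℕ
  c₀ k = (k % 27) / 9
  c₁ k = ((k % 27) / 3) % 3
  c₂ k = k % 3

  -- point with index k, line with index l (both < 27)
  incident : ℕ → ℕ → Bool
  incident k l =
    if c₀ l ≡ᵇ 0 then (c₁ k ≡ᵇ c₁ l) ∧ (c₂ k ≡ᵇ c₂ l)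
    else if c₀ l ≡ᵇ 1 then (c₀ k ≡ᵇ c₁ l) ∧ (c₂ k ≡ᵇ c₂ l)
    else (c₀ k ≡ᵇ c₁ l) ∧ (c₁ k ≡ᵇ c₂ l)

  isPoint : ℕ → Bool
  isPoint k = k <ᵇ 27

  grayAdjℕ : ℕ → ℕ → Bool
  grayAdjℕ i j =
    if isPoint i then (if isPoint j then false else incident i (j % 27))
    else (if isPoint j then incident j (i % 27) else false)

grayAdj : Fin 54 → Fin 54 → Bool
grayAdj i j = grayAdjℕ (toℕ i) (toℕ j)

private
  grayAdjℕ-sym : ∀ i j → grayAdjℕ i j ≡ grayAdjℕ j i
  grayAdjℕ-sym i j with isPoint i | isPoint j
  ... | true  | true  = refl
  ... | true  | false = refl
  ... | false | true  = refl
  ... | false | false = refl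

  grayAdjℕ-irr : ∀ i → grayAdjℕ i i ≡ false
  grayAdjℕ-irr i with isPoint i
  ... | true  = refl
  ... | false = refl

GrayGraph : Graph
GrayGraph = record
  { n        = 54
  ; adj      = grayAdj
  ; adj-sym  = λ x y → grayAdjℕ-sym (toℕ x) (toℕ y)
  ; loopless = λ x → grayAdjℕ-irr (toℕ x)
  }

{-# OPTIONS --safe #-}
module Submission where

-- Let K = Aut Γ. The two orbits of H make T = {t : t moves u₀ to u₀ or u₁} a transversal of H in K.
--
-- If p > 3, the transfer K → H followed by a character χ of H of order p vanishes, since it kills
-- the vertex stabilisers, whose orders are prime to p. Write H = ⟨b⟩⟨g⟩ with ⟨g⟩ normal and b of
-- least possible order. Evaluated at b, all contributions to the transfer cancel except those of
-- the cosets fixed by H; each of these contributes χ(b), because every automorphism of H fixes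
-- b modulo ker χ, and their number is ≡ |T| ≢ 0 mod p. This is a contradiction.
--
-- If p = 3, the same count of fixed cosets gives an automorphism of Γ that normalises H, fixes u₀
-- and rotates its neighbours. So Γ is BiCay(H, ∅, ∅, {1, a, b}), and H has an automorphism α
-- with a ↦ a⁻¹b, b ↦ a⁻¹. The commutator z = a b⁻¹ a⁻¹ b is central, so that the elements of H are
-- the products zᵉ aⁱ bʲ with b a = z a b. Unless z³ = 1 and a³ ∈ ⟨z⟩, the numbers of closed
-- non-backtracking walks of length 12 starting with colours i j i and i j k differ; hence every
-- automorphism of Γ permutes the edge colours and normalises H. In the remaining case
-- |H| = 27 and Γ is the Gray graph.

open import Defs
open import Algebra.Structures using (IsGroup)
open import Data.Bool using (Bool; true; false; if_then_else_; _∧_; _∨_; not; _xor_)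
open import Data.Bool.ListAction using (all)
import Data.Bool.Properties as Boolₚ
open import Data.Empty using (⊥; ⊥-elim)
open import Data.Fin using (Fin; zero; suc; toℕ; fromℕ<; inject≤; finToFun; funToFin; combine)
open import Data.Fin.Properties using (_≟_; any?; all?; toℕ-injective; toℕ<n; toℕ-fromℕ<; pigeonhole; suc-injective; funToFin-finToFin; finToFun-funToFin; inject≤-injective)
open import Data.List using (List; []; _∷_)
import Data.List as List
open import Data.List.Membership.Propositional using (_∈_)
import Data.List.Membership.Propositional.Properties as ∈ₚ
import Data.List.Properties as Listₚ
open import Data.List.Relation.Unary.Any using (Any; here; there; index)
open import Data.Nat using (ℕ; zero; suc; _+_; _*_; _∸_; _^_; _≤_; _<_; z≤n; s≤s; NonZero; ≢-nonZero; ≢-nonZero⁻¹; s≤s⁻¹; _≤ᵇ_; _≡ᵇ_; _<ᵇ_)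
open import Data.Nat.Coprimality using (Coprime; coprime-Bézout; coprime-divisor)
open import Data.Nat.Divisibility using (_∣_; divides; ∣m∣n⇒∣m+n; _∣0; ∣-trans; ∣-refl; ∣m+n∣m⇒∣n; m∣m*n; n∣m*n; ∣⇒≤; ∣m⇒∣m*n; ∣n⇒∣m*n; ∣1⇒≡1; m%n≡0⇒n∣m; _∣?_; ∣-antisym; n∣m⇒m%n≡0; *-cancelʳ-∣; *-monoˡ-∣)
open import Data.Nat.DivMod using (_%_; _/_; m≡m%n+[m/n]*n; m%n<n; _mod_)
open import Data.Nat.GCD using (module Bézout)
open import Data.Nat.Induction using (<-rec)
import Data.Nat.ListAction as ListAction
open import Data.Nat.Primality using (Prime; euclidsLemma; prime⇒nonZero; prime⇒nonTrivial; prime⇒irreducible; prime?; ¬prime[1])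
open import Data.Nat.Properties renaming (_≟_ to _ℕ≟_) hiding (suc-injective)
open import Data.Nat.Solver using (module +-*-Solver)
open import Data.Product using (Σ; ∃-syntax; _×_; _,_; proj₁; proj₂)
open import Data.Product.Properties using (≡-dec)
open import Data.Sum using (_⊎_; inj₁; inj₂; [_,_]′)
open import Data.Unit using (tt)
open import Data.Vec using (Vec; []; _∷_; lookup)
open import Function using (_∘_; id)
open import Relation.Binary.Definitions using (tri<; tri≈; tri>)
open import Relation.Binary.PropositionalEquality
open import Relation.Nullary using (¬_; Dec; yes; no; does; contradiction)
open import Relation.Nullary.Decidable using (dec-true; dec-false; ¬?; _×-dec_; decidable-stable; toWitness)

import Algebra.Properties.CommutativeMonoid.Sum +-0-commutativeMonoid as Sumₚ

-- Finite sums and periodic points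

-- All that enters about vertex stabilisers is how they act on the three neighbours: for p > 3 their
-- orders are prime to p, and for p = 3 the stabiliser of an edge has order prime to 3. Fixed cosets
-- are counted by letting one permutation of p-power order act at a time. The transfer needs more,
-- since its summands vary along the orbits of the powers of g; there they form arithmetic
-- progressions of length p, whose sum vanishes because p is odd.
--
-- For p = 3 a finite enumeration has to settle infinitely many groups. It can, since a walk of
-- length 12 changes the exponents of a and b by at most 6, so that relations modulo 9 are all it
-- sees. When z³ = 1, cubing is a homomorphism and α makes the cubes modulo z a cyclic module over
-- the Eisenstein integers, generated by a³. The case division follows the annihilator of a³: the
-- whole ring leads to the Gray graph, while the prime above 3 and the ideals inside (3) are settled
-- by counting walks. Metacyclicity makes z the cube of a power of g, which excludes a³ = 1.

⟦_⟧ : Bool → ℕ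
⟦ true ⟧ = 1
⟦ false ⟧ = 0

δ : ∀ {n} → Fin n → Fin n → ℕ
δ x y = ⟦ does (x ≟ y) ⟧

δ-≡ : ∀ {n} {x y : Fin n} → x ≡ y → δ x y ≡ 1
δ-≡ {x = x} {y} e = cong ⟦_⟧ (dec-true (x ≟ y) e)

δ-≢ : ∀ {n} {x y : Fin n} → x ≢ y → δ x y ≡ 0
δ-≢ {x = x} {y} e = cong ⟦_⟧ (dec-false (x ≟ y) e)

opaque
  sum : ∀ {n} → (Fin n → ℕ) → ℕ
  sum = Sumₚ.sum

  sum-zero : ∀ (f : Fin 0 → ℕ) → sum f ≡ 0
  sum-zero f = refl

  sum-suc : ∀ {n} (f : Fin (suc n) → ℕ) → sum f ≡ f zero + sum (f ∘ suc)
  sum-suc f = refl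

  sum-cong : ∀ {n} {f g : Fin n → ℕ} → (∀ i → f i ≡ g i) → sum f ≡ sum g
  sum-cong = Sumₚ.sum-cong-≗

  sum-+ : ∀ {n} (f g : Fin n → ℕ) → sum (λ i → f i + g i) ≡ sum f + sum g
  sum-+ = Sumₚ.∑-distrib-+

  sum-comm : ∀ {m n} (f : Fin m → Fin n → ℕ) → sum (λ i → sum (f i)) ≡ sum (λ j → sum (λ i → f i j))
  sum-comm = Sumₚ.∑-comm

  sum-const : ∀ n c → sum {n} (λ _ → c) ≡ n * c
  sum-const zero c = refl
  sum-const (suc n) c = cong (c +_) (sum-const n c)

  sum-*ˡ : ∀ {n} c (f : Fin n → ℕ) → sum (λ i → c * f i) ≡ c * sum f
  sum-*ˡ {zero} c f = sym (*-zeroʳ c)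
  sum-*ˡ {suc n} c f = trans (cong (c * f zero +_) (sum-*ˡ c (f ∘ suc))) (sym (*-distribˡ-+ c _ _))

  sum-mono : ∀ {n} {f g : Fin n → ℕ} → (∀ i → f i ≤ g i) → sum f ≤ sum g
  sum-mono {zero} h = z≤n
  sum-mono {suc n} h = +-mono-≤ (h zero) (sum-mono (h ∘ suc))

  sum-δ : ∀ {n} (x : Fin n) (f : Fin n → ℕ) → sum (λ y → δ x y * f y) ≡ f x
  sum-δ {suc n} zero f = trans (cong₂ _+_ (+-identityʳ (f zero)) (trans (sum-const n 0) (*-zeroʳ n))) (+-identityʳ _)
  sum-δ (suc x) f = sum-δ x (f ∘ suc)

sum-0 : ∀ {n} (f : Fin n → ℕ) → (∀ i → f i ≡ 0) → sum f ≡ 0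
sum-0 {n} f e = trans (sum-cong e) (trans (sum-const n 0) (*-zeroʳ n))

sum-*ʳ : ∀ {n} c (f : Fin n → ℕ) → sum (λ i → f i * c) ≡ sum f * c
sum-*ʳ c f = trans (sum-cong λ i → *-comm (f i) c) (trans (sum-*ˡ c f) (*-comm c _))

sum-δ1 : ∀ {n} (x : Fin n) → sum (λ y → δ x y) ≡ 1
sum-δ1 x = trans (sum-cong λ y → sym (*-identityʳ (δ x y))) (sum-δ x (λ _ → 1))

-- For injective `g` this is the indicator function of its image; it turns a sum over an enumerated
-- orbit into a sum over all points.
hits : ∀ {ℓ n} (g : Fin ℓ → Fin n) → Fin n → ℕ
hits g y = sum (λ i → δ (g i) y)

hits-1 : ∀ {ℓ n} (g : Fin ℓ → Fin n) → (∀ {i j} → g i ≡ g j → i ≡ j) → ∀ i → hits g (g i) ≡ 1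
hits-1 g inj i = trans (sum-cong lem) (sum-δ1 i)
  where
  lem : ∀ j → δ (g j) (g i) ≡ δ i j
  lem j with i ≟ j
  ... | yes e = δ-≡ (cong g (sym e))
  ... | no e = δ-≢ (λ q → e (inj (sym q)))

sum-hits : ∀ {ℓ n} (g : Fin ℓ → Fin n) (f : Fin n → ℕ) → sum (λ y → hits g y * f y) ≡ sum (f ∘ g)
sum-hits g f = begin
  sum (λ y → hits g y * f y) ≡⟨ sum-cong (λ y → sym (sum-*ʳ (f y) (λ i → δ (g i) y))) ⟩
  sum (λ y → sum (λ i → δ (g i) y * f y)) ≡⟨ sum-comm (λ y i → δ (g i) y * f y) ⟩
  sum (λ i → sum (λ y → δ (g i) y * f y)) ≡⟨ sum-cong (λ i → sum-δ (g i) f) ⟩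
  sum (f ∘ g) ∎
  where open ≡-Reasoning

hits-pos : ∀ {ℓ n} (g : Fin ℓ → Fin n) y → hits g y ≡ 0 ⊎ ∃[ i ] g i ≡ y
hits-pos g y with any? (λ i → g i ≟ y)
... | yes h = inj₂ h
... | no h = inj₁ (sum-0 _ λ i → δ-≢ λ e → h (i , e))

sumOn : ∀ {n} → (Fin n → Bool) → (Fin n → ℕ) → ℕ
sumOn B f = sum (λ x → ⟦ B x ⟧ * f x)

card : ∀ {n} → (Fin n → Bool) → ℕ
card B = sum (λ x → ⟦ B x ⟧)

sumOn-1 : ∀ {n} (B : Fin n → Bool) → sumOn B (λ _ → 1) ≡ card B
sumOn-1 B = sum-cong λ x → *-identityʳ ⟦ B x ⟧

card-cong : ∀ {n} {B C : Fin n → Bool} → (∀ x → B x ≡ C x) → card B ≡ card C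
card-cong h = sum-cong λ x → cong ⟦_⟧ (h x)

sumOn-split : ∀ {n} (B C : Fin n → Bool) (f : Fin n → ℕ) →
  sumOn B f ≡ sumOn (λ x → B x ∧ C x) f + sumOn (λ x → B x ∧ not (C x)) f
sumOn-split B C f = trans (sum-cong lem) (sum-+ _ _)
  where
  lem : ∀ x → ⟦ B x ⟧ * f x ≡ ⟦ B x ∧ C x ⟧ * f x + ⟦ B x ∧ not (C x) ⟧ * f x
  lem x with B x | C x
  ... | false | _ = refl
  ... | true | true = sym (+-identityʳ _)
  ... | true | false = refl

∧-true : ∀ {a b} → a ∧ b ≡ true → a ≡ true × b ≡ true
∧-true {true} {true} _ = refl , refl

∧-intro : ∀ {a b} → a ≡ true → b ≡ true → a ∧ b ≡ true
∧-intro refl refl = refl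

-- Both sides are one double sum: on `B` and `C` the relations φ x = y and ψ y = x coincide, which
-- is `core`.
sumOn-bij : ∀ {n m} (B : Fin n → Bool) (C : Fin m → Bool) (f : Fin m → ℕ)
  (φ : Fin n → Fin m) (ψ : Fin m → Fin n) →
  (∀ x → B x ≡ true → C (φ x) ≡ true) → (∀ y → C y ≡ true → B (ψ y) ≡ true) →
  (∀ x → B x ≡ true → ψ (φ x) ≡ x) → (∀ y → C y ≡ true → φ (ψ y) ≡ y) →
  sumOn B (f ∘ φ) ≡ sumOn C f
sumOn-bij B C f φ ψ BC CB ψφ φψ = begin
  sum (λ x → ⟦ B x ⟧ * f (φ x)) ≡⟨ sum-cong (λ x → cong (⟦ B x ⟧ *_) (sym (sum-δ (φ x) f))) ⟩
  sum (λ x → ⟦ B x ⟧ * sum (λ y → δ (φ x) y * f y)) ≡⟨ sum-cong (λ x → sym (sum-*ˡ ⟦ B x ⟧ _)) ⟩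
  sum (λ x → sum (λ y → ⟦ B x ⟧ * (δ (φ x) y * f y))) ≡⟨ sum-comm (λ x y → ⟦ B x ⟧ * (δ (φ x) y * f y)) ⟩
  sum (λ y → sum (λ x → ⟦ B x ⟧ * (δ (φ x) y * f y))) ≡⟨ sum-cong (λ y → sum-cong λ x → lem x y) ⟩
  sum (λ y → sum (λ x → δ (ψ y) x * (⟦ C y ⟧ * f y))) ≡⟨ sum-cong (λ y → sum-δ (ψ y) (λ _ → ⟦ C y ⟧ * f y)) ⟩
  sum (λ y → ⟦ C y ⟧ * f y) ∎
  where
  open ≡-Reasoning
  core : ∀ x y → ⟦ B x ⟧ * δ (φ x) y ≡ δ (ψ y) x * ⟦ C y ⟧
  core x y with B x in bx | C y in cy
  ... | false | false = sym (*-zeroʳ (δ (ψ y) x))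
  ... | true | true with φ x ≟ y
  ...   | yes e = sym (trans (*-identityʳ _) (δ-≡ (trans (cong ψ (sym e)) (ψφ x bx))))
  ...   | no e = sym (trans (*-identityʳ _) (δ-≢ λ q → e (trans (cong φ (sym q)) (φψ y cy))))
  core x y | true | false = trans (cong (_+ 0) (δ-≢ λ q → contradiction (trans (sym cy) (trans (cong C (sym q)) (BC x bx))) λ ())) (sym (*-zeroʳ (δ (ψ y) x)))
  core x y | false | true = sym (trans (*-identityʳ _) (δ-≢ λ q → contradiction (trans (sym bx) (trans (cong B (sym q)) (CB y cy))) λ ()))
  lem : ∀ x y → ⟦ B x ⟧ * (δ (φ x) y * f y) ≡ δ (ψ y) x * (⟦ C y ⟧ * f y)
  lem x y = trans (sym (*-assoc ⟦ B x ⟧ _ _)) (trans (cong (_* f y) (core x y)) (*-assoc (δ (ψ y) x) _ _))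

card-pos : ∀ {n} (B : Fin n → Bool) x → B x ≡ true → 0 < card B
card-pos B x e = ≤-trans (≤-reflexive (sym (sum-δ1 x))) (sum-mono lem)
  where
  lem : ∀ y → δ x y ≤ ⟦ B y ⟧
  lem y with x ≟ y
  ... | yes refl rewrite e = s≤s z≤n
  ... | no _ = z≤n

iter : ∀ {A : Set} → ℕ → (A → A) → A → A
iter zero s x = x
iter (suc k) s x = s (iter k s x)

iter-+ : ∀ {A : Set} (s : A → A) m n x → iter (m + n) s x ≡ iter m s (iter n s x)
iter-+ s zero n x = refl
iter-+ s (suc m) n x = cong s (iter-+ s m n x)

iter-* : ∀ {A : Set} (s : A → A) m n x → iter n s x ≡ x → iter (m * n) s x ≡ x
iter-* s zero n x e = refl
iter-* s (suc m) n x e = trans (iter-+ s n (m * n) x) (trans (cong (iter n s) (iter-* s m n x e)) e)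

least : ∀ {P : ℕ → Set} → (∀ n → Dec (P n)) → ∀ n → P n → ∃[ m ] (P m × m ≤ n × ∀ k → k < m → ¬ P k)
least {P} P? n pn = go n 0 (λ k ()) pn (+-identityʳ n)
  where
  go : ∀ d m → (∀ k → k < m → ¬ P k) → P n → d + m ≡ n → ∃[ m ] (P m × m ≤ n × ∀ k → k < m → ¬ P k)
  go zero m h pn refl = m , pn , ≤-refl , h
  go (suc d) m h pn e with P? m
  ... | yes pm = m , pm , subst (m ≤_) e (m≤n+m m (suc d)) , h
  ... | no ¬pm = go d (suc m) h' pn (trans (+-suc d m) e)
    where
    h' : ∀ k → k < suc m → ¬ P k
    h' k (s≤s k≤m) with m≤n⇒m<n∨m≡n k≤m
    ... | inj₁ k<m = h k k<m
    ... | inj₂ refl = ¬pm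

record ExactPeriod {A : Set} (s : A → A) (ℓ : ℕ) (x : A) : Set where
  field
    positive : 0 < ℓ
    period   : iter ℓ s x ≡ x
    minimal  : ∀ k → 0 < k → k < ℓ → iter k s x ≢ x

opaque
  exactPeriod : ∀ {n} (s : Fin n → Fin n) E → 0 < E → ∀ x → iter E s x ≡ x → ∃[ ℓ ] ExactPeriod s ℓ x
  exactPeriod s (suc E) _ x e with least (λ k → iter (suc k) s x ≟ x) E e
  ... | m , pm , _ , h = suc m , record { positive = s≤s z≤n ; period = pm ; minimal = λ { (suc k) _ (s≤s k<m) → h k k<m } }

exactPeriod-∣ : ∀ {A : Set} {s : A → A} {ℓ x} → ExactPeriod s ℓ x → ∀ E → iter E s x ≡ x → ℓ ∣ E
exactPeriod-∣ {s = s} {suc ℓ} {x} ep E e = m%n≡0⇒n∣m E (suc ℓ) (r≡0 (E % suc ℓ) (m%n<n E (suc ℓ)) fix)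
  where
  open ExactPeriod ep
  fix : iter (E % suc ℓ) s x ≡ x
  fix = trans (cong (iter (E % suc ℓ) s) (sym (iter-* s (E / suc ℓ) (suc ℓ) x period)))
    (trans (sym (iter-+ s (E % suc ℓ) (E / suc ℓ * suc ℓ) x))
    (trans (cong (λ k → iter k s x) (sym (m≡m%n+[m/n]*n E (suc ℓ)))) e))
  r≡0 : ∀ r → r < suc ℓ → iter r s x ≡ x → r ≡ 0
  r≡0 zero _ _ = refl
  r≡0 (suc r) lt q = contradiction q (minimal (suc r) (s≤s z≤n) lt)
exactPeriod-∣ {ℓ = zero} ep = contradiction (ExactPeriod.positive ep) λ ()

module _ {N : ℕ} (s : Fin N → Fin N) (E : ℕ) (0<E : 0 < E) (q : ℕ) (f : Fin N → ℕ) where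

  private
    OrbitSum : (Fin N → Bool) → Set
    OrbitSum B = (∀ x → B x ≡ true → B (s x) ≡ true) → (∀ x → B x ≡ true → iter E s x ≡ x) →
      (∀ x ℓ → B x ≡ true → ExactPeriod s ℓ x → q ∣ sum {ℓ} (λ i → f (iter (toℕ i) s x))) →
      q ∣ sumOn B f

  -- Induction on the size of `B`, splitting off one orbit of `s` at a time. With `f` constantly 1
  -- this is the counting behind Lagrange's theorem and behind all fixed point counts modulo p.
  orbit-sum : ∀ B → OrbitSum B
  orbit-sum B = <-rec (λ c → ∀ B → card B ≡ c → OrbitSum B) descend (card B) B refl
    where
    descend : ∀ c → (∀ {c'} → c' < c → ∀ B → card B ≡ c' → OrbitSum B) → ∀ B → card B ≡ c → OrbitSum B
    descend c rec B refl sB per dv with any? (λ x → B x Boolₚ.≟ true)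
    ... | no none = subst (q ∣_) (sym (sum-0 _ zeros)) (q ∣0)
      where
      zeros : ∀ x → ⟦ B x ⟧ * f x ≡ 0
      zeros x with B x in eq
      ... | true = contradiction (x , eq) none
      ... | false = refl
    ... | yes (x , bx) with exactPeriod s E 0<E x (per x bx)
    ... | ℓ , ep = subst (q ∣_) (sym split) (∣m∣n⇒∣m+n rest (dv x ℓ bx ep))
      where
      open ExactPeriod ep
      g : Fin ℓ → Fin N
      g i = iter (toℕ i) s x
      B-g : ∀ k → B (iter k s x) ≡ true
      B-g zero = bx
      B-g (suc k) = sB _ (B-g k)
      s-inj : ∀ {y z} → B y ≡ true → B z ≡ true → s y ≡ s z → y ≡ z
      s-inj {y} {z} by bz e = trans (sym (per y by)) (trans (lemE E 0<E) (per z bz))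
        where
        comm : ∀ k w → iter k s (s w) ≡ s (iter k s w)
        comm zero w = refl
        comm (suc k) w = cong s (comm k w)
        lemE : ∀ E → 0 < E → iter E s y ≡ iter E s z
        lemE (suc E') _ = trans (sym (comm E' y)) (trans (cong (iter E' s) e) (comm E' z))
      cancel : ∀ k m → iter k s x ≡ iter (k + m) s x → iter m s x ≡ x
      cancel zero m e = sym e
      cancel (suc k) m e = cancel k m (s-inj (B-g k) (B-g (k + m)) e)
      inj< : ∀ a b → a < b → b < ℓ → iter a s x ≢ iter b s x
      inj< a b a<b b<ℓ e = minimal (b ∸ a) (m<n⇒0<n∸m a<b) (≤-<-trans (m∸n≤m b a) b<ℓ)
        (cancel a (b ∸ a) (trans e (cong (λ k → iter k s x) (sym (m+[n∸m]≡n (<⇒≤ a<b))))))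
      g-inj : ∀ {i j} → g i ≡ g j → i ≡ j
      g-inj {i} {j} e with <-cmp (toℕ i) (toℕ j)
      ... | tri< lt _ _ = contradiction e (inj< _ _ lt (toℕ<n j))
      ... | tri≈ _ eq _ = toℕ-injective eq
      ... | tri> _ _ gt = contradiction (sym e) (inj< _ _ gt (toℕ<n i))
      zero? : ℕ → Bool
      zero? zero = true
      zero? (suc _) = false
      B' : Fin N → Bool
      B' y = B y ∧ zero? (hits g y)
      pt : ∀ y → ⟦ B y ⟧ ≡ ⟦ B' y ⟧ + hits g y
      pt y with hits-pos g y
      ... | inj₁ e rewrite e with B y
      ...   | true = refl
      ...   | false = refl
      pt y | inj₂ (i , refl) rewrite hits-1 g g-inj i | B-g (toℕ i) = refl
      split : sumOn B f ≡ sumOn B' f + sum (f ∘ g)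
      split = trans (sum-cong λ y → trans (cong (_* f y) (pt y)) (*-distribʳ-+ (f y) ⟦ B' y ⟧ (hits g y)))
        (trans (sum-+ _ _) (cong (sumOn B' f +_) (sum-hits g f)))
      cardEq : card B ≡ card B' + ℓ
      cardEq = trans (sum-cong pt) (trans (sum-+ _ _) (cong (card B' +_)
        (trans (sum-cong λ y → sym (*-identityʳ (hits g y))) (trans (sum-hits g (λ _ → 1)) (trans (sum-const ℓ 1) (*-identityʳ ℓ))))))
      card< : card B' < card B
      card< = subst (card B' <_) (sym cardEq) (m<m+n (card B') positive)
      hits≡0⇒ : ∀ {k} → zero? k ≡ true → k ≡ 0
      hits≡0⇒ {zero} _ = refl
      rest : q ∣ sumOn B' f
      rest = rec card< B' refl
        (λ y b'y → let by , hy = ∧-true {B y} b'y in ∧-intro (sB y by) (cong zero? (notHit y by (hits≡0⇒ hy))))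
        (λ y b'y → per y (proj₁ (∧-true {B y} b'y)))
        (λ y ℓ' b'y → dv y ℓ' (proj₁ (∧-true {B y} b'y)))
        where
        notHit : ∀ y → B y ≡ true → hits g y ≡ 0 → hits g (s y) ≡ 0
        notHit y by h with hits-pos g (s y)
        ... | inj₁ e = e
        ... | inj₂ (i , e) = contradiction (trans (sym h) (hit (toℕ i) (toℕ<n i) e)) λ ()
          where
          hitAt : ∀ k → k < ℓ → iter k s x ≡ y → hits g y ≡ 1
          hitAt k k<ℓ refl = trans (cong (hits g) (cong (λ m → iter m s x) (sym (toℕ-fromℕ< k<ℓ)))) (hits-1 g g-inj (fromℕ< k<ℓ))
          last : ∀ m → suc m ≡ ℓ → iter (suc m) s x ≡ x
          last m e' = trans (cong (λ k → iter k s x) e') period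
          hit : ∀ k → k < ℓ → iter k s x ≡ s y → hits g y ≡ 1
          hit (suc k) k<ℓ e = hitAt k (<⇒≤ k<ℓ) (s-inj (B-g k) by e)
          -- The predecessor of `x` on its orbit is the last point, whose index is `ℓ` minus one.
          hit zero 0<ℓ e = wrap ℓ refl 0<ℓ
            where
            wrap : ∀ m → m ≡ ℓ → 0 < m → hits g y ≡ 1
            wrap (suc m) e' _ = hitAt m (subst (m <_) e' ≤-refl) (s-inj (B-g m) by (trans (last m e') e))

-- Congruences

-- Stated so that no subtraction occurs.
infix 4 _≈_[_]
data _≈_[_] (x y m : ℕ) : Set where
  shift : ∀ k l → x + k * m ≡ y + l * m → x ≈ y [ m ]

module _ {m : ℕ} where
  open +-*-Solver

  ≈-refl : ∀ {x} → x ≈ x [ m ]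
  ≈-refl = shift 0 0 refl

  ≈-reflexive : ∀ {x y} → x ≡ y → x ≈ y [ m ]
  ≈-reflexive refl = ≈-refl

  ≈-sym : ∀ {x y} → x ≈ y [ m ] → y ≈ x [ m ]
  ≈-sym (shift k l e) = shift l k (sym e)

  ≈-trans : ∀ {x y z} → x ≈ y [ m ] → y ≈ z [ m ] → x ≈ z [ m ]
  ≈-trans {x} {y} {z} (shift k l e) (shift k' l' e') = shift (k + k') (l + l') (begin
    x + (k + k') * m ≡⟨ solve 4 (λ x k k' m → x :+ (k :+ k') :* m := (x :+ k :* m) :+ k' :* m) refl x k k' m ⟩
    x + k * m + k' * m ≡⟨ cong (_+ k' * m) e ⟩
    y + l * m + k' * m ≡⟨ solve 4 (λ x k k' m → x :+ k :* m :+ k' :* m := (x :+ k' :* m) :+ k :* m) refl y l k' m ⟩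
    y + k' * m + l * m ≡⟨ cong (_+ l * m) e' ⟩
    z + l' * m + l * m ≡⟨ solve 4 (λ x k k' m → x :+ k' :* m :+ k :* m := x :+ (k :+ k') :* m) refl z l l' m ⟩
    z + (l + l') * m ∎)
    where open ≡-Reasoning

  ≈-+ : ∀ {x y z w} → x ≈ y [ m ] → z ≈ w [ m ] → x + z ≈ y + w [ m ]
  ≈-+ {x} {y} {z} {w} (shift k l e) (shift k' l' e') = shift (k + k') (l + l')
    (trans (solve 5 (λ x z k k' m → x :+ z :+ (k :+ k') :* m := (x :+ k :* m) :+ (z :+ k' :* m)) refl x z k k' m)
    (trans (cong₂ _+_ e e') (solve 5 (λ x z k k' m → (x :+ k :* m) :+ (z :+ k' :* m) := x :+ z :+ (k :+ k') :* m) refl y w l l' m)))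

  ≈-*ˡ : ∀ {x y} c → x ≈ y [ m ] → c * x ≈ c * y [ m ]
  ≈-*ˡ {x} {y} c (shift k l e) = shift (c * k) (c * l)
    (trans (solve 4 (λ c x k m → c :* x :+ c :* k :* m := c :* (x :+ k :* m)) refl c x k m)
    (trans (cong (c *_) e) (solve 4 (λ c x k m → c :* (x :+ k :* m) := c :* x :+ c :* k :* m) refl c y l m)))

  ≈-*ʳ : ∀ {x y} c → x ≈ y [ m ] → x * c ≈ y * c [ m ]
  ≈-*ʳ {x} {y} c e = subst₂ (_≈_[ m ]) (*-comm c x) (*-comm c y) (≈-*ˡ c e)

  ∣⇒≈0 : ∀ {x} → m ∣ x → x ≈ 0 [ m ]
  ∣⇒≈0 {x} (divides q e) = shift 0 q (trans (+-identityʳ x) e)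

  ≈0⇒∣ : ∀ {x} → x ≈ 0 [ m ] → m ∣ x
  ≈0⇒∣ {x} (shift k l e) = ∣m+n∣m⇒∣n (subst (m ∣_) (trans (sym e) (+-comm x (k * m))) (n∣m*n l)) (n∣m*n k)

  ≈-cancel-+ˡ : ∀ c {x y} → c + x ≈ c + y [ m ] → x ≈ y [ m ]
  ≈-cancel-+ˡ c {x} {y} (shift k l e) = shift k l (+-cancelˡ-≡ c _ _ (trans (sym (+-assoc c x _)) (trans e (+-assoc c y _))))

  ≈-diff : ∀ {x y} → y ≤ x → m ∣ x ∸ y → x ≈ y [ m ]
  ≈-diff {x} {y} y≤x (divides q e) = shift 0 q (trans (+-identityʳ x) (trans (sym (m+[n∸m]≡n y≤x)) (cong (y +_) e)))

  ≈⇒∣diff : ∀ {x y} → y ≤ x → x ≈ y [ m ] → m ∣ x ∸ y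
  ≈⇒∣diff {x} {y} y≤x e = ≈0⇒∣ (≈-cancel-+ˡ y (≈-trans (≈-reflexive (m+[n∸m]≡n y≤x)) (≈-trans e (≈-reflexive (sym (+-identityʳ y))))))

≈-cancel-*ˡ : ∀ {p} → Prime p → ∀ c {x y} → ¬ p ∣ c → c * x ≈ c * y [ p ] → x ≈ y [ p ]
≈-cancel-*ˡ {p} pp c {x} {y} p∤c e with ≤-total y x
... | inj₁ y≤x = ≈-diff y≤x (fromEuclid (euclidsLemma c (x ∸ y) pp (subst (p ∣_) (sym (*-distribˡ-∸ c x y)) (≈⇒∣diff (*-monoʳ-≤ c y≤x) e))))
  where
  fromEuclid : p ∣ c ⊎ p ∣ x ∸ y → p ∣ x ∸ y
  fromEuclid (inj₁ h) = contradiction h p∤c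
  fromEuclid (inj₂ h) = h
... | inj₂ x≤y = ≈-sym (≈-diff x≤y (fromEuclid (euclidsLemma c (y ∸ x) pp (subst (p ∣_) (sym (*-distribˡ-∸ c y x)) (≈⇒∣diff (*-monoʳ-≤ c x≤y) (≈-sym e))))))
  where
  fromEuclid : p ∣ c ⊎ p ∣ y ∸ x → p ∣ y ∸ x
  fromEuclid (inj₁ h) = contradiction h p∤c
  fromEuclid (inj₂ h) = h

module PrimeFacts (p : ℕ) (pp : Prime p) where
  instance
    p≢0 : NonZero p
    p≢0 = prime⇒nonZero pp

  0<p : 0 < p
  0<p = n≢0⇒n>0 (≢-nonZero⁻¹ p)

  0<p^ : ∀ k → 0 < p ^ k
  0<p^ k = m^n>0 p k

  p≢1 : p ≢ 1
  p≢1 refl = contradiction (prime⇒nonTrivial pp) λ ()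

  p∤1 : ¬ p ∣ 1
  p∤1 h = p≢1 (∣1⇒≡1 h)

  1≉0 : ¬ (1 ≈ 0 [ p ])
  1≉0 h = p∤1 (≈0⇒∣ h)

  coprime-p : ∀ {d} → ¬ p ∣ d → Coprime d p
  coprime-p p∤d (h₁ , h₂) with prime⇒irreducible pp h₂
  ... | inj₁ e = e
  ... | inj₂ refl = contradiction h₁ p∤d

  coprime-p^ : ∀ {d} k → ¬ p ∣ d → Coprime d (p ^ k)
  coprime-p^ zero p∤d (h₁ , h₂) = ∣1⇒≡1 h₂
  coprime-p^ (suc k) p∤d (h₁ , h₂) = coprime-p^ k p∤d (h₁ , coprime-divisor (coprime-p (λ h → p∤d (∣-trans h h₁))) h₂)

  ∣p^⇒ : ∀ {d} k → d ∣ p ^ k → d ≡ 1 ⊎ p ∣ d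
  ∣p^⇒ {d} k h with p ∣? d
  ... | yes q = inj₂ q
  ... | no q = inj₁ (coprime-p^ k q (∣-refl , h))

  opaque
    inverse-mod : ∀ i k → ¬ p ∣ i → ∃[ i' ] ∃[ j ] i * i' ≡ 1 + j * p ^ k
    inverse-mod i k p∤i with coprime-Bézout (coprime-p^ k p∤i)
    ... | Bézout.+- x y eq = x , y , trans (*-comm i x) (sym eq)
    -- Here `x * i` is -1 modulo `p ^ k`, so its square is 1 and `x * (x * i)` inverts `i`. If
    -- `x * i` is 0, the modulus is 1 and any number serves.
    ... | Bézout.-+ x y eq = go (x * i) refl
      where
      open +-*-Solver
      i≡ : ∀ i → ¬ p ∣ i → i ≡ 1 + (i ∸ 1)
      i≡ zero h = contradiction (p ∣0) h
      i≡ (suc i) h = refl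
      go : ∀ c → x * i ≡ c → ∃[ i' ] ∃[ j ] i * i' ≡ 1 + j * p ^ k
      go zero e = 1 , i ∸ 1 , trans (*-identityʳ i) (trans (i≡ i p∤i) (cong suc (trans (sym (*-identityʳ (i ∸ 1))) (cong ((i ∸ 1) *_) (sym q≡1)))))
        where
        q≡1 : p ^ k ≡ 1
        q≡1 = m*n≡1⇒n≡1 y (p ^ k) (trans (sym eq) (cong suc e))
      go (suc c) e = x * (x * i) , c * y ,
        trans (solve 2 (λ i x → i :* (x :* (x :* i)) := (x :* i) :* (x :* i)) refl i x)
        (trans (cong₂ _*_ e e)
        (trans (solve 1 (λ c → (con 1 :+ c) :* (con 1 :+ c) := con 1 :+ c :* (con 1 :+ (con 1 :+ c))) refl c)
        (cong suc (trans (cong (c *_) (trans (cong suc (sym e)) eq)) (sym (*-assoc c y (p ^ k)))))))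

  opaque
    factor-out : ∀ u → 0 < u → ∃[ r ] ∃[ u' ] (u ≡ p ^ r * u' × ¬ p ∣ u')
    factor-out = <-rec _ descend
      where
      open +-*-Solver
      descend : ∀ u → (∀ {v} → v < u → 0 < v → ∃[ r ] ∃[ u' ] (v ≡ p ^ r * u' × ¬ p ∣ u')) → 0 < u → ∃[ r ] ∃[ u' ] (u ≡ p ^ r * u' × ¬ p ∣ u')
      descend u rec 0<u with p ∣? u
      ... | no h = 0 , u , sym (+-identityʳ u) , h
      ... | yes (divides zero refl) = contradiction 0<u λ ()
      ... | yes (divides (suc q) refl) with rec {suc q} (m<m*n (suc q) p (n>1 p p≢1)) (s≤s z≤n)
        where
        n>1 : ∀ p .{{_ : NonZero p}} → p ≢ 1 → 1 < p
        n>1 (suc zero) h = contradiction refl h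
        n>1 (suc (suc p)) h = s≤s (s≤s z≤n)
      ...   | r , u' , e , h = suc r , u' , trans (cong (_* p) e) (solve 3 (λ a b p → a :* b :* p := p :* a :* b) refl (p ^ r) u' p) , h

  -- Multiplication by κ permutes the residues mod p with orbits of p-power length, so a non-zero residue is fixed.
  opaque
    unipotent : ∀ κ k → κ ^ (p ^ k) ≈ 1 [ p ] → κ ≈ 1 [ p ]
    unipotent κ k hκ = go (any? (λ x → (s x ≟ x) ×-dec (¬? (p ∣? toℕ x))))
      where
      opaque
        s : Fin p → Fin p
        s x = fromℕ< (m%n<n (κ * toℕ x) p)
        mod≈ : ∀ x → toℕ (s x) ≈ κ * toℕ x [ p ]
        mod≈ x = let n = κ * toℕ x in shift (n / p) 0 (trans (cong (_+ n / p * p) (toℕ-fromℕ< (m%n<n n p))) (trans (sym (m≡m%n+[m/n]*n n p)) (sym (+-identityʳ n))))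
      small : ∀ {d} → p ∣ d → d < p → d ≡ 0
      small {zero} _ _ = refl
      small {suc d} h lt = contradiction (∣⇒≤ h) (<⇒≱ lt)
      ≈⇒≤ : ∀ {x y : Fin p} → toℕ y ≤ toℕ x → toℕ x ≈ toℕ y [ p ] → x ≡ y
      ≈⇒≤ {x} {y} h e = toℕ-injective (≤-antisym (m∸n≡0⇒m≤n (small (≈⇒∣diff h e) (≤-<-trans (m∸n≤m (toℕ x) (toℕ y)) (toℕ<n x)))) h)
      ≈⇒≡ : ∀ {x y : Fin p} → toℕ x ≈ toℕ y [ p ] → x ≡ y
      ≈⇒≡ {x} {y} e with ≤-total (toℕ y) (toℕ x)
      ... | inj₁ h = ≈⇒≤ h e
      ... | inj₂ h = sym (≈⇒≤ h (≈-sym e))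
      iter-s : ∀ m x → toℕ (iter m s x) ≈ κ ^ m * toℕ x [ p ]
      iter-s zero x = ≈-reflexive (sym (+-identityʳ (toℕ x)))
      iter-s (suc m) x = ≈-trans (mod≈ _) (≈-trans (≈-*ˡ κ (iter-s m x)) (≈-reflexive (sym (*-assoc κ _ _))))
      per : ∀ x → iter (p ^ k) s x ≡ x
      per x = ≈⇒≡ (≈-trans (iter-s (p ^ k) x) (≈-trans (≈-*ʳ (toℕ x) hκ) (≈-reflexive (+-identityʳ _))))
      moved : Fin p → Bool
      moved x = not (does (s x ≟ x))
      moved⇒ : ∀ {x} → moved x ≡ true → s x ≢ x
      moved⇒ {x} h with s x ≟ x
      ... | no q = q
      ⇒moved : ∀ {x} → s x ≢ x → moved x ≡ true
      ⇒moved {x} h = cong not (dec-false (s x ≟ x) h)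
      s-inj : ∀ {x y} → s x ≡ s y → x ≡ y
      s-inj {x} {y} e = trans (sym (per x)) (trans (iterE (p ^ k) (0<p^ k)) (per y))
        where
        comm : ∀ k w → iter k s (s w) ≡ s (iter k s w)
        comm zero w = refl
        comm (suc k) w = cong s (comm k w)
        iterE : ∀ E → 0 < E → iter E s x ≡ iter E s y
        iterE (suc E) _ = trans (sym (comm E x)) (trans (cong (iter E s) e) (comm E y))
      dv : p ∣ card moved
      dv = subst (p ∣_) (sumOn-1 moved) (orbit-sum s (p ^ k) (0<p^ k) p (λ _ → 1) moved
        (λ x h → ⇒moved (λ e → moved⇒ {x} h (s-inj e))) (λ x _ → per x)
        λ x ℓ h ep → subst (p ∣_) (sym (trans (sum-const ℓ 1) (*-identityʳ ℓ))) (p∣ℓ x ℓ h ep))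
        where
        p∣ℓ : ∀ x ℓ → moved x ≡ true → ExactPeriod s ℓ x → p ∣ ℓ
        p∣ℓ x ℓ h ep with ∣p^⇒ k (exactPeriod-∣ ep (p ^ k) (per x))
        ... | inj₁ refl = contradiction (ExactPeriod.period ep) (moved⇒ {x} h)
        ... | inj₂ q = q
      zeroₚ : Fin p
      zeroₚ = fromℕ< 0<p
      toℕ0 : toℕ zeroₚ ≡ 0
      toℕ0 = toℕ-fromℕ< 0<p
      s0 : s zeroₚ ≡ zeroₚ
      s0 = ≈⇒≡ (≈-trans (mod≈ _) (≈-reflexive (trans (cong (κ *_) toℕ0) (trans (*-zeroʳ κ) (sym toℕ0)))))
      go : Dec (∃[ x ] (s x ≡ x × ¬ p ∣ toℕ x)) → κ ≈ 1 [ p ]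
      go (yes (x , e , nz)) = ≈-cancel-*ˡ pp (toℕ x) nz (≈-trans (≈-reflexive (*-comm (toℕ x) κ)) (≈-trans (≈-sym (mod≈ _)) (≈-reflexive (trans (cong toℕ e) (sym (*-identityʳ _))))))
      go (no none) = contradiction (∣m+n∣m⇒∣n (subst (p ∣_) count ∣-refl) dv) p∤1
        where
        pt : ∀ x → Dec (zeroₚ ≡ x) → Dec (s x ≡ x) → 1 ≡ ⟦ moved x ⟧ + δ zeroₚ x
        pt x (yes e) _ = cong₂ _+_ (cong (⟦_⟧ ∘ not) (sym (dec-true (s x ≟ x) (subst (λ y → s y ≡ y) e s0)))) (sym (δ-≡ e))
        pt x (no q) (no q') = cong₂ _+_ (cong ⟦_⟧ (sym (⇒moved {x} q'))) (sym (δ-≢ q))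
        pt x (no q) (yes e) = contradiction (x , e , λ d → q (≈⇒≡ (≈-trans (≈-reflexive toℕ0) (≈-sym (∣⇒≈0 d))))) none
        count : p ≡ card moved + 1
        count = trans (sym (*-identityʳ p)) (trans (sym (sum-const p 1)) (trans (sum-cong (λ x → pt x (zeroₚ ≟ x) (s x ≟ x))) (trans (sum-+ _ _) (cong (card moved +_) (sum-δ1 zeroₚ)))))

-- Finite groups and p-groups

module GroupSolver where
  infixl 7 _⊗_
  infix 8 _⁻
  data Expr (k : ℕ) : Set where
    ‵ : Fin k → Expr k
    _⊗_ : Expr k → Expr k → Expr k
    _⁻ : Expr k → Expr k
    one : Expr k

  Word : ℕ → Set
  Word k = List (Bool × Fin k)

  push : ∀ {k} → Bool → Fin k → Word k → Word k
  push b v [] = (b , v) ∷ []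
  push b v ((b' , v') ∷ w) with v ≟ v' | b | b'
  ... | yes _ | true | false = w
  ... | yes _ | false | true = w
  ... | _ | _ | _ = (b , v) ∷ (b' , v') ∷ w

  -- Prepends the expression, or its inverse if the flag is false, to a word. Opposite letters
  -- cancel as soon as they meet, so starting from the empty word the result is the freely reduced
  -- form.
  norm : ∀ {k} → Expr k → Bool → Word k → Word k
  norm (‵ v) b w = push b v w
  norm (x ⊗ y) true w = norm x true (norm y true w)
  norm (x ⊗ y) false w = norm y false (norm x false w)
  norm (x ⁻) b w = norm x (not b) w
  norm one b w = w

module Grp (G : FiniteGroup) where
  infixl 7 _·_
  infix 8 _⁻
  _·_ : Carrier G → Carrier G → Carrier G
  _·_ = _∙_ G

  _⁻ : Carrier G → Carrier G
  _⁻ = _⁻¹ G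

  e : Carrier G
  e = ε G

  infixl 8 _↑_
  _↑_ : Carrier G → ℕ → Carrier G
  _↑_ = pow G

  open IsGroup (isGroup G) public using (assoc; identityˡ; identityʳ; inverseˡ; inverseʳ)

  private
    module S = GroupSolver
  open GroupSolver using (‵; one; _⊗_) public
  open GroupSolver using (Expr) renaming (_⁻ to _⊖) public

  lit : Bool → Carrier G → Carrier G
  lit true x = x
  lit false x = x ⁻

  ⟪_⟫ : ∀ {k} → S.Word k → Vec (Carrier G) k → Carrier G
  ⟪ [] ⟫ ρ = e
  ⟪ (b , v) ∷ w ⟫ ρ = lit b (lookup ρ v) · ⟪ w ⟫ ρ

  eval : ∀ {k} → Expr k → Vec (Carrier G) k → Carrier G
  eval (‵ v) ρ = lookup ρ v
  eval (x ⊗ y) ρ = eval x ρ · eval y ρ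
  eval (x ⊖) ρ = eval x ρ ⁻
  eval one ρ = e

  cancelˡ : ∀ x y → x ⁻ · (x · y) ≡ y
  cancelˡ x y = trans (sym (assoc (x ⁻) x y)) (trans (cong (_· y) (inverseˡ x)) (identityˡ y))

  cancelʳ : ∀ x y → x · (x ⁻ · y) ≡ y
  cancelʳ x y = trans (sym (assoc x (x ⁻) y)) (trans (cong (_· y) (inverseʳ x)) (identityˡ y))

  ·-cancelˡ : ∀ x {y z} → x · y ≡ x · z → y ≡ z
  ·-cancelˡ x {y} {z} q = trans (sym (cancelˡ x y)) (trans (cong (x ⁻ ·_) q) (cancelˡ x z))

  ·-cancelʳ : ∀ x {y z} → y · x ≡ z · x → y ≡ z
  ·-cancelʳ x {y} {z} q = trans (sym (lem y)) (trans (cong (_· x ⁻) q) (lem z))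
    where
    lem : ∀ y → y · x · x ⁻ ≡ y
    lem y = trans (assoc y x (x ⁻)) (trans (cong (y ·_) (inverseʳ x)) (identityʳ y))

  inv-unique : ∀ x y → x · y ≡ e → y ≡ x ⁻
  inv-unique x y q = ·-cancelˡ x (trans q (sym (inverseʳ x)))

  inv-· : ∀ x y → (x · y) ⁻ ≡ y ⁻ · x ⁻
  inv-· x y = sym (inv-unique (x · y) _ (trans (assoc x y _) (trans (cong (x ·_) (cancelʳ y (x ⁻))) (inverseʳ x))))

  inv-inv : ∀ x → x ⁻ ⁻ ≡ x
  inv-inv x = sym (inv-unique (x ⁻) x (inverseˡ x))

  inv-e : e ⁻ ≡ e
  inv-e = sym (inv-unique e e (identityˡ e))

  private
    push-sound : ∀ {k} b (v : Fin k) w ρ → ⟪ S.push b v w ⟫ ρ ≡ lit b (lookup ρ v) · ⟪ w ⟫ ρ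
    push-sound b v [] ρ = refl
    push-sound b v ((b' , v') ∷ w) ρ with v ≟ v' | b | b'
    ... | yes refl | true | false = sym (cancelʳ _ _)
    ... | yes refl | false | true = sym (cancelˡ _ _)
    ... | yes _ | true | true = refl
    ... | yes _ | false | false = refl
    ... | no _ | true | true = refl
    ... | no _ | true | false = refl
    ... | no _ | false | true = refl
    ... | no _ | false | false = refl

    norm-sound : ∀ {k} (x : Expr k) b w ρ → ⟪ S.norm x b w ⟫ ρ ≡ lit b (eval x ρ) · ⟪ w ⟫ ρ
    norm-sound (‵ v) b w ρ = push-sound b v w ρ
    norm-sound (x ⊗ y) true w ρ = trans (norm-sound x true _ ρ) (trans (cong (eval x ρ ·_) (norm-sound y true w ρ)) (sym (assoc _ _ _)))
    norm-sound (x ⊗ y) false w ρ = trans (norm-sound y false _ ρ) (trans (cong (eval y ρ ⁻ ·_) (norm-sound x false w ρ))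
      (trans (sym (assoc _ _ _)) (cong (_· ⟪ w ⟫ ρ) (sym (inv-· (eval x ρ) (eval y ρ))))))
    norm-sound (x ⊖) true w ρ = norm-sound x false w ρ
    norm-sound (x ⊖) false w ρ = trans (norm-sound x true w ρ) (cong (_· ⟪ w ⟫ ρ) (sym (inv-inv _)))
    norm-sound one true w ρ = sym (identityˡ _)
    norm-sound one false w ρ = trans (sym (identityˡ _)) (cong (_· ⟪ w ⟫ ρ) (sym inv-e))

  -- Identities of free groups: both sides are reduced to signed words.
  opaque
    group : ∀ {k} (ρ : Vec (Carrier G) k) (x y : Expr k) → S.norm x true [] ≡ S.norm y true [] → eval x ρ ≡ eval y ρ
    group ρ x y q = trans (sym (trans (norm-sound x true [] ρ) (identityʳ _)))
      (trans (cong (λ w → ⟪ w ⟫ ρ) q) (trans (norm-sound y true [] ρ) (identityʳ _)))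

  pattern v0 = ‵ zero
  pattern v1 = ‵ (suc zero)
  pattern v2 = ‵ (suc (suc zero))
  pattern v3 = ‵ (suc (suc (suc zero)))
  pattern v4 = ‵ (suc (suc (suc (suc zero))))
  pattern v5 = ‵ (suc (suc (suc (suc (suc zero)))))

  conj : Carrier G → Carrier G → Carrier G
  conj x y = x · y · x ⁻

  conj-· : ∀ x y z → conj x (y · z) ≡ conj x y · conj x z
  conj-· x y z = group (x ∷ y ∷ z ∷ []) (v0 ⊗ (v1 ⊗ v2) ⊗ v0 ⊖) (v0 ⊗ v1 ⊗ v0 ⊖ ⊗ (v0 ⊗ v2 ⊗ v0 ⊖)) refl

  conj-conj : ∀ x y z → conj (x · y) z ≡ conj x (conj y z)
  conj-conj x y z = group (x ∷ y ∷ z ∷ []) (v0 ⊗ v1 ⊗ v2 ⊗ (v0 ⊗ v1) ⊖) (v0 ⊗ (v1 ⊗ v2 ⊗ v1 ⊖) ⊗ v0 ⊖) refl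

  conj-e : ∀ x → conj x e ≡ e
  conj-e x = group (x ∷ []) (v0 ⊗ one ⊗ v0 ⊖) one refl

  e-conj : ∀ x → conj e x ≡ x
  e-conj x = group (x ∷ []) (one ⊗ v0 ⊗ one ⊖) v0 refl

  conj-injective : ∀ x {y z} → conj x y ≡ conj x z → y ≡ z
  conj-injective x q = ·-cancelˡ x (·-cancelʳ (x ⁻) q)

  commute⇒conj : ∀ {x y} → x · y ≡ y · x → conj x y ≡ y
  commute⇒conj {x} {y} q = trans (cong (_· x ⁻) q) (group (x ∷ y ∷ []) (v1 ⊗ v0 ⊗ v0 ⊖) v1 refl)

  conj⇒commute : ∀ {x y} → conj x y ≡ y → x · y ≡ y · x
  conj⇒commute {x} {y} q = trans (group (x ∷ y ∷ []) (v0 ⊗ v1) (v0 ⊗ v1 ⊗ v0 ⊖ ⊗ v0) refl) (cong (_· x) q)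

  ↑-+ : ∀ x m n → x ↑ (m + n) ≡ x ↑ m · x ↑ n
  ↑-+ x zero n = sym (identityˡ _)
  ↑-+ x (suc m) n = trans (cong (x ·_) (↑-+ x m n)) (sym (assoc _ _ _))

  e-↑ : ∀ n → e ↑ n ≡ e
  e-↑ zero = refl
  e-↑ (suc n) = trans (identityˡ _) (e-↑ n)

  ↑-* : ∀ x m n → x ↑ (m * n) ≡ (x ↑ m) ↑ n
  ↑-* x m zero = cong (x ↑_) (*-zeroʳ m)
  ↑-* x m (suc n) = trans (cong (x ↑_) (*-suc m n)) (trans (↑-+ x m (m * n)) (cong (x ↑ m ·_) (↑-* x m n)))

  ↑-*′ : ∀ x m n → x ↑ (m * n) ≡ (x ↑ n) ↑ m
  ↑-*′ x m n = trans (cong (x ↑_) (*-comm m n)) (↑-* x n m)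

  ↑-1 : ∀ x → x ↑ 1 ≡ x
  ↑-1 x = identityʳ x

  ↑-swap : ∀ x m n → (x ↑ m) ↑ n ≡ (x ↑ n) ↑ m
  ↑-swap x m n = trans (sym (↑-* x m n)) (↑-*′ x m n)

  commute-↑ : ∀ {x y} n → x · y ≡ y · x → x · y ↑ n ≡ y ↑ n · x
  commute-↑ zero q = trans (identityʳ _) (sym (identityˡ _))
  commute-↑ {x} {y} (suc n) q = trans (sym (assoc x y _)) (trans (cong (_· y ↑ n) q) (trans (assoc y x _) (trans (cong (y ·_) (commute-↑ n q)) (sym (assoc _ _ _)))))

  commute-↑↑ : ∀ {x y} m n → x · y ≡ y · x → x ↑ m · y ↑ n ≡ y ↑ n · x ↑ m
  commute-↑↑ m n q = sym (commute-↑ m (sym (commute-↑ n q)))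

  self-commute : ∀ x m n → x ↑ m · x ↑ n ≡ x ↑ n · x ↑ m
  self-commute x m n = commute-↑↑ m n refl

  ↑-· : ∀ {x y} n → x · y ≡ y · x → (x · y) ↑ n ≡ x ↑ n · y ↑ n
  ↑-· zero q = sym (identityˡ _)
  ↑-· {x} {y} (suc n) q = trans (cong (x · y ·_) (↑-· n q))
    (trans (group (x ∷ y ∷ x ↑ n ∷ y ↑ n ∷ []) (v0 ⊗ v1 ⊗ (v2 ⊗ v3)) (v0 ⊗ (v1 ⊗ v2) ⊗ v3) refl)
    (trans (cong (λ w → x · w · y ↑ n) (commute-↑ n (sym q)))
    (group (x ∷ y ∷ x ↑ n ∷ y ↑ n ∷ []) (v0 ⊗ (v2 ⊗ v1) ⊗ v3) (v0 ⊗ v2 ⊗ (v1 ⊗ v3)) refl)))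

  conj-↑ : ∀ x y n → conj x (y ↑ n) ≡ conj x y ↑ n
  conj-↑ x y zero = conj-e x
  conj-↑ x y (suc n) = trans (conj-· x y (y ↑ n)) (cong (conj x y ·_) (conj-↑ x y n))

  conj-inv′ : ∀ x y → conj (x ⁻) (conj x y) ≡ y
  conj-inv′ x y = group (x ∷ y ∷ []) (v0 ⊖ ⊗ (v0 ⊗ v1 ⊗ v0 ⊖) ⊗ v0 ⊖ ⊖) v1 refl

  ↑-⁻ : ∀ x n → (x ⁻) ↑ n ≡ (x ↑ n) ⁻
  ↑-⁻ x zero = sym inv-e
  ↑-⁻ x (suc n) = trans (cong (x ⁻ ·_) (↑-⁻ x n)) (trans (sym (inv-· (x ↑ n) x)) (cong _⁻ (sym (commute-↑ n refl))))

  ↑-+-cancel : ∀ x m n → x ↑ (m + n) ≡ x ↑ m → x ↑ n ≡ e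
  ↑-+-cancel x m n q = ·-cancelˡ (x ↑ m) (trans (sym (↑-+ x m n)) (trans q (sym (identityʳ _))))

  conj-iterate : ∀ x y κ → conj x y ≡ y ↑ κ → ∀ k → conj (x ↑ k) y ≡ y ↑ (κ ^ k)
  conj-iterate x y κ q zero = trans (e-conj y) (sym (↑-1 y))
  conj-iterate x y κ q (suc k) = trans (conj-conj x (x ↑ k) y) (trans (cong (conj x) (conj-iterate x y κ q k))
    (trans (conj-↑ x y (κ ^ k)) (trans (cong (_↑ κ ^ k) q) (sym (↑-* y κ (κ ^ k))))))

  iter-· : ∀ x k y → iter k (x ·_) y ≡ x ↑ k · y
  iter-· x zero y = sym (identityˡ y)
  iter-· x (suc k) y = trans (cong (x ·_) (iter-· x k y)) (sym (assoc x _ y))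

  finite-order : ∀ x → ∃[ k ] (0 < k × x ↑ k ≡ e)
  finite-order x with pigeonhole (n<1+n (order G)) (λ i → x ↑ toℕ i)
  ... | i , j , i<j , q = toℕ j ∸ toℕ i , m<n⇒0<n∸m i<j ,
    ↑-+-cancel x (toℕ i) (toℕ j ∸ toℕ i) (trans (cong (x ↑_) (m+[n∸m]≡n (<⇒≤ i<j))) (sym q))

  ↑-∣ : ∀ x {m k} → x ↑ m ≡ e → m ∣ k → x ↑ k ≡ e
  ↑-∣ x {m} q (divides c refl) = trans (↑-*′ x c m) (trans (cong (_↑ c) q) (e-↑ c))

  opaque
    -- Left multiplication by `x` has no orbit shorter than that of the identity: a period of any
    -- point is an exponent killing `x`. So the order of `x` divides all orbit lengths and hence the
    -- order of the group.
    ↑-order : ∀ x → x ↑ order G ≡ e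
    ↑-order x with finite-order x
    ... | E , 0<E , q with exactPeriod (x ·_) E 0<E e (trans (iter-· x E e) (trans (identityʳ _) q))
    ... | ℓ , ep = ↑-∣ x xℓ ℓ∣N
      where
      xℓ : x ↑ ℓ ≡ e
      xℓ = trans (sym (identityʳ _)) (trans (sym (iter-· x ℓ e)) (ExactPeriod.period ep))
      per⇒ : ∀ y k → iter k (x ·_) y ≡ y → x ↑ k ≡ e
      per⇒ y k h = ·-cancelʳ y (trans (sym (iter-· x k y)) (trans h (sym (identityˡ y))))
      ℓ∣N : ℓ ∣ order G
      ℓ∣N = subst (ℓ ∣_) (trans (sumOn-1 (λ _ → true)) (trans (sum-const _ 1) (*-identityʳ _)))
        (orbit-sum (x ·_) E 0<E ℓ (λ _ → 1) (λ _ → true) (λ _ _ → refl)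
          (λ y _ → trans (iter-· x E y) (trans (cong (_· y) q) (identityˡ y)))
          λ y ℓ' _ ep' → subst (ℓ ∣_) (sym (trans (sum-const ℓ' 1) (*-identityʳ ℓ')))
            (exactPeriod-∣ ep ℓ' (trans (iter-· x ℓ' e) (trans (identityʳ _) (per⇒ y ℓ' (ExactPeriod.period ep'))))))

module PGroup (p : ℕ) (pp : Prime p) (G : FiniteGroup) (pg : IsPGroup p G) where
  open Grp G public
  open PrimeFacts p pp public

  K : ℕ
  K = proj₁ pg

  ↑-p^K : ∀ x → x ↑ (p ^ K) ≡ e
  ↑-p^K x = trans (cong (x ↑_) (sym (proj₂ pg))) (↑-order x)

  ↑-multiple : ∀ x j → x ↑ (j * p ^ K) ≡ e
  ↑-multiple x j = trans (↑-* x j (p ^ K)) (↑-p^K _)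

  opaque
    -- Extraction of i-th roots, by an inverse of `i` modulo the group order. The root is again a
    -- power, so it stays inside every cyclic subgroup.
    root : ∀ i → ¬ p ∣ i → ∃[ i' ] ∀ x → (x ↑ i) ↑ i' ≡ x
    root i p∤i with inverse-mod i K p∤i
    ... | i' , j , q = i' , λ x → trans (sym (↑-* x i i')) (trans (cong (x ↑_) q)
      (trans (cong (x ·_) (↑-multiple x j)) (identityʳ x)))

  ↑≡e : ∀ {x} i → ¬ p ∣ i → x ↑ i ≡ e → x ≡ e
  ↑≡e {x} i p∤i q with root i p∤i
  ... | i' , h = trans (sym (h x)) (trans (cong (_↑ i') q) (e-↑ i'))

  inv-↑ : ∀ x → x ⁻ ≡ x ↑ (p ^ K ∸ 1)
  inv-↑ x = sym (inv-unique x _ (trans (cong (x ↑_) (trans (+-comm 1 _) (m∸n+n≡m (0<p^ K)))) (↑-p^K x)))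

  opaque
    ↑-≈ : ∀ {x} → x ≢ e → ∀ {i j} → x ↑ i ≡ x ↑ j → i ≈ j [ p ]
    ↑-≈ {x} x≢e {i} {j} q with ≤-total j i
    ... | inj₁ h = ≈-diff h (dv i j h q)
      where
      dv : ∀ i j → j ≤ i → x ↑ i ≡ x ↑ j → p ∣ i ∸ j
      dv i j h q with p ∣? (i ∸ j)
      ... | yes d = d
      ... | no d = contradiction (↑≡e (i ∸ j) d (↑-+-cancel x j (i ∸ j) (trans (cong (x ↑_) (m+[n∸m]≡n h)) q))) x≢e
    ... | inj₂ h = ≈-sym (≈-diff h (dv j i h (sym q)))
      where
      dv : ∀ i j → j ≤ i → x ↑ i ≡ x ↑ j → p ∣ i ∸ j
      dv i j h q with p ∣? (i ∸ j)
      ... | yes d = d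
      ... | no d = contradiction (↑≡e (i ∸ j) d (↑-+-cancel x j (i ∸ j) (trans (cong (x ↑_) (m+[n∸m]≡n h)) q))) x≢e

  opaque
    ↑≡e⇒∣ : ∀ {x} → x ≢ e → ∀ i → x ↑ i ≡ e → p ∣ i
    ↑≡e⇒∣ x≢e i q = ≈0⇒∣ (↑-≈ x≢e {i} {0} q)

  opaque
    -- Since `x` has p-power order, so has κ modulo p, and `unipotent` gives κ ≡ 1. In other words,
    -- elements of a p-group act trivially on a normal cyclic subgroup modulo its p-th powers.
    conj-unipotent : ∀ x g κ → conj x g ≡ g ↑ κ → ∃[ l ] conj x g ≡ g ↑ (1 + l * p)
    conj-unipotent x g κ q with g ≟ e
    ... | yes refl = 0 , trans (conj-e x) (sym (e-↑ 1))
    ... | no g≢e with unipotent κ K (↑-≈ g≢e {κ ^ (p ^ K)} {1} (trans (sym (conj-iterate x g κ q (p ^ K)))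
                      (trans (cong (λ w → conj w g) (↑-p^K x)) (trans (e-conj g) (sym (↑-1 g))))))
    -- From κ + k p = 1 + l p no subtraction is possible. Instead k p times the group order is added
    -- to the exponent, which does not change the power of `g`.
    ...   | shift k l w = l + k * (p ^ K ∸ 1) , trans q (trans (sym (identityʳ _)) (trans (cong (g ↑ κ ·_) (sym one')) (trans (sym (↑-+ g κ _)) (cong (g ↑_) eqn))))
      where
      open +-*-Solver
      one' : g ↑ (k * p * p ^ K) ≡ e
      one' = ↑-multiple g (k * p)
      split : p ^ K ≡ 1 + (p ^ K ∸ 1)
      split = sym (m+[n∸m]≡n (0<p^ K))
      eqn : κ + k * p * p ^ K ≡ 1 + (l + k * (p ^ K ∸ 1)) * p
      eqn = trans (cong (λ t → κ + k * p * t) split)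
        (trans (solve 4 (λ κ k p t → κ :+ k :* p :* (con 1 :+ t) := κ :+ k :* p :+ k :* t :* p) refl κ k p (p ^ K ∸ 1))
        (trans (cong (_+ k * (p ^ K ∸ 1) * p) w)
        (solve 4 (λ k p t l → con 1 :+ l :* p :+ k :* t :* p := con 1 :+ (l :+ k :* t) :* p) refl k p (p ^ K ∸ 1) l)))

-- The automorphism group of a cubic edge-transitive graph

bool-iff : ∀ {x y} → (x ≡ true → y ≡ true) → (y ≡ true → x ≡ true) → x ≡ y
bool-iff {true} h _ = sym (h refl)
bool-iff {false} {true} _ h = h refl
bool-iff {false} {false} _ _ = refl

true⇒ : ∀ {P : Set} (d : Dec P) → does d ≡ true → P
true⇒ (yes h) _ = h

enumerate : ∀ {N} {P : Fin N → Set} → (∀ x → Dec (P x)) →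
  ∃[ M ] Σ (Fin M → Fin N) λ el → (∀ i → P (el i)) × (∀ {i j} → el i ≡ el j → i ≡ j) × (∀ x → P x → ∃[ i ] el i ≡ x)
enumerate {zero} P? = 0 , (λ ()) , (λ ()) , (λ {i} → ⊥-elim (absurd i)) , λ ()
  where
  absurd : Fin 0 → ⊥
  absurd ()
enumerate {suc N} {P} P? with enumerate (λ x → P? (suc x)) | P? zero
... | M , el , prop , inj , surj | no ¬p = M , suc ∘ el , prop , inj ∘ suc-injective , surj'
  where
  surj' : ∀ x → P x → ∃[ i ] suc (el i) ≡ x
  surj' zero h = contradiction h ¬p
  surj' (suc x) h with surj x h
  ... | i , q = i , cong suc q
... | M , el , prop , inj , surj | yes p₀ = suc M , el' , prop' , inj' , surj'
  where
  el' : Fin (suc M) → Fin (suc N)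
  el' zero = zero
  el' (suc i) = suc (el i)
  prop' : ∀ i → P (el' i)
  prop' zero = p₀
  prop' (suc i) = prop i
  inj' : ∀ {i j} → el' i ≡ el' j → i ≡ j
  inj' {zero} {zero} _ = refl
  inj' {suc i} {suc j} q = cong suc (inj (suc-injective q))
  surj' : ∀ x → P x → ∃[ i ] el' i ≡ x
  surj' zero _ = zero , refl
  surj' (suc x) h with surj x h
  ... | i , q = suc i , cong suc q

funToFin-cong : ∀ {m n} {f g : Fin m → Fin n} → (∀ i → f i ≡ g i) → funToFin f ≡ funToFin g
funToFin-cong {zero} h = refl
funToFin-cong {suc m} h = cong₂ combine (h zero) (funToFin-cong (h ∘ suc))

-- The full automorphism group as a `FiniteGroup`, so that the same group theory applies to it and
-- to H. It acts from the right, in accordance with `ρ-hom`.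
record AutAction (Γ : Graph) : Set where
  field
    K        : FiniteGroup
    act      : Fin (n Γ) → Carrier K → Fin (n Γ)
    act-ε    : ∀ v → act v (ε K) ≡ v
    act-∙    : ∀ v k l → act v (_∙_ K k l) ≡ act (act v k) l
    act-adj  : ∀ k u v → adj Γ (act u k) (act v k) ≡ adj Γ u v
    faithful : ∀ {k l} → (∀ v → act v k ≡ act v l) → k ≡ l
    complete : (σ : Aut Γ) → ∃[ k ] ∀ v → act v k ≡ Iso.to σ v

private
  -- Self-maps of the vertex set are coded by numbers, so being an automorphism is decidable and the
  -- automorphisms can be enumerated without repetition.
  construct : (Γ : Graph) → AutAction Γ
  construct Γ = record
    { K = record { order = M ; _∙_ = _⊙_ ; ε = one ; _⁻¹ = inv ; isGroup = grp }
    ; act = act ; act-ε = one-act ; act-∙ = λ v k l → ⊙-act k l v ; act-adj = λ k → proj₁ (el-aut k)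
    ; faithful = faithful ; complete = λ σ → lookup-aut (Iso.to σ) (Iso.from σ) (Iso.from∘to σ) (Iso.to∘from σ) (Iso.adj-pres σ) }
    where
    V = Fin (n Γ)
    fn : Fin (n Γ ^ n Γ) → V → V
    fn = finToFun
    IsAut : Fin (n Γ ^ n Γ) → Set
    IsAut x = (∀ u v → adj Γ (fn x u) (fn x v) ≡ adj Γ u v) × ∃[ y ] ((∀ v → fn y (fn x v) ≡ v) × (∀ v → fn x (fn y v) ≡ v))
    isAut? : ∀ x → Dec (IsAut x)
    isAut? x = all? (λ u → all? λ v → adj Γ (fn x u) (fn x v) Boolₚ.≟ adj Γ u v) ×-dec
      any? (λ y → all? (λ v → fn y (fn x v) ≟ v) ×-dec all? (λ v → fn x (fn y v) ≟ v))
    auts = enumerate isAut?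
    M = proj₁ auts
    el = proj₁ (proj₂ auts)
    el-aut : ∀ i → IsAut (el i)
    el-aut = proj₁ (proj₂ (proj₂ auts))
    act : V → Fin M → V
    act v k = fn (el k) v
    faithful : ∀ {k l} → (∀ v → act v k ≡ act v l) → k ≡ l
    faithful {k} {l} h = proj₁ (proj₂ (proj₂ (proj₂ auts)))
      (trans (sym (funToFin-finToFin {n Γ} (el k))) (trans (funToFin-cong h) (funToFin-finToFin {n Γ} (el l))))
    lookup-aut : (f f' : V → V) → (∀ v → f' (f v) ≡ v) → (∀ v → f (f' v) ≡ v) → (∀ u v → adj Γ (f u) (f v) ≡ adj Γ u v) →
      ∃[ k ] ∀ v → act v k ≡ f v
    lookup-aut f f' q q' a with proj₂ (proj₂ (proj₂ (proj₂ auts))) (funToFin f)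
        ( (λ u v → trans (cong₂ (adj Γ) (finToFun-funToFin f u) (finToFun-funToFin f v)) (a u v))
        , funToFin f'
        , (λ v → trans (finToFun-funToFin f' _) (trans (cong f' (finToFun-funToFin f v)) (q v)))
        , (λ v → trans (finToFun-funToFin f _) (trans (cong f (finToFun-funToFin f' v)) (q' v))))
    ... | k , h = k , λ v → trans (cong (λ x → fn x v) h) (finToFun-funToFin f v)
    back : Fin M → V → V
    back k = fn (proj₁ (proj₂ (el-aut k)))
    back-act : ∀ k v → back k (act v k) ≡ v
    back-act k = proj₁ (proj₂ (proj₂ (el-aut k)))
    act-back : ∀ k v → act (back k v) k ≡ v
    act-back k = proj₂ (proj₂ (proj₂ (el-aut k)))
    ⊙-aut : ∀ k l → ∃[ m ] ∀ v → act v m ≡ act (act v k) l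
    ⊙-aut k l = lookup-aut (λ v → act (act v k) l) (λ v → back k (back l v))
      (λ v → trans (cong (back k) (back-act l _)) (back-act k v))
      (λ v → trans (cong (λ w → act w l) (act-back k _)) (act-back l v))
      (λ u v → trans (proj₁ (el-aut l) _ _) (proj₁ (el-aut k) u v))
    _⊙_ : Fin M → Fin M → Fin M
    k ⊙ l = proj₁ (⊙-aut k l)
    ⊙-act : ∀ k l v → act v (k ⊙ l) ≡ act (act v k) l
    ⊙-act k l = proj₂ (⊙-aut k l)
    one-aut : ∃[ m ] ∀ v → act v m ≡ v
    one-aut = lookup-aut id id (λ _ → refl) (λ _ → refl) (λ _ _ → refl)
    one = proj₁ one-aut
    one-act : ∀ v → act v one ≡ v
    one-act = proj₂ one-aut
    inv-aut : ∀ k → ∃[ m ] ∀ v → act v m ≡ back k v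
    inv-aut k = lookup-aut (back k) (λ v → act v k) (act-back k) (back-act k)
      (λ u v → trans (sym (proj₁ (el-aut k) _ _)) (cong₂ (adj Γ) (act-back k u) (act-back k v)))
    inv : Fin M → Fin M
    inv k = proj₁ (inv-aut k)
    inv-act : ∀ k v → act v (inv k) ≡ back k v
    inv-act k = proj₂ (inv-aut k)
    grp : IsGroup _≡_ _⊙_ one inv
    grp = record
      { isMonoid = record
        { isSemigroup = record
          { isMagma = record { isEquivalence = isEquivalence ; ∙-cong = cong₂ _⊙_ }
          ; assoc = λ x y z → faithful λ v → trans (⊙-act (x ⊙ y) z v) (trans (cong (λ w → act w z) (⊙-act x y v))
              (sym (trans (⊙-act x (y ⊙ z) v) (⊙-act y z _)))) }
        ; identity = (λ x → faithful λ v → trans (⊙-act one x v) (cong (λ w → act w x) (one-act v)))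
                   , (λ x → faithful λ v → trans (⊙-act x one v) (one-act _)) }
      ; inverse = (λ x → faithful λ v → trans (⊙-act (inv x) x v) (trans (cong (λ w → act w x) (inv-act x v)) (trans (act-back x v) (sym (one-act v)))))
                , (λ x → faithful λ v → trans (⊙-act x (inv x) v) (trans (inv-act x _) (trans (back-act x v) (sym (one-act v)))))
      ; ⁻¹-cong = cong inv }

opaque
  autAction : (Γ : Graph) → AutAction Γ
  autAction = construct

sum-list : ∀ m (f : Fin m → ℕ) → ListAction.sum (List.map f (List.allFin m)) ≡ sum f
sum-list m f = trans (cong ListAction.sum (Listₚ.map-tabulate id f)) (go m f)
  where
  go : ∀ m (f : Fin m → ℕ) → ListAction.sum (List.tabulate f) ≡ sum f
  go zero f = sym (sum-zero f)
  go (suc m) f = trans (cong (f zero +_) (go m (f ∘ suc))) (sym (sum-suc f))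

module GraphAction (Γ : Graph) (cubic : Cubic Γ) (AA : AutAction Γ) where
  open AutAction AA public
  open Grp K public

  V : Set
  V = Fin (n Γ)

  infix 4 _~_
  _~_ : V → V → Set
  x ~ y = adj Γ x y ≡ true

  degree-card : ∀ x → card (adj Γ x) ≡ 3
  degree-card x = trans (sum-cong pt) (trans (sym (sum-list (n Γ) _)) (cubic x))
    where
    pt : ∀ y → ⟦ adj Γ x y ⟧ ≡ (if adj Γ x y then 1 else 0)
    pt y with adj Γ x y
    ... | true = refl
    ... | false = refl

  ~-sym : ∀ {x y} → x ~ y → y ~ x
  ~-sym {x} {y} h = trans (adj-sym Γ y x) h

  ~-act : ∀ k {x y} → x ~ y → act x k ~ act y k
  ~-act k h = trans (act-adj k _ _) h

  card≢0 : ∀ {m} (B : Fin m → Bool) → card B ≢ 0 → ∃[ x ] B x ≡ true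
  card≢0 B h with any? (λ x → B x Boolₚ.≟ true)
  ... | yes q = q
  ... | no q = contradiction (sum-0 _ λ x → cong ⟦_⟧ (Boolₚ.¬-not λ e → q (x , e))) h

  neighbour : ∀ x → ∃[ y ] x ~ y
  neighbour x = card≢0 (adj Γ x) λ q → contradiction (trans (sym (degree-card x)) q) λ ()

  act-inv : ∀ k {x y} → act x k ≡ y → act y (k ⁻) ≡ x
  act-inv k {x} refl = trans (sym (act-∙ x k (k ⁻))) (trans (cong (act x) (inverseʳ k)) (act-ε x))

  act-injective : ∀ k {x y} → act x k ≡ act y k → x ≡ y
  act-injective k {x} {y} q = trans (sym (act-inv k q)) (act-inv k refl)

  module LocalTransitivity (et : EdgeTransitive Γ) where

    edge-transitive : ∀ {u v u' v'} → u ~ v → u' ~ v' →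
      ∃[ k ] ((act u k ≡ u' × act v k ≡ v') ⊎ (act u k ≡ v' × act v k ≡ u'))
    edge-transitive {u} {v} {u'} {v'} h h' with et u v u' v' h h'
    ... | σ , r with complete σ
    ...   | k , q = k , conv r
      where
      conv : _ → _
      conv (inj₁ (a , b)) = inj₁ (trans (q u) a , trans (q v) b)
      conv (inj₂ (a , b)) = inj₂ (trans (q u) a , trans (q v) b)

    -- If the arcs at v were not all equivalent, the orbit of one arc would orient Γ invariantly,
    -- with equal in- and out-degrees adding up to 3.
    locally-transitive : ∀ {v w w'} → v ~ w → v ~ w' → ∃[ k ] (act v k ≡ v × act w k ≡ w')
    locally-transitive {v} {w} {w'} vw vw' = caseA (any? λ x → any? λ y → O? x y ×-dec O? y x)
      where
      O : V → V → Set
      O x y = ∃[ k ] (act v k ≡ x × act w k ≡ y)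
      O? : ∀ x y → Dec (O x y)
      O? x y = any? λ k → (act v k ≟ x) ×-dec (act w k ≟ y)
      O-act : ∀ l {x y} → O x y → O (act x l) (act y l)
      O-act l (k , refl , refl) = k · l , act-∙ v k l , act-∙ w k l
      O-adj : ∀ {x y} → O x y → x ~ y
      O-adj (k , refl , refl) = ~-act k vw
      O-total : ∀ {x y} → x ~ y → O x y ⊎ O y x
      O-total {x} {y} h with edge-transitive vw h
      ... | k , inj₁ q = inj₁ (k , q)
      ... | k , inj₂ q = inj₂ (k , q)
      caseB : ¬ (∃[ x ] ∃[ y ] (O x y × O y x)) → O v w' ⊎ O w' v → O v w'
      caseB _ (inj₁ h) = h
      caseB asym (inj₂ (k , vk , wk)) = ⊥-elim (3≢2d (outdeg v) (*-cancelˡ-≡ 3 (outdeg v + outdeg v) (n Γ) {{≢-nonZero nonempty}} total))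
        where
        nonempty : n Γ ≢ 0
        nonempty q = contradiction (subst Fin q v) λ ()
        transitive : ∀ x → ∃[ l ] act v l ≡ x
        transitive x with neighbour x
        ... | y , xy with O-total xy
        ...   | inj₁ (l , q , _) = l , q
        ...   | inj₂ (l , _ , q) = k ⁻ · l , trans (act-∙ v (k ⁻) l) (trans (cong (λ t → act t l) (act-inv k wk)) q)
        o : V → V → Bool
        o x y = does (O? x y)
        o-act : ∀ l x y → o (act x l) (act y l) ≡ o x y
        o-act l x y with O? x y
        ... | yes h = dec-true (O? _ _) (O-act l h)
        ... | no h = dec-false (O? _ _) λ h' → h (subst₂ O (act-inv l refl) (act-inv l refl) (O-act (l ⁻) h'))
        outdeg indeg : V → ℕ
        outdeg x = card (o x)
        indeg x = card (λ y → o y x)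
        outdeg-const : ∀ x → outdeg x ≡ outdeg v
        outdeg-const x with transitive x
        ... | l , refl = sym (trans (sym (sumOn-1 (o v))) (trans (sumOn-bij (o v) (o (act v l)) (λ _ → 1)
          (λ y → act y l) (λ y → act y (l ⁻)) (λ y h → trans (o-act l v y) h)
          (λ y h → trans (sym (o-act l v (act y (l ⁻)))) (trans (cong (o (act v l)) (lem y)) h))
          (λ y _ → act-inv l refl) (λ y _ → lem y)) (sumOn-1 (o (act v l)))))
          where
          lem : ∀ y → act (act y (l ⁻)) l ≡ y
          lem y = trans (sym (act-∙ y (l ⁻) l)) (trans (cong (act y) (inverseˡ l)) (act-ε y))
        deg : ∀ x → outdeg x + indeg x ≡ 3
        deg x = trans (sym (sum-+ _ _)) (trans (sum-cong pt) (degree-card x))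
          where
          pt : ∀ y → ⟦ o x y ⟧ + ⟦ o y x ⟧ ≡ ⟦ adj Γ x y ⟧
          pt y with O? x y | O? y x
          ... | yes a | yes b = contradiction (x , y , a , b) asym
          ... | yes a | no b = cong ⟦_⟧ (sym (O-adj a))
          ... | no a | yes b = cong ⟦_⟧ (sym (~-sym (O-adj b)))
          ... | no a | no b = cong ⟦_⟧ (sym (Boolₚ.¬-not λ q → [ a , b ]′ (O-total q)))
        total : n Γ * 3 ≡ n Γ * (outdeg v + outdeg v)
        total = begin
          n Γ * 3 ≡⟨ sym (sum-const (n Γ) 3) ⟩
          sum (λ (x : V) → 3) ≡⟨ sum-cong (λ x → sym (deg x)) ⟩
          sum (λ x → outdeg x + indeg x) ≡⟨ sum-+ _ _ ⟩
          sum outdeg + sum indeg ≡⟨ cong (sum outdeg +_) (sum-comm (λ x y → ⟦ o y x ⟧)) ⟩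
          sum outdeg + sum outdeg ≡⟨ cong (λ t → t + t) (trans (sum-cong outdeg-const) (sum-const (n Γ) (outdeg v))) ⟩
          n Γ * outdeg v + n Γ * outdeg v ≡⟨ sym (*-distribˡ-+ (n Γ) _ _) ⟩
          n Γ * (outdeg v + outdeg v) ∎
          where open ≡-Reasoning
        3≢2d : ∀ d → 3 ≢ d + d
        3≢2d zero ()
        3≢2d (suc zero) ()
        3≢2d (suc (suc zero)) ()
        3≢2d (suc (suc (suc d))) q = contradiction (trans (cong (_∸ 3) q) (+-suc d _)) λ ()
      caseA : Dec (∃[ x ] ∃[ y ] (O x y × O y x)) → O v w'
      caseA (no h) = caseB h (O-total vw')
      caseA (yes (x , y , (k₁ , a₁ , b₁) , (k₂ , a₂ , b₂))) with O-total vw'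
      ... | inj₁ h = h
      -- Some edge has both of its arcs in the orbit, so `k₂ · k₁ ⁻` interchanges `v` and `w`;
      -- followed by `k₃` it takes the arc from `v` to `w` to the one from `v` to `w'`.
      ... | inj₂ (k₃ , a₃ , b₃) = k₂ · k₁ ⁻ · k₃ ,
        trans (act-∙ v _ k₃) (trans (cong (λ t → act t k₃) (trans (act-∙ v k₂ _) (trans (cong (λ t → act t (k₁ ⁻)) a₂) (act-inv k₁ b₁)))) b₃) ,
        trans (act-∙ w _ k₃) (trans (cong (λ t → act t k₃) (trans (act-∙ w k₂ _) (trans (cong (λ t → act t (k₁ ⁻)) b₂) (act-inv k₁ a₁)))) a₃)

  record IsSubgroup (X : Carrier K → Bool) : Set where
    field
      has-ε : X e ≡ true
      has-∙ : ∀ {k l} → X k ≡ true → X l ≡ true → X (k · l) ≡ true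
      has-⁻ : ∀ {k} → X k ≡ true → X (k ⁻) ≡ true

  stab : (Carrier K → Bool) → V → Carrier K → Bool
  stab X v k = X k ∧ does (act v k ≟ v)

  inOrbit? : ∀ (X : Carrier K → Bool) v w → Dec (∃[ k ] (X k ≡ true × act v k ≡ w))
  inOrbit? X v w = any? λ k → (X k Boolₚ.≟ true) ×-dec (act v k ≟ w)

  orbit : (Carrier K → Bool) → V → V → Bool
  orbit X v w = does (inOrbit? X v w)

  stab-subgroup : ∀ {X} → IsSubgroup X → ∀ v → IsSubgroup (stab X v)
  stab-subgroup {X} S v = record
    { has-ε = ∧-intro has-ε (dec-true (_ ≟ _) (act-ε v))
    ; has-∙ = λ {k} {l} h h' → let a , b = ∧-true {X k} h ; a' , b' = ∧-true {X l} h' in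
        ∧-intro (has-∙ a a') (dec-true (_ ≟ _) (trans (act-∙ v k l) (trans (cong (λ t → act t l) (true⇒ (_ ≟ _) b)) (true⇒ (_ ≟ _) b'))))
    ; has-⁻ = λ {k} h → let a , b = ∧-true {X k} h in ∧-intro (has-⁻ a) (dec-true (_ ≟ _) (act-inv k (true⇒ (_ ≟ _) b))) }
    where open IsSubgroup S

  -- A non-empty fibre is a coset of the stabiliser, by translation with any one of its elements.
  fibre-card : ∀ {X} → IsSubgroup X → ∀ v w → card (λ k → X k ∧ does (act v k ≟ w)) ≡ ⟦ orbit X v w ⟧ * card (stab X v)
  fibre-card {X} S v w = fibre (inOrbit? X v w) refl
    where
    open IsSubgroup S
    fibre : (d : Dec (∃[ k ] (X k ≡ true × act v k ≡ w))) → does d ≡ orbit X v w →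
      card (λ k → X k ∧ does (act v k ≟ w)) ≡ ⟦ orbit X v w ⟧ * card (stab X v)
    fibre (no h) q = trans (sum-0 _ pt) (cong (λ b → ⟦ b ⟧ * card (stab X v)) q)
      where
      pt : ∀ k → ⟦ X k ∧ does (act v k ≟ w) ⟧ ≡ 0
      pt k with X k in eq
      ... | true = δ-≢ λ q → h (k , eq , q)
      ... | false = refl
    fibre (yes (k₀ , x₀ , refl)) q = trans (trans (sym (sumOn-1 fib)) (trans (sumOn-bij fib (stab X v) (λ _ → 1) (λ k → k · k₀ ⁻) (λ k → k · k₀) to from
          (λ k _ → group (k ∷ k₀ ∷ []) (v0 ⊗ v1 ⊖ ⊗ v1) v0 refl) (λ k _ → group (k ∷ k₀ ∷ []) (v0 ⊗ v1 ⊗ v1 ⊖) v0 refl))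
          (sumOn-1 (stab X v)))) (trans (sym (+-identityʳ _)) (cong (λ b → ⟦ b ⟧ * card (stab X v)) q))
      where
      fib : Carrier K → Bool
      fib k = X k ∧ does (act v k ≟ act v k₀)
      to : ∀ k → fib k ≡ true → stab X v (k · k₀ ⁻) ≡ true
      to k h = let a , b = ∧-true {X k} h in ∧-intro (has-∙ a (has-⁻ x₀)) (dec-true (_ ≟ _)
        (trans (act-∙ v k (k₀ ⁻)) (act-inv k₀ (sym (true⇒ (_ ≟ _) b)))))
      from : ∀ k → stab X v k ≡ true → fib (k · k₀) ≡ true
      from k h = let a , b = ∧-true {X k} h in ∧-intro (has-∙ a x₀) (dec-true (_ ≟ _)
        (trans (act-∙ v k k₀) (cong (λ t → act t k₀) (true⇒ (_ ≟ _) b))))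

  orbit-stabiliser : ∀ {X} → IsSubgroup X → ∀ v → card X ≡ card (orbit X v) * card (stab X v)
  orbit-stabiliser {X} S v = begin
    card X ≡⟨ sum-cong (λ k → trans (sym (*-identityʳ ⟦ X k ⟧)) (trans (cong (⟦ X k ⟧ *_) (sym (sum-δ1 (act v k)))) (sym (sum-*ˡ ⟦ X k ⟧ _)))) ⟩
    sum (λ k → sum (λ w → ⟦ X k ⟧ * δ (act v k) w)) ≡⟨ sum-comm (λ k w → ⟦ X k ⟧ * δ (act v k) w) ⟩
    sum (λ w → sum (λ k → ⟦ X k ⟧ * δ (act v k) w)) ≡⟨ sum-cong (λ w → trans (sum-cong λ k → sym (∧-* (X k) _)) (fibre-card S v w)) ⟩
    sum (λ w → ⟦ orbit X v w ⟧ * card (stab X v)) ≡⟨ sum-*ʳ (card (stab X v)) (λ w → ⟦ orbit X v w ⟧) ⟩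
    card (orbit X v) * card (stab X v) ∎
    where
    open ≡-Reasoning
    ∧-* : ∀ a b → ⟦ a ∧ b ⟧ ≡ ⟦ a ⟧ * ⟦ b ⟧
    ∧-* true b = sym (+-identityʳ ⟦ b ⟧)
    ∧-* false b = refl

-- The cosets of H in Aut Γ

≈-∣ : ∀ {m x y} → x ≈ y [ m ] → m ∣ x → m ∣ y
≈-∣ e h = ≈0⇒∣ (≈-trans (≈-sym e) (∣⇒≈0 h))

module FixStep (p : ℕ) (pp : Prime p) {N : ℕ} (s : Fin N → Fin N) (k : ℕ) where
  open PrimeFacts p pp

  fixed : (Fin N → Bool) → Fin N → Bool
  fixed B x = B x ∧ does (s x ≟ x)

  module _ (B : Fin N → Bool) (s-B : ∀ x → B x ≡ true → B (s x) ≡ true) (per : ∀ x → B x ≡ true → iter (p ^ k) s x ≡ x) where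

    period-∣ : ∀ {x ℓ} → B x ≡ true → s x ≢ x → ExactPeriod s ℓ x → p ∣ ℓ
    period-∣ {x} {ℓ} bx mv ep with ∣p^⇒ k (exactPeriod-∣ ep (p ^ k) (per x bx))
    ... | inj₁ refl = contradiction (ExactPeriod.period ep) mv
    ... | inj₂ h = h

    -- The moved points are again stable under `s`, and their orbits contribute 0 modulo p one by
    -- one.
    sum-fixed : ∀ (f : Fin N → ℕ) →
      (∀ x ℓ → B x ≡ true → s x ≢ x → ExactPeriod s ℓ x → p ∣ sum {ℓ} (λ i → f (iter (toℕ i) s x))) →
      sumOn B f ≈ sumOn (fixed B) f [ p ]
    sum-fixed f dv = ≈-trans (≈-reflexive (sumOn-split B (λ x → does (s x ≟ x)) f))
      (≈-trans (≈-+ ≈-refl (∣⇒≈0 moved)) (≈-reflexive (+-identityʳ _)))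
      where
      B' : Fin N → Bool
      B' x = B x ∧ not (does (s x ≟ x))
      B'⇒ : ∀ {x} → B' x ≡ true → B x ≡ true × s x ≢ x
      B'⇒ {x} h with B x | s x ≟ x
      ... | true | no q = refl , q
      s-inj : ∀ {x y} → B x ≡ true → B y ≡ true → s x ≡ s y → x ≡ y
      s-inj {x} {y} bx by q = trans (sym (per x bx)) (trans (go (p ^ k) (0<p^ k)) (per y by))
        where
        comm : ∀ m w → iter m s (s w) ≡ s (iter m s w)
        comm zero w = refl
        comm (suc m) w = cong s (comm m w)
        go : ∀ m → 0 < m → iter m s x ≡ iter m s y
        go (suc m) _ = trans (sym (comm m x)) (trans (cong (iter m s) q) (comm m y))
      moved : p ∣ sumOn B' f
      moved = orbit-sum s (p ^ k) (0<p^ k) p f B'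
        (λ x h → let bx , mv = B'⇒ {x} h in ∧-intro (s-B x bx) (cong not (dec-false (_ ≟ _) λ q → mv (s-inj (s-B x bx) bx q))))
        (λ x h → per x (proj₁ (B'⇒ {x} h)))
        (λ x ℓ h → let bx , mv = B'⇒ {x} h in dv x ℓ bx mv)

    card-fixed : card B ≈ card (fixed B) [ p ]
    card-fixed = subst₂ (_≈_[ p ]) (sumOn-1 B) (sumOn-1 (fixed B)) (sum-fixed (λ _ → 1)
      λ x ℓ bx mv ep → subst (p ∣_) (sym (trans (sum-const ℓ 1) (*-identityʳ ℓ))) (period-∣ bx mv ep))

module Core (p : ℕ) (pp : Prime p) (H : FiniteGroup) (pg : IsPGroup p H) (Γ : Graph) (conn : Connected Γ)
            (cubic : Cubic Γ) (et : EdgeTransitive Γ) (A : BiCayleyAction H Γ) where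

  module ℍ = PGroup p pp H pg
  module 𝔾 = GraphAction Γ cubic (autAction Γ)
  open 𝔾 public
  open 𝔾.LocalTransitivity et public

  private
    ι-aut : ∀ h → ∃[ k ] ∀ v → act v k ≡ ρ A h v
    ι-aut h = complete record
      { to = ρ A h ; from = ρ A (h ℍ.⁻)
      ; from∘to = λ v → trans (sym (ρ-hom A h (h ℍ.⁻) v)) (trans (cong (λ g → ρ A g v) (ℍ.inverseʳ h)) (ρ-ε A v))
      ; to∘from = λ v → trans (sym (ρ-hom A (h ℍ.⁻) h v)) (trans (cong (λ g → ρ A g v) (ℍ.inverseˡ h)) (ρ-ε A v))
      ; adj-pres = ρ-adj A h }

  opaque
    ι : Carrier H → Carrier K
    ι h = proj₁ (ι-aut h)

    ι-act : ∀ h v → act v (ι h) ≡ ρ A h v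
    ι-act h = proj₂ (ι-aut h)

  ι-∙ : ∀ h h' → ι (h ℍ.· h') ≡ ι h · ι h'
  ι-∙ h h' = faithful λ v → trans (ι-act _ v) (trans (ρ-hom A h h' v) (sym (trans (act-∙ v (ι h) (ι h'))
    (trans (ι-act h' _) (cong (ρ A h') (ι-act h v))))))

  ι-e : ι ℍ.e ≡ e
  ι-e = faithful λ v → trans (ι-act _ v) (trans (ρ-ε A v) (sym (act-ε v)))

  ι-⁻ : ∀ h → ι (h ℍ.⁻) ≡ ι h ⁻
  ι-⁻ h = inv-unique (ι h) _ (trans (sym (ι-∙ h _)) (trans (cong ι (ℍ.inverseʳ h)) ι-e))

  ι-↑ : ∀ h m → ι (h ℍ.↑ m) ≡ ι h ↑ m
  ι-↑ h zero = ι-e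
  ι-↑ h (suc m) = trans (ι-∙ h _) (cong (ι h ·_) (ι-↑ h m))

  u : Bool → V
  u false = proj₁ (two-orbits A)
  u true = proj₁ (proj₂ (two-orbits A))

  semireg : ∀ h v → act v (ι h) ≡ v → h ≡ ℍ.e
  semireg h v q = semiregular A h v (trans (sym (ι-act h v)) q)

  ι-injective : ∀ {h h'} → ι h ≡ ι h' → h ≡ h'
  ι-injective {h} {h'} q = trans (sym (ℍ.inv-inv h)) (sym (ℍ.inv-unique (h ℍ.⁻) h' (semireg _ (u false)
    (trans (cong (act (u false)) (trans (ι-∙ _ _) (trans (cong₂ _·_ (ι-⁻ h) (sym q)) (inverseˡ _)))) (act-ε _)))))

  coord : ∀ v → ∃[ i ] ∃[ h ] act (u i) (ι h) ≡ v
  coord v with proj₂ (proj₂ (proj₂ (two-orbits A))) v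
  ... | h , inj₁ q = false , h , trans (ι-act h _) q
  ... | h , inj₂ q = true , h , trans (ι-act h _) q

  side : V → Bool
  side v = proj₁ (coord v)

  hc : V → Carrier H
  hc v = proj₁ (proj₂ (coord v))

  hc-eq : ∀ v → act (u (side v)) (ι (hc v)) ≡ v
  hc-eq v = proj₂ (proj₂ (coord v))

  act-ι-⁻ : ∀ {v w} h → act v (ι h) ≡ w → act w (ι (h ℍ.⁻)) ≡ v
  act-ι-⁻ {v} {w} h q = trans (cong (act w) (ι-⁻ h)) (act-inv (ι h) q)

  act-ι-∙ : ∀ v h h' → act v (ι (h ℍ.· h')) ≡ act (act v (ι h)) (ι h')
  act-ι-∙ v h h' = trans (cong (act v) (ι-∙ h h')) (act-∙ v _ _)

  coord-unique : ∀ i j h h' → act (u i) (ι h) ≡ act (u j) (ι h') → i ≡ j × h ≡ h'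
  coord-unique i j h h' q = sides i j diff , lem i j (sides i j diff) diff
    where
    diff : act (u i) (ι (h ℍ.· h' ℍ.⁻)) ≡ u j
    diff = trans (act-ι-∙ (u i) h _) (act-ι-⁻ h' (sym q))
    sides : ∀ i j → act (u i) (ι (h ℍ.· h' ℍ.⁻)) ≡ u j → i ≡ j
    sides false false _ = refl
    sides true true _ = refl
    sides false true q = contradiction (trans (sym (ι-act _ _)) q) (proj₁ (proj₂ (proj₂ (two-orbits A))) _)
    sides true false q = contradiction (trans (sym (ι-act _ _)) (act-ι-⁻ _ q)) (proj₁ (proj₂ (proj₂ (two-orbits A))) _)
    lem : ∀ i j → i ≡ j → act (u i) (ι (h ℍ.· h' ℍ.⁻)) ≡ u j → h ≡ h'
    lem i .i refl q = trans (ℍ.group (h ∷ h' ∷ []) ℍ.v0 (ℍ.v0 ℍ.⊗ ℍ.v1 ℍ.⊖ ℍ.⊗ ℍ.v1) refl)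
      (trans (cong (ℍ._· h') (semireg _ (u i) q)) (ℍ.identityˡ h'))

  coord-of : ∀ {v} i h → act (u i) (ι h) ≡ v → side v ≡ i × hc v ≡ h
  coord-of {v} i h q = coord-unique _ _ _ _ (trans (hc-eq v) (sym q))

  -- T is a transversal of the cosets t H in Aut Γ.

  InT : Carrier K → Set
  InT t = ∃[ i ] act (u false) t ≡ u i

  InT? : ∀ t → Dec (InT t)
  InT? t with act (u false) t ≟ u false | act (u false) t ≟ u true
  ... | yes q | _ = yes (false , q)
  ... | no _ | yes q = yes (true , q)
  ... | no q | no q' = no λ { (false , r) → q r ; (true , r) → q' r }

  T : Carrier K → Bool
  T t = does (InT? t)

  infixr 6 _•_
  -- The cocycle of the transversal: `g · t` lies in the coset of `g • t`, and `c g t` is the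
  -- remaining factor from H. It is read off from the image of the base vertex, because H acts
  -- semiregularly.
  c : Carrier K → Carrier K → Carrier H
  c g t = hc (act (u false) (g · t))

  _•_ : Carrier K → Carrier K → Carrier K
  g • t = g · t · ι (c g t) ⁻

  •-InT : ∀ g t → InT (g • t)
  •-InT g t = side w , trans (act-∙ (u false) (g · t) (ι (c g t) ⁻)) (act-inv _ (hc-eq w))
    where w = act (u false) (g · t)

  •-eq : ∀ g t → g · t ≡ (g • t) · ι (c g t)
  •-eq g t = group (g · t ∷ ι (c g t) ∷ []) v0 (v0 ⊗ v1 ⊖ ⊗ v1) refl

  •-unique : ∀ {g t t'} h → InT t' → g · t ≡ t' · ι h → g • t ≡ t' × c g t ≡ h
  •-unique {g} {t} {t'} h (i , q) r = trans (cong₂ (λ x y → x · ι y ⁻) r c≡) (group (t' ∷ ι h ∷ []) (v0 ⊗ v1 ⊗ v1 ⊖) v0 refl) , c≡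
    where
    c≡ : c g t ≡ h
    c≡ = proj₂ (coord-of i h (trans (cong (λ v → act v (ι h)) (sym q)) (trans (sym (act-∙ (u false) t' (ι h))) (cong (act (u false)) (sym r)))))

  •-∙ : ∀ g g' t → (g · g') • t ≡ g • g' • t × c (g · g') t ≡ c g (g' • t) ℍ.· c g' t
  •-∙ g g' t = •-unique _ (•-InT g (g' • t)) (begin
    g · g' · t ≡⟨ assoc g g' t ⟩
    g · (g' · t) ≡⟨ cong (g ·_) (•-eq g' t) ⟩
    g · ((g' • t) · ι (c g' t)) ≡⟨ sym (assoc g _ _) ⟩
    g · (g' • t) · ι (c g' t) ≡⟨ cong (_· ι (c g' t)) (•-eq g (g' • t)) ⟩
    (g • g' • t) · ι (c g (g' • t)) · ι (c g' t) ≡⟨ assoc _ _ _ ⟩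
    (g • g' • t) · (ι (c g (g' • t)) · ι (c g' t)) ≡⟨ cong ((g • g' • t) ·_) (sym (ι-∙ _ _)) ⟩
    (g • g' • t) · ι (c g (g' • t) ℍ.· c g' t) ∎)
    where open ≡-Reasoning

  e-• : ∀ {t} → InT t → e • t ≡ t
  e-• {t} h = proj₁ (•-unique {e} ℍ.e h (trans (identityˡ t) (sym (trans (cong (t ·_) ι-e) (identityʳ t)))))

  -- t is fixed by k exactly when k normalises t H t⁻¹, and then c k t = t⁻¹ k t.
  fixed-conj : ∀ {g t} → g • t ≡ t → conj (t ⁻) g ≡ ι (c g t)
  fixed-conj {g} {t} q = begin
    t ⁻ · g · t ⁻ ⁻ ≡⟨ group (t ∷ g ∷ []) (v0 ⊖ ⊗ v1 ⊗ v0 ⊖ ⊖) (v0 ⊖ ⊗ (v1 ⊗ v0)) refl ⟩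
    t ⁻ · (g · t) ≡⟨ cong (t ⁻ ·_) (•-eq g t) ⟩
    t ⁻ · ((g • t) · ι (c g t)) ≡⟨ cong (λ x → t ⁻ · (x · ι (c g t))) q ⟩
    t ⁻ · (t · ι (c g t)) ≡⟨ cancelˡ t _ ⟩
    ι (c g t) ∎
    where open ≡-Reasoning

  conj-fixed : ∀ {g t} h → InT t → conj (t ⁻) g ≡ ι h → g • t ≡ t × c g t ≡ h
  conj-fixed {g} {t} h it q = •-unique h it (trans (group (t ∷ g ∷ []) (v1 ⊗ v0) (v0 ⊗ (v0 ⊖ ⊗ v1 ⊗ v0 ⊖ ⊖)) refl) (cong (t ·_) q))

  ⇒T : ∀ {t} → InT t → T t ≡ true
  ⇒T {t} h = dec-true (InT? t) h

  T⇒ : ∀ {t} → T t ≡ true → InT t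
  T⇒ {t} h = true⇒ (InT? t) h

  iter-• : ∀ h m {t} → InT t → iter m (ι h •_) t ≡ ι (h ℍ.↑ m) • t
  iter-• h zero it = sym (trans (cong (_• _) ι-e) (e-• it))
  iter-• h (suc m) {t} it = trans (cong (ι h •_) (iter-• h m it)) (sym (trans (cong (_• t) (ι-∙ h _)) (proj₁ (•-∙ (ι h) _ t))))

  period-• : ∀ h {t} → InT t → iter (p ^ ℍ.K) (ι h •_) t ≡ t
  period-• h {t} it = trans (iter-• h (p ^ ℍ.K) it) (trans (cong (λ x → ι x • t) (ℍ.↑-p^K h)) (trans (cong (_• t) ι-e) (e-• it)))

  Fix : Carrier H → (Carrier K → Bool) → Carrier K → Bool
  Fix h = FixStep.fixed p pp (ι h •_) ℍ.K

  Fix⇒ : ∀ h {B t} → Fix h B t ≡ true → B t ≡ true × ι h • t ≡ t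
  Fix⇒ h {B} {t} q = let a , b = ∧-true {B t} q in a , true⇒ (_ ≟ _) b

  ⇒Fix : ∀ h {B t} → B t ≡ true → ι h • t ≡ t → Fix h B t ≡ true
  ⇒Fix h a b = ∧-intro a (dec-true (_ ≟ _) b)

  everything : Carrier K → Bool
  everything _ = true

  everything-subgroup : IsSubgroup everything
  everything-subgroup = record { has-ε = refl ; has-∙ = λ _ _ → refl ; has-⁻ = λ _ → refl }

  card-T : card T ≡ (1 + ⟦ orbit everything (u false) (u true) ⟧) * card (stab everything (u false))
  card-T = trans (sum-cong pt) (trans (sum-+ _ _) (cong (card (stab everything (u false)) +_) (fibre-card everything-subgroup (u false) (u true))))
    where
    u≢ : u false ≢ u true
    u≢ q = contradiction (trans (ι-act _ _) (trans (ρ-ε A _) q) ) λ r → proj₁ (proj₂ (proj₂ (two-orbits A))) ℍ.e (trans (sym (ι-act _ _)) r)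
    pt : ∀ t → ⟦ T t ⟧ ≡ ⟦ stab everything (u false) t ⟧ + ⟦ does (act (u false) t ≟ u true) ⟧
    pt t with act (u false) t ≟ u false | act (u false) t ≟ u true
    ... | yes q | yes q' = contradiction (trans (sym q) q') u≢
    ... | yes q | no _ = refl
    ... | no _ | yes q = refl
    ... | no _ | no _ = refl

  module Pair (g b : Carrier H) (g-normal : ∀ x → ∃[ j ] ℍ.conj x g ≡ g ℍ.↑ j) where

    -- If `g` and `b` generate H, these are the members of the transversal whose coset is fixed by
    -- H, that is, those that normalise H.
    T₀ : Carrier K → Bool
    T₀ = Fix b (Fix g T)

    -- Two rounds of counting fixed points, first of ⟨g⟩, then of b on the fixed points of ⟨g⟩.
    card-T₀ : card T ≈ card T₀ [ p ]
    card-T₀ = ≈-trans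
      (FixStep.card-fixed p pp (ι g •_) ℍ.K T (λ t h → ⇒T (•-InT (ι g) t)) (λ t h → period-• g (T⇒ {t} h)))
      (FixStep.card-fixed p pp (ι b •_) ℍ.K (Fix g T) stable (λ t h → period-• b (T⇒ {t} (proj₁ (Fix⇒ g {T} {t} h)))))
      where
      fixed-↑ : ∀ {t} → InT t → ι g • t ≡ t → ∀ j → ι (g ℍ.↑ j) • t ≡ t
      fixed-↑ it q zero = trans (cong (_• _) ι-e) (e-• it)
      fixed-↑ {t} it q (suc j) = trans (cong (_• t) (ι-∙ g _)) (trans (proj₁ (•-∙ (ι g) _ t)) (trans (cong (ι g •_) (fixed-↑ it q j)) q))
      stable : ∀ t → Fix g T t ≡ true → Fix g T (ι b • t) ≡ true
      stable t h with Fix⇒ g {T} {t} h | g-normal (b ℍ.⁻)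
      ... | tT , q | j , r = ⇒Fix g {T} (⇒T (•-InT (ι b) t)) (begin
        ι g • ι b • t ≡⟨ sym (proj₁ (•-∙ (ι g) (ι b) t)) ⟩
        (ι g · ι b) • t ≡⟨ cong (_• t) (trans (sym (ι-∙ g b)) (trans (cong ι swap) (ι-∙ b _))) ⟩
        (ι b · ι (g ℍ.↑ j)) • t ≡⟨ proj₁ (•-∙ (ι b) _ t) ⟩
        ι b • ι (g ℍ.↑ j) • t ≡⟨ cong (ι b •_) (fixed-↑ (T⇒ {t} tT) q j) ⟩
        ι b • t ∎)
        where
        open ≡-Reasoning
        swap : g ℍ.· b ≡ b ℍ.· g ℍ.↑ j
        swap = trans (ℍ.group (b ∷ g ∷ []) (ℍ.v1 ℍ.⊗ ℍ.v0) (ℍ.v0 ℍ.⊗ (ℍ.v0 ℍ.⊖ ℍ.⊗ ℍ.v1 ℍ.⊗ ℍ.v0 ℍ.⊖ ℍ.⊖)) refl) (cong (b ℍ.·_) r)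

-- The transfer to H vanishes for p > 3

module CoreLemmas (p : ℕ) (pp : Prime p) (H : FiniteGroup) (pg : IsPGroup p H) (Γ : Graph) (conn : Connected Γ)
                  (cubic : Cubic Γ) (et : EdgeTransitive Γ) (A : BiCayleyAction H Γ) where
  open Core p pp H pg Γ conn cubic et A public

  -- Local transitivity makes the three neighbours of the base vertex one orbit of its stabiliser.
  3∣stab : 3 ∣ card (stab everything (u false))
  3∣stab with neighbour (u false)
  ... | y , uy = divides (card (stab X y)) (trans (orbit-stabiliser (stab-subgroup everything-subgroup (u false)) y)
    (trans (cong (_* card (stab X y)) orbit≡3) (*-comm 3 (card (stab X y)))))
    where
    X = stab everything (u false)
    orbit≡3 : card (orbit X y) ≡ 3
    orbit≡3 = trans (card-cong pt) (degree-card (u false))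
      where
      pt : ∀ w → orbit X y w ≡ adj Γ (u false) w
      pt w with inOrbit? X y w
      ... | yes (k , xk , refl) = sym (trans (cong (λ v → adj Γ v (act y k)) (sym (true⇒ (_ ≟ _) xk))) (~-act k uy))
      ... | no h = sym (Boolₚ.¬-not λ q → let k , a , b = locally-transitive uy q in h (k , dec-true (_ ≟ _) a , b))

  order-∣-subgroup : ∀ {X} → IsSubgroup X → ∀ {g} → X g ≡ true → ∃[ ℓ ] (g ↑ ℓ ≡ e × ℓ ∣ card X)
  order-∣-subgroup {X} S {g} Xg with finite-order g
  ... | E , 0<E , q with exactPeriod (g ·_) E 0<E e (trans (iter-· g E e) (trans (identityʳ _) q))
  ... | ℓ , ep = ℓ , trans (sym (identityʳ _)) (trans (sym (iter-· g ℓ e)) (ExactPeriod.period ep)) ,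
    subst (ℓ ∣_) (sumOn-1 X) (orbit-sum (g ·_) E 0<E ℓ (λ _ → 1) X (λ _ → IsSubgroup.has-∙ S Xg)
        (λ y _ → trans (iter-· g E y) (trans (cong (_· y) q) (identityˡ y)))
        λ y ℓ' _ ep' → subst (ℓ ∣_) (sym (trans (sum-const ℓ' 1) (*-identityʳ ℓ')))
          (exactPeriod-∣ ep ℓ' (trans (iter-· g ℓ' e) (trans (identityʳ _) (per⇒ y ℓ' (ExactPeriod.period ep'))))))
    where
    per⇒ : ∀ y k → iter k (g ·_) y ≡ y → g ↑ k ≡ e
    per⇒ y k h = ·-cancelʳ y (trans (sym (iter-· g k y)) (trans h (sym (identityˡ y))))

  Fixes : (Carrier K → Bool) → V → Set
  Fixes X v = ∀ k → X k ≡ true → act v k ≡ v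

  ¬Fixes⇒ : ∀ X v → ¬ Fixes X v → ∃[ k ] (X k ≡ true × act v k ≢ v)
  ¬Fixes⇒ X v h with any? (λ k → (X k Boolₚ.≟ true) ×-dec ¬? (act v k ≟ v))
  ... | yes r = r
  ... | no r = contradiction (λ k a → decidable-stable (act v k ≟ v) λ b → r (k , a , b)) h

  fixes? : ∀ X v → Dec (Fixes X v)
  fixes? X v with any? (λ k → (X k Boolₚ.≟ true) ×-dec ¬? (act v k ≟ v))
  ... | yes (k , a , b) = no λ h → b (h k a)
  ... | no h = yes λ k a → decidable-stable (act v k ≟ v) λ b → h (k , a , b)

  -- Near X x says that X moves every neighbour of x in an orbit of length prime to q; fixing one
  -- vertex after the other along walks then shows that the order of X is prime to q.
  module StabiliserChain (q : ℕ) (qp : Prime q) (Near : (Carrier K → Bool) → V → Set)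
      (near-fixes : ∀ {X x} → Near X x → Fixes X x)
      (near-next : ∀ {X x y} → Near X x → x ~ y → Fixes X y → Near X y)
      (near-stab : ∀ {X x} y → Near X x → Near (stab X y) x)
      (near-orbit : ∀ {X x y} → IsSubgroup X → Near X x → x ~ y → ¬ Fixes X y → ¬ q ∣ card (orbit X y)) where

    private
      boundary : ∀ X {v w} → Walk Γ v w → Near X v → ¬ Fixes X w → ∃[ x ] ∃[ y ] (x ~ y × Near X x × ¬ Fixes X y)
      boundary X here h h' = contradiction (near-fixes h) h'
      boundary X (step {x} {y} xy w) h h' with fixes? X y
      ... | yes f = boundary X w (near-next h xy f) h'
      ... | no f = x , y , xy , h , f

    coprime : ∀ X → IsSubgroup X → ∀ v → Near X v → ¬ q ∣ card X
    coprime X = <-rec (λ m → ∀ X → card X ≡ m → IsSubgroup X → ∀ v → Near X v → ¬ q ∣ card X) descend (card X) X refl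
      where
      descend : ∀ m → (∀ {m'} → m' < m → ∀ X → card X ≡ m' → IsSubgroup X → ∀ v → Near X v → ¬ q ∣ card X) →
        ∀ X → card X ≡ m → IsSubgroup X → ∀ v → Near X v → ¬ q ∣ card X
      descend m rec X refl S v fv with any? (λ w → ¬? (fixes? X w))
      ... | no none = λ h → PrimeFacts.p∤1 q qp (subst (q ∣_) one' h)
        where
        one' : card X ≡ 1
        one' = trans (sum-cong pt) (sum-δ1 e)
          where
          pt : ∀ k → ⟦ X k ⟧ ≡ δ e k
          pt k with X k in eq
          ... | true = sym (δ-≡ {x = e} {k} (faithful λ w → trans (act-ε w) (sym (decidable-stable (fixes? X w) (λ f → none (w , f)) k eq))))
          ... | false = sym (δ-≢ {x = e} {k} λ { refl → contradiction (trans (sym eq) (IsSubgroup.has-ε S)) λ () })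
      ... | yes (w , ¬fw) with boundary X (conn v w) fv ¬fw
      ... | x , y , xy , nx , ¬fy = λ h → bad (euclidsLemma (card (orbit X y)) (card (stab X y)) qp (subst (q ∣_) os h))
        where
        os = orbit-stabiliser S y
        moves = ¬Fixes⇒ X y ¬fy
        k₀ = proj₁ moves
        ≥2 : 2 ≤ card (orbit X y)
        ≥2 = ≤-trans (≤-reflexive (sym (trans (sum-+ (δ y) (δ (act y k₀))) (cong₂ _+_ (sum-δ1 y) (sum-δ1 (act y k₀)))))) (sum-mono pt)
          where
          pt : ∀ z → δ y z + δ (act y k₀) z ≤ ⟦ orbit X y z ⟧
          pt z with y ≟ z | act y k₀ ≟ z
          ... | yes a | yes b = contradiction (trans b (sym a)) (proj₂ (proj₂ moves))
          ... | no a | no b = z≤n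
          ... | yes refl | no b = ≤-reflexive (cong ⟦_⟧ (sym (dec-true (inOrbit? X y y) (e , IsSubgroup.has-ε S , act-ε y))))
          ... | no a | yes refl = ≤-reflexive (cong ⟦_⟧ (sym (dec-true (inOrbit? X y (act y k₀)) (k₀ , proj₁ (proj₂ moves) , refl))))
        pos : 0 < card (stab X y)
        pos = card-pos (stab X y) e (IsSubgroup.has-ε (stab-subgroup S y))
        smaller : card (stab X y) < card X
        smaller = ≤-trans (m<m*n (card (stab X y)) (card (orbit X y)) {{≢-nonZero (m<n⇒n≢0 pos)}} ≥2) (≤-reflexive (trans (*-comm (card (stab X y)) _) (sym os)))
        bad : q ∣ card (orbit X y) ⊎ q ∣ card (stab X y) → ⊥
        bad (inj₁ h) = near-orbit S nx xy ¬fy h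
        bad (inj₂ h) = rec smaller (stab X y) refl (stab-subgroup S y) v (near-stab y fv) h

  orbit-adjacent : ∀ {X x y} → Fixes X x → x ~ y → ∀ z → orbit X y z ≡ true → x ~ z
  orbit-adjacent {X} {x} {y} fx xy z h with true⇒ (inOrbit? X y z) h
  ... | k , xk , refl = trans (cong (λ t → adj Γ t (act y k)) (sym (fx k xk))) (~-act k xy)

  orbit-pos : ∀ {X} → IsSubgroup X → ∀ y → 0 < card (orbit X y)
  orbit-pos {X} S y = card-pos (orbit X y) y (dec-true (inOrbit? X y y) (e , IsSubgroup.has-ε S , act-ε y))

  orbit≤3 : ∀ {X x y} → Fixes X x → x ~ y → card (orbit X y) ≤ 3
  orbit≤3 {X} {x} {y} fx xy = ≤-trans (sum-mono pt) (≤-reflexive (degree-card x))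
    where
    pt : ∀ z → ⟦ orbit X y z ⟧ ≤ ⟦ adj Γ x z ⟧
    pt z with orbit X y z in eq
    ... | false = z≤n
    ... | true = ≤-reflexive (cong ⟦_⟧ (sym (orbit-adjacent {X} fx xy z eq)))

  Fixes-stab : ∀ {X v} y → Fixes X v → Fixes (stab X y) v
  Fixes-stab {X} y f k h = f k (proj₁ (∧-true {X k} h))

  -- A group fixing a vertex and one of its neighbours has only two further neighbours to permute,
  -- so the orbits met along the chain of stabilisers have length 1 or 2. A newly fixed vertex again
  -- has a fixed neighbour, the one it was reached from.
  edge-stabiliser : ∀ X → IsSubgroup X → ∀ {v w} → v ~ w → Fixes X v → Fixes X w → ¬ 3 ∣ card X
  edge-stabiliser X S {v} {w} vw fv fw = StabiliserChain.coprime 3 (toWitness {a? = prime? 3} _) (λ X x → Fixes X x × ∃[ w ] (x ~ w × Fixes X w))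
    proj₁ (λ {X} {x} (fx , _) xy fy → fy , x , ~-sym xy , fx) (λ {X} y (fx , w , xw , fw) → Fixes-stab {X} y fx , w , xw , Fixes-stab {X} y fw)
    near-orbit X S v (fv , w , vw , fw)
    where
    near-orbit : ∀ {X x y} → IsSubgroup X → Fixes X x × ∃[ w ] (x ~ w × Fixes X w) → x ~ y → ¬ Fixes X y → ¬ 3 ∣ card (orbit X y)
    near-orbit {X} {x} {y} S (fx , w , xw , fw) xy ¬fy h = small (card (orbit X y)) (orbit-pos S y) (s≤s⁻¹ (subst (_≤ 3) (+-comm (card (orbit X y)) 1) ≤2)) h
      where
      small : ∀ d → 0 < d → d ≤ 2 → ¬ 3 ∣ d
      small 1 _ _ h = contradiction (∣⇒≤ h) λ { (s≤s ()) }
      small 2 _ _ h = contradiction (∣⇒≤ h) λ { (s≤s (s≤s ())) }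
      small (suc (suc (suc _))) _ (s≤s (s≤s ()))
      ≤2 : card (orbit X y) + 1 ≤ 3
      ≤2 = ≤-trans (≤-reflexive (trans (cong (card (orbit X y) +_) (sym (sum-δ1 w))) (sym (sum-+ _ _)))) (≤-trans (sum-mono pt) (≤-reflexive (degree-card x)))
        where
        pt : ∀ z → ⟦ orbit X y z ⟧ + δ w z ≤ ⟦ adj Γ x z ⟧
        pt z with orbit X y z in eq | w ≟ z
        ... | false | no _ = z≤n
        ... | false | yes refl = ≤-reflexive (cong ⟦_⟧ (sym xw))
        ... | true | no _ = ≤-reflexive (cong ⟦_⟧ (sym (orbit-adjacent {X} fx xy z eq)))
        ... | true | yes refl with true⇒ (inOrbit? X y w) eq
        ...   | k , xk , q = contradiction (subst (Fixes X) (act-injective k (trans (fw k xk) (sym q))) fw) ¬fy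

  module BigPrime (p∤2 : ¬ p ∣ 2) (p∤3 : ¬ p ∣ 3) where

    -- One fixed vertex suffices as starting point: orbits on its neighbours have length at most 3,
    -- and p divides none of 1, 2, 3.
    stabiliser-coprime : ∀ X → IsSubgroup X → ∀ v → Fixes X v → ¬ p ∣ card X
    stabiliser-coprime = StabiliserChain.coprime p pp Fixes id (λ _ _ f → f) (λ {X} y → Fixes-stab {X} y)
      λ {X} {x} {y} S fx xy _ → small (card (orbit X y)) (orbit-pos S y) (orbit≤3 {X} fx xy)
      where
      small : ∀ d → 0 < d → d ≤ 3 → ¬ p ∣ d
      small 1 _ _ = ℍ.p∤1
      small 2 _ _ = p∤2
      small 3 _ _ = p∤3
      small (suc (suc (suc (suc d)))) _ (s≤s (s≤s (s≤s ())))

    stab-fixes : ∀ v → Fixes (stab everything v) v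
    stab-fixes v k h = true⇒ (act v k ≟ v) h

    p∤card-T : ¬ p ∣ card T
    p∤card-T h = bad (euclidsLemma _ _ pp (subst (p ∣_) card-T h))
      where
      bad : p ∣ 1 + ⟦ orbit everything (u false) (u true) ⟧ ⊎ p ∣ card (stab everything (u false)) → ⊥
      bad (inj₂ q) = stabiliser-coprime _ (stab-subgroup everything-subgroup (u false)) (u false) (stab-fixes (u false)) q
      bad (inj₁ q) = lem (orbit everything (u false) (u true)) q
        where
        lem : ∀ b → p ∣ 1 + ⟦ b ⟧ → ⊥
        lem true = p∤2
        lem false = ℍ.p∤1

    stab-order : ∀ v g → act v g ≡ v → ∃[ ℓ ] (g ↑ ℓ ≡ e × ¬ p ∣ ℓ)
    stab-order v g q with order-∣-subgroup (stab-subgroup everything-subgroup v) {g} (dec-true (act v g ≟ v) q)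
    ... | ℓ , a , b = ℓ , a , λ h → stabiliser-coprime _ (stab-subgroup everything-subgroup v) v (stab-fixes v) (∣-trans h b)

    module Transfer (χ : Carrier H → ℕ) (χ-∙ : ∀ h h' → χ (h ℍ.· h') ≈ χ h + χ h' [ p ]) where

      tr : Carrier K → ℕ
      tr g = sumOn T (λ t → χ (c g t))

      sumOn-≈ : ∀ {m} (B : Fin m → Bool) {f f' : Fin m → ℕ} → (∀ x → f x ≈ f' x [ p ]) → sumOn B f ≈ sumOn B f' [ p ]
      sumOn-≈ {zero} B h = ≈-reflexive (trans (sum-zero _) (sym (sum-zero _)))
      sumOn-≈ {suc m} B h = ≈-trans (≈-reflexive (sum-suc _)) (≈-trans (≈-+ (≈-*ˡ ⟦ B zero ⟧ (h zero)) (sumOn-≈ (B ∘ suc) (h ∘ suc))) (≈-reflexive (sym (sum-suc _))))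

      -- The cocycle identity splits the sum in two. In the first part `t` is replaced by `g' • t`,
      -- which permutes the transversal.
      tr-∙ : ∀ g g' → tr (g · g') ≈ tr g + tr g' [ p ]
      tr-∙ g g' = ≈-trans (sumOn-≈ T (λ t → ≈-trans (≈-reflexive (cong χ (proj₂ (•-∙ g g' t)))) (χ-∙ _ _)))
        (≈-reflexive (trans (sum-cong λ t → *-distribˡ-+ ⟦ T t ⟧ _ _) (trans (sum-+ _ _) (cong (_+ tr g')
          (sumOn-bij T T (λ t → χ (c g t)) (g' •_) (g' ⁻ •_) (λ t _ → ⇒T (•-InT g' t)) (λ t _ → ⇒T (•-InT (g' ⁻) t))
            (λ t h → back (inverseˡ g') h) (λ t h → back (inverseʳ g') h))))))
        where
        back : ∀ {x y t} → x · y ≡ e → T t ≡ true → x • y • t ≡ t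
        back {x} {y} {t} q h = trans (sym (proj₁ (•-∙ x y t))) (trans (cong (_• t) q) (e-• (T⇒ {t} h)))

      tr-e : tr e ≈ 0 [ p ]
      tr-e = ≈-cancel-+ˡ (tr e) (≈-trans (≈-sym (tr-∙ e e)) (≈-reflexive (trans (cong tr (identityˡ e)) (sym (+-identityʳ _)))))

      tr-↑ : ∀ g m → tr (g ↑ m) ≈ m * tr g [ p ]
      tr-↑ g zero = tr-e
      tr-↑ g (suc m) = ≈-trans (tr-∙ g (g ↑ m)) (≈-+ ≈-refl (tr-↑ g m))

      -- Some exponent prime to p kills `g`, while the transfer takes values modulo p.
      tr-stab : ∀ v g → act v g ≡ v → tr g ≈ 0 [ p ]
      tr-stab v g q with stab-order v g q
      ... | ℓ , gℓ , p∤ℓ = ≈-cancel-*ˡ pp ℓ p∤ℓ (≈-trans (≈-sym (tr-↑ g ℓ)) (≈-trans (≈-reflexive (cong tr gℓ))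
        (≈-trans tr-e (≈-reflexive (sym (*-zeroʳ ℓ))))))

      private
        -- x is reached from the base vertex by an automorphism killed by the transfer (resp. some neighbour of x is).
        State : Bool → V → Set
        State false x = ∃[ k ] (act (u false) k ≡ x × tr k ≈ 0 [ p ])
        State true x = ∃[ y ] (y ~ x × State false y)

        -- On passing `x`, an element of the stabiliser of `x` carries the vertex before it to the
        -- vertex after it, and the transfer of that element is 0. Hence only every second vertex of
        -- a walk is reached.
        advance : ∀ s {x y} → x ~ y → State s x → State (not s) y
        advance false {x} xy h = x , xy , h
        advance true {x} {y} xy (z , zx , k , q , r) with locally-transitive (~-sym zx) xy
        ... | g , gx , gz = k · g , trans (act-∙ _ k g) (trans (cong (λ w → act w g) q) gz) ,
          ≈-trans (tr-∙ k g) (≈-+ r (tr-stab x g gx))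

        final : ∀ {x y} → Bool → Walk Γ x y → Bool
        final s here = s
        final s (step _ w) = final (not s) w

        final-not : ∀ {x y} s (w : Walk Γ x y) → final (not s) w ≡ not (final s w)
        final-not s here = refl
        final-not s (step _ w) = final-not (not s) w

        run : ∀ {x y} s (w : Walk Γ x y) → State s x → State (final s w) y
        run s here h = h
        run s (step xy w) h = run (not s) w (advance s xy h)

        translate : ∀ k {x y} → Walk Γ x y → Walk Γ (act x k) (act y k)
        translate k here = here
        translate k (step xy w) = step (~-act k xy) (translate k w)

        final-translate : ∀ k s {x y} (w : Walk Γ x y) → final s (translate k w) ≡ final s w
        final-translate k s here = refl
        final-translate k s (step _ w) = final-translate k (not s) w

      tr-reached : ∀ {x} k → act (u false) k ≡ x → State false x → tr k ≈ 0 [ p ]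
      tr-reached k q (k' , q' , r) = ≈-trans (≈-reflexive (cong tr (group (k ∷ k' ∷ []) v0 (v0 ⊗ v1 ⊖ ⊗ v1) refl)))
        (≈-trans (tr-∙ (k · k' ⁻) k') (≈-+ (tr-stab (u false) _ (trans (act-∙ _ k (k' ⁻)) (act-inv k' (trans q' (sym q))))) r))

      -- Stabilisers generate the even part of Aut Γ, and the square of every element is even.
      tr-vanishes : ∀ g → tr g ≈ 0 [ p ]
      tr-vanishes g = go (final false w) refl
        where
        w = conn (u false) (act (u false) g)
        start : State false (u false)
        start = e , act-ε _ , tr-e
        go : ∀ s → final false w ≡ s → tr g ≈ 0 [ p ]
        go false q = tr-reached g refl (subst (λ s → State s _) q (run false w start))
        go true q = ≈-cancel-*ˡ pp 2 p∤2 (≈-trans (≈-sym (tr-↑ g 2)) (tr-reached (g ↑ 2) refl (subst (State false) end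
          (subst (λ s → State s _) fin (run true (translate g w) (subst (λ s → State s _) q (run false w start)))))))
          where
          fin : final true (translate g w) ≡ false
          fin = trans (final-translate g true w) (trans (final-not false w) (cong not q))
          end : act (act (u false) g) g ≡ act (u false) (g ↑ 2)
          end = sym (trans (cong (λ t → act (u false) (g · t)) (↑-1 g)) (act-∙ _ g g))

-- Metacyclic p-groups

-- The geometric sum 1 + κ + ... + κ^(m-1). It is the exponent of g in (b g)^m when conjugation by
-- b⁻¹ raises g to the power κ.
geom : ℕ → ℕ → ℕ
geom κ zero = 0
geom κ (suc m) = κ ^ m + geom κ m

-- Modulo p² the powers of κ = 1 + l p are linear: κ^i ≡ 1 + i l p. Their sum is p + l p · p (p - 1)
-- / 2, and for odd p the second term is a multiple of p². So the sum is p times a unit.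
geom-odd : ∀ l h → let p = 1 + (h + h) in ∃[ m ] geom (1 + l * p) p ≡ p * (1 + p * m)
geom-odd l h = l * h + proj₁ (expand p) , (begin
  geom κ p ≡⟨ proj₂ (expand p) ⟩
  p + l * p * tri p + p * p * proj₁ (expand p) ≡⟨ cong (λ t → p + l * p * t + p * p * proj₁ (expand p)) tri-p ⟩
  p + l * p * (h * p) + p * p * proj₁ (expand p) ≡⟨ solve 4 (λ p l h m → p :+ l :* p :* (h :* p) :+ p :* p :* m := p :* (con 1 :+ p :* (l :* h :+ m))) refl p l h (proj₁ (expand p)) ⟩
  p * (1 + p * (l * h + proj₁ (expand p))) ∎)
  where
  open ≡-Reasoning
  open +-*-Solver
  p = 1 + (h + h)
  κ = 1 + l * p
  tri : ℕ → ℕ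
  tri zero = 0
  tri (suc m) = m + tri m
  power : ∀ i → ∃[ m ] κ ^ i ≡ 1 + i * (l * p) + p * p * m
  power zero = 0 , sym (cong suc (*-zeroʳ (p * p)))
  power (suc i) with power i
  ... | m , q = i * l * l + m + l * p * m , trans (cong (κ *_) q)
    (solve 4 (λ i l p m → (con 1 :+ l :* p) :* (con 1 :+ i :* (l :* p) :+ p :* p :* m) :=
      con 1 :+ (con 1 :+ i) :* (l :* p) :+ p :* p :* (i :* l :* l :+ m :+ l :* p :* m)) refl i l p m)
  expand : ∀ i → ∃[ m ] geom κ i ≡ i + l * p * tri i + p * p * m
  expand zero = 0 , sym (trans (cong (_+ p * p * 0) (*-zeroʳ (l * p))) (*-zeroʳ (p * p)))
  expand (suc i) with power i | expand i
  ... | m , q | m' , q' = m + m' , trans (cong₂ _+_ q q')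
    (solve 6 (λ i l p m m' t → con 1 :+ i :* (l :* p) :+ p :* p :* m :+ (i :+ l :* p :* t :+ p :* p :* m') :=
      con 1 :+ i :+ l :* p :* (i :+ t) :+ p :* p :* (m :+ m')) refl i l p m m' (tri i))
  tri-double : ∀ m → tri m + tri m + m ≡ m * m
  tri-double zero = refl
  tri-double (suc m) = trans (solve 2 (λ m t → m :+ t :+ (m :+ t) :+ (con 1 :+ m) := t :+ t :+ m :+ (con 1 :+ m :+ m)) refl m (tri m))
    (trans (cong (_+ (1 + m + m)) (tri-double m)) (solve 1 (λ m → m :* m :+ (con 1 :+ m :+ m) := (con 1 :+ m) :* (con 1 :+ m)) refl m))
  double-injective : ∀ x y → x + x ≡ y + y → x ≡ y
  double-injective zero zero _ = refl
  double-injective (suc x) (suc y) q = cong suc (double-injective x y (cong (λ t → t ∸ 2) (trans (cong suc (sym (+-suc x x))) (trans q (cong suc (+-suc y y))))))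
  tri-p : tri p ≡ h * p
  tri-p = double-injective _ _ (+-cancelʳ-≡ p _ _ (trans (tri-double p)
    (solve 1 (λ h → (con 1 :+ (h :+ h)) :* (con 1 :+ (h :+ h)) := h :* (con 1 :+ (h :+ h)) :+ h :* (con 1 :+ (h :+ h)) :+ (con 1 :+ (h :+ h))) refl h)))

module Metacyclics (p : ℕ) (pp : Prime p) (H : FiniteGroup) (pg : IsPGroup p H) where
  open PGroup p pp H pg public

  Normal : Carrier H → Set
  Normal g = ∀ x → ∃[ j ] conj x g ≡ g ↑ j

  Generate : Carrier H → Carrier H → Set
  Generate g b = ∀ h → ∃[ i ] ∃[ j ] h ≡ b ↑ i · g ↑ j

  infix 4 _∈⟨_⟩
  _∈⟨_⟩ : Carrier H → Carrier H → Set
  x ∈⟨ g ⟩ = ∃[ j ] x ≡ g ↑ j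

  ∈-e : ∀ {g} → e ∈⟨ g ⟩
  ∈-e = 0 , refl

  ∈-· : ∀ {g x y} → x ∈⟨ g ⟩ → y ∈⟨ g ⟩ → x · y ∈⟨ g ⟩
  ∈-· {g} (i , refl) (j , refl) = i + j , sym (↑-+ g i j)

  ∈-↑ : ∀ {g x} k → x ∈⟨ g ⟩ → x ↑ k ∈⟨ g ⟩
  ∈-↑ {g} k (i , refl) = i * k , sym (↑-* g i k)

  ∈-⁻ : ∀ {g x} → x ∈⟨ g ⟩ → x ⁻ ∈⟨ g ⟩
  ∈-⁻ {g} {x} h = subst (_∈⟨ g ⟩) (sym (inv-↑ x)) (∈-↑ (p ^ K ∸ 1) h)

  ∈-trans : ∀ {f g x} → x ∈⟨ f ⟩ → f ∈⟨ g ⟩ → x ∈⟨ g ⟩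
  ∈-trans (i , refl) h = ∈-↑ i h

  ∈-root : ∀ {g x} i → ¬ p ∣ i → x ↑ i ∈⟨ g ⟩ → x ∈⟨ g ⟩
  ∈-root {g} {x} i p∤i h with root i p∤i
  ... | i' , r = subst (_∈⟨ g ⟩) (r x) (∈-↑ i' h)

  Normal-↑ : ∀ {g} → Normal g → ∀ k → Normal (g ↑ k)
  Normal-↑ {g} N k x with N x
  ... | j , q = j , trans (conj-↑ x g k) (trans (cong (_↑ k) q) (↑-swap g j k))

  ∈-conj : ∀ {g} → Normal g → ∀ x {y} → y ∈⟨ g ⟩ → conj x y ∈⟨ g ⟩
  ∈-conj N x (k , refl) with Normal-↑ N k x
  ... | j , q = subst (_∈⟨ _ ⟩) (sym q) (∈-↑ j (k , refl))

  module Mod (ζ : Carrier H) (N : Normal ζ) where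
    infix 4 _≋_
    -- Congruence modulo the normal subgroup ⟨ζ⟩ takes the place of the quotient group, whose
    -- elements would have to be enumerated to form a `FiniteGroup`.
    data _≋_ (x y : Carrier H) : Set where
      mod : x · y ⁻ ∈⟨ ζ ⟩ → x ≋ y

    ≋-refl : ∀ {x} → x ≋ x
    ≋-refl {x} = mod (subst (_∈⟨ ζ ⟩) (sym (inverseʳ x)) ∈-e)

    ≋-reflexive : ∀ {x y} → x ≡ y → x ≋ y
    ≋-reflexive refl = ≋-refl

    ≋-sym : ∀ {x y} → x ≋ y → y ≋ x
    ≋-sym {x} {y} (mod h) = mod (subst (_∈⟨ ζ ⟩) (group (x ∷ y ∷ []) ((v0 ⊗ v1 ⊖) ⊖) (v1 ⊗ v0 ⊖) refl) (∈-⁻ h))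

    ≋-trans : ∀ {x y z} → x ≋ y → y ≋ z → x ≋ z
    ≋-trans {x} {y} {z} (mod h) (mod h') = mod (subst (_∈⟨ ζ ⟩) (group (x ∷ y ∷ z ∷ []) (v0 ⊗ v1 ⊖ ⊗ (v1 ⊗ v2 ⊖)) (v0 ⊗ v2 ⊖) refl) (∈-· h h'))

    ≋-· : ∀ {x y z w} → x ≋ y → z ≋ w → x · z ≋ y · w
    ≋-· {x} {y} {z} {w} (mod h) (mod h') = mod (subst (_∈⟨ ζ ⟩)
      (group (x ∷ y ∷ z ∷ w ∷ []) (v0 ⊗ (v2 ⊗ v3 ⊖) ⊗ v0 ⊖ ⊗ (v0 ⊗ v1 ⊖)) (v0 ⊗ v2 ⊗ (v1 ⊗ v3) ⊖) refl) (∈-· (∈-conj N x h') h))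

    ≋-↑ : ∀ {x y} k → x ≋ y → x ↑ k ≋ y ↑ k
    ≋-↑ zero h = ≋-refl
    ≋-↑ (suc k) h = ≋-· h (≋-↑ k h)

    ≋-cancelʳ : ∀ {x y} z → x · z ≋ y · z → x ≋ y
    ≋-cancelʳ {x} {y} z h = ≋-trans (≋-reflexive (group (x ∷ z ∷ []) v0 (v0 ⊗ v1 ⊗ v1 ⊖) refl))
      (≋-trans (≋-· h ≋-refl) (≋-reflexive (group (y ∷ z ∷ []) (v0 ⊗ v1 ⊗ v1 ⊖) v0 refl)))

    ∈⇒≋e : ∀ {x} → x ∈⟨ ζ ⟩ → x ≋ e
    ∈⇒≋e {x} h = mod (subst (_∈⟨ ζ ⟩) (group (x ∷ []) v0 (v0 ⊗ one ⊖) refl) h)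

    ≋e⇒∈ : ∀ {x} → x ≋ e → x ∈⟨ ζ ⟩
    ≋e⇒∈ {x} (mod h) = subst (_∈⟨ ζ ⟩) (group (x ∷ []) (v0 ⊗ one ⊖) v0 refl) h

    ≋⇒∈ : ∀ {x y} → x ≋ y → x · y ⁻ ∈⟨ ζ ⟩
    ≋⇒∈ (mod h) = h

    ≋-commute-↑ : ∀ {x y} k → x · y ≋ y · x → x · y ↑ k ≋ y ↑ k · x
    ≋-commute-↑ zero h = ≋-reflexive (trans (identityʳ _) (sym (identityˡ _)))
    ≋-commute-↑ {x} {y} (suc k) h = ≋-trans (≋-reflexive (sym (assoc x y _))) (≋-trans (≋-· h ≋-refl)
      (≋-trans (≋-reflexive (assoc y x _)) (≋-trans (≋-· ≋-refl (≋-commute-↑ k h)) (≋-reflexive (sym (assoc _ _ _))))))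

    ≋-commute-↑↑ : ∀ {x y} m k → x · y ≋ y · x → x ↑ m · y ↑ k ≋ y ↑ k · x ↑ m
    ≋-commute-↑↑ m k h = ≋-sym (≋-commute-↑ m (≋-sym (≋-commute-↑ k h)))

    ≋-↑-· : ∀ {x y} k → x · y ≋ y · x → (x · y) ↑ k ≋ x ↑ k · y ↑ k
    ≋-↑-· zero h = ≋-reflexive (sym (identityˡ _))
    ≋-↑-· {x} {y} (suc k) h = ≋-trans (≋-· ≋-refl (≋-↑-· k h))
      (≋-trans (≋-reflexive (group (x ∷ y ∷ x ↑ k ∷ y ↑ k ∷ []) (v0 ⊗ v1 ⊗ (v2 ⊗ v3)) (v0 ⊗ (v1 ⊗ v2) ⊗ v3) refl))
      (≋-trans (≋-· (≋-· ≋-refl (≋-commute-↑ k (≋-sym h))) ≋-refl)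
      (≋-reflexive (group (x ∷ y ∷ x ↑ k ∷ y ↑ k ∷ []) (v0 ⊗ (v2 ⊗ v1) ⊗ v3) (v0 ⊗ v2 ⊗ (v1 ⊗ v3)) refl))))

    ≋-abelian : ∀ {g b} → Generate g b → b · g ≋ g · b → ∀ x y → x · y ≋ y · x
    ≋-abelian {g} {b} G h x y with G x | G y
    ... | i , j , refl | i' , j' , refl = ≋-trans (≋-reflexive (group (B ∷ Q ∷ B' ∷ Q' ∷ []) (v0 ⊗ v1 ⊗ (v2 ⊗ v3)) (v0 ⊗ (v1 ⊗ v2) ⊗ v3) refl))
        (≋-trans (≋-· (≋-· ≋-refl (≋-commute-↑↑ j i' (≋-sym h))) ≋-refl)
        (≋-trans (≋-reflexive (trans (group (B ∷ Q ∷ B' ∷ Q' ∷ []) (v0 ⊗ (v2 ⊗ v1) ⊗ v3) (v0 ⊗ v2 ⊗ (v1 ⊗ v3)) refl)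
          (trans (cong₂ _·_ (self-commute b i i') (self-commute g j j')) (group (B ∷ Q ∷ B' ∷ Q' ∷ []) (v2 ⊗ v0 ⊗ (v3 ⊗ v1)) (v2 ⊗ (v0 ⊗ v3) ⊗ v1) refl))))
        (≋-trans (≋-· (≋-· ≋-refl (≋-commute-↑↑ i j' h)) ≋-refl)
        (≋-reflexive (group (B ∷ Q ∷ B' ∷ Q' ∷ []) (v2 ⊗ (v3 ⊗ v0) ⊗ v1) (v2 ⊗ v3 ⊗ (v0 ⊗ v1)) refl)))))
      where
      B = b ↑ i
      Q = g ↑ j
      B' = b ↑ i'
      Q' = g ↑ j'

  Normal-e : Normal e
  Normal-e x = 0 , conj-e x

  private
    module M₁ = Mod e Normal-e

  commuting⇒abelian : ∀ {g b} → Generate g b → b · g ≡ g · b → ∀ x y → x · y ≡ y · x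
  commuting⇒abelian G h x y with M₁.≋⇒∈ (M₁.≋-abelian G (M₁.≋-reflexive h) x y)
  ... | k , q = ·-cancelʳ ((y · x) ⁻) (trans q (trans (e-↑ k) (sym (inverseʳ (y · x)))))

  shift-↑ : ∀ {g} → Normal g → ∀ b w i → ∃[ k ] (b · g ↑ w) ↑ i ≡ b ↑ i · g ↑ k
  shift-↑ N b w zero = 0 , sym (identityˡ _)
  shift-↑ {g} N b w (suc i) with shift-↑ N b w i | ∈-conj N (b ↑ i ⁻) (w , refl)
  ... | k , q | k' , q' = k' + k , (begin
    b · g ↑ w · (b · g ↑ w) ↑ i ≡⟨ cong (b · g ↑ w ·_) q ⟩
    b · g ↑ w · (b ↑ i · g ↑ k) ≡⟨ group (b ∷ g ↑ w ∷ b ↑ i ∷ g ↑ k ∷ []) (v0 ⊗ v1 ⊗ (v2 ⊗ v3)) (v0 ⊗ v2 ⊗ (v2 ⊖ ⊗ v1 ⊗ v2 ⊖ ⊖ ⊗ v3)) refl ⟩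
    b · b ↑ i · (conj (b ↑ i ⁻) (g ↑ w) · g ↑ k) ≡⟨ cong (λ t → b · b ↑ i · (t · g ↑ k)) q' ⟩
    b · b ↑ i · (g ↑ k' · g ↑ k) ≡⟨ cong (b · b ↑ i ·_) (sym (↑-+ g k' k)) ⟩
    b · b ↑ i · g ↑ (k' + k) ∎)
    where open ≡-Reasoning

  Generate-shift : ∀ {g b} → Normal g → Generate g b → ∀ w → Generate g (b · g ↑ w)
  Generate-shift {g} {b} N G w h with G h
  ... | i , j , refl with shift-↑ N b w i
  ...   | k , q with ∈-· (∈-⁻ {g} (k , refl)) (j , refl)
  ...     | j' , q' = i , j' , sym (trans (cong₂ _·_ q (sym q')) (group (b ↑ i ∷ g ↑ k ∷ g ↑ j ∷ []) (v0 ⊗ v1 ⊗ (v1 ⊖ ⊗ v2)) (v0 ⊗ v2) refl))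

  -- Inverting the expression for the inverse of `h` reverses the order of the two factors.
  Generate-swap : ∀ {g b} → Generate g b → Generate b g
  Generate-swap {g} {b} G h with G (h ⁻)
  ... | i , j , q with ∈-⁻ {g} (j , refl) | ∈-⁻ {b} (i , refl)
  ...   | j' , r | i' , r' = j' , i' , trans (sym (inv-inv h)) (trans (cong _⁻ q) (trans (inv-· _ _) (cong₂ _·_ r r')))

  Generate-root : ∀ {g b} → Normal g → Generate g b → ∀ i j → ¬ p ∣ i → Generate g (b ↑ i · g ↑ j)
  Generate-root {g} {b} N G i j p∤i = Generate-shift N G' j
    where
    G' : Generate g (b ↑ i)
    G' h with G h | root i p∤i
    ... | m , l , refl | i' , r = i' * m , l , cong (_· g ↑ l) (trans (cong (_↑ m) (sym (r b))) (sym (↑-* (b ↑ i) i' m)))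

  opaque
    -- By `conj-unipotent`, `b` and `s` commute up to a power of s^p. This lets `s` permute the
    -- cosets that are fixed by both `b` and s^p.
    twist : ∀ {s} → Normal s → ∀ b → ∃[ k ] b · s ≡ s · (b · s ↑ (k * p))
    twist {s} Ns b with conj-unipotent (b ⁻) s (proj₁ (Ns (b ⁻))) (proj₂ (Ns (b ⁻)))
    ... | l , q with ∈-⁻ {s ↑ p} {(s ↑ p) ↑ l} (l , refl)
    ...   | k , r = k , (begin
      b · s ≡⟨ group (b ∷ s ∷ y ∷ []) (v0 ⊗ v1) (v0 ⊗ (v1 ⊗ v2) ⊗ v2 ⊖) refl ⟩
      b · (s · y) · y ⁻ ≡⟨ cong (λ w → b · w · y ⁻) (trans (cong (s ·_) (sym (↑-*′ s l p))) (sym q)) ⟩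
      b · conj (b ⁻) s · y ⁻ ≡⟨ group (b ∷ s ∷ y ∷ []) (v0 ⊗ (v0 ⊖ ⊗ v1 ⊗ v0 ⊖ ⊖) ⊗ v2 ⊖) (v1 ⊗ (v0 ⊗ v2 ⊖)) refl ⟩
      s · (b · y ⁻) ≡⟨ cong (λ w → s · (b · w)) (trans r (sym (↑-*′ s k p))) ⟩
      s · (b · s ↑ (k * p)) ∎)
      where
      open ≡-Reasoning
      y : Carrier H
      y = (s ↑ p) ↑ l

  private
    module PowProd (h : ℕ) (odd : p ≡ 1 + (h + h)) where
      open ≡-Reasoning

      -- Here the oddness of p enters, through `geom-odd`: up to a unit in one exponent, p-th powers
      -- are multiplicative on b⟨g⟩. The unit is the same for all `w`, so the equation can later be
      -- solved for `w`.
      base : ∀ {g} → Normal g → ∀ b → ∃[ m ] ∀ w → (b · g ↑ w) ↑ p ≡ b ↑ p · (g ↑ p) ↑ (w * (1 + p * m))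
      base {g} N b with N (b ⁻)
      ... | κ₀ , q₀ with conj-unipotent (b ⁻) g κ₀ q₀
      ...   | l , q = m , λ w → trans (gen w p) (cong (b ↑ p ·_) (trans (cong (λ t → g ↑ (w * t)) geom-p) (trans (cong (g ↑_) (reorder w)) (↑-* g p _))))
        where
        κ = 1 + l * p
        m = proj₁ (geom-odd l h)
        geom-p : geom κ p ≡ p * (1 + p * m)
        geom-p = subst (λ p → geom (1 + l * p) p ≡ p * (1 + p * m)) (sym odd) (proj₂ (geom-odd l h))
        reorder : ∀ w → w * (p * (1 + p * m)) ≡ p * (w * (1 + p * m))
        reorder w = +-*-Solver.solve 3 (λ w p t → w +-*-Solver.:* (p +-*-Solver.:* t) +-*-Solver.:= p +-*-Solver.:* (w +-*-Solver.:* t)) refl w p (1 + p * m)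
        conj-b : ∀ i w → conj (b ↑ i ⁻) (g ↑ w) ≡ g ↑ (κ ^ i * w)
        conj-b i w = begin
          conj (b ↑ i ⁻) (g ↑ w) ≡⟨ cong (λ t → conj t (g ↑ w)) (sym (↑-⁻ b i)) ⟩
          conj ((b ⁻) ↑ i) (g ↑ w) ≡⟨ conj-↑ _ g w ⟩
          conj ((b ⁻) ↑ i) g ↑ w ≡⟨ cong (_↑ w) (conj-iterate (b ⁻) g κ q i) ⟩
          (g ↑ (κ ^ i)) ↑ w ≡⟨ sym (↑-* g (κ ^ i) w) ⟩
          g ↑ (κ ^ i * w) ∎
        gen : ∀ w i → (b · g ↑ w) ↑ i ≡ b ↑ i · g ↑ (w * geom κ i)
        gen w zero = sym (trans (identityˡ _) (cong (g ↑_) (*-zeroʳ w)))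
        gen w (suc i) = begin
          b · g ↑ w · (b · g ↑ w) ↑ i ≡⟨ cong (b · g ↑ w ·_) (gen w i) ⟩
          b · g ↑ w · (b ↑ i · g ↑ k) ≡⟨ group (b ∷ g ↑ w ∷ b ↑ i ∷ g ↑ k ∷ []) (v0 ⊗ v1 ⊗ (v2 ⊗ v3)) (v0 ⊗ v2 ⊗ (v2 ⊖ ⊗ v1 ⊗ v2 ⊖ ⊖ ⊗ v3)) refl ⟩
          b · b ↑ i · (conj (b ↑ i ⁻) (g ↑ w) · g ↑ k) ≡⟨ cong (λ t → b · b ↑ i · (t · g ↑ k)) (conj-b i w) ⟩
          b · b ↑ i · (g ↑ (κ ^ i * w) · g ↑ k) ≡⟨ cong (b · b ↑ i ·_) (sym (↑-+ g (κ ^ i * w) k)) ⟩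
          b · b ↑ i · g ↑ (κ ^ i * w + k) ≡⟨ cong (λ t → b · b ↑ i · g ↑ t) (+-*-Solver.solve 3 (λ w x y → x +-*-Solver.:* w +-*-Solver.:+ w +-*-Solver.:* y +-*-Solver.:= w +-*-Solver.:* (x +-*-Solver.:+ y)) refl w (κ ^ i) (geom κ i)) ⟩
          b · b ↑ i · g ↑ (w * (κ ^ i + geom κ i)) ∎
          where k = w * geom κ i

      powprod : ∀ {g} → Normal g → ∀ b s → ∃[ m ] ∀ w → (b · g ↑ w) ↑ (p ^ s) ≡ b ↑ (p ^ s) · (g ↑ (p ^ s)) ↑ (w * (1 + p * m))
      powprod {g} N b zero = 0 , λ w → trans (identityʳ _) (sym (cong₂ _·_ (identityʳ b) (trans (cong (_↑ (w * (1 + p * 0))) (identityʳ g))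
        (cong (g ↑_) (trans (cong (λ t → w * (1 + t)) (*-zeroʳ p)) (*-identityʳ w))))))
      powprod {g} N b (suc s) with base N b | powprod (Normal-↑ N p) (b ↑ p) s
      ... | m , q | m' , q' = m + m' + p * m * m' , λ w → begin
        (b · g ↑ w) ↑ (p * p ^ s) ≡⟨ ↑-* _ p (p ^ s) ⟩
        ((b · g ↑ w) ↑ p) ↑ (p ^ s) ≡⟨ cong (_↑ (p ^ s)) (q w) ⟩
        (b ↑ p · (g ↑ p) ↑ (w * (1 + p * m))) ↑ (p ^ s) ≡⟨ q' (w * (1 + p * m)) ⟩
        (b ↑ p) ↑ (p ^ s) · ((g ↑ p) ↑ (p ^ s)) ↑ (w * (1 + p * m) * (1 + p * m')) ≡⟨ cong₂ _·_ (sym (↑-* b p (p ^ s))) (cong₂ _↑_ (sym (↑-* g p (p ^ s))) (solve 4 (λ w p m m' → w :* (con 1 :+ p :* m) :* (con 1 :+ p :* m') := w :* (con 1 :+ p :* (m :+ m' :+ p :* m :* m'))) refl w p m m')) ⟩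
        b ↑ (p * p ^ s) · (g ↑ (p * p ^ s)) ↑ (w * (1 + p * (m + m' + p * m * m'))) ∎
        where open +-*-Solver

  module Odd (h : ℕ) (odd : p ≡ 1 + (h + h)) where
    opaque
      powprod : ∀ {g} → Normal g → ∀ b s → ∃[ m ] ∀ w → (b · g ↑ w) ↑ (p ^ s) ≡ b ↑ (p ^ s) · (g ↑ (p ^ s)) ↑ (w * (1 + p * m))
      powprod = PowProd.powprod h odd

    p∤1+pm : ∀ m → ¬ p ∣ 1 + p * m
    p∤1+pm m d = p∤1 (∣m+n∣m⇒∣n (subst (p ∣_) (+-comm 1 (p * m)) d) (m∣m*n m))

    -- If a power of `b` is the same power of an element of ⟨g⟩, then `b` can be corrected within
    -- b⟨g⟩ so that this power becomes trivial.
    shorten : ∀ {g} → Normal g → ∀ b s x → b ↑ (p ^ s) ≡ (g ↑ (p ^ s)) ↑ x → ∃[ w ] (b · g ↑ w) ↑ (p ^ s) ≡ e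
    shorten {g} N b s x q with powprod N b s
    ... | m , r with root (1 + p * m) (p∤1+pm m)
    ...   | i' , r' = w , (begin
      (b · g ↑ w) ↑ (p ^ s) ≡⟨ r w ⟩
      b ↑ (p ^ s) · ζ ↑ (w * (1 + p * m)) ≡⟨ cong₂ _·_ q eq ⟩
      ζ ↑ x · (ζ ↑ x) ⁻ ≡⟨ inverseʳ _ ⟩
      e ∎)
      where
      open ≡-Reasoning
      ζ = g ↑ (p ^ s)
      -- This is -x divided by the unit 1 + p m; the factor p^K - 1 acts as -1 on exponents.
      w = i' * (x * (p ^ K ∸ 1))
      eq : ζ ↑ (w * (1 + p * m)) ≡ (ζ ↑ x) ⁻
      eq = begin
        ζ ↑ (w * (1 + p * m)) ≡⟨ ↑-*′ ζ w (1 + p * m) ⟩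
        (ζ ↑ (1 + p * m)) ↑ (i' * (x * (p ^ K ∸ 1))) ≡⟨ ↑-* _ i' _ ⟩
        ((ζ ↑ (1 + p * m)) ↑ i') ↑ (x * (p ^ K ∸ 1)) ≡⟨ cong (_↑ (x * (p ^ K ∸ 1))) (r' ζ) ⟩
        ζ ↑ (x * (p ^ K ∸ 1)) ≡⟨ ↑-* ζ x _ ⟩
        (ζ ↑ x) ↑ (p ^ K ∸ 1) ≡⟨ sym (inv-↑ (ζ ↑ x)) ⟩
        (ζ ↑ x) ⁻ ∎

-- A metacyclic presentation H = ⟨b⟩⟨g⟩ in which the order of b is as small as possible.
module MinimalPair (p : ℕ) (pp : Prime p) (H : FiniteGroup) (pg : IsPGroup p H) (h : ℕ) (odd : p ≡ 1 + (h + h))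
    (E : ℕ)
    (minimal : ∀ {E'} → E' < E → ∀ g b → Metacyclics.Normal p pp H pg g → Metacyclics.Generate p pp H pg g b → pow H b (p ^ E') ≡ ε H → ⊥)
    (g b : Carrier H) (N : Metacyclics.Normal p pp H pg g) (G : Metacyclics.Generate p pp H pg g b) (bE : pow H b (p ^ E) ≡ ε H)
    (nonabelian : ¬ (∀ x y → _∙_ H x y ≡ _∙_ H y x)) where
  open Metacyclics p pp H pg

  open Odd h odd

  private
    opaque
      -- The commutator of `b` and `g` is a power of `g`. With the prime-to-p part of its exponent
      -- split off, the power g^(p^r) generates the same subgroup, which is the derived subgroup of
      -- H.
      commutator : ∃[ r ] ∃[ u' ] (¬ p ∣ u' × b · g ≡ (g ↑ (p ^ r)) ↑ u' · (g · b) × g ↑ (p ^ r) ≢ e)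
      commutator with conj-unipotent b g (proj₁ (N b)) (proj₂ (N b))
      ... | l , q = split (factor-out (l * p) (n≢0⇒n>0 λ z → nontrivial (cong (g ↑_) z)))
        where
        bg₀ : b · g ≡ g ↑ (l * p) · (g · b)
        bg₀ = trans (group (b ∷ g ∷ []) (v0 ⊗ v1) (v0 ⊗ v1 ⊗ v0 ⊖ ⊗ v0) refl) (trans (cong (_· b) (trans q (commute-↑ (l * p) refl))) (assoc _ _ _))
        nontrivial : g ↑ (l * p) ≢ e
        nontrivial z = nonabelian (commuting⇒abelian G (trans bg₀ (trans (cong (_· (g · b)) z) (identityˡ _))))
        split : ∃[ r ] ∃[ u' ] (l * p ≡ p ^ r * u' × ¬ p ∣ u') → ∃[ r ] ∃[ u' ] (¬ p ∣ u' × b · g ≡ (g ↑ (p ^ r)) ↑ u' · (g · b) × g ↑ (p ^ r) ≢ e)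
        split (r , u' , w , d) = r , u' , d , trans bg₀ (cong (_· (g · b)) gu≡) , λ z → nontrivial (trans gu≡ (trans (cong (_↑ u') z) (e-↑ u')))
          where
          gu≡ : g ↑ (l * p) ≡ (g ↑ (p ^ r)) ↑ u'
          gu≡ = trans (cong (g ↑_) w) (↑-* g (p ^ r) u')

  r u' : ℕ
  r = proj₁ commutator
  u' = proj₁ (proj₂ commutator)

  p∤u' : ¬ p ∣ u'
  p∤u' = proj₁ (proj₂ (proj₂ commutator))

  ζ : Carrier H
  ζ = g ↑ (p ^ r)

  bg : b · g ≡ ζ ↑ u' · (g · b)
  bg = proj₁ (proj₂ (proj₂ (proj₂ commutator)))

  ζ≢e : ζ ≢ e
  ζ≢e = proj₂ (proj₂ (proj₂ (proj₂ commutator)))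

  Nζ : Normal ζ
  Nζ = Normal-↑ N (p ^ r)

  ζ∈g : ζ ∈⟨ g ⟩
  ζ∈g = p ^ r , refl

  module Mζ = Mod ζ Nζ
  module ML = Mod (ζ ↑ p) (Normal-↑ Nζ p)

  abelian-mod-ζ : ∀ x y → x · y Mζ.≋ y · x
  abelian-mod-ζ = Mζ.≋-abelian G (Mζ.≋-trans (Mζ.≋-reflexive bg) (Mζ.≋-trans (Mζ.≋-· (Mζ.∈⇒≋e (u' , refl)) Mζ.≋-refl) (Mζ.≋-reflexive (identityˡ _))))

  private
    ≥-factor : ∀ y r x' → r ≤ y → p ^ y * x' ≡ p ^ r * (p ^ (y ∸ r) * x')
    ≥-factor y r x' le = trans (cong (λ t → p ^ t * x') (sym (m+[n∸m]≡n le))) (trans (cong (_* x') (^-distribˡ-+-* p r (y ∸ r))) (*-assoc (p ^ r) _ x'))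

    -- Every subgroup that contains the derived subgroup ⟨ζ⟩ is normal. This permits exchanging the
    -- roles of `b` and `g`.
    Nb : ζ ∈⟨ b ⟩ → Normal b
    Nb m x with ∈-· (∈-trans (Mζ.≋⇒∈ (abelian-mod-ζ x b)) m) (1 , refl)
    ... | j , q = j , trans (group (x ∷ b ∷ []) (v0 ⊗ v1 ⊗ v0 ⊖) (v0 ⊗ v1 ⊗ (v1 ⊗ v0) ⊖ ⊗ v1) refl) (trans (cong (x · b · (b · x) ⁻ ·_) (sym (↑-1 b))) q)

  -- Otherwise b could be replaced by a shorter element of b⟨g⟩, or the roles of b and g exchanged.
  ζ∉b : r < E → ¬ ζ ∈⟨ b ⟩
  ζ∉b r<E (zero , q) = ζ≢e q
  ζ∉b r<E (suc x₀ , q) with factor-out (suc x₀) (s≤s z≤n)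
  ... | y , x' , xe , p∤x' with r ≤? y
  ...   | yes r≤y = minimal r<E b (g · b ↑ proj₁ sh) nb (Generate-shift nb (Generate-swap G) (proj₁ sh)) (proj₂ sh)
    where
    nb = Nb (suc x₀ , q)
    sh = shorten nb g r (p ^ (y ∸ r) * x') (trans q (trans (cong (b ↑_) (trans xe (≥-factor y r x' r≤y))) (↑-* b (p ^ r) _)))
  ...   | no r≰y = minimal (<-trans y<r r<E) g (b · g ↑ proj₁ sh) N (Generate-shift N G (proj₁ sh)) (proj₂ sh)
    where
    y<r = ≰⇒> r≰y
    rt = root x' p∤x'
    by : b ↑ (p ^ y) ≡ (g ↑ (p ^ y)) ↑ (p ^ (r ∸ y) * proj₁ rt)
    by = trans (sym (proj₂ rt (b ↑ (p ^ y)))) (trans (cong (_↑ proj₁ rt) (trans (sym (↑-* b (p ^ y) x')) (trans (cong (b ↑_) (sym xe)) (sym q))))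
      (trans (sym (↑-* g (p ^ r) (proj₁ rt))) (trans (cong (g ↑_) (≥-factor r y (proj₁ rt) (<⇒≤ y<r))) (↑-* g (p ^ y) _))))
    sh = shorten N b y (p ^ (r ∸ y) * proj₁ rt) by

  -- Comparing the powers of p in the two exponents, either `b` can be shortened, or a power of `g`
  -- with exponent p^y, y < r, lies in ⟨b⟩ and drags ζ along, against `ζ∉b`.
  bʳ∉g : r < E → ¬ b ↑ (p ^ r) ∈⟨ g ⟩
  bʳ∉g r<E (zero , q) = minimal r<E g b N G q
  bʳ∉g r<E (suc x₀ , q) with factor-out (suc x₀) (s≤s z≤n)
  ... | y , x' , xe , p∤x' with r ≤? y
  ...   | yes r≤y = minimal r<E g (b · g ↑ proj₁ sh) N (Generate-shift N G (proj₁ sh)) (proj₂ sh)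
    where
    sh = shorten N b r (p ^ (y ∸ r) * x') (trans q (trans (cong (g ↑_) (trans xe (≥-factor y r x' r≤y))) (↑-* g (p ^ r) _)))
  ...   | no r≰y = ζ∉b r<E (subst (_∈⟨ b ⟩) (trans (sym (↑-* g (p ^ y) (p ^ (r ∸ y)))) (cong (g ↑_) (trans (sym (^-distribˡ-+-* p y (r ∸ y))) (cong (p ^_) (m+[n∸m]≡n (<⇒≤ (≰⇒> r≰y)))))))
      (∈-↑ (p ^ (r ∸ y)) (∈-root x' p∤x' (subst (_∈⟨ b ⟩) (trans q (trans (cong (g ↑_) xe) (↑-* g (p ^ y) x'))) (p ^ r , refl)))))

  b∉g : ∀ i → b ↑ i ∈⟨ g ⟩ → p ∣ i
  b∉g i m with p ∣? i
  ... | yes d = d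
  ... | no d with ∈-root i d m
  ...   | k , q = contradiction (commuting⇒abelian G (trans (cong (_· g) q) (trans (sym (commute-↑ k refl)) (cong (g ·_) (sym q))))) nonabelian

  exponent-unique : ∀ {i j i' j'} → b ↑ i · g ↑ j ≡ b ↑ i' · g ↑ j' → i ≈ i' [ p ]
  exponent-unique {i} {j} {i'} {j'} q with ≤-total i' i
  ... | inj₁ le = ≈-diff le (b∉g (i ∸ i') (lem i i' j j' le q))
    where
    lem : ∀ i i' j j' → i' ≤ i → b ↑ i · g ↑ j ≡ b ↑ i' · g ↑ j' → b ↑ (i ∸ i') ∈⟨ g ⟩
    lem i i' j j' le q = subst (_∈⟨ g ⟩) (sym (·-cancelˡ (b ↑ i') (trans (sym (↑-+ b i' (i ∸ i'))) (trans (cong (b ↑_) (m+[n∸m]≡n le))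
      (trans (group (b ↑ i ∷ g ↑ j ∷ []) v0 (v0 ⊗ v1 ⊗ v1 ⊖) refl) (trans (cong (_· (g ↑ j) ⁻) q) (assoc _ _ _))))))) (∈-· (j' , refl) (∈-⁻ (j , refl)))
  ... | inj₂ le = ≈-sym (≈-diff le (b∉g (i' ∸ i) (lem i' i j' j le (sym q))))
    where
    lem : ∀ i i' j j' → i' ≤ i → b ↑ i · g ↑ j ≡ b ↑ i' · g ↑ j' → b ↑ (i ∸ i') ∈⟨ g ⟩
    lem i i' j j' le q = subst (_∈⟨ g ⟩) (sym (·-cancelˡ (b ↑ i') (trans (sym (↑-+ b i' (i ∸ i'))) (trans (cong (b ↑_) (m+[n∸m]≡n le))
      (trans (group (b ↑ i ∷ g ↑ j ∷ []) v0 (v0 ⊗ v1 ⊗ v1 ⊖) refl) (trans (cong (_· (g ↑ j) ⁻) q) (assoc _ _ _))))))) (∈-· (j' , refl) (∈-⁻ (j , refl)))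

  -- A character to the integers modulo p whose kernel is generated by `g` and b^p. The chosen
  -- exponent of `b` is well defined modulo p because no power of `b` prime to p lies in ⟨g⟩.
  χ : Carrier H → ℕ
  χ x = proj₁ (G x)

  χ-of : ∀ {x} i j → x ≡ b ↑ i · g ↑ j → χ x ≈ i [ p ]
  χ-of {x} i j q = exponent-unique {χ x} {proj₁ (proj₂ (G x))} {i} {j} (trans (sym (proj₂ (proj₂ (G x)))) q)

  χ-∙ : ∀ x y → χ (x · y) ≈ χ x + χ y [ p ]
  χ-∙ x y with G x | G y
  ... | i , j , refl | i' , j' , refl with ∈-· (∈-conj N (b ↑ i' ⁻) (j , refl)) (j' , refl)
  ...   | k , q = χ-of (i + i') k (trans (group (b ↑ i ∷ g ↑ j ∷ b ↑ i' ∷ g ↑ j' ∷ []) (v0 ⊗ v1 ⊗ (v2 ⊗ v3)) (v0 ⊗ v2 ⊗ (v2 ⊖ ⊗ v1 ⊗ v2 ⊖ ⊖ ⊗ v3)) refl)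
            (cong₂ _·_ (sym (↑-+ b i i')) q))

  χ-g : ∀ j → χ (g ↑ j) ≈ 0 [ p ]
  χ-g j = χ-of 0 j (sym (identityˡ _))

  -- An element outside the kernel could replace `b` in the presentation of H, so by the minimality
  -- of `E` it cannot be killed by a smaller power of p.
  χ-short : ∀ {E'} → E' < E → ∀ x → x ↑ (p ^ E') ≡ e → χ x ≈ 0 [ p ]
  χ-short E'<E x q with p ∣? χ x
  ... | yes d = ∣⇒≈0 d
  ... | no d with G x
  ...   | i , j , refl = ⊥-elim (minimal E'<E g _ N (Generate-root N G i j d) q)

  b≢e : b ≢ e
  b≢e q = nonabelian (commuting⇒abelian G (trans (cong (_· g) q) (trans (identityˡ g) (sym (trans (cong (g ·_) q) (identityʳ g))))))

  module _ (τ : Carrier H → Carrier H) (τ-∙ : ∀ x y → τ (x · y) ≡ τ x · τ y) (τ-inj : ∀ {x} → τ x ≡ e → x ≡ e) where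

    private
      τ-e : τ e ≡ e
      τ-e = ·-cancelˡ (τ e) (trans (sym (τ-∙ e e)) (trans (cong τ (identityˡ e)) (sym (identityʳ _))))

      τ-↑ : ∀ x k → τ (x ↑ k) ≡ τ x ↑ k
      τ-↑ x zero = τ-e
      τ-↑ x (suc k) = trans (τ-∙ x _) (cong (τ x ·_) (τ-↑ x k))

      i j i' j' : ℕ
      i = proj₁ (G (τ g))
      j = proj₁ (proj₂ (G (τ g)))
      i' = proj₁ (G (τ b))
      j' = proj₁ (proj₂ (G (τ b)))

      τg : τ g ≡ b ↑ i · g ↑ j
      τg = proj₂ (proj₂ (G (τ g)))
      τb : τ b ≡ b ↑ i' · g ↑ j'
      τb = proj₂ (proj₂ (G (τ b)))

      τbg : τ b · τ g ≡ τ ζ ↑ u' · (τ g · τ b)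
      τbg = trans (sym (τ-∙ b g)) (trans (cong τ bg) (trans (τ-∙ _ _) (cong₂ _·_ (τ-↑ ζ u') (τ-∙ g b))))

      τζ∈ : τ ζ ∈⟨ ζ ⟩
      τζ∈ = ∈-root u' p∤u' (subst (_∈⟨ ζ ⟩) (trans (cong (_· (τ g · τ b) ⁻) τbg) (group (τ ζ ↑ u' ∷ τ g · τ b ∷ []) (v0 ⊗ v1 ⊗ v1 ⊖) v0 refl)) (Mζ.≋⇒∈ (abelian-mod-ζ (τ b) (τ g))))

      pw : ∀ x y → ∃[ m ] (b ↑ x · g ↑ y) ↑ (p ^ r) ≡ (b ↑ (p ^ r)) ↑ x · ζ ↑ (y * (1 + p * m))
      pw x y with powprod N (b ↑ x) r
      ... | m , q = m , trans (q y) (cong (_· ζ ↑ (y * (1 + p * m))) (↑-swap b x (p ^ r)))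

      m₁ = proj₁ (pw i j)
      τζ : τ ζ ≡ (b ↑ (p ^ r)) ↑ i · ζ ↑ (j * (1 + p * m₁))
      τζ = trans (τ-↑ g (p ^ r)) (trans (cong (_↑ (p ^ r)) τg) (proj₂ (pw i j)))

      bri∈ζ : (b ↑ (p ^ r)) ↑ i ∈⟨ ζ ⟩
      bri∈ζ = subst (_∈⟨ ζ ⟩) (trans (cong (_· (ζ ↑ (j * (1 + p * m₁))) ⁻) τζ) (group ((b ↑ (p ^ r)) ↑ i ∷ ζ ↑ (j * (1 + p * m₁)) ∷ []) (v0 ⊗ v1 ⊗ v1 ⊖) v0 refl))
        (∈-· τζ∈ (∈-⁻ (j * (1 + p * m₁) , refl)))

      short : E ≤ r → b ↑ (p ^ r) ≡ e
      short le = ↑-∣ b bE (divides (p ^ (r ∸ E)) (trans (cong (p ^_) (sym (m+[n∸m]≡n le))) (trans (^-distribˡ-+-* p E (r ∸ E)) (*-comm (p ^ E) _))))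

      -- The element is a power of ζ; were its exponent prime to p, then ζ would lie in ⟨b⟩.
      in-L : (b ↑ (p ^ r)) ↑ i ∈⟨ ζ ↑ p ⟩
      in-L with E ≤? r
      ... | yes le = 0 , trans (cong (_↑ i) (short le)) (e-↑ i)
      ... | no nle with bri∈ζ
      ...   | k , q with p ∣? k
      ...     | yes (divides k' refl) = k' , trans q (↑-*′ ζ k' p)
      ...     | no d = contradiction (∈-root k d (subst (_∈⟨ b ⟩) q (∈-↑ i (p ^ r , refl)))) (ζ∉b (≰⇒> nle))

      -- If b^(p^r) = 1, the same holds for τ b, whose p^r-th power is then a unit multiple of j' in
      -- the exponent of ζ; so p divides j'. Otherwise b^(p^r) is outside ⟨g⟩ while its i-th power
      -- is inside, so p divides i.
      p∣ij' : p ∣ i * j'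
      p∣ij' with E ≤? r
      ... | yes le = ∣n⇒∣m*n i (fromEuclid (euclidsLemma j' _ pp (↑≡e⇒∣ ζ≢e _ zero-power)))
        where
        m₂ = proj₁ (pw i' j')
        zero-power : ζ ↑ (j' * (1 + p * m₂)) ≡ e
        zero-power = begin
          ζ ↑ (j' * (1 + p * m₂)) ≡⟨ sym (identityˡ _) ⟩
          e · ζ ↑ (j' * (1 + p * m₂)) ≡⟨ cong (_· ζ ↑ (j' * (1 + p * m₂))) (sym (trans (cong (_↑ i') (short le)) (e-↑ i'))) ⟩
          (b ↑ (p ^ r)) ↑ i' · ζ ↑ (j' * (1 + p * m₂)) ≡⟨ sym (proj₂ (pw i' j')) ⟩
          (b ↑ i' · g ↑ j') ↑ (p ^ r) ≡⟨ cong (_↑ (p ^ r)) (sym τb) ⟩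
          τ b ↑ (p ^ r) ≡⟨ sym (τ-↑ b (p ^ r)) ⟩
          τ (b ↑ (p ^ r)) ≡⟨ cong τ (short le) ⟩
          τ e ≡⟨ τ-e ⟩
          e ∎
          where open ≡-Reasoning
        fromEuclid : p ∣ j' ⊎ p ∣ 1 + p * m₂ → p ∣ j'
        fromEuclid (inj₁ d) = d
        fromEuclid (inj₂ d) = contradiction d (p∤1+pm m₂)
      ... | no nle with p ∣? i
      ...   | yes d = ∣m⇒∣m*n j' d
      ...   | no d = contradiction (∈-trans (∈-root i d bri∈ζ) ζ∈g) (bʳ∉g (≰⇒> nle))

      ζ-multiple : ∀ k → p ∣ k → ζ ↑ k ML.≋ e
      ζ-multiple k (divides q refl) = ML.∈⇒≋e (q , ↑-*′ ζ q p)

      τζ≋ : τ ζ ML.≋ ζ ↑ j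
      τζ≋ = ML.≋-trans (ML.≋-reflexive (trans τζ (cong ((b ↑ (p ^ r)) ↑ i ·_) (trans (cong (ζ ↑_) (*-distribˡ-+ j 1 (p * m₁))) (trans (↑-+ ζ (j * 1) (j * (p * m₁))) (cong (λ t → ζ ↑ t · ζ ↑ (j * (p * m₁))) (*-identityʳ j)))))))
        (ML.≋-trans (ML.≋-· (ML.∈⇒≋e in-L) (ML.≋-· ML.≋-refl (ζ-multiple _ (∣n⇒∣m*n j (m∣m*n m₁))))) (ML.≋-reflexive (trans (identityˡ _) (identityʳ _))))

      -- Otherwise τ would map ζ into ⟨ζ^p⟩. Iterating it K times would then kill ζ, though τ is
      -- injective.
      p∤j : ¬ p ∣ j
      p∤j d with ML.≋e⇒∈ (ML.≋-trans τζ≋ (ζ-multiple j d))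
      ... | k , q = ζ≢e (kill K (trans (trans (cong (ζ ↑_) (^-distribʳ-* K p k)) (↑-* ζ (p ^ K) (k ^ K))) (trans (cong (_↑ (k ^ K)) (↑-p^K ζ)) (e-↑ (k ^ K)))))
        where
        ^-distribʳ-* : ∀ m x y → (x * y) ^ m ≡ x ^ m * y ^ m
        ^-distribʳ-* zero x y = refl
        ^-distribʳ-* (suc m) x y = trans (cong (x * y *_) (^-distribʳ-* m x y)) (solve 4 (λ x y a b → x :* y :* (a :* b) := x :* a :* (y :* b)) refl x y (x ^ m) (y ^ m))
          where open +-*-Solver
        kill : ∀ m → ζ ↑ ((p * k) ^ m) ≡ e → ζ ≡ e
        kill zero q' = trans (sym (↑-1 ζ)) q'
        kill (suc m) q' = kill m (τ-inj (trans (τ-↑ ζ ((p * k) ^ m)) (trans (cong (_↑ ((p * k) ^ m)) (trans q (sym (↑-* ζ p k)))) (trans (sym (↑-* ζ (p * k) _)) q'))))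

      ζ-central : ∀ x → x · ζ ML.≋ ζ · x
      ζ-central x with conj-unipotent x ζ (proj₁ (Nζ x)) (proj₂ (Nζ x))
      ... | l , q = ML.≋-trans (ML.≋-reflexive (trans (group (x ∷ ζ ∷ []) (v0 ⊗ v1) (v0 ⊗ v1 ⊗ v0 ⊖ ⊗ v0) refl) (cong (_· x) q)))
        (ML.≋-· (ML.≋-trans (ML.≋-· ML.≋-refl (ζ-multiple _ (n∣m*n l))) (ML.≋-reflexive (identityʳ ζ))) ML.≋-refl)

      -- Modulo ζ^p the derived subgroup is central, so commutators are bilinear in the exponents
      -- there.
      b-g↑ : ∀ k → b · g ↑ k ML.≋ ζ ↑ (u' * k) · (g ↑ k · b)
      b-g↑ zero = ML.≋-reflexive (trans (identityʳ b) (sym (trans (cong (λ t → ζ ↑ t · (e · b)) (*-zeroʳ u')) (trans (identityˡ _) (identityˡ b)))))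
      b-g↑ (suc k) = ML.≋-trans (ML.≋-reflexive (trans (sym (assoc b g _)) (cong (_· g ↑ k) bg)))
        (ML.≋-trans (ML.≋-reflexive (group (ζ ↑ u' ∷ g ∷ b ∷ g ↑ k ∷ []) (v0 ⊗ (v1 ⊗ v2) ⊗ v3) (v0 ⊗ (v1 ⊗ (v2 ⊗ v3))) refl))
        (ML.≋-trans (ML.≋-· ML.≋-refl (ML.≋-· ML.≋-refl (b-g↑ k)))
        (ML.≋-trans (ML.≋-reflexive (group (ζ ↑ u' ∷ g ∷ ζ ↑ (u' * k) ∷ g ↑ k ∷ b ∷ []) (v0 ⊗ (v1 ⊗ (v2 ⊗ (v3 ⊗ v4)))) (v0 ⊗ (v1 ⊗ v2) ⊗ (v3 ⊗ v4)) refl))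
        (ML.≋-trans (ML.≋-· (ML.≋-· ML.≋-refl (ML.≋-commute-↑ (u' * k) (ζ-central g))) ML.≋-refl)
        (ML.≋-reflexive (trans (group (ζ ↑ u' ∷ g ∷ ζ ↑ (u' * k) ∷ g ↑ k ∷ b ∷ []) (v0 ⊗ (v2 ⊗ v1) ⊗ (v3 ⊗ v4)) (v0 ⊗ v2 ⊗ (v1 ⊗ v3 ⊗ v4)) refl)
          (cong (_· (g · g ↑ k · b)) (trans (sym (↑-+ ζ u' (u' * k))) (cong (ζ ↑_) (sym (*-suc u' k)))))))))))

      b↑-g↑ : ∀ m k → b ↑ m · g ↑ k ML.≋ ζ ↑ (u' * k * m) · (g ↑ k · b ↑ m)
      b↑-g↑ zero k = ML.≋-reflexive (trans (identityˡ _) (sym (trans (cong (λ t → ζ ↑ t · (g ↑ k · e)) (*-zeroʳ (u' * k))) (trans (identityˡ _) (identityʳ _)))))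
      b↑-g↑ (suc m) k = ML.≋-trans (ML.≋-reflexive (assoc b (b ↑ m) _)) (ML.≋-trans (ML.≋-· ML.≋-refl (b↑-g↑ m k))
        (ML.≋-trans (ML.≋-reflexive (group (b ∷ z ∷ g ↑ k ∷ b ↑ m ∷ []) (v0 ⊗ (v1 ⊗ (v2 ⊗ v3))) (v0 ⊗ v1 ⊗ v2 ⊗ v3) refl))
        (ML.≋-trans (ML.≋-· (ML.≋-· (ML.≋-commute-↑ (u' * k * m) (ζ-central b)) ML.≋-refl) ML.≋-refl)
        (ML.≋-trans (ML.≋-reflexive (group (b ∷ z ∷ g ↑ k ∷ b ↑ m ∷ []) (v1 ⊗ v0 ⊗ v2 ⊗ v3) (v1 ⊗ (v0 ⊗ v2) ⊗ v3) refl))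
        (ML.≋-trans (ML.≋-· (ML.≋-· ML.≋-refl (b-g↑ k)) ML.≋-refl)
        (ML.≋-reflexive (trans (group (b ∷ z ∷ g ↑ k ∷ b ↑ m ∷ ζ ↑ (u' * k) ∷ []) (v1 ⊗ (v4 ⊗ (v2 ⊗ v0)) ⊗ v3) (v1 ⊗ v4 ⊗ (v2 ⊗ (v0 ⊗ v3))) refl)
          (cong (_· (g ↑ k · (b · b ↑ m))) (trans (sym (↑-+ ζ (u' * k * m) (u' * k))) (cong (ζ ↑_) (trans (+-comm (u' * k * m) _) (sym (*-suc (u' * k) m))))))))))))) 
        where z = ζ ↑ (u' * k * m)

    -- Apply τ to the relation saying that the commutator of `b` and `g` is ζ^u', and compare
    -- exponents of ζ modulo ζ^p. The commutator of τ b and τ g has exponent u' (i' j - i j'), a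
    -- determinant, and the right side has exponent u' j. Since p divides i j' but neither u' nor j,
    -- it follows that i' ≡ 1.
    χ-invariant : χ (τ b) ≈ 1 [ p ]
    χ-invariant = ≈-cancel-*ˡ pp (u' * j) p∤u'j (↑-≈-mod eq)
      where
      open ML
      X = b ↑ i'
      Y = g ↑ j'
      Z = b ↑ i
      W = g ↑ j
      Q = Z · W · (X · Y)
      p∤u'j : ¬ p ∣ u' * j
      p∤u'j d with euclidsLemma u' j pp d
      ... | inj₁ d' = p∤u' d'
      ... | inj₂ d' = p∤j d'
      ↑-≈-mod : ∀ {x y} → ζ ↑ x ≋ ζ ↑ y → x ≈ y [ p ]
      ↑-≈-mod {x} {y} h with ≋⇒∈ h
      ... | k , q = ≈-trans (↑-≈ ζ≢e (trans (group (ζ ↑ x ∷ ζ ↑ y ∷ []) v0 (v0 ⊗ v1 ⊖ ⊗ v1) refl) (trans (cong (_· ζ ↑ y) (trans q (sym (↑-* ζ p k)))) (sym (↑-+ ζ (p * k) y)))))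
        (≈-+ (∣⇒≈0 (m∣m*n k)) ≈-refl)
      YZ : Y · Z ≋ Z · Y
      YZ = ≋-sym (≋-trans (b↑-g↑ i j') (≋-trans (≋-· (ζ-multiple _ (subst (p ∣_) (solve 3 (λ u i j → u :* (i :* j) := u :* j :* i) refl u' i j') (∣n⇒∣m*n u' p∣ij'))) ≋-refl) (≋-reflexive (identityˡ _))))
        where open +-*-Solver
      left : τ b · τ g ≋ ζ ↑ (u' * j * i') · Q
      left = ≋-trans (≋-reflexive (trans (cong₂ _·_ τb τg) (group (X ∷ Y ∷ Z ∷ W ∷ []) (v0 ⊗ v1 ⊗ (v2 ⊗ v3)) (v0 ⊗ (v1 ⊗ v2) ⊗ v3) refl)))
        (≋-trans (≋-· (≋-· ≋-refl YZ) ≋-refl)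
        (≋-trans (≋-reflexive (trans (group (X ∷ Y ∷ Z ∷ W ∷ []) (v0 ⊗ (v2 ⊗ v1) ⊗ v3) (v0 ⊗ v2 ⊗ (v1 ⊗ v3)) refl)
          (trans (cong₂ _·_ (self-commute b i' i) (self-commute g j' j)) (group (X ∷ Y ∷ Z ∷ W ∷ []) (v2 ⊗ v0 ⊗ (v3 ⊗ v1)) (v2 ⊗ (v0 ⊗ v3) ⊗ v1) refl))))
        (≋-trans (≋-· (≋-· ≋-refl (b↑-g↑ i' j)) ≋-refl)
        (≋-trans (≋-reflexive (group (X ∷ Y ∷ Z ∷ W ∷ ζ ↑ (u' * j * i') ∷ []) (v2 ⊗ (v4 ⊗ (v3 ⊗ v0)) ⊗ v1) (v2 ⊗ v4 ⊗ (v3 ⊗ (v0 ⊗ v1))) refl))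
        (≋-trans (≋-· (≋-commute-↑ (u' * j * i') (ζ-central Z)) ≋-refl)
        (≋-reflexive (group (X ∷ Y ∷ Z ∷ W ∷ ζ ↑ (u' * j * i') ∷ []) (v4 ⊗ v2 ⊗ (v3 ⊗ (v0 ⊗ v1))) (v4 ⊗ (v2 ⊗ v3 ⊗ (v0 ⊗ v1))) refl)))))))
      right : τ b · τ g ≋ ζ ↑ (u' * j * 1) · Q
      right = ≋-trans (≋-reflexive τbg) (≋-· (≋-trans (≋-↑ u' τζ≋) (≋-reflexive (trans (sym (↑-* ζ j u')) (cong (ζ ↑_) (trans (*-comm j u') (sym (*-identityʳ _))))))) (≋-reflexive (cong₂ _·_ τg τb)))
      eq : ζ ↑ (u' * j * i') ≋ ζ ↑ (u' * j * 1)
      eq = ≋-cancelʳ Q (≋-trans (≋-sym left) right)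

-- The value of the transfer at b

sum-toℕ : ∀ m → sum {m} toℕ + sum {m} toℕ + m ≡ m * m
sum-toℕ zero = cong (λ t → t + t + 0) (sum-zero _)
sum-toℕ (suc m) = trans (cong (λ t → t + t + suc m) (trans (sum-suc _) (trans (sum-+ (λ _ → 1) toℕ) (cong (_+ sum {m} toℕ) (trans (sum-const m 1) (*-identityʳ m))))))
  (trans (solve 2 (λ m t → m :+ t :+ (m :+ t) :+ (con 1 :+ m) := t :+ t :+ m :+ (con 1 :+ m :+ m)) refl m (sum {m} toℕ))
  (trans (cong (_+ (1 + m + m)) (sum-toℕ m)) (solve 1 (λ m → m :* m :+ (con 1 :+ m :+ m) := (con 1 :+ m) :* (con 1 :+ m)) refl m)))
  where open +-*-Solver

module NoBigPrime (p : ℕ) (pp : Prime p) (h : ℕ) (odd : p ≡ 1 + (h + h)) (p∤2 : ¬ p ∣ 2) (p∤3 : ¬ p ∣ 3)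
    (H : FiniteGroup) (pg : IsPGroup p H) (nonabelian : NonAbelian H)
    (Γ : Graph) (conn : Connected Γ) (cubic : Cubic Γ) (et : EdgeTransitive Γ) (A : BiCayleyAction H Γ) where
  open CoreLemmas p pp H pg Γ conn cubic et A
  open BigPrime p∤2 p∤3
  module 𝕄 = Metacyclics p pp H pg

  module _ (E : ℕ)
      (minimal : ∀ {E'} → E' < E → ∀ g b → 𝕄.Normal g → 𝕄.Generate g b → b ℍ.↑ (p ^ E') ≡ ℍ.e → ⊥)
      (g b : Carrier H) (N : 𝕄.Normal g) (G : 𝕄.Generate g b) (bE : b ℍ.↑ (p ^ E) ≡ ℍ.e) where

    private
      notAbelian : ¬ (∀ x y → x ℍ.· y ≡ y ℍ.· x)
      notAbelian ab = proj₂ (proj₂ nonabelian) (ab _ _)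

    open MinimalPair p pp H pg h odd E minimal g b N G bE notAbelian
    open Transfer χ χ-∙
    open Pair g b N

    private
      f : Carrier K → ℕ
      f t = χ (c (ι b) t)

      χ-e : χ ℍ.e ≈ 0 [ p ]
      χ-e = χ-g 0

      c-e : ∀ {t} → InT t → c (ι ℍ.e) t ≡ ℍ.e
      c-e {t} it = proj₂ (•-unique {ι ℍ.e} {t} ℍ.e it (trans (cong (_· t) ι-e) (trans (identityˡ t) (sym (trans (cong (t ·_) ι-e) (identityʳ t))))))

      c-∙ : ∀ x y t → c (ι (x ℍ.· y)) t ≡ c (ι x) (ι y • t) ℍ.· c (ι y) t
      c-∙ x y t = trans (cong (λ k → c k t) (ι-∙ x y)) (proj₂ (•-∙ (ι x) (ι y) t))

      •-ι∙ : ∀ x y t → ι (x ℍ.· y) • t ≡ ι x • ι y • t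
      •-ι∙ x y t = trans (cong (_• t) (ι-∙ x y)) (proj₁ (•-∙ (ι x) (ι y) t))

      iter-comm : ∀ {X : Set} (s : X → X) m x → iter m s (s x) ≡ s (iter m s x)
      iter-comm s zero x = refl
      iter-comm s (suc m) x = cong s (iter-comm s m x)

      -- Along an orbit of `b` the cocycle values multiply up to the cocycle of a power of `b`.
      cocycle-sum : ∀ ℓ {t} → InT t → sum {ℓ} (λ i → f (iter (toℕ i) (ι b •_) t)) ≈ χ (c (ι (b ℍ.↑ ℓ)) t) [ p ]
      cocycle-sum zero it = ≈-trans (≈-reflexive (sum-zero _)) (≈-sym (≈-trans (≈-reflexive (cong χ (c-e it))) χ-e))
      cocycle-sum (suc ℓ) {t} it = ≈-trans (≈-reflexive (trans (sum-suc _) (+-comm (f t) _)))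
        (≈-trans (≈-+ (≈-trans (≈-reflexive (sum-cong {ℓ} λ i → cong f (sym (iter-comm (ι b •_) (toℕ i) t)))) (cocycle-sum ℓ (•-InT (ι b) t))) ≈-refl)
        (≈-trans (≈-sym (χ-∙ _ _)) (≈-reflexive (cong χ (trans (sym (c-∙ (b ℍ.↑ ℓ) b t)) (cong (λ x → c (ι x) t) (sym (ℍ.commute-↑ ℓ refl))))))))

      fixed-↑ : ∀ x {t} → InT t → ι x • t ≡ t → ∀ k → ι (x ℍ.↑ k) • t ≡ t
      fixed-↑ x it q zero = trans (cong (_• _) ι-e) (e-• it)
      fixed-↑ x {t} it q (suc k) = trans (•-ι∙ x _ t) (trans (cong (ι x •_) (fixed-↑ x it q k)) q)

      -- The argument of χ is b^ℓ conjugated by t⁻¹. As p divides ℓ, its order is smaller than that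
      -- of `b`, and χ vanishes on it by the minimality of `E`.
      long-orbit : ∀ E₁ → E ≡ E₁ → ∀ t ℓ → InT t → p ∣ ℓ → ι (b ℍ.↑ ℓ) • t ≡ t → χ (c (ι (b ℍ.↑ ℓ)) t) ≈ 0 [ p ]
      long-orbit zero refl t ℓ it d q = contradiction (trans (sym (ℍ.↑-1 b)) bE) b≢e
      long-orbit (suc E') refl t ℓ it (divides m refl) q = χ-short ≤-refl x (ι-injective (begin
        ι (x ℍ.↑ (p ^ E')) ≡⟨ ι-↑ x (p ^ E') ⟩
        ι x ↑ (p ^ E') ≡⟨ cong (_↑ (p ^ E')) (sym (fixed-conj q)) ⟩
        conj (t ⁻) (ι (b ℍ.↑ (m * p))) ↑ (p ^ E') ≡⟨ sym (conj-↑ (t ⁻) _ (p ^ E')) ⟩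
        conj (t ⁻) (ι (b ℍ.↑ (m * p)) ↑ (p ^ E')) ≡⟨ cong (conj (t ⁻)) (trans (sym (ι-↑ _ (p ^ E'))) (trans (cong ι kills) ι-e)) ⟩
        conj (t ⁻) e ≡⟨ conj-e (t ⁻) ⟩
        e ≡⟨ sym ι-e ⟩
        ι ℍ.e ∎))
        where
        open ≡-Reasoning
        x = c (ι (b ℍ.↑ (m * p))) t
        kills : (b ℍ.↑ (m * p)) ℍ.↑ (p ^ E') ≡ ℍ.e
        kills = trans (sym (ℍ.↑-* b (m * p) (p ^ E'))) (ℍ.↑-∣ b bE (divides m (*-assoc m p (p ^ E'))))

      B₁ : Carrier K → Bool
      B₁ = Fix b T

      step₁ : sumOn T f ≈ sumOn B₁ f [ p ]
      step₁ = FixStep.sum-fixed p pp (ι b •_) ℍ.K T (λ t _ → ⇒T (•-InT (ι b) t)) per f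
        λ t ℓ tT mv ep → ≈0⇒∣ (≈-trans (cocycle-sum ℓ (T⇒ {t} tT)) (long-orbit E refl t ℓ (T⇒ {t} tT)
          (FixStep.period-∣ p pp (ι b •_) ℍ.K T (λ t _ → ⇒T (•-InT (ι b) t)) per tT mv ep)
          (trans (sym (iter-• b ℓ (T⇒ {t} tT))) (ExactPeriod.period ep))))
        where
        per : ∀ t → T t ≡ true → iter (p ^ ℍ.K) (ι b •_) t ≡ t
        per t tT = period-• b (T⇒ {t} tT)

      -- A descending filtration: for j = K the condition on `g` is void and all cosets fixed by `b`
      -- are included, while for j = 0 only the cosets fixed by H remain.
      B : ℕ → Carrier K → Bool
      B j = Fix (g ℍ.↑ (p ^ j)) B₁

      B⇒ : ∀ j {t} → B j t ≡ true → InT t × ι b • t ≡ t × ι (g ℍ.↑ (p ^ j)) • t ≡ t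
      B⇒ j {t} q = let a , b' = Fix⇒ (g ℍ.↑ (p ^ j)) {B₁} {t} q ; a' , b'' = Fix⇒ b {T} {t} a in T⇒ {t} a' , b'' , b'

      ⇒B : ∀ j {t} → InT t → ι b • t ≡ t → ι (g ℍ.↑ (p ^ j)) • t ≡ t → B j t ≡ true
      ⇒B j {t} it q q' = ⇒Fix (g ℍ.↑ (p ^ j)) {B₁} (⇒Fix b {T} (⇒T it) q) q'

      sumOn-set : ∀ {B C : Carrier K → Bool} → (∀ t → B t ≡ true → C t ≡ true) → (∀ t → C t ≡ true → B t ≡ true) → sumOn B f ≡ sumOn C f
      sumOn-set {B} {C} h h' = sum-cong λ t → cong (λ x → ⟦ x ⟧ * f t) (bool-iff {B t} {C t} (h t) (h' t))

      module Level (j : ℕ) where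
        s : Carrier H
        s = g ℍ.↑ (p ^ j)

        sᵖ : s ℍ.↑ p ≡ g ℍ.↑ (p ^ suc j)
        sᵖ = trans (sym (ℍ.↑-* g (p ^ j) p)) (cong (g ℍ.↑_) (*-comm (p ^ j) p))

        twist : ∃[ k ] b ℍ.· s ≡ s ℍ.· (b ℍ.· s ℍ.↑ (k * p))
        twist = 𝕄.twist (𝕄.Normal-↑ N (p ^ j)) b

        w : Carrier H
        w = s ℍ.↑ (proj₁ twist * p)

        module At {t} (m : B (suc j) t ≡ true) where
          it : InT t
          it = proj₁ (B⇒ (suc j) {t} m)
          bt : ι b • t ≡ t
          bt = proj₁ (proj₂ (B⇒ (suc j) {t} m))
          spt : ι (s ℍ.↑ p) • t ≡ t
          spt = trans (cong (λ x → ι x • t) sᵖ) (proj₂ (proj₂ (B⇒ (suc j) {t} m)))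
          wt : ι w • t ≡ t
          wt = trans (cong (λ x → ι x • t) (ℍ.↑-*′ s (proj₁ twist) p)) (fixed-↑ (s ℍ.↑ p) it spt (proj₁ twist))
          stable : B (suc j) (ι s • t) ≡ true
          stable = ⇒B (suc j) (•-InT (ι s) t)
            (trans (sym (•-ι∙ b s t)) (trans (cong (λ x → ι x • t) (proj₂ twist)) (trans (•-ι∙ s _ t) (cong (ι s •_) (trans (•-ι∙ b w t) (trans (cong (ι b •_) wt) bt))))))
            (trans (cong (λ x → ι x • ι s • t) (sym sᵖ)) (trans (sym (•-ι∙ (s ℍ.↑ p) s t)) (trans (cong (λ x → ι x • t) (sym (ℍ.commute-↑ p refl))) (trans (•-ι∙ s _ t) (cong (ι s •_) spt)))))
          private
            cs cb cw cb' cw' : Carrier H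
            cs = c (ι s) t
            cb = c (ι b) t
            cw = c (ι w) t
            cb' = c (ι b) (ι s • t)
            cw' = c (ι w) (ι s • t)

            c-bs : cb' ℍ.· cs ≡ cs ℍ.· (cb ℍ.· cw)
            c-bs = begin
              cb' ℍ.· cs ≡⟨ sym (c-∙ b s t) ⟩
              c (ι (b ℍ.· s)) t ≡⟨ cong (λ x → c (ι x) t) (proj₂ twist) ⟩
              c (ι (s ℍ.· (b ℍ.· w))) t ≡⟨ c-∙ s (b ℍ.· w) t ⟩
              c (ι s) (ι (b ℍ.· w) • t) ℍ.· c (ι (b ℍ.· w)) t ≡⟨ cong₂ (λ x y → c (ι s) x ℍ.· y) (trans (•-ι∙ b w t) (trans (cong (ι b •_) wt) bt)) (c-∙ b w t) ⟩
              cs ℍ.· (c (ι b) (ι w • t) ℍ.· cw) ≡⟨ cong (λ x → cs ℍ.· (c (ι b) x ℍ.· cw)) wt ⟩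
              cs ℍ.· (cb ℍ.· cw) ∎
              where open ≡-Reasoning

            c-ws : cw' ℍ.· cs ≡ cs ℍ.· cw
            c-ws = begin
              cw' ℍ.· cs ≡⟨ sym (c-∙ w s t) ⟩
              c (ι (w ℍ.· s)) t ≡⟨ cong (λ x → c (ι x) t) (sym (ℍ.commute-↑ {s} {s} (proj₁ twist * p) refl)) ⟩
              c (ι (s ℍ.· w)) t ≡⟨ c-∙ s w t ⟩
              c (ι s) (ι w • t) ℍ.· cw ≡⟨ cong (λ x → c (ι s) x ℍ.· cw) wt ⟩
              cs ℍ.· cw ∎
              where open ≡-Reasoning

            χ-swap : ∀ x y z → x ℍ.· y ≡ y ℍ.· z → χ x ≈ χ z [ p ]
            χ-swap x y z q = ≈-cancel-+ˡ (χ y) (≈-trans (≈-reflexive (+-comm (χ y) (χ x))) (≈-trans (≈-sym (χ-∙ x y)) (≈-trans (≈-reflexive (cong χ q)) (χ-∙ y z))))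

          -- Evaluate the cocycle on b s = s b w, where `w` is a power of s^p and so fixes `t`. The
          -- contributions of `s` cancel because χ takes values in an abelian group.
          f-shift : f (ι s • t) ≈ f t + χ (c (ι w) t) [ p ]
          f-shift = ≈-trans (χ-swap cb' cs (cb ℍ.· cw) c-bs) (χ-∙ cb cw)
          ω-shift : χ (c (ι w) (ι s • t)) ≈ χ (c (ι w) t) [ p ]
          ω-shift = χ-swap cw' cs cw c-ws

        orbit-B : ∀ {t} i → B (suc j) t ≡ true → B (suc j) (iter i (ι s •_) t) ≡ true
        orbit-B zero m = m
        orbit-B {t} (suc i) m = At.stable {iter i (ι s •_) t} (orbit-B i m)

        ω-const : ∀ {t} i → B (suc j) t ≡ true → χ (c (ι w) (iter i (ι s •_) t)) ≈ χ (c (ι w) t) [ p ]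
        ω-const zero m = ≈-refl
        ω-const {t} (suc i) m = ≈-trans (At.ω-shift {iter i (ι s •_) t} (orbit-B i m)) (ω-const i m)

        f-linear : ∀ {t} i → B (suc j) t ≡ true → f (iter i (ι s •_) t) ≈ f t + i * χ (c (ι w) t) [ p ]
        f-linear {t} zero m = ≈-reflexive (sym (+-identityʳ (f t)))
        f-linear {t} (suc i) m = ≈-trans (At.f-shift {iter i (ι s •_) t} (orbit-B i m)) (≈-trans (≈-+ (f-linear i m) (ω-const i m))
          (≈-reflexive (trans (+-assoc (f t) _ _) (cong (f t +_) (+-comm (i * χ (c (ι w) t)) _)))))

        sum-≈ : ∀ m {φ ψ : Fin m → ℕ} → (∀ i → φ i ≈ ψ i [ p ]) → sum φ ≈ sum ψ [ p ]
        sum-≈ zero h = ≈-reflexive (trans (sum-zero _) (sym (sum-zero _)))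
        sum-≈ (suc m) h = ≈-trans (≈-reflexive (sum-suc _)) (≈-trans (≈-+ (h zero) (sum-≈ m (h ∘ suc))) (≈-reflexive (sym (sum-suc _))))

        p∣triangle : p ∣ sum {p} toℕ
        p∣triangle = cancel2 (∣m+n∣m⇒∣n (subst (p ∣_) (trans (sym (sum-toℕ p)) (+-comm _ p)) (m∣m*n p)) ∣-refl)
          where
          cancel2 : p ∣ sum {p} toℕ + sum {p} toℕ → p ∣ sum {p} toℕ
          cancel2 d with euclidsLemma 2 (sum {p} toℕ) pp (subst (p ∣_) (cong (sum {p} toℕ +_) (sym (+-identityʳ _))) d)
          ... | inj₁ d' = contradiction d' p∤2
          ... | inj₂ d' = d'

        -- An orbit on which `s` acts non-trivially has length p, and `f` runs through an arithmetic
        -- progression on it. The sum is p f t + ω p (p - 1) / 2, a multiple of p as p is odd.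
        orbit-vanishes : ∀ t ℓ → B (suc j) t ≡ true → ι s • t ≢ t → ExactPeriod (ι s •_) ℓ t → p ∣ sum {ℓ} (λ i → f (iter (toℕ i) (ι s •_) t))
        orbit-vanishes t ℓ m mv ep = go (ℍ.∣p^⇒ 1 (subst (ℓ ∣_) (sym (*-identityʳ p)) ℓ∣p))
          where
          ω = χ (c (ι w) t)
          ℓ∣p : ℓ ∣ p
          ℓ∣p = exactPeriod-∣ ep p (trans (iter-• s p (At.it {t} m)) (At.spt {t} m))
          ℓ≡p : p ∣ ℓ → ℓ ≡ p
          ℓ≡p d = ∣-antisym ℓ∣p d
          total : ∀ q → sum {q} (λ i → f (iter (toℕ i) (ι s •_) t)) ≈ q * f t + sum {q} toℕ * ω [ p ]
          total q = ≈-trans (sum-≈ q λ i → f-linear (toℕ i) m) (≈-reflexive (trans (sum-+ _ _) (cong₂ _+_ (sum-const q (f t)) (sum-*ʳ ω toℕ))))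
          go : ℓ ≡ 1 ⊎ p ∣ ℓ → p ∣ sum {ℓ} (λ i → f (iter (toℕ i) (ι s •_) t))
          go (inj₁ refl) = contradiction (ExactPeriod.period ep) mv
          go (inj₂ d) = subst (λ q → p ∣ sum {q} (λ i → f (iter (toℕ i) (ι s •_) t))) (sym (ℓ≡p d))
            (≈0⇒∣ (≈-trans (total p) (∣⇒≈0 (∣m∣n⇒∣m+n (m∣m*n (f t)) (∣m⇒∣m*n ω p∣triangle)))))

        descent : sumOn (B (suc j)) f ≈ sumOn (B j) f [ p ]
        descent = ≈-trans (FixStep.sum-fixed p pp (ι s •_) ℍ.K (B (suc j)) (λ t m → At.stable {t} m) (λ t m → period-• s (At.it {t} m)) f orbit-vanishes)
          (≈-reflexive (sumOn-set
            (λ t q → let a , q' = Fix⇒ s {B (suc j)} {t} q ; it , bt , _ = B⇒ (suc j) {t} a in ⇒B j {t} it bt q')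
            (λ t q → let it , bt , q' = B⇒ j {t} q in ⇒Fix s {B (suc j)} (⇒B (suc j) it bt (trans (cong (λ x → ι x • t) (sym sᵖ)) (fixed-↑ s it q' p))) q')))

      descend-all : ∀ j → sumOn (B j) f ≈ sumOn (B 0) f [ p ]
      descend-all zero = ≈-refl
      descend-all (suc j) = ≈-trans (Level.descent j) (descend-all j)

      top : sumOn B₁ f ≡ sumOn (B ℍ.K) f
      top = sumOn-set (λ t q → ⇒Fix (g ℍ.↑ (p ^ ℍ.K)) {B₁} q (trans (cong (λ x → ι x • t) (ℍ.↑-p^K g)) (trans (cong (_• t) ι-e) (e-• (T⇒ {t} (proj₁ (Fix⇒ b {T} {t} q)))))))
        (λ t q → proj₁ (Fix⇒ (g ℍ.↑ (p ^ ℍ.K)) {B₁} {t} q))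

      -- A coset fixed by H makes its cocycle an injective endomorphism of H, namely conjugation by
      -- t⁻¹, to which `χ-invariant` applies.
      normaliser : ∀ t → B 0 t ≡ true → f t ≈ 1 [ p ]
      normaliser t m = χ-invariant τ τ-∙ τ-inj
        where
        it = proj₁ (B⇒ 0 {t} m)
        gt : ι g • t ≡ t
        gt = trans (cong (λ x → ι x • t) (sym (ℍ.↑-1 g))) (proj₂ (proj₂ (B⇒ 0 {t} m)))
        τ : Carrier H → Carrier H
        τ x = c (ι x) t
        fix : ∀ x → ι x • t ≡ t
        fix x with G x
        ... | i , j , refl = trans (•-ι∙ (b ℍ.↑ i) (g ℍ.↑ j) t) (trans (cong (ι (b ℍ.↑ i) •_) (fixed-↑ g it gt j)) (fixed-↑ b it (proj₁ (proj₂ (B⇒ 0 {t} m))) i))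
        τ-∙ : ∀ x y → τ (x ℍ.· y) ≡ τ x ℍ.· τ y
        τ-∙ x y = trans (c-∙ x y t) (cong (λ z → c (ι x) z ℍ.· τ y) (fix y))
        τ-inj : ∀ {x} → τ x ≡ ℍ.e → x ≡ ℍ.e
        τ-inj {x} q = ι-injective (trans (conj-injective (t ⁻) (trans (fixed-conj (fix x)) (trans (cong ι q) (trans ι-e (sym (conj-e (t ⁻))))))) (sym ι-e))

      final-count : sumOn (B 0) f ≈ card (B 0) [ p ]
      final-count = ≈-trans (go (B 0) f normaliser) (≈-reflexive (sumOn-1 (B 0)))
        where
        go : ∀ {m} (B : Fin m → Bool) (f : Fin m → ℕ) → (∀ t → B t ≡ true → f t ≈ 1 [ p ]) → sumOn B f ≈ sumOn B (λ _ → 1) [ p ]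
        go {zero} B f h = ≈-reflexive (trans (sum-zero _) (sym (sum-zero _)))
        go {suc m} B f h = ≈-trans (≈-reflexive (sum-suc _)) (≈-trans (≈-+ (pt (B zero) (h zero)) (go (B ∘ suc) (f ∘ suc) (λ t → h (suc t)))) (≈-reflexive (sym (sum-suc _))))
          where
          pt : ∀ x → (x ≡ true → f zero ≈ 1 [ p ]) → ⟦ x ⟧ * f zero ≈ ⟦ x ⟧ * 1 [ p ]
          pt true q = ≈-*ˡ 1 (q refl)
          pt false q = ≈-refl

      same : card T₀ ≡ card (B 0)
      same = card-cong λ t → bool-iff
        (λ q → let a , bt = Fix⇒ b {Fix g T} {t} q ; a' , gt = Fix⇒ g {T} {t} a in ⇒B 0 {t} (T⇒ {t} a') bt (trans (cong (λ x → ι x • t) (ℍ.↑-1 g)) gt))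
        (λ q → let it , bt , gt = B⇒ 0 {t} q in ⇒Fix b {Fix g T} (⇒Fix g {T} (⇒T it) (trans (cong (λ x → ι x • t) (sym (ℍ.↑-1 g))) gt)) bt)

    impossible : ⊥
    -- Modulo p, the size of the transversal, the number of cosets fixed by H, the sum of `f` over
    -- them and the transfer of `b` all agree, and the last is 0.
    impossible = p∤card-T (≈0⇒∣ (≈-trans card-T₀ (≈-trans (≈-reflexive same) (≈-trans (≈-sym final-count)
      (≈-trans (≈-sym (descend-all ℍ.K)) (≈-trans (≈-reflexive (sym top)) (≈-trans (≈-sym step₁) (tr-vanishes (ι b)))))))))

  contradiction-for : Metacyclic H → ⊥
  contradiction-for (g , a , N , G) = <-rec (λ E → ∀ g b → 𝕄.Normal g → 𝕄.Generate g b → b ℍ.↑ (p ^ E) ≡ ℍ.e → ⊥)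
    (λ E rec g b N G bE → impossible E rec g b N G bE) ℍ.K g a
    (λ x → let j , q = N x 1 in j , trans (cong (ℍ.conj x) (sym (ℍ.↑-1 g))) q) G (ℍ.↑-p^K a)

-- p = 3: rotating the neighbours

pick : ∀ {N m} (B : Fin N → Bool) → card B ≡ suc m → ∃[ x ] (B x ≡ true × card (λ y → B y ∧ not (does (x ≟ y))) ≡ m)
pick {m = m} B q with any? (λ x → B x Boolₚ.≟ true)
... | no h = contradiction (trans (sym q) (sum-0 _ λ x → cong ⟦_⟧ (Boolₚ.¬-not λ e → h (x , e)))) λ ()
... | yes (x , bx) = x , bx , +-cancelˡ-≡ 1 _ _ (trans (sym split) q)
  where
  split : card B ≡ 1 + card (λ y → B y ∧ not (does (x ≟ y)))
  split = trans (sum-cong pt) (trans (sum-+ (δ x) (λ y → ⟦ B y ∧ not (does (x ≟ y)) ⟧)) (cong (_+ card (λ y → B y ∧ not (does (x ≟ y)))) (sum-δ1 x)))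
    where
    pt : ∀ y → ⟦ B y ⟧ ≡ δ x y + ⟦ B y ∧ not (does (x ≟ y)) ⟧
    pt y with x ≟ y
    ... | yes refl rewrite bx = refl
    ... | no _ with B y
    ...   | true = refl
    ...   | false = refl

three-elements : ∀ {N} (B : Fin N → Bool) → card B ≡ 3 →
  ∃[ x ] ∃[ y ] ∃[ z ] (B x ≡ true × B y ≡ true × B z ≡ true × x ≢ y × x ≢ z × y ≢ z × (∀ w → B w ≡ true → w ≡ x ⊎ w ≡ y ⊎ w ≡ z))
three-elements B q with pick B q
... | x , bx , qx with pick _ qx
... | y , by' , qy with pick _ qy
... | z , bz' , qz = x , y , z , bx , by , bz , x≢y , x≢z , y≢z , only
  where
  ≢-of : ∀ {a} {u v : Fin _} → a ∧ not (does (u ≟ v)) ≡ true → u ≢ v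
  ≢-of {true} {u} {v} h with u ≟ v
  ... | no n = n
  by = proj₁ (∧-true {B y} by')
  x≢y = ≢-of {B y} by'
  bz₁ = proj₁ (∧-true {B z ∧ not (does (x ≟ z))} bz')
  y≢z = ≢-of {B z ∧ not (does (x ≟ z))} bz'
  bz = proj₁ (∧-true {B z} bz₁)
  x≢z = ≢-of {B z} bz₁
  only : ∀ w → B w ≡ true → w ≡ x ⊎ w ≡ y ⊎ w ≡ z
  only w bw with x ≟ w | y ≟ w | z ≟ w
  ... | yes e | _ | _ = inj₁ (sym e)
  ... | no _ | yes e | _ = inj₂ (inj₁ (sym e))
  ... | no _ | no _ | yes e = inj₂ (inj₂ (sym e))
  ... | no a | no b | no c = contradiction (card-pos _ w (∧-intro (∧-intro (∧-intro bw (cong not (dec-false (x ≟ w) a))) (cong not (dec-false (y ≟ w) b))) (cong not (dec-false (z ≟ w) c)))) (subst (λ t → ¬ 0 < t) (sym qz) λ ())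

pattern 0F = zero
pattern 1F = suc zero
pattern 2F = suc (suc zero)

perm-0↦1 : (π : Fin 3 → Fin 3) → (∀ {c d} → π c ≡ π d → c ≡ d) → π 0F ≡ 1F → (π 1F ≡ 2F × π 2F ≡ 0F) ⊎ (π 1F ≡ 0F × π 2F ≡ 2F)
perm-0↦1 π inj q with π 1F in q₁ | π 2F in q₂
... | 1F | _ = contradiction (inj {0F} {1F} (trans q (sym q₁))) λ ()
... | 0F | 1F = contradiction (inj {0F} {2F} (trans q (sym q₂))) λ ()
... | 2F | 1F = contradiction (inj {0F} {2F} (trans q (sym q₂))) λ ()
... | 0F | 0F = contradiction (inj {1F} {2F} (trans q₁ (sym q₂))) λ ()
... | 2F | 2F = contradiction (inj {1F} {2F} (trans q₁ (sym q₂))) λ ()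
... | 0F | 2F = inj₂ (refl , refl)
... | 2F | 0F = inj₁ (refl , refl)

perm-0↦2 : (π : Fin 3 → Fin 3) → (∀ {c d} → π c ≡ π d → c ≡ d) → π 0F ≡ 2F → (π 1F ≡ 0F × π 2F ≡ 1F) ⊎ (π 1F ≡ 1F × π 2F ≡ 0F)
perm-0↦2 π inj q with π 1F in q₁ | π 2F in q₂
... | 2F | _ = contradiction (inj {0F} {1F} (trans q (sym q₁))) λ ()
... | 0F | 2F = contradiction (inj {0F} {2F} (trans q (sym q₂))) λ ()
... | 1F | 2F = contradiction (inj {0F} {2F} (trans q (sym q₂))) λ ()
... | 0F | 0F = contradiction (inj {1F} {2F} (trans q₁ (sym q₂))) λ ()
... | 1F | 1F = contradiction (inj {1F} {2F} (trans q₁ (sym q₂))) λ ()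
... | 0F | 1F = inj₁ (refl , refl)
... | 1F | 0F = inj₂ (refl , refl)

colour : (H : FiniteGroup) (a b : Carrier H) → Fin 3 → Carrier H
colour H a b zero = ε H
colour H a b (suc zero) = a
colour H a b (suc (suc zero)) = b

-- The neighbour of h₀ (resp. h₁) along the edge of colour c is (s h)₁ (resp. (s⁻¹ h)₀).
next : (H : FiniteGroup) (a b : Carrier H) → Fin 3 → Bool → Carrier H → Carrier H
next H a b c false h = _∙_ H (colour H a b c) h
next H a b c true h = _∙_ H (_⁻¹ H (colour H a b c)) h

-- The bi-Cayley graph BiCay(H, ∅, ∅, {1, a, b}) with an automorphism permuting 1 → a → b → 1.
record HaarGraph (H : FiniteGroup) (Γ : Graph) (A : BiCayleyAction H Γ) : Set where
  open Grp H
  field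
    vtx        : Bool → Carrier H → Fin (n Γ)
    vtx-inj    : ∀ {i j h k} → vtx i h ≡ vtx j k → i ≡ j × h ≡ k
    vtx-surj   : ∀ v → ∃[ i ] ∃[ h ] vtx i h ≡ v
    vtx-ρ      : ∀ i h k → ρ A k (vtx i h) ≡ vtx i (h · k)
    a b        : Carrier H
    colour-inj : ∀ {c d} → colour H a b c ≡ colour H a b d → c ≡ d
    edge       : ∀ i h c → adj Γ (vtx i h) (vtx (not i) (next H a b c i h)) ≡ true
    edge-only  : ∀ i h w → adj Γ (vtx i h) w ≡ true → ∃[ c ] w ≡ vtx (not i) (next H a b c i h)
    α          : Carrier H → Carrier H
    α-∙        : ∀ x y → α (x · y) ≡ α x · α y
    α-a        : α a ≡ a ⁻ · b
    α-b        : α b ≡ a ⁻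

module Rotation (pp : Prime 3) (H : FiniteGroup) (pg : IsPGroup 3 H) (Γ : Graph) (conn : Connected Γ)
                (cubic : Cubic Γ) (et : EdgeTransitive Γ) (A : BiCayleyAction H Γ)
                (g₀ b₀ : Carrier H) (N : ∀ x → ∃[ j ] _∙_ H (_∙_ H x g₀) (_⁻¹ H x) ≡ pow H g₀ j)
                (G : ∀ h → ∃[ i ] ∃[ j ] h ≡ _∙_ H (pow H b₀ i) (pow H g₀ j)) where
  open CoreLemmas 3 pp H pg Γ conn cubic et A
  open Pair g₀ b₀ N

  private
    Normalises : Carrier K → Set
    Normalises k = ∀ h → ∃[ h' ] conj (k ⁻) (ι h) ≡ ι h'

    opaque
      normalises? : ∀ k → Dec (Normalises k)
      normalises? k = all? λ h → any? λ h' → conj (k ⁻) (ι h) ≟ ι h'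

    X : Carrier K → Bool
    X k = does (normalises? k)

    normalises-∙ : ∀ {k l} → Normalises k → Normalises l → Normalises (k · l)
    normalises-∙ {k} {l} f f' h with f h
    ... | h₁ , q₁ with f' h₁
    ... | h₂ , q₂ = h₂ , trans (group (k ∷ l ∷ ι h ∷ []) ((v0 ⊗ v1) ⊖ ⊗ v2 ⊗ (v0 ⊗ v1) ⊖ ⊖) (v1 ⊖ ⊗ (v0 ⊖ ⊗ v2 ⊗ v0 ⊖ ⊖) ⊗ v1 ⊖ ⊖) refl) (trans (cong (conj (l ⁻)) q₁) q₂)

    normalises-e : Normalises e
    normalises-e h = h , group (ι h ∷ []) (one ⊖ ⊗ v0 ⊗ one ⊖ ⊖) v0 refl

    normalises-↑ : ∀ {k} → Normalises k → ∀ m → Normalises (k ↑ m)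
    normalises-↑ f zero = normalises-e
    normalises-↑ {k} f (suc m) = normalises-∙ {k} {k ↑ m} f (normalises-↑ f m)

    -- `Normalises` asks for an inclusion only; the inverse is reached as a positive power of `k`.
    normalises-⁻ : ∀ {k} → Normalises k → Normalises (k ⁻)
    normalises-⁻ {k} f with finite-order k
    ... | suc m , _ , q = subst Normalises (inv-unique k (k ↑ m) q) (normalises-↑ f m)

    X-subgroup : IsSubgroup X
    X-subgroup = record
      { has-ε = dec-true (normalises? e) normalises-e
      ; has-∙ = λ {k} {l} x y → dec-true (normalises? (k · l)) (normalises-∙ {k} {l} (true⇒ (normalises? k) x) (true⇒ (normalises? l) y))
      ; has-⁻ = λ {k} x → dec-true (normalises? (k ⁻)) (normalises-⁻ {k} (true⇒ (normalises? k) x)) }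

    T₀⇒X : ∀ t → T₀ t ≡ true → T t ≡ true × Normalises t
    T₀⇒X t q with Fix⇒ b₀ {Fix g₀ T} {t} q
    ... | q' , bt with Fix⇒ g₀ {T} {t} q'
    ... | tT , gt = tT , λ h → c (ι h) t , fixed-conj (fix h)
      where
      fixed-↑ : ∀ x → ι x • t ≡ t → ∀ k → ι (x ℍ.↑ k) • t ≡ t
      fixed-↑ x q zero = trans (cong (_• _) ι-e) (e-• (T⇒ {t} tT))
      fixed-↑ x q (suc k) = trans (cong (_• t) (ι-∙ x _)) (trans (proj₁ (•-∙ (ι x) _ t)) (trans (cong (ι x •_) (fixed-↑ x q k)) q))
      fix : ∀ h → ι h • t ≡ t
      fix h with G h
      ... | i , j , refl = trans (cong (_• t) (ι-∙ (b₀ ℍ.↑ i) (g₀ ℍ.↑ j))) (trans (proj₁ (•-∙ (ι (b₀ ℍ.↑ i)) _ t)) (trans (cong (ι (b₀ ℍ.↑ i) •_) (fixed-↑ g₀ gt j)) (fixed-↑ b₀ bt i)))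

    X⇒T₀ : ∀ t → T t ≡ true → Normalises t → T₀ t ≡ true
    X⇒T₀ t tT f = ⇒Fix b₀ {Fix g₀ T} (⇒Fix g₀ {T} tT (fx g₀)) (fx b₀)
      where
      fx : ∀ h → ι h • t ≡ t
      fx h = let h' , q = f h in proj₁ (conj-fixed {ι h} {t} h' (T⇒ {t} tT) q)

    card-T₀-X : card T₀ ≡ (1 + ⟦ orbit X (u false) (u true) ⟧) * card (stab X (u false))
    card-T₀-X = trans (sum-cong pt) (trans (sum-+ _ _) (cong (card (stab X (u false)) +_) (fibre-card X-subgroup (u false) (u true))))
      where
      u≢ : u false ≢ u true
      u≢ q = contradiction (proj₁ (coord-unique false true ℍ.e ℍ.e (cong (λ v → act v (ι ℍ.e)) q))) λ ()
      pt : ∀ t → ⟦ T₀ t ⟧ ≡ ⟦ stab X (u false) t ⟧ + ⟦ X t ∧ does (act (u false) t ≟ u true) ⟧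
      pt t = cases (normalises? t) (act (u false) t ≟ u false) (act (u false) t ≟ u true)
        where
        cases : (d : Dec (Normalises t)) (x : Dec (act (u false) t ≡ u false)) (y : Dec (act (u false) t ≡ u true)) →
          ⟦ T₀ t ⟧ ≡ ⟦ does d ∧ does x ⟧ + ⟦ does d ∧ does y ⟧
        cases (no f) _ _ = cong ⟦_⟧ (Boolₚ.¬-not λ q → f (proj₂ (T₀⇒X t q)))
        cases (yes f) (yes q) (yes q') = contradiction (trans (sym q) q') u≢
        cases (yes f) (yes q) (no _) = cong ⟦_⟧ (X⇒T₀ t (⇒T (false , q)) f)
        cases (yes f) (no _) (yes q) = cong ⟦_⟧ (X⇒T₀ t (⇒T (true , q)) f)
        cases (yes f) (no q) (no q') = cong ⟦_⟧ (Boolₚ.¬-not λ r → neither (T⇒ {t} (proj₁ (T₀⇒X t r))))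
          where
          neither : InT t → ⊥
          neither (false , r) = q r
          neither (true , r) = q' r

    Y : Carrier K → Bool
    Y = stab X (u false)

    Y-subgroup : IsSubgroup Y
    Y-subgroup = stab-subgroup X-subgroup (u false)

    Y-fixes : Fixes Y (u false)
    Y-fixes k h = true⇒ (act (u false) k ≟ u false) (proj₂ (∧-true {X k} h))

    -- The transversal has a size divisible by 3, hence so has `T₀`; and the size of `T₀` is that of
    -- `Y` times 1 or 2.
    3∣Y : 3 ∣ card Y
    3∣Y = cases (euclidsLemma (1 + ⟦ orbit X (u false) (u true) ⟧) (card Y) pp
      (subst (3 ∣_) card-T₀-X (≈-∣ card-T₀ (subst (3 ∣_) (sym card-T) (∣n⇒∣m*n (1 + ⟦ orbit everything (u false) (u true) ⟧) 3∣stab)))))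
      where
      bad : ∀ x → 3 ∣ 1 + ⟦ x ⟧ → ⊥
      bad true d = contradiction (∣⇒≤ d) λ { (s≤s (s≤s ())) }
      bad false d = contradiction (∣⇒≤ d) λ { (s≤s ()) }
      cases : 3 ∣ 1 + ⟦ orbit X (u false) (u true) ⟧ ⊎ 3 ∣ card Y → 3 ∣ card Y
      cases (inj₂ d) = d
      cases (inj₁ d) = ⊥-elim (bad (orbit X (u false) (u true)) d)

    opaque
      -- The order of `Y` is divisible by 3, that of the stabiliser of an edge is not. So 3 divides
      -- the length of the orbit of `x`, which must then contain all three neighbours.
      transitive : ∀ {x y} → u false ~ x → u false ~ y → ∃[ k ] (Y k ≡ true × act x k ≡ y)
      transitive {x} {y} ux uy = cases (euclidsLemma (card (orbit Y x)) (card (stab Y x)) pp (subst (3 ∣_) (orbit-stabiliser Y-subgroup x) 3∣Y))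
        where
        cases : 3 ∣ card (orbit Y x) ⊎ 3 ∣ card (stab Y x) → ∃[ k ] (Y k ≡ true × act x k ≡ y)
        cases (inj₂ d) = contradiction d (edge-stabiliser (stab Y x) (stab-subgroup Y-subgroup x) ux (Fixes-stab {Y} x Y-fixes) λ k h → true⇒ (act x k ≟ x) (proj₂ (∧-true {Y k} h)))
        cases (inj₁ d) = true⇒ (inOrbit? Y x y) (whole (orbit Y x y) refl)
         where
         lt : ∀ {m} (B C : Fin m → Bool) z → (∀ w → B w ≡ true → C w ≡ true) → B z ≡ false → C z ≡ true → card B + 1 ≤ card C
         lt B C z sub bz cz = ≤-trans (≤-reflexive (trans (cong (card B +_) (sym (sum-δ1 z))) (sym (sum-+ _ _)))) (sum-mono pt)
           where
           pt : ∀ w → ⟦ B w ⟧ + δ z w ≤ ⟦ C w ⟧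
           pt w with z ≟ w
           ... | yes refl rewrite bz | cz = s≤s z≤n
           ... | no _ with B w in bw
           ...   | true rewrite sub w bw = s≤s z≤n
           ...   | false = z≤n
         whole : ∀ r → orbit Y x y ≡ r → orbit Y x y ≡ true
         whole true q = q
         whole false q = ⊥-elim (small (card (orbit Y x)) (orbit-pos Y-subgroup x)
           (s≤s⁻¹ (subst (_≤ 3) (+-comm (card (orbit Y x)) 1) (≤-trans (lt (orbit Y x) (adj Γ (u false)) y (orbit-adjacent {Y} Y-fixes ux) q uy) (≤-reflexive (degree-card (u false)))))) d)
           where
           small : ∀ d → 0 < d → d ≤ 2 → ¬ 3 ∣ d
           small 1 _ _ h = contradiction (∣⇒≤ h) λ { (s≤s ()) }
           small 2 _ _ h = contradiction (∣⇒≤ h) λ { (s≤s (s≤s ())) }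
           small (suc (suc (suc _))) _ (s≤s (s≤s ()))

  module Three {m₀ m₁ m₂ : V} (um₀ : u false ~ m₀) (um₁ : u false ~ m₁) (um₂ : u false ~ m₂)
      (m₀≢m₁ : m₀ ≢ m₁) (m₀≢m₂ : m₀ ≢ m₂) (m₁≢m₂ : m₁ ≢ m₂) (only : ∀ w → u false ~ w → w ≡ m₀ ⊎ w ≡ m₁ ⊎ w ≡ m₂) where

    private
      Rotates : Carrier K → Set
      Rotates k = Y k ≡ true × act m₀ k ≡ m₁ × act m₁ k ≡ m₂ × act m₂ k ≡ m₀

      stays : ∀ {k w} → Y k ≡ true → u false ~ w → u false ~ act w k
      stays {k} {w} yk uw = trans (cong (λ v → adj Γ v (act w k)) (sym (Y-fixes k yk))) (~-act k uw)

      comp : ∀ {k l x y z} → act x k ≡ y → act y l ≡ z → act x (k · l) ≡ z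
      comp {k} {l} {x} q q' = trans (act-∙ x k l) (trans (cong (λ v → act v l) q) q')

      Y-∙ : ∀ {k l} → Y k ≡ true → Y l ≡ true → Y (k · l) ≡ true
      Y-∙ = IsSubgroup.has-∙ Y-subgroup

      mm : Fin 3 → V
      mm zero = m₀
      mm (suc zero) = m₁
      mm (suc (suc zero)) = m₂

      u~mm : ∀ c → u false ~ mm c
      u~mm zero = um₀
      u~mm (suc zero) = um₁
      u~mm (suc (suc zero)) = um₂

      mm-inj : ∀ {c d} → mm c ≡ mm d → c ≡ d
      mm-inj {zero} {zero} _ = refl
      mm-inj {zero} {suc zero} q = contradiction q m₀≢m₁
      mm-inj {zero} {suc (suc zero)} q = contradiction q m₀≢m₂
      mm-inj {suc zero} {zero} q = contradiction (sym q) m₀≢m₁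
      mm-inj {suc zero} {suc zero} q = refl
      mm-inj {suc zero} {suc (suc zero)} q = contradiction q m₁≢m₂
      mm-inj {suc (suc zero)} {zero} q = contradiction (sym q) m₀≢m₂
      mm-inj {suc (suc zero)} {suc zero} q = contradiction (sym q) m₁≢m₂
      mm-inj {suc (suc zero)} {suc (suc zero)} q = refl

      image : ∀ {k} → Y k ≡ true → ∀ c → ∃[ d ] act (mm c) k ≡ mm d
      image {k} yk c = conv (only (act (mm c) k) (stays yk (u~mm c)))
        where
        conv : act (mm c) k ≡ m₀ ⊎ act (mm c) k ≡ m₁ ⊎ act (mm c) k ≡ m₂ → ∃[ d ] act (mm c) k ≡ mm d
        conv (inj₁ q) = 0F , q
        conv (inj₂ (inj₁ q)) = 1F , q
        conv (inj₂ (inj₂ q)) = 2F , q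

      perm : ∀ {k} → Y k ≡ true → Fin 3 → Fin 3
      perm yk c = proj₁ (image yk c)

      perm-act : ∀ {k} (yk : Y k ≡ true) {c d} → perm yk c ≡ d → act (mm c) k ≡ mm d
      perm-act yk {c} q = trans (proj₂ (image yk c)) (cong mm q)

      act-perm : ∀ {k} (yk : Y k ≡ true) {c d} → act (mm c) k ≡ mm d → perm yk c ≡ d
      act-perm yk {c} q = mm-inj (trans (sym (proj₂ (image yk c))) q)

      perm-inj : ∀ {k} (yk : Y k ≡ true) {c d} → perm yk c ≡ perm yk d → c ≡ d
      perm-inj {k} yk {c} {d} q = mm-inj (act-injective k (trans (perm-act yk q) (sym (proj₂ (image yk d)))))

      -- A rotation, or a product of two transpositions, or the square of a rotation in the other direction.
      rotation : ∃[ k ] Rotates k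
      rotation = first (transitive um₀ um₁)
        where
        second : ∀ {k} → Y k ≡ true → act m₀ k ≡ m₁ → act m₁ k ≡ m₀ → act m₂ k ≡ m₂ → ∃[ k ] (Y k ≡ true × act m₀ k ≡ m₂) → ∃[ k ] Rotates k
        second {k} yk q₀ q₁ q₂ (l , yl , r₀) = cases (perm-0↦2 (perm yl) (perm-inj yl) (act-perm yl {0F} {2F} r₀))
          where
          cases : _ → ∃[ k ] Rotates k
          cases (inj₁ (r₁ , r₂)) = l · l , Y-∙ {l} {l} yl yl , comp r₀ (perm-act yl {2F} r₂) , comp (perm-act yl {1F} r₁) r₀ , comp (perm-act yl {2F} r₂) (perm-act yl {1F} r₁)
          cases (inj₂ (r₁ , r₂)) = k · l , Y-∙ {k} {l} yk yl , comp q₀ (perm-act yl {1F} r₁) , comp q₁ r₀ , comp q₂ (perm-act yl {2F} r₂)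
        first : ∃[ k ] (Y k ≡ true × act m₀ k ≡ m₁) → ∃[ k ] Rotates k
        first (k , yk , q₀) = cases (perm-0↦1 (perm yk) (perm-inj yk) (act-perm yk {0F} {1F} q₀))
          where
          cases : _ → ∃[ k ] Rotates k
          cases (inj₁ (q₁ , q₂)) = k , yk , q₀ , perm-act yk {1F} q₁ , perm-act yk {2F} q₂
          cases (inj₂ (q₁ , q₂)) = second yk q₀ (perm-act yk {1F} q₁) (perm-act yk {2F} q₂) (transitive um₀ um₂)

      y : Carrier K
      y = proj₁ rotation
      yY : Y y ≡ true
      yY = proj₁ (proj₂ rotation)
      y₀ : act m₀ y ≡ m₁
      y₀ = proj₁ (proj₂ (proj₂ rotation))
      y₁ : act m₁ y ≡ m₂
      y₁ = proj₁ (proj₂ (proj₂ (proj₂ rotation)))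
      y₂ : act m₂ y ≡ m₀
      y₂ = proj₂ (proj₂ (proj₂ (proj₂ rotation)))
      y-normal : Normalises y
      y-normal = true⇒ (normalises? y) (proj₁ (∧-true {X y} yY))
      α : Carrier H → Carrier H
      α h = proj₁ (y-normal h)
      αy : ∀ v h → act (act v (ι h)) y ≡ act (act v y) (ι (α h))
      αy v h = trans (sym (act-∙ v (ι h) y)) (trans (cong (act v) (trans (group (y ∷ ι h ∷ []) (v1 ⊗ v0) (v0 ⊗ (v0 ⊖ ⊗ v1 ⊗ v0 ⊖ ⊖)) refl) (cong (y ·_) (proj₂ (y-normal h))))) (act-∙ v y _))
      α-∙ : ∀ h h' → α (h ℍ.· h') ≡ α h ℍ.· α h'
      α-∙ h h' = ι-injective (trans (sym (proj₂ (y-normal (h ℍ.· h')))) (trans (cong (conj (y ⁻)) (ι-∙ h h')) (trans (conj-· (y ⁻) (ι h) (ι h'))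
        (trans (cong₂ _·_ (proj₂ (y-normal h)) (proj₂ (y-normal h'))) (sym (ι-∙ _ _))))))

      side-y : ∀ v → side v ≡ false → side (act v y) ≡ false
      side-y v q = proj₁ (coord-of false (α (hc v)) (sym (trans (cong (λ w → act w y) (sym (trans (cong (λ i → act (u i) (ι (hc v))) (sym q)) (hc-eq v)))) (trans (αy (u false) (hc v)) (cong (λ w → act w (ι (α (hc v)))) (Y-fixes y yY))))))

      -- If one neighbour of the base vertex lay in its own orbit under H, the rotation would put
      -- all three there. Translates by H carry this to all other vertices of the orbit, and a
      -- connected graph would have only one orbit. So no edge stays inside an orbit.
      side-stable : side m₀ ≡ false → ∀ {x z} → Walk Γ x z → side x ≡ false → side z ≡ false
      side-stable s₀ here q = q
      side-stable s₀ (step {x} {w} xw r) q = side-stable s₀ r (back (only _ (subst (_~ act w (ι h ⁻)) back-x (~-act (ι h ⁻) xw))))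
        where
        h = hc x
        s₁ : side m₁ ≡ false
        s₁ = subst (λ v → side v ≡ false) y₀ (side-y m₀ s₀)
        s₂ : side m₂ ≡ false
        s₂ = subst (λ v → side v ≡ false) y₁ (side-y m₁ s₁)
        back-x : act x (ι h ⁻) ≡ u false
        back-x = act-inv (ι h) (trans (cong (λ i → act (u i) (ι h)) (sym q)) (hc-eq x))
        fwd : ∀ {v} → act w (ι h ⁻) ≡ v → side v ≡ false → side w ≡ false
        fwd {v} r s = proj₁ (coord-of false (hc v ℍ.· h) (trans (act-ι-∙ (u false) (hc v) h) (trans (cong (λ t → act t (ι h)) (trans (cong (λ i → act (u i) (ι (hc v))) (sym s)) (hc-eq v)))
          (trans (cong (λ t → act t (ι h)) (sym r)) (trans (sym (act-∙ w (ι h ⁻) (ι h))) (trans (cong (act w) (inverseˡ (ι h))) (act-ε w)))))))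
        back : act w (ι h ⁻) ≡ m₀ ⊎ act w (ι h ⁻) ≡ m₁ ⊎ act w (ι h ⁻) ≡ m₂ → side w ≡ false
        back (inj₁ r) = fwd r s₀
        back (inj₂ (inj₁ r)) = fwd r s₁
        back (inj₂ (inj₂ r)) = fwd r s₂

      side-u : ∀ i → side (u i) ≡ i
      side-u i = proj₁ (coord-of i ℍ.e (trans (cong (act (u i)) ι-e) (act-ε _)))

      side₀ : side m₀ ≡ true
      side₀ = Boolₚ.¬-not λ q → contradiction (trans (sym (side-u true)) (side-stable q (conn (u false) (u true)) (side-u false))) λ ()

      pow-side : ∀ m v → side v ≡ false → side (act v (y ↑ m)) ≡ false
      pow-side zero v q = subst (λ w → side w ≡ false) (sym (act-ε v)) q
      pow-side (suc m) v q = subst (λ w → side w ≡ false) (sym (act-∙ v y (y ↑ m))) (pow-side m (act v y) (side-y v q))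

      y-side₁ : ∀ v → side (act v y) ≡ false → side v ≡ false
      y-side₁ v q = undo (finite-order y)
        where
        undo : ∃[ m ] (0 < m × y ↑ m ≡ e) → side v ≡ false
        undo (suc m , _ , r) = subst (λ w → side w ≡ false) (trans (sym (act-∙ v y (y ↑ m))) (trans (cong (act v) r) (act-ε v))) (pow-side m (act v y) q)

      side₁ : side m₁ ≡ true
      side₁ = Boolₚ.¬-not λ q → contradiction (trans (sym (y-side₁ m₀ (trans (cong side y₀) q))) side₀) λ ()

      side₂ : side m₂ ≡ true
      side₂ = Boolₚ.¬-not λ q → contradiction (trans (sym (y-side₁ m₁ (trans (cong side y₁) q))) side₁) λ ()

      from-m₀ : ∀ v → side v ≡ true → ∃[ h ] act m₀ (ι h) ≡ v
      from-m₀ v s = hc m₀ ℍ.⁻ ℍ.· hc v , trans (act-ι-∙ m₀ (hc m₀ ℍ.⁻) (hc v)) (trans (cong (λ w → act w (ι (hc v))) (act-ι-⁻ (hc m₀) (trans (cong (λ i → act (u i) (ι (hc m₀))) (sym side₀)) (hc-eq m₀))))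
        (trans (cong (λ i → act (u i) (ι (hc v))) (sym s)) (hc-eq v)))

      a b : Carrier H
      a = proj₁ (from-m₀ m₁ side₁)
      b = proj₁ (from-m₀ m₂ side₂)
      am : act m₀ (ι a) ≡ m₁
      am = proj₂ (from-m₀ m₁ side₁)
      bm : act m₀ (ι b) ≡ m₂
      bm = proj₂ (from-m₀ m₂ side₂)

      -- The second orbit is based at the neighbour `m₀` instead of `u true`, which makes the
      -- identity one of the three colours.
      base : Bool → V
      base false = u false
      base true = m₀

      vtx : Bool → Carrier H → V
      vtx i h = act (base i) (ι h)

      side-vtx : ∀ i h → side (vtx i h) ≡ i
      side-vtx false h = proj₁ (coord-of false h refl)
      side-vtx true h = proj₁ (coord-of true (hc m₀ ℍ.· h) (trans (act-ι-∙ (u true) (hc m₀) h) (cong (λ w → act w (ι h)) (trans (cong (λ i → act (u i) (ι (hc m₀))) (sym side₀)) (hc-eq m₀)))))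

      regular : ∀ v h k → act v (ι h) ≡ act v (ι k) → h ≡ k
      regular v h k q = trans (ℍ.group (h ∷ k ∷ []) ℍ.v0 (ℍ.v0 ℍ.⊗ ℍ.v1 ℍ.⊖ ℍ.⊗ ℍ.v1) refl) (trans (cong (ℍ._· k) (semireg _ v (trans (act-ι-∙ v h _) (act-ι-⁻ k (sym q))))) (ℍ.identityˡ k))

      vtx-inj : ∀ {i j h k} → vtx i h ≡ vtx j k → i ≡ j × h ≡ k
      vtx-inj {i} {j} {h} {k} q = i≡j , same i≡j q
        where
        i≡j = trans (sym (side-vtx i h)) (trans (cong side q) (side-vtx j k))
        same : i ≡ j → vtx i h ≡ vtx j k → h ≡ k
        same refl q = regular (base i) h k q

      vtx-surj : ∀ v → ∃[ i ] ∃[ h ] vtx i h ≡ v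
      vtx-surj v = cases (side v) refl
        where
        cases : ∀ i → side v ≡ i → ∃[ i ] ∃[ h ] vtx i h ≡ v
        cases false q = false , hc v , trans (cong (λ i → act (u i) (ι (hc v))) (sym q)) (hc-eq v)
        cases true q = true , from-m₀ v q

      vtx-ρ : ∀ i h k → ρ A k (vtx i h) ≡ vtx i (h ℍ.· k)
      vtx-ρ i h k = trans (sym (ι-act k _)) (sym (act-ι-∙ (base i) h k))

      col : Fin 3 → Carrier H
      col = colour H a b

      colour-mm : ∀ c → act m₀ (ι (col c)) ≡ mm c
      colour-mm zero = trans (cong (act m₀) ι-e) (act-ε m₀)
      colour-mm (suc zero) = am
      colour-mm (suc (suc zero)) = bm

      colour-inj : ∀ {c d} → col c ≡ col d → c ≡ d
      colour-inj {c} {d} q = mm-inj (trans (sym (colour-mm c)) (trans (cong (λ x → act m₀ (ι x)) q) (colour-mm d)))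

      edge₀ : ∀ h c → vtx false h ~ vtx true (col c ℍ.· h)
      edge₀ h c = subst (vtx false h ~_) (trans (cong (λ w → act w (ι h)) (sym (colour-mm c))) (sym (act-ι-∙ m₀ (col c) h))) (~-act (ι h) (u~mm c))

      edge-only₀ : ∀ h w → vtx false h ~ w → ∃[ c ] w ≡ vtx true (col c ℍ.· h)
      edge-only₀ h w vw = conv (only (act w (ι h ⁻)) (subst (_~ act w (ι h ⁻)) (act-inv (ι h) refl) (~-act (ι h ⁻) vw)))
        where
        forth : ∀ c → act w (ι h ⁻) ≡ mm c → w ≡ vtx true (col c ℍ.· h)
        forth c q = trans (sym (trans (sym (act-∙ w (ι h ⁻) (ι h))) (trans (cong (act w) (inverseˡ (ι h))) (act-ε w))))
          (trans (cong (λ v → act v (ι h)) (trans q (sym (colour-mm c)))) (sym (act-ι-∙ m₀ (col c) h)))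
        conv : act w (ι h ⁻) ≡ m₀ ⊎ act w (ι h ⁻) ≡ m₁ ⊎ act w (ι h ⁻) ≡ m₂ → ∃[ c ] w ≡ vtx true (col c ℍ.· h)
        conv (inj₁ q) = zero , forth zero q
        conv (inj₂ (inj₁ q)) = suc zero , forth (suc zero) q
        conv (inj₂ (inj₂ q)) = suc (suc zero) , forth (suc (suc zero)) q

      edge₁ : ∀ h c → vtx true h ~ vtx false (col c ℍ.⁻ ℍ.· h)
      edge₁ h c = ~-sym (subst (λ x → vtx false (col c ℍ.⁻ ℍ.· h) ~ vtx true x) (ℍ.cancelʳ (col c) h) (edge₀ _ c))

      -- The three translates of the base edges already give all three neighbours.
      edge-only₁ : ∀ h w → vtx true h ~ w → ∃[ c ] w ≡ vtx false (col c ℍ.⁻ ℍ.· h)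
      edge-only₁ h w vw = conv (any? λ c → w ≟ nb c)
        where
        nb : Fin 3 → V
        nb c = vtx false (col c ℍ.⁻ ℍ.· h)
        nb-inj : ∀ {c d} → nb c ≡ nb d → c ≡ d
        nb-inj {c} {d} q = colour-inj (trans (sym (ℍ.inv-inv _)) (trans (cong ℍ._⁻ (ℍ.·-cancelʳ h (proj₂ (vtx-inj {false} {false} q)))) (ℍ.inv-inv _)))
        conv : Dec (∃[ c ] w ≡ nb c) → ∃[ c ] w ≡ nb c
        conv (yes q) = q
        conv (no q) = contradiction (≤-trans (≤-reflexive (sym total)) (≤-trans (sum-mono pt) (≤-reflexive (degree-card (vtx true h))))) λ { (s≤s (s≤s (s≤s ()))) }
          where
          total : sum (λ z → hits nb z + δ w z) ≡ 4
          total = trans (sum-+ (hits nb) (δ w)) (cong₂ _+_ (trans (sum-cong λ z → sym (*-identityʳ (hits nb z))) (trans (sum-hits nb (λ _ → 1)) (sum-const 3 1))) (sum-δ1 w))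
          pt : ∀ z → hits nb z + δ w z ≤ ⟦ adj Γ (vtx true h) z ⟧
          pt z with hits-pos nb z
          ... | inj₂ (c , refl) = ≤-reflexive (trans (cong₂ _+_ (hits-1 nb (nb-inj) c) (δ-≢ λ r → q (c , r))) (cong ⟦_⟧ (sym (edge₁ h c))))
          ... | inj₁ r rewrite r with w ≟ z
          ...   | yes refl = ≤-reflexive (cong ⟦_⟧ (sym vw))
          ...   | no _ = z≤n

      αvtx : ∀ h → act (vtx true h) y ≡ vtx true (a ℍ.· α h)
      αvtx h = trans (αy m₀ h) (trans (cong (λ w → act w (ι (α h))) (trans y₀ (sym am))) (sym (act-ι-∙ m₀ a (α h))))

    haar : HaarGraph H Γ A
    haar = record
      { vtx = vtx ; vtx-inj = vtx-inj ; vtx-surj = vtx-surj ; vtx-ρ = vtx-ρ ; a = a ; b = b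
      ; colour-inj = colour-inj
      ; edge = λ { false → edge₀ ; true → edge₁ }
      ; edge-only = λ { false → edge-only₀ ; true → edge-only₁ }
      ; α = α ; α-∙ = α-∙
      -- The rotation sends `vtx true h` to `vtx true (a · α h)`. It takes `m₁` to `m₂` and `m₂` to
      -- `m₀`, that is, a · α a = b and a · α b = 1.
      ; α-a = ℍ.·-cancelˡ a (trans (regular m₀ _ _ (trans (sym (αvtx a)) (trans (cong (λ w → act w y) am) (trans y₁ (sym bm))))) (sym (ℍ.cancelʳ a b)))
      ; α-b = ℍ.inv-unique a _ (regular m₀ _ _ (trans (sym (αvtx b)) (trans (cong (λ w → act w y) bm) (trans y₂ (sym (trans (cong (act m₀) ι-e) (act-ε m₀))))))) }

  haarGraph : HaarGraph H Γ A
  haarGraph with three-elements (adj Γ (u false)) (degree-card (u false))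
  ... | m₀ , m₁ , m₂ , a₀ , a₁ , a₂ , n₀₁ , n₀₂ , n₁₂ , only = Three.haar a₀ a₁ a₂ n₀₁ n₀₂ n₁₂ only

-- Closed walks determine the colours

-- The word may follow an edge of colour `c` without backtracking. Repeating a colour is
-- backtracking, because each colour acts on the vertices as an involution. The empty word gets a
-- trivially true condition.
Reduced : Fin 3 → List (Fin 3) → Set
Reduced c [] = c ≡ c
Reduced c (d ∷ w) = d ≢ c × Reduced d w

others : Fin 3 → List (Fin 3)
others 0F = 1F ∷ 2F ∷ []
others 1F = 0F ∷ 2F ∷ []
others 2F = 0F ∷ 1F ∷ []

others-complete : ∀ c d → d ≢ c → d ∈ others c
others-complete 0F 0F h = contradiction refl h
others-complete 0F 1F h = here refl
others-complete 0F 2F h = there (here refl)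
others-complete 1F 0F h = here refl
others-complete 1F 1F h = contradiction refl h
others-complete 1F 2F h = there (here refl)
others-complete 2F 0F h = here refl
others-complete 2F 1F h = there (here refl)
others-complete 2F 2F h = contradiction refl h

reduced : ℕ → Fin 3 → List (List (Fin 3))
reduced zero c = [] ∷ []
reduced (suc m) c = List.concatMap (λ d → List.map (d ∷_) (reduced m d)) (others c)

reduced-complete : ∀ m c w → Reduced c w → List.length w ≡ m → w ∈ reduced m c
reduced-complete zero c [] _ _ = here refl
reduced-complete (suc m) c (d ∷ w) (d≢c , r) q =
  ∈ₚ.∈-concatMap⁺ (λ d → List.map (d ∷_) (reduced m d)) (Any-map (others-complete c d d≢c))
  where
  Any-map : ∀ {ds} → d ∈ ds → Any (λ d' → (d ∷ w) ∈ List.map (d' ∷_) (reduced m d')) ds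
  Any-map (here refl) = here (∈ₚ.∈-map⁺ (d ∷_) (reduced-complete m d w r (suc-injectiveℕ q)))
    where
    suc-injectiveℕ : ∀ {x y} → suc x ≡ suc y → x ≡ y
    suc-injectiveℕ refl = refl
  Any-map (there h) = there (Any-map h)

lookup-index : ∀ {X : Set} {x : X} {xs} (m : x ∈ xs) → List.lookup xs (index m) ≡ x
lookup-index (here refl) = refl
lookup-index (there m) = lookup-index m

overfull : ∀ {X : Set} {xs : List X} {m} → List.length xs < m → (f : Fin m → X) → (∀ {i j} → f i ≡ f j → i ≡ j) → ¬ (∀ i → f i ∈ xs)
overfull {xs = xs} lt f inj mem with pigeonhole lt (λ i → index (mem i))
... | i , j , i<j , q = <-irrefl (cong toℕ (inj (trans (sym (lookup-index (mem i))) (trans (cong (List.lookup xs) q) (lookup-index (mem j)))))) i<j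

module Colours (H : FiniteGroup) (Γ : Graph) (A : BiCayleyAction H Γ) (conn : Connected Γ) (haar : HaarGraph H Γ A) where
  open Grp H
  open HaarGraph haar

  State : Set
  State = Bool × Carrier H

  at : State → Fin (n Γ)
  at (i , h) = vtx i h

  nb : Fin 3 → State → State
  nb c (i , h) = not i , next H a b c i h

  walk : List (Fin 3) → State → State
  walk [] s = s
  walk (c ∷ w) s = walk w (nb c s)

  at-inj : ∀ {s t} → at s ≡ at t → s ≡ t
  at-inj {i , h} {j , k} q with vtx-inj q
  ... | refl , refl = refl

  next-inj : ∀ i {c d h} → next H a b c i h ≡ next H a b d i h → c ≡ d
  next-inj false {h = h} q = colour-inj (·-cancelʳ h q)
  next-inj true {h = h} q = colour-inj (trans (sym (inv-inv _)) (trans (cong _⁻ (·-cancelʳ h q)) (inv-inv _)))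

  nb-inj : ∀ s {c d} → nb c s ≡ nb d s → c ≡ d
  nb-inj (i , h) q = next-inj i (cong proj₂ q)

  nb-nb : ∀ c s → nb c (nb c s) ≡ s
  nb-nb c (false , h) = cong (false ,_) (cancelˡ _ h)
  nb-nb c (true , h) = cong (true ,_) (cancelʳ _ h)

  Γ-induction : (P : State → Set) (s₀ : State) → P s₀ → (∀ s c → P s → P (nb c s)) → ∀ s → P s
  Γ-induction P s₀ p₀ ps s = along (conn (at s₀) (at s)) s₀ refl p₀ s refl
    where
    along : ∀ {v w} → Walk Γ v w → ∀ t → at t ≡ v → P t → ∀ s → at s ≡ w → P s
    along here t q pt s r = subst P (at-inj (trans q (sym r))) pt
    along (step {x} {y} xy wk) t@(i , h) q pt s r with edge-only i h y (trans (cong (λ v → adj Γ v y) q) xy)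
    ... | c , q' = along wk (nb c t) (sym q') (ps t c pt) s r

  -- Steps along edges multiply by the colours and their inverses, so connectedness says that `a`
  -- and `b` generate H.
  H-induction : (P : Carrier H → Set) → P e → (∀ c h → P h → P (colour H a b c · h)) → (∀ c h → P h → P (colour H a b c ⁻ · h)) → ∀ h → P h
  H-induction P pe ps ps⁻ h = Γ-induction (P ∘ proj₂) (false , e) pe (λ { (false , k) c q → ps c k q ; (true , k) c q → ps⁻ c k q }) (false , h)

  module _ (σ : Aut Γ) where
    private
      module σ = Iso {Γ} {Γ} σ

    φ : State → State
    φ s = let i , h , _ = vtx-surj (σ.to (at s)) in i , h

    at-φ : ∀ s → at (φ s) ≡ σ.to (at s)
    at-φ s = proj₂ (proj₂ (vtx-surj (σ.to (at s))))

    φ-inj : ∀ {s t} → φ s ≡ φ t → s ≡ t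
    φ-inj {s} {t} q = at-inj (trans (sym (σ.from∘to (at s))) (trans (cong σ.from (trans (sym (at-φ s)) (trans (cong at q) (at-φ t)))) (σ.from∘to (at t))))

    opaque
      φ-edge : ∀ s c → ∃[ d ] φ (nb c s) ≡ nb d (φ s)
      φ-edge s@(i , h) c with edge-only (proj₁ (φ s)) (proj₂ (φ s)) (σ.to (at (nb c s)))
        (trans (cong (λ v → adj Γ v (σ.to (at (nb c s)))) (at-φ s)) (trans (σ.adj-pres _ _) (edge i h c)))
      ... | d , q = d , at-inj (trans (at-φ (nb c s)) q)

    -- The permutation of colours that σ induces on the edges at `s`. Normality of H will follow
    -- once it is independent of `s`.
    π : State → Fin 3 → Fin 3
    π s c = proj₁ (φ-edge s c)

    φ-nb : ∀ s c → φ (nb c s) ≡ nb (π s c) (φ s)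
    φ-nb s c = proj₂ (φ-edge s c)

    π-inj : ∀ s {c d} → π s c ≡ π s d → c ≡ d
    π-inj s {c} {d} q = nb-inj s (φ-inj (trans (φ-nb s c) (trans (cong (λ x → nb x (φ s)) q) (sym (φ-nb s d)))))

    π-same : ∀ s c → π (nb c s) c ≡ π s c
    π-same s c = nb-inj (nb (π s c) (φ s)) (trans (cong (nb (π (nb c s) c)) (sym (φ-nb s c))) (trans (sym (φ-nb (nb c s) c)) (trans (cong φ (nb-nb c s)) (sym (nb-nb (π s c) (φ s))))))

    image : State → List (Fin 3) → List (Fin 3)
    image s [] = []
    image s (c ∷ w) = π s c ∷ image (nb c s) w

    image-inj : ∀ s w w' → image s w ≡ image s w' → w ≡ w'
    image-inj s [] [] _ = refl
    image-inj s (c ∷ w) (d ∷ w') q with π-inj s (Listₚ.∷-injectiveˡ q)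
    ... | refl = cong (c ∷_) (image-inj (nb c s) w w' (Listₚ.∷-injectiveʳ q))

    image-length : ∀ s w → List.length (image s w) ≡ List.length w
    image-length s [] = refl
    image-length s (c ∷ w) = cong suc (image-length (nb c s) w)

    image-walk : ∀ s w → walk (image s w) (φ s) ≡ φ (walk w s)
    image-walk s [] = refl
    image-walk s (c ∷ w) = trans (cong (walk (image (nb c s) w)) (sym (φ-nb s c))) (image-walk (nb c s) w)

    image-reduced : ∀ s c w → Reduced c w → Reduced (π s c) (image (nb c s) w)
    image-reduced s c [] _ = refl
    image-reduced s c (d ∷ w) (d≢c , r) = (λ q → d≢c (π-inj (nb c s) (trans q (sym (π-same s c))))) , image-reduced (nb c s) d w r

  -- A colour triple is straight if its outer colours agree; the number of closed walks through a
  -- 3-path distinguishes straight from bent paths.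
  record Separation : Set where
    field
      tail   : ℕ
      bound  : ℕ
      inner  : Bool → Fin 3 → Fin 3 → List (List (Fin 3))
      inner-bound : ∀ i c d → c ≢ d → List.length (inner i c d) ≤ bound
      inner-complete : ∀ i h c d w → c ≢ d → Reduced c w → List.length w ≡ tail → walk (c ∷ d ∷ c ∷ w) (i , h) ≡ (i , h) → w ∈ inner i c d
      outer  : Bool → (c d f : Fin 3) → c ≢ d → d ≢ f → c ≢ f → Fin (suc bound) → List (Fin 3)
      outer-inj : ∀ i c d f p q r {x y} → outer i c d f p q r x ≡ outer i c d f p q r y → x ≡ y
      outer-length : ∀ i c d f p q r x → List.length (outer i c d f p q r x) ≡ tail
      outer-reduced : ∀ i c d f p q r x → Reduced f (outer i c d f p q r x)
      outer-closed : ∀ i h c d f p q r x → walk (c ∷ d ∷ f ∷ outer i c d f p q r x) (i , h) ≡ (i , h)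

  module _ (sep : Separation) where
    open Separation sep

    -- If a bent path had a straight image, its more than `bound` closed walks would map injectively
    -- to closed walks through a straight path, of which there are at most `bound`.
    bent : ∀ σ s c d f → c ≢ d → d ≢ f → c ≢ f → π σ (nb d (nb c s)) f ≢ π σ s c
    bent σ s@(i , h) c d f c≢d d≢f c≢f q = overfull {xs = inner i' c' d'} (s≤s (inner-bound i' c' d' c'≢d')) img img-inj mem
      where
      i' = proj₁ (φ σ s)
      h' = proj₂ (φ σ s)
      c' = π σ s c
      d' = π σ (nb c s) d
      s₃ = nb f (nb d (nb c s))
      c'≢d' : c' ≢ d'
      c'≢d' r = c≢d (π-inj σ (nb c s) (trans (π-same σ s c) r))
      tl : Fin (suc bound) → List (Fin 3)
      tl = outer i c d f c≢d d≢f c≢f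
      img : Fin (suc bound) → List (Fin 3)
      img x = image σ s₃ (tl x)
      img-inj : ∀ {x y} → img x ≡ img y → x ≡ y
      img-inj {x} {y} r = outer-inj i c d f c≢d d≢f c≢f (image-inj σ s₃ (tl x) (tl y) r)
      mem : ∀ x → img x ∈ inner i' c' d'
      mem x = inner-complete i' h' c' d' (img x) c'≢d'
        (subst (λ t → Reduced t (img x)) q (image-reduced σ (nb d (nb c s)) f (tl x) (outer-reduced i c d f c≢d d≢f c≢f x)))
        (trans (image-length σ s₃ (tl x)) (outer-length i c d f c≢d d≢f c≢f x))
        (trans (cong (λ t → walk (c' ∷ d' ∷ t ∷ img x) (φ σ s)) (sym q)) (trans (image-walk σ s (c ∷ d ∷ f ∷ tl x)) (cong (φ σ) (outer-closed i h c d f c≢d d≢f c≢f x))))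

    -- After the colours `c`, `d` a path continues with `c` or with the third colour `f`. By `bent`
    -- the second continuation does not have a straight image; if the first had none either, four
    -- distinct colours would occur.
    straight : ∀ σ s c d → c ≢ d → π σ (nb d (nb c s)) c ≡ π σ s c
    straight σ s c d c≢d = cases (π σ (nb d (nb c s)) c ≟ π σ s c)
      where
      s' = nb d (nb c s)
      f = third c d c≢d
        where
        third : ∀ c d → c ≢ d → ∃[ f ] (d ≢ f × c ≢ f × (∀ x → x ≢ d → x ≡ c ⊎ x ≡ f))
        third 0F 0F h = contradiction refl h
        third 0F 1F h = 2F , (λ ()) , (λ ()) , λ { 0F _ → inj₁ refl ; 1F h → contradiction refl h ; 2F _ → inj₂ refl }
        third 0F 2F h = 1F , (λ ()) , (λ ()) , λ { 0F _ → inj₁ refl ; 2F h → contradiction refl h ; 1F _ → inj₂ refl }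
        third 1F 0F h = 2F , (λ ()) , (λ ()) , λ { 1F _ → inj₁ refl ; 0F h → contradiction refl h ; 2F _ → inj₂ refl }
        third 1F 1F h = contradiction refl h
        third 1F 2F h = 0F , (λ ()) , (λ ()) , λ { 1F _ → inj₁ refl ; 2F h → contradiction refl h ; 0F _ → inj₂ refl }
        third 2F 0F h = 1F , (λ ()) , (λ ()) , λ { 2F _ → inj₁ refl ; 0F h → contradiction refl h ; 1F _ → inj₂ refl }
        third 2F 1F h = 0F , (λ ()) , (λ ()) , λ { 2F _ → inj₁ refl ; 1F h → contradiction refl h ; 0F _ → inj₂ refl }
        third 2F 2F h = contradiction refl h
      cases : Dec (π σ s' c ≡ π σ s c) → π σ s' c ≡ π σ s c
      cases (yes q) = q
      cases (no q) = ⊥-elim (full (π σ s c) (π σ (nb c s) d) (π σ s' c) (π σ s' (proj₁ f))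
        (λ r → c≢d (π-inj σ (nb c s) (trans (π-same σ s c) r))) (q ∘ sym)
        (λ r → bent σ s c d (proj₁ f) c≢d (proj₁ (proj₂ f)) (proj₁ (proj₂ (proj₂ f))) (sym r))
        (λ r → c≢d (sym (π-inj σ s' (trans (π-same σ (nb c s) d) r))))
        (λ r → proj₁ (proj₂ f) (π-inj σ s' (trans (π-same σ (nb c s) d) r)))
        (λ r → proj₁ (proj₂ (proj₂ f)) (π-inj σ s' r)))
        where
        full : ∀ (x y z w : Fin 3) → x ≢ y → x ≢ z → x ≢ w → y ≢ z → y ≢ w → z ≢ w → ⊥
        full x y z w xy xz xw yz yw zw with pigeonhole ≤-refl (λ (k : Fin 4) → pickᵥ k)
          where
          pickᵥ : Fin 4 → Fin 3
          pickᵥ 0F = x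
          pickᵥ 1F = y
          pickᵥ 2F = z
          pickᵥ (suc 2F) = w
        ... | 0F , 1F , _ , r = xy r
        ... | 0F , 2F , _ , r = xz r
        ... | 0F , suc 2F , _ , r = xw r
        ... | 1F , 2F , _ , r = yz r
        ... | 1F , suc 2F , _ , r = yw r
        ... | 2F , suc 2F , _ , r = zw r
        ... | 1F , 1F , s≤s () , r
        ... | 2F , 1F , s≤s () , r
        ... | 2F , 2F , s≤s (s≤s ()) , r
        ... | suc 2F , 1F , s≤s () , r
        ... | suc 2F , 2F , s≤s (s≤s ()) , r
        ... | suc 2F , suc 2F , s≤s (s≤s (s≤s ())) , r

    -- `straight`, begun one step back along `c`, compares the edges of colour `c` at the two ends
    -- of an edge of colour `d`.
    π-const : ∀ σ s d c → π σ (nb d s) c ≡ π σ s c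
    π-const σ s d c with c ≟ d
    ... | yes refl = π-same σ s c
    ... | no c≢d = trans (cong (λ t → π σ (nb d t) c) (sym (nb-nb c s))) (trans (straight σ (nb c s) c d c≢d) (π-same σ s c))

    translate : Carrier H → State → State
    translate k (i , h) = i , h · k

    translate-nb : ∀ k c s → translate k (nb c s) ≡ nb c (translate k s)
    translate-nb k c (false , h) = cong (true ,_) (assoc _ _ _)
    translate-nb k c (true , h) = cong (false ,_) (assoc _ _ _)

    -- As σ permutes the colours in the same way everywhere, it conjugates a translation to a map
    -- that preserves sides and colours. Such a map of a connected graph is the translation
    -- determined by its effect on one vertex.
    normal : NormalBiCayley A
    normal σ h = h' , λ v → at-vertex v (vtx-surj v)
      where
      s₀ : State
      s₀ = false , e
      side-shift : ∀ s → proj₁ (φ σ (translate h s)) ≡ proj₁ (φ σ s)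
      side-shift s = trans (parity (translate h s)) (sym (parity s))
        where
        xor-not : ∀ x y → _xor_ x (not y) ≡ not (_xor_ x y)
        xor-not true y = refl
        xor-not false y = refl
        parity : ∀ s → proj₁ (φ σ s) ≡ _xor_ (proj₁ (φ σ s₀)) (proj₁ s)
        parity = Γ-induction _ s₀ (sym (Boolₚ.xor-identityʳ _)) λ s c q →
          trans (cong proj₁ (φ-nb σ s c)) (trans (cong not q) (sym (xor-not (proj₁ (φ σ s₀)) (proj₁ s))))
      h' : Carrier H
      h' = proj₂ (φ σ s₀) ⁻ · proj₂ (φ σ (translate h s₀))
      intertwine : ∀ s → φ σ (translate h s) ≡ translate h' (φ σ s)
      intertwine = Γ-induction _ s₀ (cong₂ _,_ (side-shift s₀) (sym (cancelʳ _ _))) λ s c q → begin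
        φ σ (translate h (nb c s)) ≡⟨ cong (φ σ) (translate-nb h c s) ⟩
        φ σ (nb c (translate h s)) ≡⟨ φ-nb σ (translate h s) c ⟩
        nb (π σ (translate h s) c) (φ σ (translate h s)) ≡⟨ cong₂ nb (trans (π-all (translate h s) c) (sym (π-all s c))) q ⟩
        nb (π σ s c) (translate h' (φ σ s)) ≡⟨ sym (translate-nb h' (π σ s c) (φ σ s)) ⟩
        translate h' (nb (π σ s c) (φ σ s)) ≡⟨ cong (translate h') (sym (φ-nb σ s c)) ⟩
        translate h' (φ σ (nb c s)) ∎
        where
        open ≡-Reasoning
        π-all : ∀ s c → π σ s c ≡ π σ s₀ c
        π-all s c = Γ-induction (λ s → π σ s c ≡ π σ s₀ c) s₀ refl (λ s d q → trans (π-const σ s d c) q) s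
      at-vertex : ∀ v → ∃[ i ] ∃[ k ] vtx i k ≡ v → Iso.to σ (ρ A h v) ≡ ρ A h' (Iso.to σ v)
      at-vertex v (i , k , refl) = trans (cong (Iso.to σ) (vtx-ρ i k h)) (trans (sym (at-φ σ (i , k · h))) (trans (cong at (intertwine (i , k)))
        (trans (sym (vtx-ρ _ _ h')) (cong (ρ A h') (at-φ σ (i , k))))))

-- The commutator of the two generators

module Commutator (pp : Prime 3) (H : FiniteGroup) (pg : IsPGroup 3 H) (nonabelian : NonAbelian H)
    (Γ : Graph) (A : BiCayleyAction H Γ) (conn : Connected Γ) (haar : HaarGraph H Γ A)
    (g b₀ : Carrier H) (N : Metacyclics.Normal 3 pp H pg g) (G : Metacyclics.Generate 3 pp H pg g b₀) where
  open Metacyclics 3 pp H pg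
  open HaarGraph haar public
  open Colours H Γ A conn haar public using (H-induction)

  z : Carrier H
  z = a · b ⁻ · a ⁻ · b

  private
    -- The automorphism α permutes `a`, `x₁` and `b ⁻` cyclically, and their product in this order
    -- is 1. Statements about `a` are carried over to the other two in this way.
    x₁ : Carrier H
    x₁ = a ⁻ · b

    module Mg = Mod g N

  -- Modulo ⟨g⟩ the group is cyclic, hence abelian, and `z` is a commutator.
  z∈g : z ∈⟨ g ⟩
  z∈g = subst (_∈⟨ g ⟩) (group (a ∷ b ∷ []) (v0 ⊗ v1 ⊖ ⊗ (v1 ⊖ ⊗ v0) ⊖) (v0 ⊗ v1 ⊖ ⊗ v0 ⊖ ⊗ v1) refl)
    (Mg.≋⇒∈ (Mg.≋-abelian G (Mg.≋-trans (Mg.≋-· Mg.≋-refl g≋e) (Mg.≋-trans (Mg.≋-reflexive (trans (identityʳ _) (sym (identityˡ _)))) (Mg.≋-· (Mg.≋-sym g≋e) Mg.≋-refl))) a (b ⁻)))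
    where
    g≋e : g Mg.≋ e
    g≋e = Mg.∈⇒≋e (1 , sym (↑-1 g))

  Nz : Normal z
  Nz x with z∈g
  ... | k , q with Normal-↑ N k x
  ...   | j , r = j , trans (cong (conj x) q) (trans r (cong (_↑ j) (sym q)))

  module Mz = Mod z Nz

  -- Whatever identifies a b with b a makes H abelian, since a and b generate.
  abelian-mod : ∀ ζ (Nζ : Normal ζ) → (let open Mod ζ Nζ) → a · b ≋ b · a → ∀ x y → x · y ≋ y · x
  abelian-mod ζ Nζ ab x y = H-induction (λ x → x · y ≋ y · x) (≋-reflexive (trans (identityˡ y) (sym (identityʳ y))))
      (λ c h q → push (gen c y) q) (λ c h q → push (inverse (gen c y)) q) x
    where
    open Mod ζ Nζ
    push : ∀ {c h y} → c · y ≋ y · c → h · y ≋ y · h → (c · h) · y ≋ y · (c · h)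
    push {c} {h} {y} p q = ≋-trans (≋-reflexive (assoc c h y)) (≋-trans (≋-· ≋-refl q) (≋-trans (≋-reflexive (sym (assoc c y h))) (≋-trans (≋-· p ≋-refl) (≋-reflexive (assoc y c h)))))
    inverse : ∀ {c y} → c · y ≋ y · c → c ⁻ · y ≋ y · c ⁻
    inverse {c} {y} p = ≋-trans (≋-reflexive (group (c ∷ y ∷ []) (v0 ⊖ ⊗ v1) (v0 ⊖ ⊗ (v1 ⊗ v0) ⊗ v0 ⊖) refl)) (≋-trans (≋-· (≋-· ≋-refl (≋-sym p)) ≋-refl)
      (≋-reflexive (group (c ∷ y ∷ []) (v0 ⊖ ⊗ (v0 ⊗ v1) ⊗ v0 ⊖) (v1 ⊗ v0 ⊖) refl)))
    with-b : ∀ c → b · colour H a b c ≋ colour H a b c · b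
    with-b 0F = ≋-reflexive (trans (identityʳ b) (sym (identityˡ b)))
    with-b 1F = ≋-sym ab
    with-b 2F = ≋-refl
    with-a : ∀ c → a · colour H a b c ≋ colour H a b c · a
    with-a 0F = ≋-reflexive (trans (identityʳ a) (sym (identityˡ a)))
    with-a 1F = ≋-refl
    with-a 2F = ab
    gen : ∀ c y → colour H a b c · y ≋ y · colour H a b c
    gen c y = H-induction (λ y → colour H a b c · y ≋ y · colour H a b c) (≋-reflexive (trans (identityʳ _) (sym (identityˡ _))))
      (λ d h q → ≋-sym (push (≋-sym (both c d)) (≋-sym q))) (λ d h q → ≋-sym (push (inverse (≋-sym (both c d))) (≋-sym q))) y
      where
      both : ∀ c d → colour H a b c · colour H a b d ≋ colour H a b d · colour H a b c
      both 0F d = ≋-reflexive (trans (identityˡ _) (sym (identityʳ _)))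
      both 1F d = with-a d
      both 2F d = with-b d

  ab-mod : ∀ ζ (Nζ : Normal ζ) → z ∈⟨ ζ ⟩ → (let open Mod ζ Nζ) → a · b ≋ b · a
  ab-mod ζ Nζ m = ≋-sym (≋-trans (≋-reflexive (group (a ∷ b ∷ []) (v1 ⊗ v0) (v1 ⊗ (v0 ⊗ v1 ⊖ ⊗ v0 ⊖ ⊗ v1 ⊗ (v1 ⊖ ⊗ v0)) ⊗ v1) refl))
    (≋-trans (≋-· (≋-· ≋-refl (≋-· (∈⇒≋e m) ≋-refl)) ≋-refl) (≋-reflexive (group (a ∷ b ∷ []) (v1 ⊗ (one ⊗ (v1 ⊖ ⊗ v0)) ⊗ v1) (v0 ⊗ v1) refl))))
    where open Mod ζ Nζ

  z∈⇒abelian : ∀ ζ (Nζ : Normal ζ) → z ∈⟨ ζ ⟩ → (let open Mod ζ Nζ) → ∀ x y → x · y ≋ y · x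
  z∈⇒abelian ζ Nζ m = abelian-mod ζ Nζ (ab-mod ζ Nζ m)

  z≢e : z ≢ e
  z≢e q = proj₂ (proj₂ nonabelian) (trivial (≋⇒∈ (z∈⇒abelian e Normal-e (0 , q) _ _)))
    where
    open Mod e Normal-e
    trivial : ∀ {x y} → x · y ⁻ ∈⟨ e ⟩ → x ≡ y
    trivial {x} {y} (k , r) = ·-cancelʳ (y ⁻) (trans r (trans (e-↑ k) (sym (inverseʳ y))))

  private
    module M³ = Mod (z ↑ 3) (Normal-↑ Nz 3)

  z-central-mod³ : ∀ x → x · z M³.≋ z · x
  z-central-mod³ x with conj-unipotent x z (proj₁ (Nz x)) (proj₂ (Nz x))
  ... | l , q = M³.≋-trans (M³.≋-reflexive (trans (group (x ∷ z ∷ []) (v0 ⊗ v1) (v0 ⊗ v1 ⊗ v0 ⊖ ⊗ v0) refl) (cong (_· x) q)))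
    (M³.≋-· (M³.≋-trans (M³.≋-· M³.≋-refl (M³.∈⇒≋e (l , ↑-*′ z l 3))) (M³.≋-reflexive (identityʳ z))) M³.≋-refl)

  z∉z³ : ¬ z ∈⟨ z ↑ 3 ⟩
  z∉z³ (k , q) = 1≉0 (≈-trans (↑-≈ z≢e {1} {3 * k} (trans (↑-1 z) (trans q (sym (↑-* z 3 k))))) (∣⇒≈0 (m∣m*n k)))

  -- Otherwise g would lie in ⟨z⟩, and H would be abelian modulo z³.
  opaque
    z-exponent : ∃[ k ] z ≡ g ↑ (k * 3)
    z-exponent with z∈g
    ... | k , q with 3 ∣? k
    ...   | yes (divides k' refl) = k' , q
    ...   | no d = ⊥-elim (z∉z³ (subst (_∈⟨ z ↑ 3 ⟩) (group (a ∷ b ∷ []) (v0 ⊗ v1 ⊖ ⊗ (v1 ⊖ ⊗ v0) ⊖) (v0 ⊗ v1 ⊖ ⊗ v0 ⊖ ⊗ v1) refl)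
              (M³.≋⇒∈ (M³.≋-abelian G bg a (b ⁻)))))
      where
      rt : ∃[ i' ] ∀ x → (x ↑ k) ↑ i' ≡ x
      rt = root k d
      g≡ : z ↑ proj₁ rt ≡ g
      g≡ = trans (cong (_↑ proj₁ rt) q) (proj₂ rt g)
      bg : b₀ · g M³.≋ g · b₀
      bg = subst (λ t → b₀ · t M³.≋ t · b₀) g≡ (M³.≋-commute-↑ (proj₁ rt) (z-central-mod³ b₀))

  abelian-mod-z : ∀ x y → x · y Mz.≋ y · x
  abelian-mod-z = z∈⇒abelian z Nz (1 , sym (↑-1 z))

  α-e : α e ≡ e
  α-e = ·-cancelˡ (α e) (trans (sym (α-∙ e e)) (trans (cong α (identityˡ e)) (sym (identityʳ _))))

  α-⁻ : ∀ x → α (x ⁻) ≡ α x ⁻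
  α-⁻ x = inv-unique (α x) _ (trans (sym (α-∙ x (x ⁻))) (trans (cong α (inverseʳ x)) α-e))

  α-↑ : ∀ x k → α (x ↑ k) ≡ α x ↑ k
  α-↑ x zero = α-e
  α-↑ x (suc k) = trans (α-∙ x _) (cong (α x ·_) (α-↑ x k))

  α-conj : ∀ x y → α (conj x y) ≡ conj (α x) (α y)
  α-conj x y = trans (α-∙ _ _) (cong₂ _·_ (α-∙ x y) (α-⁻ x))

  α-x₁ : α x₁ ≡ b ⁻
  α-x₁ = trans (α-∙ _ _) (trans (cong₂ _·_ (trans (α-⁻ a) (cong _⁻ α-a)) α-b) (group (a ∷ b ∷ []) ((v0 ⊖ ⊗ v1) ⊖ ⊗ v0 ⊖) (v1 ⊖) refl))

  α-z : α z ≡ conj x₁ z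
  α-z = trans (trans (α-∙ _ _) (cong₂ _·_ (trans (α-∙ _ _) (cong₂ _·_ (trans (α-∙ _ _) (cong₂ _·_ α-a (trans (α-⁻ b) (cong _⁻ α-b)))) (trans (α-⁻ a) (cong _⁻ α-a)))) α-b))
    (group (a ∷ b ∷ []) (v0 ⊖ ⊗ v1 ⊗ v0 ⊖ ⊖ ⊗ (v0 ⊖ ⊗ v1) ⊖ ⊗ v0 ⊖) (v0 ⊖ ⊗ v1 ⊗ (v0 ⊗ v1 ⊖ ⊗ v0 ⊖ ⊗ v1) ⊗ (v0 ⊖ ⊗ v1) ⊖) refl)

  private
    opaque
      unip : ∃[ l ] conj a z ≡ z ↑ (1 + l * 3)
      unip = conj-unipotent a z (proj₁ (Nz a)) (proj₂ (Nz a))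

    l κ : ℕ
    l = proj₁ unip
    κ = 1 + l * 3

    conj-a : conj a z ≡ z ↑ κ
    conj-a = proj₂ unip

    -- Apply α to the equation for `a`, using that α z is `z` conjugated by `x₁`.
    conj-x₁ : conj x₁ z ≡ z ↑ κ
    conj-x₁ = conj-injective x₁ (begin
      conj x₁ (conj x₁ z) ≡⟨ cong₂ conj (sym α-a) (sym α-z) ⟩
      conj (α a) (α z) ≡⟨ sym (α-conj a z) ⟩
      α (conj a z) ≡⟨ cong α conj-a ⟩
      α (z ↑ κ) ≡⟨ α-↑ z κ ⟩
      α z ↑ κ ≡⟨ cong (_↑ κ) α-z ⟩
      conj x₁ z ↑ κ ≡⟨ sym (conj-↑ x₁ z κ) ⟩
      conj x₁ (z ↑ κ) ∎)
      where open ≡-Reasoning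

    α-z' : α z ≡ z ↑ κ
    α-z' = trans α-z conj-x₁

    conj-b⁻ : conj (b ⁻) z ≡ z ↑ κ
    conj-b⁻ = ↑κ-inj (begin
      conj (b ⁻) z ↑ κ ≡⟨ sym (conj-↑ (b ⁻) z κ) ⟩
      conj (b ⁻) (z ↑ κ) ≡⟨ cong₂ conj (sym α-x₁) (sym α-z') ⟩
      conj (α x₁) (α z) ≡⟨ sym (α-conj x₁ z) ⟩
      α (conj x₁ z) ≡⟨ cong α conj-x₁ ⟩
      α (z ↑ κ) ≡⟨ α-↑ z κ ⟩
      α z ↑ κ ≡⟨ cong (_↑ κ) α-z' ⟩
      (z ↑ κ) ↑ κ ∎)
      where
      open ≡-Reasoning
      3∤κ : ¬ 3 ∣ κ
      3∤κ d = p∤1 (∣m+n∣m⇒∣n (subst (3 ∣_) (+-comm 1 (l * 3)) d) (n∣m*n l))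
      ↑κ-inj : ∀ {x y} → x ↑ κ ≡ y ↑ κ → x ≡ y
      ↑κ-inj {x} {y} q = let i , r = root κ 3∤κ in trans (sym (r x)) (trans (cong (_↑ i) q) (r y))

    -- Indeed a · x₁ · b⁻¹ = 1, and the three factors act on z alike.
    κ³ : conj a (conj a (conj a z)) ≡ z
    κ³ = begin
      conj a (conj a (conj a z)) ≡⟨ cong (conj a) (cong (conj a) (trans conj-a (sym conj-b⁻))) ⟩
      conj a (conj a (conj (b ⁻) z)) ≡⟨ cong (conj a) (trans (cong (conj a) conj-b⁻) (trans (conj-↑ a z κ) (trans (cong (_↑ κ) (trans conj-a (sym conj-x₁))) (trans (sym (conj-↑ x₁ z κ)) (cong (conj x₁) (sym conj-b⁻)))))) ⟩
      conj a (conj x₁ (conj (b ⁻) z)) ≡⟨ group (a ∷ b ∷ z ∷ []) (v0 ⊗ (v0 ⊖ ⊗ v1 ⊗ (v1 ⊖ ⊗ v2 ⊗ v1 ⊖ ⊖) ⊗ (v0 ⊖ ⊗ v1) ⊖) ⊗ v0 ⊖) v2 refl ⟩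
      z ∎
      where open ≡-Reasoning

  -- To refute the assumption it is enough that `a` commutes with a power g^n' generating ⟨z⟩. Since
  -- a g a⁻¹ = z^t g for some t, this follows from z^n' = 1. That in turn is extracted from the fact
  -- that `a` commutes with x₁^n', which rests on the symmetry α.
  module NonCentral (nc : conj a z ≢ z) where
    private
      Acts : Carrier H → Set
      Acts h = ∃[ m ] conj h z ≡ conj (a ↑ m) z

      aaa : ∀ x → x ∈⟨ z ⟩ → conj (a ↑ 3) x ≡ x
      aaa x (k , refl) = trans (conj-↑ (a ↑ 3) z k) (cong (_↑ k) (trans (group (a ∷ z ∷ []) (v0 ⊗ (v0 ⊗ (v0 ⊗ one)) ⊗ v1 ⊗ (v0 ⊗ (v0 ⊗ (v0 ⊗ one))) ⊖) (v0 ⊗ (v0 ⊗ (v0 ⊗ v1 ⊗ v0 ⊖) ⊗ v0 ⊖) ⊗ v0 ⊖) refl) κ³))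

      transport : ∀ {c h} → conj c z ≡ conj a z → Acts h → Acts (c · h)
      transport {c} {h} q (m , r) = suc m , trans (conj-conj c h z) (trans (cong (conj c) r) (trans (same (∈-conj Nz (a ↑ m) (1 , sym (↑-1 z)))) (sym (conj-conj a (a ↑ m) z))))
        where
        same : ∀ {x} → x ∈⟨ z ⟩ → conj c x ≡ conj a x
        same (k , refl) = trans (conj-↑ c z k) (trans (cong (_↑ k) q) (sym (conj-↑ a z k)))

      transport⁻ : ∀ {c h} → conj c z ≡ conj a z → Acts h → Acts (c ⁻ · h)
      transport⁻ {c} {h} q (m , r) = suc (suc m) , conj-injective c (trans (sym (conj-conj c (c ⁻ · h) z)) (trans (cong (λ t → conj t z) (cancelʳ c h)) (trans r
        (sym (trans (same (∈-conj Nz (a ↑ suc (suc m)) (1 , sym (↑-1 z)))) (trans (sym (conj-conj a _ z)) (trans (cong (λ t → conj t z) (group (a ∷ a ↑ m ∷ []) (v0 ⊗ (v0 ⊗ (v0 ⊗ v1))) (v0 ⊗ (v0 ⊗ (v0 ⊗ one)) ⊗ v1) refl)) (trans (conj-conj (a ↑ 3) (a ↑ m) z) (aaa _ (∈-conj Nz (a ↑ m) (1 , sym (↑-1 z)))))))))))) 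
        where
        same : ∀ {x} → x ∈⟨ z ⟩ → conj c x ≡ conj a x
        same (k , refl) = trans (conj-↑ c z k) (trans (cong (_↑ k) q) (sym (conj-↑ a z k)))

      acts : ∀ h → Acts h
      acts = H-induction Acts (0 , refl) up down
        where
        b⁻z : conj (b ⁻) z ≡ conj a z
        b⁻z = trans conj-b⁻ (sym conj-a)
        up : ∀ c h → Acts h → Acts (colour H a b c · h)
        up 0F h q = subst Acts (sym (identityˡ h)) q
        up 1F h q = transport refl q
        up 2F h q = subst (λ t → Acts (t · h)) (inv-inv b) (transport⁻ b⁻z q)
        down : ∀ c h → Acts h → Acts (colour H a b c ⁻ · h)
        down 0F h q = subst Acts (sym (trans (cong (_· h) inv-e) (identityˡ h))) q
        down 1F h q = transport⁻ refl q
        down 2F h q = transport b⁻z q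

      cube-acts : ∀ h x → x ∈⟨ z ⟩ → conj (h ↑ 3) x ≡ x
      cube-acts h x (k , refl) = trans (conj-↑ (h ↑ 3) z k) (cong (_↑ k) (trans (unfold h) (trans (three (proj₁ (acts h)) (proj₂ (acts h))) fix)))
        where
        unfold : ∀ h → conj (h ↑ 3) z ≡ conj h (conj h (conj h z))
        unfold h = group (h ∷ z ∷ []) (v0 ⊗ (v0 ⊗ (v0 ⊗ one)) ⊗ v1 ⊗ (v0 ⊗ (v0 ⊗ (v0 ⊗ one))) ⊖) (v0 ⊗ (v0 ⊗ (v0 ⊗ v1 ⊗ v0 ⊖) ⊗ v0 ⊖) ⊗ v0 ⊖) refl
        same : ∀ m → conj h z ≡ conj (a ↑ m) z → ∀ {x} → x ∈⟨ z ⟩ → conj h x ≡ conj (a ↑ m) x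
        same m q (k , refl) = trans (conj-↑ h z k) (trans (cong (_↑ k) q) (sym (conj-↑ (a ↑ m) z k)))
        z∈z : z ∈⟨ z ⟩
        z∈z = 1 , sym (↑-1 z)
        three : ∀ m → conj h z ≡ conj (a ↑ m) z → conj h (conj h (conj h z)) ≡ conj ((a ↑ m) ↑ 3) z
        three m q = trans (cong (conj h) (trans (cong (conj h) q) (same m q (∈-conj Nz (a ↑ m) z∈z)))) (trans (same m q (∈-conj Nz (a ↑ m) (∈-conj Nz (a ↑ m) z∈z))) (sym (unfold (a ↑ m))))
        fix : conj ((a ↑ proj₁ (acts h)) ↑ 3) z ≡ z
        fix = trans (cong (λ t → conj t z) (↑-swap a (proj₁ (acts h)) 3)) (go (proj₁ (acts h)))
          where
          go : ∀ m → conj ((a ↑ 3) ↑ m) z ≡ z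
          go zero = e-conj z
          go (suc m) = trans (conj-conj (a ↑ 3) _ z) (trans (cong (conj (a ↑ 3)) (go m)) (aaa z z∈z))

      g-acts : ∀ k → conj (g ↑ k) z ≡ z
      g-acts k with z∈g
      ... | j , q = commute⇒conj (subst (λ t → g ↑ k · t ≡ t · g ↑ k) (sym q) (self-commute g k j))

      cube-multiple : ∀ h i → 3 ∣ i → conj (h ↑ i) z ≡ z
      cube-multiple h i (divides m refl) = trans (cong (λ t → conj t z) (↑-* h m 3)) (cube-acts (h ↑ m) z (1 , sym (↑-1 z)))

      -- H = ⟨a⟩⟨g⟩, since a moves z while g and cubes do not
      Ga : Generate g a
      Ga = go (G a)
        where
        go : ∃[ i ] ∃[ j ] a ≡ b₀ ↑ i · g ↑ j → Generate g a
        go (i , j , q) with 3 ∣? i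
        ... | no d = subst (Generate g) (sym q) (Generate-root N G i j d)
        ... | yes d = contradiction (trans (cong (λ t → conj t z) q) (trans (conj-conj (b₀ ↑ i) (g ↑ j) z) (trans (cong (conj (b₀ ↑ i)) (g-acts j)) (cube-multiple b₀ i d)))) nc

      -- Both `g` and all cubes centralise `z`, whereas `x₁` acts on `z` like `a`. An exponent
      -- congruent to 0 or 2 modulo 3 would make this action trivial.
      x₁-form : ∃[ s ] ∃[ j ] x₁ ≡ a ↑ (1 + 3 * s) · g ↑ j
      x₁-form = go (Ga x₁)
        where
        go : ∃[ i ] ∃[ j ] x₁ ≡ a ↑ i · g ↑ j → ∃[ s ] ∃[ j ] x₁ ≡ a ↑ (1 + 3 * s) · g ↑ j
        go (i , j , q) = residue i refl (i % 3) (i / 3) (m≡m%n+[m/n]*n i 3) (m%n<n i 3)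
          where
          ax : conj (a ↑ i) z ≡ conj a z
          ax = trans (cong (conj (a ↑ i)) (sym (g-acts j))) (trans (sym (conj-conj (a ↑ i) (g ↑ j) z)) (trans (cong (λ t → conj t z) (sym q)) (trans conj-x₁ (sym conj-a))))
          residue : ∀ i' → i ≡ i' → ∀ ρ q' → i' ≡ ρ + q' * 3 → ρ < 3 → ∃[ s ] ∃[ j ] x₁ ≡ a ↑ (1 + 3 * s) · g ↑ j
          residue i' refl 0 q' r _ = contradiction (trans (sym ax) (cube-multiple a i (divides q' r))) nc
          residue i' refl 1 q' r _ = q' , j , trans q (cong (λ t → a ↑ t · g ↑ j) (trans r (cong suc (*-comm q' 3))))
          residue i' refl 2 q' r _ = contradiction (conj-injective a (trans (sym (conj-conj a a z)) (trans (cong (λ t → conj (a · t) z) (sym (↑-1 a)))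
            (trans (cong (conj (a ↑ 2)) (sym (cube-multiple a (q' * 3) (n∣m*n q')))) (trans (sym (conj-conj (a ↑ 2) (a ↑ (q' * 3)) z)) (trans (cong (λ t → conj t z) (trans (sym (↑-+ a 2 (q' * 3))) (cong (a ↑_) (sym r)))) ax)))))) nc
          residue i' refl (suc (suc (suc _))) q' r (s≤s (s≤s (s≤s ())))

      s j₁ : ℕ
      s = proj₁ x₁-form
      j₁ = proj₁ (proj₂ x₁-form)
      x₁≡ : x₁ ≡ a ↑ (1 + 3 * s) · g ↑ j₁
      x₁≡ = proj₂ (proj₂ x₁-form)

      opaque
        -- By `z-exponent` the element `z` is a power of g³; dropping the prime-to-3 part of the
        -- exponent does not change the subgroup.
        generator : ∃[ M ] (g ↑ (3 * M) ∈⟨ z ⟩ × z ∈⟨ g ↑ (3 * M) ⟩)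
        generator with z-exponent
        ... | zero , q = contradiction q z≢e
        ... | suc k₀ , q with factor-out (suc k₀) (s≤s z≤n)
        ...   | r , u , w , d = 3 ^ r , ∈-root u d (subst (_∈⟨ z ⟩) (trans (sym (↑-1 z)) (trans (↑-1 z) zg)) (1 , sym (↑-1 z))) , (u , zg)
          where
          zg : z ≡ (g ↑ (3 * 3 ^ r)) ↑ u
          zg = trans q (trans (cong (g ↑_) (trans (cong (_* 3) w) (trans (*-comm (3 ^ r * u) 3) (sym (*-assoc 3 (3 ^ r) u))))) (↑-* g (3 * 3 ^ r) u))

      M n' : ℕ
      M = proj₁ generator
      n' = 3 * M

      open Mz

      α-≋ : ∀ {x y} → x ≋ y → α x ≋ α y
      α-≋ {x} {y} (mod (k , q)) = mod (∈-trans (k , trans (cong (α x ·_) (sym (α-⁻ y))) (trans (sym (α-∙ x (y ⁻))) (trans (cong α q) (α-↑ z k)))) (κ , α-z'))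

      gn : g ↑ n' ≋ e
      gn = ∈⇒≋e (proj₁ (proj₂ generator))

      i₁ : ℕ
      i₁ = 1 + 3 * s

      x₁n : x₁ ↑ n' ≋ a ↑ (n' * i₁)
      x₁n = ≋-trans (≋-reflexive (cong (_↑ n') x₁≡)) (≋-trans (≋-↑-· n' (abelian-mod-z _ _)) (≋-trans (≋-· ≋-refl (≋-trans (≋-reflexive (↑-swap g j₁ n')) (≋-trans (≋-↑ j₁ gn) (≋-reflexive (e-↑ j₁)))))
        (≋-reflexive (trans (identityʳ _) (sym (↑-*′ a n' i₁))))))

      b⁻n : (b ⁻) ↑ n' ≋ a ↑ (n' * (i₁ * i₁))
      b⁻n = ≋-trans (≋-reflexive (trans (cong (_↑ n') (sym α-x₁)) (sym (α-↑ x₁ n')))) (≋-trans (α-≋ x₁n) (≋-trans (≋-reflexive (trans (α-↑ a (n' * i₁)) (trans (cong (_↑ (n' * i₁)) α-a) (↑-* x₁ n' i₁))))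
        (≋-trans (≋-↑ i₁ x₁n) (≋-reflexive (trans (sym (↑-* a (n' * i₁) i₁)) (cong (a ↑_) (*-assoc n' i₁ i₁)))))))

      -- Modulo z the n'-th powers of `a`, `x₁`, `b ⁻` are those of a, a^i₁, a^(i₁²), and their
      -- product is 1. As i₁ ≡ 1 modulo 3, the number 1 + i₁ + i₁² is 3 times a unit.
      a3n : a ↑ (3 * n') ∈⟨ z ⟩
      a3n = ∈-root (1 + 3 * (s + s * s)) unit (≋e⇒∈ (≋-trans (≋-reflexive (trans (sym (↑-* a (3 * n') (1 + 3 * (s + s * s)))) (trans (cong (a ↑_) expand) (trans (↑-+ a n' _) (cong (a ↑ n' ·_) (↑-+ a (n' * i₁) _))))))
        (≋-trans (≋-· ≋-refl (≋-· (≋-sym x₁n) (≋-sym b⁻n))) (≋-trans (≋-· ≋-refl (≋-sym (≋-↑-· n' (abelian-mod-z _ _)))) (≋-trans (≋-sym (≋-↑-· n' (abelian-mod-z _ _)))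
        (≋-reflexive (trans (cong (_↑ n') (group (a ∷ b ∷ []) (v0 ⊗ (v0 ⊖ ⊗ v1 ⊗ v1 ⊖)) one refl)) (e-↑ n'))))))))
        where
        open +-*-Solver
        unit : ¬ 3 ∣ 1 + 3 * (s + s * s)
        unit d = p∤1 (∣m+n∣m⇒∣n (subst (3 ∣_) (+-comm 1 _) d) (m∣m*n (s + s * s)))
        expand : 3 * n' * (1 + 3 * (s + s * s)) ≡ n' + (n' * i₁ + n' * (i₁ * i₁))
        expand = solve 2 (λ n s → con 3 :* n :* (con 1 :+ con 3 :* (s :+ s :* s)) := n :+ (n :* (con 1 :+ con 3 :* s) :+ n :* ((con 1 :+ con 3 :* s) :* (con 1 :+ con 3 :* s)))) refl n' s

      x₁n≋ : x₁ ↑ n' ≋ a ↑ n'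
      x₁n≋ = ≋-trans x₁n (≋-trans (≋-reflexive (trans (cong (a ↑_) (solve 2 (λ n s → n :* (con 1 :+ con 3 :* s) := n :+ con 3 :* n :* s) refl n' s)) (trans (↑-+ a n' _) (cong (a ↑ n' ·_) (↑-* a (3 * n') s)))))
        (≋-trans (≋-· ≋-refl (≋-trans (≋-↑ s (∈⇒≋e a3n)) (≋-reflexive (e-↑ s)))) (≋-reflexive (identityʳ _))))
        where open +-*-Solver

      y : Carrier H
      y = x₁ ↑ n' · (a ↑ n') ⁻

      y∈z : y ∈⟨ z ⟩
      y∈z = ≋⇒∈ x₁n≋

      α-∈ : ∀ {x} → x ∈⟨ z ⟩ → α x ≡ x ↑ κ
      α-∈ (k , refl) = trans (α-↑ z k) (trans (cong (_↑ k) α-z') (↑-swap z κ k))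

      -- On ⟨z⟩ the automorphism α is the κ-th power map. The three factors are thus α² y, α y and
      -- y, quotients of neighbours in the cycle of n'-th powers of `a`, `b ⁻`, `x₁`, and the
      -- product telescopes.
      y-relation : (y ↑ κ) ↑ κ · (y ↑ κ · y) ≡ e
      y-relation = begin
        (y ↑ κ) ↑ κ · (y ↑ κ · y) ≡⟨ cong₂ (λ p q → p · (q · y)) (trans (sym (α-∈ (∈-↑ κ y∈z))) (cong α (sym (α-∈ y∈z)))) (sym (α-∈ y∈z)) ⟩
        α (α y) · (α y · y) ≡⟨ cong₂ (λ p q → p · (q · y)) (trans (cong α αy) ααy) αy ⟩
        a ↑ n' · ((b ⁻) ↑ n') ⁻ · ((b ⁻) ↑ n' · (x₁ ↑ n') ⁻ · (x₁ ↑ n' · (a ↑ n') ⁻)) ≡⟨ group (a ↑ n' ∷ (b ⁻) ↑ n' ∷ x₁ ↑ n' ∷ []) (v0 ⊗ v1 ⊖ ⊗ (v1 ⊗ v2 ⊖ ⊗ (v2 ⊗ v0 ⊖))) one refl ⟩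
        e ∎
        where
        open ≡-Reasoning
        αy : α y ≡ (b ⁻) ↑ n' · (x₁ ↑ n') ⁻
        αy = trans (α-∙ _ _) (cong₂ _·_ (trans (α-↑ x₁ n') (cong (_↑ n') α-x₁)) (trans (α-⁻ _) (cong _⁻ (trans (α-↑ a n') (cong (_↑ n') α-a)))))
        ααy : α ((b ⁻) ↑ n' · (x₁ ↑ n') ⁻) ≡ a ↑ n' · ((b ⁻) ↑ n') ⁻
        ααy = trans (α-∙ _ _) (cong₂ _·_ (trans (α-↑ (b ⁻) n') (cong (_↑ n') (trans (α-⁻ b) (trans (cong _⁻ α-b) (inv-inv a))))) (trans (α-⁻ _) (cong _⁻ (trans (α-↑ x₁ n') (cong (_↑ n') α-x₁)))))

      -- 1 + κ + κ² is 3 times a unit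
      norm-κ : ∀ x → (x ↑ κ) ↑ κ · (x ↑ κ · x) ≡ (x ↑ 3) ↑ (1 + 3 * (l + l * l))
      norm-κ x = trans (cong₂ (λ p q → p · (x ↑ κ · q)) (sym (↑-* x κ κ)) (sym (↑-1 x))) (trans (cong (x ↑ (κ * κ) ·_) (sym (↑-+ x κ 1))) (trans (sym (↑-+ x (κ * κ) (κ + 1)))
        (trans (cong (x ↑_) (solve 1 (λ l → (con 1 :+ l :* con 3) :* (con 1 :+ l :* con 3) :+ (con 1 :+ l :* con 3 :+ con 1) := con 3 :* (con 1 :+ con 3 :* (l :+ l :* l))) refl l)) (↑-* x 3 (1 + 3 * (l + l * l))))))
        where open +-*-Solver

      unit-κ : ¬ 3 ∣ 1 + 3 * (l + l * l)
      unit-κ d = p∤1 (∣m+n∣m⇒∣n (subst (3 ∣_) (+-comm 1 _) d) (m∣m*n (l + l * l)))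

      y³ : y ↑ 3 ≡ e
      y³ = ↑≡e (1 + 3 * (l + l * l)) unit-κ (trans (sym (norm-κ y)) y-relation)

      y-fixed : conj a y ≡ y
      y-fixed = trans (conj-κ y∈z) (trans (cong (y ·_) (trans (↑-*′ y l 3) (trans (cong (_↑ l) y³) (e-↑ l)))) (identityʳ y))
        where
        conj-κ : ∀ {x} → x ∈⟨ z ⟩ → conj a x ≡ x ↑ κ
        conj-κ (k , refl) = trans (conj-↑ a z k) (trans (cong (_↑ k) conj-a) (↑-swap z κ k))

      x₁n-fixed : conj a (x₁ ↑ n') ≡ x₁ ↑ n'
      x₁n-fixed = trans (cong (conj a) split) (trans (conj-· a y (a ↑ n')) (trans (cong₂ _·_ y-fixed (commute⇒conj (commute-↑ n' refl))) (sym split)))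
        where
        split : x₁ ↑ n' ≡ y · a ↑ n'
        split = group (x₁ ↑ n' ∷ a ↑ n' ∷ []) v0 (v0 ⊗ v1 ⊖ ⊗ v1) refl

      w : Carrier H
      w = (z ↑ κ) ⁻

      w∈z : w ∈⟨ z ⟩
      w∈z = ∈-⁻ (κ , refl)

      conj-ax₁ : conj a x₁ ≡ w · x₁
      conj-ax₁ = trans (group (a ∷ b ∷ []) (v0 ⊗ (v0 ⊖ ⊗ v1) ⊗ v0 ⊖) ((v0 ⊖ ⊗ v1 ⊗ (v0 ⊗ v1 ⊖ ⊗ v0 ⊖ ⊗ v1) ⊗ (v0 ⊖ ⊗ v1) ⊖) ⊖ ⊗ (v0 ⊖ ⊗ v1)) refl) (cong (λ t → t ⁻ · x₁) conj-x₁)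

      conj-x₁∈ : ∀ {x} → x ∈⟨ z ⟩ → conj x₁ x ≡ x ↑ κ
      conj-x₁∈ (k , refl) = trans (conj-↑ x₁ z k) (trans (cong (_↑ k) conj-x₁) (↑-swap z κ k))

      W : Carrier H
      W = (w ↑ 3) ↑ (1 + 3 * (l + l * l))

      cube : (w · x₁) ↑ 3 ≡ W · x₁ ↑ 3
      cube = begin
        (w · x₁) ↑ 3 ≡⟨ group (w ∷ x₁ ∷ []) (v0 ⊗ v1 ⊗ (v0 ⊗ v1 ⊗ (v0 ⊗ v1 ⊗ one))) (v0 ⊗ ((v1 ⊗ v0 ⊗ v1 ⊖) ⊗ (v1 ⊗ (v1 ⊗ v0 ⊗ v1 ⊖) ⊗ v1 ⊖)) ⊗ (v1 ⊗ (v1 ⊗ (v1 ⊗ one)))) refl ⟩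
        w · (conj x₁ w · conj x₁ (conj x₁ w)) · x₁ ↑ 3 ≡⟨ cong (λ t → w · t · x₁ ↑ 3) (cong₂ _·_ (conj-x₁∈ w∈z) (trans (cong (conj x₁) (conj-x₁∈ w∈z)) (conj-x₁∈ (∈-↑ κ w∈z)))) ⟩
        w · (w ↑ κ · (w ↑ κ) ↑ κ) · x₁ ↑ 3 ≡⟨ cong (_· x₁ ↑ 3) (trans (cong₂ (λ p q → p · (w ↑ κ · q)) (sym (↑-1 w)) (sym (↑-* w κ κ))) (trans (cong (w ↑ 1 ·_) (sym (↑-+ w κ (κ * κ)))) (trans (sym (↑-+ w 1 (κ + κ * κ)))
            (trans (cong (w ↑_) (solve 1 (λ l → con 1 :+ ((con 1 :+ l :* con 3) :+ (con 1 :+ l :* con 3) :* (con 1 :+ l :* con 3)) := con 3 :* (con 1 :+ con 3 :* (l :+ l :* l))) refl l)) (↑-* w 3 (1 + 3 * (l + l * l))))))) ⟩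
        W · x₁ ↑ 3 ∎
        where
        open ≡-Reasoning
        open +-*-Solver

      W∈z : W ∈⟨ z ⟩
      W∈z = ∈-↑ (1 + 3 * (l + l * l)) (∈-↑ 3 w∈z)

      -- Conjugation by `a` fixes x₁^n' but multiplies `x₁` by `w`. Cubes centralise ⟨z⟩, so on
      -- raising w x₁ to the power n' = 3 M the factor W^M splits off.
      WM : W ↑ M ≡ e
      WM = ·-cancelʳ (x₁ ↑ n') (begin
        W ↑ M · x₁ ↑ n' ≡⟨ cong (W ↑ M ·_) (↑-* x₁ 3 M) ⟩
        W ↑ M · (x₁ ↑ 3) ↑ M ≡⟨ sym (↑-· M (sym (conj⇒commute (cube-acts x₁ W W∈z)))) ⟩
        (W · x₁ ↑ 3) ↑ M ≡⟨ cong (_↑ M) (sym cube) ⟩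
        ((w · x₁) ↑ 3) ↑ M ≡⟨ sym (↑-* (w · x₁) 3 M) ⟩
        (w · x₁) ↑ n' ≡⟨ cong (_↑ n') (sym conj-ax₁) ⟩
        conj a x₁ ↑ n' ≡⟨ sym (conj-↑ a x₁ n') ⟩
        conj a (x₁ ↑ n') ≡⟨ x₁n-fixed ⟩
        x₁ ↑ n' ≡⟨ sym (identityˡ _) ⟩
        e · x₁ ↑ n' ∎)
        where open ≡-Reasoning

      wn : w ↑ n' ≡ e
      wn = ↑≡e (1 + 3 * (l + l * l)) unit-κ (trans (cong (_↑ (1 + 3 * (l + l * l))) (↑-* w 3 M)) (trans (↑-swap (w ↑ 3) M (1 + 3 * (l + l * l))) WM))

      zn : z ↑ n' ≡ e
      zn = ↑≡e κ 3∤κ (trans (↑-swap z n' κ) (trans (sym (inv-inv _)) (trans (cong _⁻ (trans (sym (↑-⁻ (z ↑ κ) n')) wn)) inv-e)))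
        where
        3∤κ : ¬ 3 ∣ κ
        3∤κ d = p∤1 (∣m+n∣m⇒∣n (subst (3 ∣_) (+-comm 1 (l * 3)) d) (n∣m*n l))

      zg-commute : ∀ {x} → x ∈⟨ z ⟩ → x · g ≡ g · x
      zg-commute m with ∈-trans m z∈g
      ... | k , refl = sym (commute-↑ k refl)

      gn-fixed : conj a (g ↑ n') ≡ g ↑ n'
      gn-fixed = go (≋⇒∈ (abelian-mod-z a g))
        where
        go : a · g · (g · a) ⁻ ∈⟨ z ⟩ → conj a (g ↑ n') ≡ g ↑ n'
        go (t , q) = trans (conj-↑ a g n') (trans (cong (_↑ n') (trans (group (a ∷ g ∷ []) (v0 ⊗ v1 ⊗ v0 ⊖) (v0 ⊗ v1 ⊗ (v1 ⊗ v0) ⊖ ⊗ v1) refl) (cong (_· g) q)))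
          (trans (↑-· n' (zg-commute (t , refl))) (trans (cong (_· g ↑ n') (trans (↑-swap z t n') (trans (cong (_↑ t) zn) (e-↑ t)))) (identityˡ _))))

    absurd : ⊥
    absurd = go (proj₂ (proj₂ generator))
      where
      go : z ∈⟨ g ↑ n' ⟩ → ⊥
      go (k , q) = nc (trans (cong (conj a) q) (trans (conj-↑ a (g ↑ n') k) (trans (cong (_↑ k) gn-fixed) (sym q))))

  private
    a-fixes : conj a z ≡ z
    a-fixes = decidable-stable (conj a z ≟ z) NonCentral.absurd

    κ-trivial : z ↑ κ ≡ z
    κ-trivial = trans (sym conj-a) a-fixes

  z-central : ∀ x → x · z ≡ z · x
  z-central = H-induction (λ x → x · z ≡ z · x) (trans (identityˡ z) (sym (identityʳ z))) (λ c h q → push (conj⇒commute (col c)) q) (λ c h q → push (conj⇒commute (undo (col c))) q)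
    where
    push : ∀ {c h} → c · z ≡ z · c → h · z ≡ z · h → (c · h) · z ≡ z · (c · h)
    push {c} {h} p q = trans (assoc c h z) (trans (cong (c ·_) q) (trans (sym (assoc c z h)) (trans (cong (_· h) p) (assoc z c h))))
    undo : ∀ {c} → conj c z ≡ z → conj (c ⁻) z ≡ z
    undo {c} q = trans (cong (conj (c ⁻)) (sym q)) (conj-inv′ c z)
    col : ∀ c → conj (colour H a b c) z ≡ z
    col 0F = e-conj z
    col 1F = a-fixes
    col 2F = trans (cong (λ t → conj t z) (sym (inv-inv b))) (undo (trans conj-b⁻ κ-trivial))

  ba : b · a ≡ z · (a · b)
  ba = trans (group (a ∷ b ∷ []) (v1 ⊗ v0) (v1 ⊗ (v0 ⊗ v1 ⊖ ⊗ v0 ⊖ ⊗ v1) ⊗ (v1 ⊖ ⊗ (v0 ⊗ v1))) refl)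
    (trans (cong (_· (b ⁻ · (a · b))) (z-central b)) (group (a ∷ b ∷ z ∷ []) (v2 ⊗ v1 ⊗ (v1 ⊖ ⊗ (v0 ⊗ v1))) (v2 ⊗ (v0 ⊗ v1)) refl))

  α-fixes-z : α z ≡ z
  α-fixes-z = trans α-z' κ-trivial

open import Data.Integer using (ℤ; +_; -[1+_]; ∣_∣)
import Data.Integer as ℤ
import Data.Integer.Properties as ℤₚ
import Data.Integer.Divisibility.Signed as ℤ∣
import Data.Integer.Solver as ℤSolver

-- Counting closed walks of length 12

-- Exponents are kept as integers, without reduction by the relations of a particular group, so that
-- one enumeration serves a whole family of groups.
Triple : Set
Triple = ℤ × ℤ × ℤ

-- Left multiplication by a^±1 and b^±1 on z^e a^i b^j, where b a = z a b and z is central.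
move : Bool → Fin 3 → Triple → Triple
move s 0F t = t
move false 1F (e , i , j) = e , ℤ.suc i , j
move true 1F (e , i , j) = e , ℤ.pred i , j
move false 2F (e , i , j) = e ℤ.+ i , i , ℤ.suc j
move true 2F (e , i , j) = e ℤ.- i , i , ℤ.pred j

trace : Bool → List (Fin 3) → Triple → Triple
trace s [] t = t
trace s (c ∷ w) t = trace (not s) w (move s c t)

origin : Triple
origin = + 0 , + 0 , + 0

sameColour : Fin 3 → Fin 3 → Bool
sameColour 0F 0F = true
sameColour 1F 1F = true
sameColour 2F 2F = true
sameColour _ _ = false

sameWord : List (Fin 3) → List (Fin 3) → Bool
sameWord [] [] = true
sameWord (c ∷ w) (d ∷ w') = sameColour c d ∧ sameWord w w'
sameWord _ _ = false

distinct : List (List (Fin 3)) → Bool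
distinct [] = true
distinct (w ∷ ws) = all (λ w' → not (sameWord w w')) ws ∧ distinct ws

sameColour-refl : ∀ c → sameColour c c ≡ true
sameColour-refl 0F = refl
sameColour-refl 1F = refl
sameColour-refl 2F = refl

sameWord-refl : ∀ w → sameWord w w ≡ true
sameWord-refl [] = refl
sameWord-refl (c ∷ w) = ∧-intro (sameColour-refl c) (sameWord-refl w)

all-∈ : ∀ {X : Set} (f : X → Bool) {xs x} → all f xs ≡ true → x ∈ xs → f x ≡ true
all-∈ f {x ∷ xs} h (here refl) = proj₁ (∧-true {f x} h)
all-∈ f {x ∷ xs} h (there m) = all-∈ f (proj₂ (∧-true {f x} h)) m

lookup-∈ : ∀ {X : Set} (xs : List X) i → List.lookup xs i ∈ xs
lookup-∈ (x ∷ xs) zero = here refl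
lookup-∈ (x ∷ xs) (suc i) = there (lookup-∈ xs i)

distinct-lookup : ∀ ws → distinct ws ≡ true → ∀ {x y} → List.lookup ws x ≡ List.lookup ws y → x ≡ y
distinct-lookup (w ∷ ws) h {zero} {zero} q = refl
distinct-lookup (w ∷ ws) h {suc x} {suc y} q = cong suc (distinct-lookup ws (proj₂ (∧-true {all _ ws} h)) q)
distinct-lookup (w ∷ ws) h {zero} {suc y} refl = contradiction (trans (sym (cong not (sameWord-refl w))) (all-∈ _ (proj₁ (∧-true {all _ ws} h)) (lookup-∈ ws y))) λ ()
distinct-lookup (w ∷ ws) h {suc x} {zero} refl = contradiction (trans (sym (cong not (sameWord-refl w))) (all-∈ _ (proj₁ (∧-true {all _ ws} h)) (lookup-∈ ws x))) λ ()

reduced-length : ∀ m c {w} → w ∈ reduced m c → List.length w ≡ m × Reduced c w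
reduced-length zero c (here refl) = refl , refl
reduced-length (suc m) c {w} h with ∈ₚ.∈-concatMap⁻ (λ d → List.map (d ∷_) (reduced m d)) {xs = others c} h
... | r = go (others c) (others-sound c) r
  where
  others-sound : ∀ c {d} → d ∈ others c → d ≢ c
  others-sound 0F (here refl) ()
  others-sound 0F (there (here refl)) ()
  others-sound 1F (here refl) ()
  others-sound 1F (there (here refl)) ()
  others-sound 2F (here refl) ()
  others-sound 2F (there (here refl)) ()
  go : ∀ ds → (∀ {d} → d ∈ ds → d ≢ c) → Any (λ d → w ∈ List.map (d ∷_) (reduced m d)) ds → List.length w ≡ suc m × Reduced c w
  go (d ∷ ds) snd (here q) with ∈ₚ.∈-map⁻ (d ∷_) q
  ... | w' , mem , refl = cong suc (proj₁ (reduced-length m d mem)) , snd (here refl) , proj₂ (reduced-length m d mem)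
  go (d ∷ ds) snd (there q) = go ds (snd ∘ there) q

-- The relations that can occur among z, a, b: P is a necessary and Q a sufficient condition for z^e a^i b^j = 1.
record Criterion : Set where
  field
    P Q   : Triple → Bool
    bound : ℕ

  -- The ways to complete the path `c`, `d`, `f` to a walk of length 12 accepted by `R`. With `P`
  -- this bounds the closed walks from above, with `Q` from below.
  closing : (Triple → Bool) → Bool → Fin 3 → Fin 3 → Fin 3 → List (List (Fin 3))
  closing R s c d f = List.filterᵇ (λ w → R (trace s (c ∷ d ∷ f ∷ w) origin)) (reduced 9 f)

  outerTest : Bool → Fin 3 → Fin 3 → Fin 3 → Bool
  outerTest s c d f = sameColour c f ∨ sameColour d f ∨ ((suc bound ≤ᵇ List.length (closing Q s c d f)) ∧ distinct (closing Q s c d f))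

  test : Bool → Fin 3 → Fin 3 → Bool
  test s c d = sameColour c d ∨ ((List.length (closing P s c d c) ≤ᵇ bound) ∧ all (outerTest s c d) (0F ∷ 1F ∷ 2F ∷ []))

  testFrom : Bool → Fin 3 → Bool
  testFrom s c = all (test s c) (0F ∷ 1F ∷ 2F ∷ [])

  testSide : Bool → Bool
  testSide s = all (testFrom s) (0F ∷ 1F ∷ 2F ∷ [])

  separates : Bool
  separates = all testSide (true ∷ false ∷ [])

-- Wrapped in a record so that comparing types never evaluates the enumeration.
record Separates (crit : Criterion) : Set where
  constructor computed
  field proof : Criterion.separates crit ≡ true

divisible : (m : ℕ) .{{_ : NonZero m}} → ℤ → Bool
divisible m i = (∣ i ∣ % m) ≡ᵇ 0

isZero : ℤ → Bool
isZero i = ∣ i ∣ ≡ᵇ 0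

-- On walks of length 12 the exponents of `a` and `b` are at most 6 in absolute value, so
-- divisibility by 9 means that they vanish. In the first case 9 divides the order of `z`. In the
-- second `z` has order 3, and a further factor 3 comes from the independence of a³ and b³ modulo
-- `z`.
criterionI criterionII : Criterion
criterionI = record
  { P = λ (e , i , j) → divisible 9 i ∧ divisible 9 j ∧ (not (isZero i ∧ isZero j) ∨ divisible 9 e)
  ; Q = λ (e , i , j) → isZero i ∧ isZero j ∧ isZero e
  ; bound = 1 }
criterionII = record
  { P = λ (e , i , j) → divisible 9 i ∧ divisible 9 j ∧ (not (isZero i ∧ isZero j) ∨ divisible 3 e)
  ; Q = λ (e , i , j) → isZero i ∧ isZero j ∧ divisible 3 e
  ; bound = 3 }

-- For z³ = 1, a³ outside ⟨z⟩ and a³ b³ = z^d. With i = 3 i' and j = 3 j', the element is z^(e + d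
-- j') times (a³)^(i' - j'), so the test is both necessary and sufficient.
criterionIII : ℕ → Criterion
criterionIII d = record
  { P = test₃ ; Q = test₃ ; bound = 7 }
  where
  test₃ : Triple → Bool
  test₃ (e , i , j) = divisible 3 i ∧ divisible 3 j ∧ divisible 9 (i ℤ.- j) ∧ divisible 9 (+ d ℤ.* j ℤ.+ + 3 ℤ.* e)

opaque
  separatesI : Separates criterionI
  separatesI = computed refl
  separatesII : Separates criterionII
  separatesII = computed refl
  separatesIII₁ : Separates (criterionIII 1)
  separatesIII₁ = computed refl
  separatesIII₂ : Separates (criterionIII 2)
  separatesIII₂ = computed refl

module Heisenberg (H : FiniteGroup) (Γ : Graph) (A : BiCayleyAction H Γ) (conn : Connected Γ) (haar : HaarGraph H Γ A)
    (z : Carrier H) (z-central : ∀ x → _∙_ H x z ≡ _∙_ H z x)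
    (ba : _∙_ H (HaarGraph.b haar) (HaarGraph.a haar) ≡ _∙_ H z (_∙_ H (HaarGraph.a haar) (HaarGraph.b haar))) where
  open Grp H
  open HaarGraph haar
  open Colours H Γ A conn haar

  infixl 8 _↥_
  _↥_ : Carrier H → ℤ → Carrier H
  x ↥ (+ m) = x ↑ m
  x ↥ -[1+ m ] = (x ⁻) ↑ suc m

  ↥-suc : ∀ x i → x ↥ ℤ.suc i ≡ x · x ↥ i
  ↥-suc x (+ m) = refl
  ↥-suc x -[1+ zero ] = sym (trans (cong (x ·_) (identityʳ _)) (inverseʳ x))
  ↥-suc x -[1+ suc m ] = sym (cancelʳ x _)

  ↥-pred : ∀ x i → x ↥ ℤ.pred i ≡ x ⁻ · x ↥ i
  ↥-pred x (+ zero) = refl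
  ↥-pred x (+ suc m) = sym (cancelˡ x _)
  ↥-pred x -[1+ m ] = refl

  ↥-+ : ∀ x i j → x ↥ (i ℤ.+ j) ≡ x ↥ i · x ↥ j
  ↥-+ x (+ zero) j = trans (cong (x ↥_) (ℤₚ.+-identityˡ j)) (sym (identityˡ _))
  ↥-+ x (+ suc m) j = trans (cong (x ↥_) (ℤₚ.+-assoc (+ 1) (+ m) j)) (trans (↥-suc x (+ m ℤ.+ j)) (trans (cong (x ·_) (↥-+ x (+ m) j)) (sym (assoc _ _ _))))
  ↥-+ x -[1+ zero ] j = trans (↥-pred x j) (cong (_· x ↥ j) (sym (identityʳ _)))
  ↥-+ x -[1+ suc m ] j = trans (cong (x ↥_) (ℤₚ.+-assoc (ℤ.- (+ 1)) -[1+ m ] j)) (trans (↥-pred x (-[1+ m ] ℤ.+ j)) (trans (cong (x ⁻ ·_) (↥-+ x -[1+ m ] j)) (sym (assoc _ _ _))))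

  ↥-central : ∀ i x → x · z ↥ i ≡ z ↥ i · x
  ↥-central (+ m) x = commute-↑ m (z-central x)
  ↥-central -[1+ m ] x = commute-↑ (suc m) (begin
    x · z ⁻ ≡⟨ group (x ∷ z ∷ []) (v0 ⊗ v1 ⊖) (v1 ⊖ ⊗ (v1 ⊗ v0) ⊗ v1 ⊖) refl ⟩
    z ⁻ · (z · x) · z ⁻ ≡⟨ cong (λ t → z ⁻ · t · z ⁻) (sym (z-central x)) ⟩
    z ⁻ · (x · z) · z ⁻ ≡⟨ group (x ∷ z ∷ []) (v1 ⊖ ⊗ (v0 ⊗ v1) ⊗ v1 ⊖) (v1 ⊖ ⊗ v0) refl ⟩
    z ⁻ · x ∎)
    where open ≡-Reasoning

  b-a↥ : ∀ i → b · a ↥ i ≡ z ↥ i · (a ↥ i · b)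
  b-a↥ (+ zero) = trans (identityʳ b) (sym (trans (identityˡ _) (identityˡ b)))
  b-a↥ (+ suc m) = begin
    b · (a · a ↑ m) ≡⟨ trans (sym (assoc _ _ _)) (cong (_· a ↑ m) ba) ⟩
    z · (a · b) · a ↑ m ≡⟨ group (z ∷ a ∷ b ∷ a ↑ m ∷ []) (v0 ⊗ (v1 ⊗ v2) ⊗ v3) (v0 ⊗ (v1 ⊗ (v2 ⊗ v3))) refl ⟩
    z · (a · (b · a ↑ m)) ≡⟨ cong (λ t → z · (a · t)) (b-a↥ (+ m)) ⟩
    z · (a · (z ↑ m · (a ↑ m · b))) ≡⟨ group (z ∷ a ∷ b ∷ a ↑ m ∷ z ↑ m ∷ []) (v0 ⊗ (v1 ⊗ (v4 ⊗ (v3 ⊗ v2)))) (v0 ⊗ (v1 ⊗ v4) ⊗ (v3 ⊗ v2)) refl ⟩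
    z · (a · z ↑ m) · (a ↑ m · b) ≡⟨ cong (λ t → z · t · (a ↑ m · b)) (↥-central (+ m) a) ⟩
    z · (z ↑ m · a) · (a ↑ m · b) ≡⟨ group (z ∷ a ∷ b ∷ a ↑ m ∷ z ↑ m ∷ []) (v0 ⊗ (v4 ⊗ v1) ⊗ (v3 ⊗ v2)) (v0 ⊗ v4 ⊗ (v1 ⊗ v3 ⊗ v2)) refl ⟩
    z · z ↑ m · (a · a ↑ m · b) ∎
    where open ≡-Reasoning
  b-a↥ -[1+ m ] = go (suc m)
    where
    open ≡-Reasoning
    ba⁻ : b · a ⁻ ≡ z ⁻ · (a ⁻ · b)
    ba⁻ = begin
      b · a ⁻ ≡⟨ group (z ∷ a ∷ b ∷ []) (v2 ⊗ v1 ⊖) (v1 ⊖ ⊗ v0 ⊖ ⊗ (v0 ⊗ (v1 ⊗ v2)) ⊗ v1 ⊖) refl ⟩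
      a ⁻ · z ⁻ · (z · (a · b)) · a ⁻ ≡⟨ cong (λ t → a ⁻ · z ⁻ · t · a ⁻) (sym ba) ⟩
      a ⁻ · z ⁻ · (b · a) · a ⁻ ≡⟨ group (z ∷ a ∷ b ∷ []) (v1 ⊖ ⊗ v0 ⊖ ⊗ (v2 ⊗ v1) ⊗ v1 ⊖) (v1 ⊖ ⊗ v0 ⊖ ⊗ v2) refl ⟩
      a ⁻ · z ⁻ · b ≡⟨ cong (_· b) (trans (cong (a ⁻ ·_) (sym (↑-1 (z ⁻)))) (trans (↥-central -[1+ 0 ] (a ⁻)) (cong (_· a ⁻) (↑-1 (z ⁻))))) ⟩
      z ⁻ · a ⁻ · b ≡⟨ assoc _ _ _ ⟩
      z ⁻ · (a ⁻ · b) ∎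
    central⁻ : ∀ m x → x · (z ⁻) ↑ m ≡ (z ⁻) ↑ m · x
    central⁻ zero x = ↥-central (+ 0) x
    central⁻ (suc m) x = ↥-central -[1+ m ] x
    go : ∀ m → b · (a ⁻) ↑ m ≡ (z ⁻) ↑ m · ((a ⁻) ↑ m · b)
    go zero = trans (identityʳ b) (sym (trans (identityˡ _) (identityˡ b)))
    go (suc m) = begin
      b · (a ⁻ · (a ⁻) ↑ m) ≡⟨ trans (sym (assoc _ _ _)) (cong (_· (a ⁻) ↑ m) ba⁻) ⟩
      z ⁻ · (a ⁻ · b) · (a ⁻) ↑ m ≡⟨ group (z ∷ a ∷ b ∷ (a ⁻) ↑ m ∷ []) (v0 ⊖ ⊗ (v1 ⊖ ⊗ v2) ⊗ v3) (v0 ⊖ ⊗ (v1 ⊖ ⊗ (v2 ⊗ v3))) refl ⟩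
      z ⁻ · (a ⁻ · (b · (a ⁻) ↑ m)) ≡⟨ cong (λ t → z ⁻ · (a ⁻ · t)) (go m) ⟩
      z ⁻ · (a ⁻ · ((z ⁻) ↑ m · ((a ⁻) ↑ m · b))) ≡⟨ group (z ∷ a ∷ b ∷ (a ⁻) ↑ m ∷ (z ⁻) ↑ m ∷ []) (v0 ⊖ ⊗ (v1 ⊖ ⊗ (v4 ⊗ (v3 ⊗ v2)))) (v0 ⊖ ⊗ (v1 ⊖ ⊗ v4) ⊗ (v3 ⊗ v2)) refl ⟩
      z ⁻ · (a ⁻ · (z ⁻) ↑ m) · ((a ⁻) ↑ m · b) ≡⟨ cong (λ t → z ⁻ · t · ((a ⁻) ↑ m · b)) (central⁻ m (a ⁻)) ⟩
      z ⁻ · ((z ⁻) ↑ m · a ⁻) · ((a ⁻) ↑ m · b) ≡⟨ group (z ∷ a ∷ b ∷ (a ⁻) ↑ m ∷ (z ⁻) ↑ m ∷ []) (v0 ⊖ ⊗ (v4 ⊗ v1 ⊖) ⊗ (v3 ⊗ v2)) (v0 ⊖ ⊗ v4 ⊗ (v1 ⊖ ⊗ v3 ⊗ v2)) refl ⟩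
      z ⁻ · (z ⁻) ↑ m · (a ⁻ · (a ⁻) ↑ m · b) ∎

  val : Triple → Carrier H
  val (ez , i , j) = z ↥ ez · a ↥ i · b ↥ j

  private
    pull : ∀ x ez i j → x · (z ↥ ez · a ↥ i · b ↥ j) ≡ z ↥ ez · (x · a ↥ i) · b ↥ j
    pull x ez i j = trans (group (x ∷ z ↥ ez ∷ a ↥ i ∷ b ↥ j ∷ []) (v0 ⊗ (v1 ⊗ v2 ⊗ v3)) (v0 ⊗ v1 ⊗ v2 ⊗ v3) refl)
      (trans (cong (λ t → t · a ↥ i · b ↥ j) (↥-central ez x)) (group (x ∷ z ↥ ez ∷ a ↥ i ∷ b ↥ j ∷ []) (v1 ⊗ v0 ⊗ v2 ⊗ v3) (v1 ⊗ (v0 ⊗ v2) ⊗ v3) refl))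

    b-val : ∀ ez i j → b · val (ez , i , j) ≡ val (ez ℤ.+ i , i , ℤ.suc j)
    b-val ez i j = begin
      b · val (ez , i , j) ≡⟨ pull b ez i j ⟩
      z ↥ ez · (b · a ↥ i) · b ↥ j ≡⟨ cong (λ t → z ↥ ez · t · b ↥ j) (b-a↥ i) ⟩
      z ↥ ez · (z ↥ i · (a ↥ i · b)) · b ↥ j ≡⟨ group (z ↥ ez ∷ z ↥ i ∷ a ↥ i ∷ b ∷ b ↥ j ∷ []) (v0 ⊗ (v1 ⊗ (v2 ⊗ v3)) ⊗ v4) (v0 ⊗ v1 ⊗ v2 ⊗ (v3 ⊗ v4)) refl ⟩
      z ↥ ez · z ↥ i · a ↥ i · (b · b ↥ j) ≡⟨ cong₂ (λ s t → s · a ↥ i · t) (sym (↥-+ z ez i)) (sym (↥-suc b j)) ⟩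
      val (ez ℤ.+ i , i , ℤ.suc j) ∎
      where open ≡-Reasoning

  move-val : ∀ s c t → next H a b c s (val t) ≡ val (move s c t)
  move-val false 0F t = identityˡ _
  move-val true 0F t = trans (cong (_· val t) inv-e) (identityˡ _)
  move-val false 1F (ez , i , j) = trans (pull a ez i j) (cong (λ t → z ↥ ez · t · b ↥ j) (sym (↥-suc a i)))
  move-val true 1F (ez , i , j) = trans (pull (a ⁻) ez i j) (cong (λ t → z ↥ ez · t · b ↥ j) (sym (↥-pred a i)))
  move-val false 2F (ez , i , j) = b-val ez i j
  move-val true 2F (ez , i , j) = trans (cong (b ⁻ ·_) (sym (trans (b-val (ez ℤ.- i) i (ℤ.pred j)) (cong₂ (λ s t → val (s , i , t)) cancel (ℤₚ.suc-pred j))))) (cancelˡ b _)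
    where
    cancel : ez ℤ.- i ℤ.+ i ≡ ez
    cancel = trans (ℤₚ.+-assoc ez (ℤ.- i) i) (trans (cong (λ t → ez ℤ.+ t) (ℤₚ.+-inverseˡ i)) (ℤₚ.+-identityʳ ez))

  next-· : ∀ c s x h → next H a b c s (x · h) ≡ next H a b c s x · h
  next-· c false x h = sym (assoc _ _ _)
  next-· c true x h = sym (assoc _ _ _)

  walk-val : ∀ w s t h → proj₂ (walk w (s , val t · h)) ≡ val (trace s w t) · h
  walk-val [] s t h = refl
  walk-val (c ∷ w) s t h = trans (cong (λ x → proj₂ (walk w (not s , x))) (trans (next-· c s (val t) h) (cong (_· h) (move-val s c t)))) (walk-val w (not s) (move s c t) h)

  walk-origin : ∀ w s h → proj₂ (walk w (s , h)) ≡ val (trace s w origin) · h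
  walk-origin w s h = trans (cong (λ x → proj₂ (walk w (s , x))) (sym (trans (cong (_· h) (trans (identityʳ _) (identityʳ e))) (identityˡ h)))) (walk-val w s origin h)

  walk-side : ∀ w s → proj₁ (walk w s) ≡ iter (List.length w) not (proj₁ s)
  walk-side [] s = refl
  walk-side (c ∷ w) s = trans (walk-side w (nb c s)) (swap (List.length w) (proj₁ s))
    where
    swap : ∀ m x → iter m not (not x) ≡ not (iter m not x)
    swap zero x = refl
    swap (suc m) x = cong not (swap m x)

  filter-∈ : ∀ {X : Set} (f : X → Bool) {x xs} → x ∈ xs → f x ≡ true → x ∈ List.filterᵇ f xs
  filter-∈ f {x} {y ∷ xs} (here refl) q rewrite q = here refl
  filter-∈ f {x} {y ∷ xs} (there m) q with f y
  ... | true = there (filter-∈ f m q)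
  ... | false = filter-∈ f m q

  ∈-filter : ∀ {X : Set} (f : X → Bool) {x} xs → x ∈ List.filterᵇ f xs → x ∈ xs × f x ≡ true
  ∈-filter f (y ∷ xs) m with f y in q
  ∈-filter f (y ∷ xs) (here refl) | true = here refl , q
  ∈-filter f (y ∷ xs) (there m) | true = there (proj₁ (∈-filter f xs m)) , proj₂ (∈-filter f xs m)
  ∈-filter f (y ∷ xs) m | false = there (proj₁ (∈-filter f xs m)) , proj₂ (∈-filter f xs m)

  module _ (crit : Criterion) (ok : Separates crit)
      (necessary : ∀ t → val t ≡ e → Criterion.P crit t ≡ true) (sufficient : ∀ t → Criterion.Q crit t ≡ true → val t ≡ e) where
    open Criterion crit

    private
      colours : ∀ (c : Fin 3) → c ∈ (0F ∷ 1F ∷ 2F ∷ [])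
      colours 0F = here refl
      colours 1F = there (here refl)
      colours 2F = there (there (here refl))

      sides : ∀ (s : Bool) → s ∈ (true ∷ false ∷ [])
      sides true = here refl
      sides false = there (here refl)

      ∨-false : ∀ {x y} → x ∨ y ≡ true → x ≡ false → y ≡ true
      ∨-false {false} h _ = h

      different : ∀ {c d} → c ≢ d → sameColour c d ≡ false
      different {0F} {0F} h = contradiction refl h
      different {0F} {1F} h = refl
      different {0F} {2F} h = refl
      different {1F} {0F} h = refl
      different {1F} {1F} h = contradiction refl h
      different {1F} {2F} h = refl
      different {2F} {0F} h = refl
      different {2F} {1F} h = refl
      different {2F} {2F} h = contradiction refl h

      opaque
        tested : ∀ s c d → c ≢ d → (List.length (closing P s c d c) ≤ᵇ bound) ≡ true ×
          (∀ f → d ≢ f → c ≢ f → (suc bound ≤ᵇ List.length (closing Q s c d f)) ≡ true × distinct (closing Q s c d f) ≡ true)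
        tested s c d c≢d = proj₁ both , λ f d≢f c≢f →
          ∧-true {suc bound ≤ᵇ List.length (closing Q s c d f)} (∨-false {sameColour d f} (∨-false {sameColour c f} (all-∈ (outerTest s c d) (proj₂ both) (colours f)) (different c≢f)) (different d≢f))
          where
          both : (List.length (closing P s c d c) ≤ᵇ bound) ≡ true × all (outerTest s c d) (0F ∷ 1F ∷ 2F ∷ []) ≡ true
          both = ∧-true {List.length (closing P s c d c) ≤ᵇ bound} (∨-false {sameColour c d}
            (all-∈ (test s c) (all-∈ (testFrom s) (all-∈ testSide (Separates.proof ok) (sides s)) (colours c)) (colours d)) (different c≢d))

      ≤ᵇ-sound : ∀ {m k} → (m ≤ᵇ k) ≡ true → m ≤ k
      ≤ᵇ-sound {m} {k} h = ≤ᵇ⇒≤ m k (subst (λ x → Data.Bool.T x) (sym h) tt)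

      pickOuter : ∀ s c d f → c ≢ d → d ≢ f → c ≢ f → Fin (suc bound) → List (Fin 3)
      pickOuter s c d f p q r x = List.lookup (closing Q s c d f) (inject≤ x (≤ᵇ-sound (proj₁ (proj₂ (tested s c d p) f q r))))

      outer-mem : ∀ s c d f p q r x → pickOuter s c d f p q r x ∈ reduced 9 f × Q (trace s (c ∷ d ∷ f ∷ pickOuter s c d f p q r x) origin) ≡ true
      outer-mem s c d f p q r x = ∈-filter (λ w → Q (trace s (c ∷ d ∷ f ∷ w) origin)) (reduced 9 f) (lookup-∈ (closing Q s c d f) _)

    separation : Separation
    separation = record
      -- Three of the twelve steps are prescribed.
      { tail = 9
      ; bound = bound
      ; inner = λ s c d → closing P s c d c
      ; inner-bound = λ s c d c≢d → ≤ᵇ-sound (proj₁ (tested s c d c≢d))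
      ; inner-complete = λ s h c d w c≢d red len cl → filter-∈ (λ w → P (trace s (c ∷ d ∷ c ∷ w) origin)) (reduced-complete 9 c w red len)
          (necessary (trace s (c ∷ d ∷ c ∷ w) origin) (·-cancelʳ h (trans (sym (walk-origin (c ∷ d ∷ c ∷ w) s h)) (trans (cong proj₂ cl) (sym (identityˡ h))))))
      ; outer = pickOuter
      ; outer-inj = λ s c d f p q r eq → inject≤-injective _ _ _ _ (distinct-lookup (closing Q s c d f) (proj₂ (proj₂ (tested s c d p) f q r)) eq)
      ; outer-length = λ s c d f p q r x → proj₁ (reduced-length 9 f (proj₁ (outer-mem s c d f p q r x)))
      ; outer-reduced = λ s c d f p q r x → proj₂ (reduced-length 9 f (proj₁ (outer-mem s c d f p q r x)))
      ; outer-closed = λ s h c d f p q r x → let w = c ∷ d ∷ f ∷ pickOuter s c d f p q r x in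
          cong₂ _,_ (trans (walk-side w (s , h)) (trans (cong (λ m → iter (suc (suc (suc m))) not s) (proj₁ (reduced-length 9 f (proj₁ (outer-mem s c d f p q r x))))) (twelve s)))
            (trans (walk-origin w s h) (trans (cong (_· h) (sufficient _ (proj₂ (outer-mem s c d f p q r x)))) (identityˡ h)))
      }
      where
      twelve : ∀ s → iter 12 not s ≡ s
      twelve true = refl
      twelve false = refl

    normal-of-criterion : NormalBiCayley A
    normal-of-criterion = normal separation

-- The possible relations among z, a and b

divisible⇒∣ : ∀ m .{{_ : NonZero m}} i → divisible m i ≡ true → m ∣ ∣ i ∣
divisible⇒∣ m i h = m%n≡0⇒n∣m ∣ i ∣ m (zero? (∣ i ∣ % m) h)
  where
  zero? : ∀ r → (r ≡ᵇ 0) ≡ true → r ≡ 0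
  zero? zero _ = refl

∣⇒divisible : ∀ m .{{_ : NonZero m}} i → m ∣ ∣ i ∣ → divisible m i ≡ true
∣⇒divisible m i h = cong (_≡ᵇ 0) (n∣m⇒m%n≡0 ∣ i ∣ m h)

and₃ : ∀ {x y w} → x ≡ true → y ≡ true → w ≡ true → x ∧ (y ∧ w) ≡ true
and₃ refl refl refl = refl

and₄ : ∀ {x y w t} → x ≡ true → y ≡ true → w ≡ true → t ≡ true → x ∧ (y ∧ (w ∧ t)) ≡ true
and₄ refl refl refl refl = refl

isZero⇒ : ∀ i → isZero i ≡ true → i ≡ + 0
isZero⇒ (+ zero) _ = refl

third : ∀ i → 3 ∣ ∣ i ∣ → ∃[ i' ] i ≡ i' ℤ.* + 3
third i d with ℤ∣.∣ᵤ⇒∣ {+ 3} {i} d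
... | ℤ∣.divides i' q = i' , q

3∣third : ∀ k → 9 ∣ ∣ k ℤ.* + 3 ∣ → 3 ∣ ∣ k ∣
3∣third k d = *-cancelʳ-∣ 3 (subst (9 ∣_) (ℤₚ.abs-* k (+ 3)) d)

third∣9 : ∀ k → 3 ∣ ∣ k ∣ → 9 ∣ ∣ k ℤ.* + 3 ∣
third∣9 k d = subst (9 ∣_) (sym (ℤₚ.abs-* k (+ 3))) (*-monoˡ-∣ 3 d)

module Cases (pp : Prime 3) (H : FiniteGroup) (pg : IsPGroup 3 H) (nonabelian : NonAbelian H)
    (Γ : Graph) (A : BiCayleyAction H Γ) (conn : Connected Γ) (haar : HaarGraph H Γ A)
    (g b₀ : Carrier H) (N : Metacyclics.Normal 3 pp H pg g) (G : Metacyclics.Generate 3 pp H pg g b₀) where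
  open Metacyclics 3 pp H pg
  open Commutator pp H pg nonabelian Γ A conn haar g b₀ N G public
  open Heisenberg H Γ A conn haar z z-central ba public

  e-↥ : ∀ i → e ↥ i ≡ e
  e-↥ (+ m) = e-↑ m
  e-↥ -[1+ m ] = trans (cong (_↑ suc m) inv-e) (e-↑ (suc m))

  ↥≡e⇒ : ∀ {x} i → x ↥ i ≡ e → x ↑ ∣ i ∣ ≡ e
  ↥≡e⇒ (+ m) q = q
  ↥≡e⇒ {x} -[1+ m ] q = trans (sym (inv-inv _)) (trans (cong _⁻ (trans (sym (↑-⁻ x (suc m))) q)) inv-e)

  ↥-∈ : ∀ {x} i → x ↥ i ∈⟨ x ⟩
  ↥-∈ (+ m) = m , refl
  ↥-∈ {x} -[1+ m ] = ∈-↑ (suc m) (∈-⁻ (1 , sym (↑-1 x)))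

  ↥-∣∣∈ : ∀ {x y} i → x ↥ i ∈⟨ y ⟩ → x ↑ ∣ i ∣ ∈⟨ y ⟩
  ↥-∣∣∈ (+ m) h = h
  ↥-∣∣∈ {x} {y} -[1+ m ] h = subst (_∈⟨ y ⟩) (trans (cong _⁻ (↑-⁻ x (suc m))) (inv-inv _)) (∈-⁻ h)

  ↥-·3 : ∀ x i → x ↥ (i ℤ.* + 3) ≡ (x ↑ 3) ↥ i
  ↥-·3 x (+ zero) = refl
  ↥-·3 x (+ suc m) = ↑-*′ x (suc m) 3
  ↥-·3 x -[1+ m ] = trans (↑-*′ (x ⁻) (suc m) 3) (cong (_↑ suc m) (↑-⁻ x 3))

  ↥-↑3 : ∀ x i → (x ↥ i) ↑ 3 ≡ (x ↑ 3) ↥ i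
  ↥-↑3 x (+ m) = ↑-swap x m 3
  ↥-↑3 x -[1+ m ] = trans (↑-swap (x ⁻) (suc m) 3) (cong (_↑ suc m) (↑-⁻ x 3))

  ⁻-commute : ∀ {x y} → x · y ≡ y · x → x ⁻ · y ≡ y · x ⁻
  ⁻-commute {x} {y} q = trans (group (x ∷ y ∷ []) (v0 ⊖ ⊗ v1) (v0 ⊖ ⊗ (v1 ⊗ v0) ⊗ v0 ⊖) refl) (trans (cong (λ t → x ⁻ · t · x ⁻) (sym q)) (group (x ∷ y ∷ []) (v0 ⊖ ⊗ (v0 ⊗ v1) ⊗ v0 ⊖) (v1 ⊗ v0 ⊖) refl))

  ↥-· : ∀ {x y} i → x · y ≡ y · x → (x · y) ↥ i ≡ x ↥ i · y ↥ i
  ↥-· (+ m) q = ↑-· m q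
  ↥-· {x} {y} -[1+ m ] q = trans (cong (_↑ suc m) (trans (cong _⁻ q) (inv-· y x))) (↑-· (suc m) (⁻-commute (sym (⁻-commute (sym q)))))

  ↥-neg : ∀ x i → (x ⁻) ↥ i ≡ x ↥ (ℤ.- i)
  ↥-neg x (+ zero) = refl
  ↥-neg x (+ suc m) = refl
  ↥-neg x -[1+ m ] = cong (_↑ suc m) (inv-inv x)

  ↥-scale : ∀ x d i → (x ↑ d) ↥ i ≡ x ↥ (+ d ℤ.* i)
  ↥-scale x zero i = trans (e-↥ i) (cong (x ↥_) (sym (ℤₚ.*-zeroˡ i)))
  ↥-scale x (suc d) i = trans (↥-· {x} {x ↑ d} i (commute-↑ d refl)) (trans (cong (x ↥ i ·_) (↥-scale x d i)) (trans (sym (↥-+ x i (+ d ℤ.* i)))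
    (cong (x ↥_) (sym (trans (ℤₚ.*-distribʳ-+ i (+ 1) (+ d)) (cong (ℤ._+ (+ d ℤ.* i)) (ℤₚ.*-identityˡ i)))))))

  b↥-a : ∀ j → b ↥ j · a ≡ z ↥ j · (a · b ↥ j)
  b↥-a (+ zero) = trans (identityˡ a) (sym (trans (identityˡ _) (identityʳ a)))
  b↥-a (+ suc m) = begin
    b · b ↑ m · a ≡⟨ trans (assoc _ _ _) (cong (b ·_) (b↥-a (+ m))) ⟩
    b · (z ↑ m · (a · b ↑ m)) ≡⟨ trans (sym (assoc _ _ _)) (cong (_· (a · b ↑ m)) (↥-central (+ m) b)) ⟩
    z ↑ m · b · (a · b ↑ m) ≡⟨ group (z ↑ m ∷ b ∷ a ∷ b ↑ m ∷ []) (v0 ⊗ v1 ⊗ (v2 ⊗ v3)) (v0 ⊗ (v1 ⊗ v2) ⊗ v3) refl ⟩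
    z ↑ m · (b · a) · b ↑ m ≡⟨ cong (λ t → z ↑ m · t · b ↑ m) ba ⟩
    z ↑ m · (z · (a · b)) · b ↑ m ≡⟨ group (z ↑ m ∷ b ∷ a ∷ b ↑ m ∷ z ∷ []) (v0 ⊗ (v4 ⊗ (v2 ⊗ v1)) ⊗ v3) (v0 ⊗ v4 ⊗ (v2 ⊗ (v1 ⊗ v3))) refl ⟩
    z ↑ m · z · (a · (b · b ↑ m)) ≡⟨ cong (_· (a · (b · b ↑ m))) (sym (commute-↑ m refl)) ⟩
    z · z ↑ m · (a · (b · b ↑ m)) ∎
    where open ≡-Reasoning
  b↥-a -[1+ m ] = go (suc m)
    where
    open ≡-Reasoning
    b⁻a : b ⁻ · a ≡ z ⁻ · (a · b ⁻)
    b⁻a = ·-cancelˡ (z · b) (begin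
      z · b · (b ⁻ · a) ≡⟨ group (z ∷ b ∷ a ∷ []) (v0 ⊗ v1 ⊗ (v1 ⊖ ⊗ v2)) (v0 ⊗ (v2 ⊗ v1) ⊗ v1 ⊖) refl ⟩
      z · (a · b) · b ⁻ ≡⟨ cong (_· b ⁻) (sym ba) ⟩
      b · a · b ⁻ ≡⟨ group (z ∷ b ∷ a ∷ []) (v1 ⊗ v2 ⊗ v1 ⊖) (v1 ⊗ v0 ⊗ (v0 ⊖ ⊗ (v2 ⊗ v1 ⊖))) refl ⟩
      b · z · (z ⁻ · (a · b ⁻)) ≡⟨ cong (_· (z ⁻ · (a · b ⁻))) (z-central b) ⟩
      z · b · (z ⁻ · (a · b ⁻)) ∎)
    z⁻-central : ∀ m x → x · (z ⁻) ↑ m ≡ (z ⁻) ↑ m · x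
    z⁻-central zero x = ↥-central (+ 0) x
    z⁻-central (suc m) x = ↥-central -[1+ m ] x
    go : ∀ m → (b ⁻) ↑ m · a ≡ (z ⁻) ↑ m · (a · (b ⁻) ↑ m)
    go zero = trans (identityˡ a) (sym (trans (identityˡ _) (identityʳ a)))
    go (suc m) = begin
      b ⁻ · (b ⁻) ↑ m · a ≡⟨ trans (assoc _ _ _) (cong (b ⁻ ·_) (go m)) ⟩
      b ⁻ · (Z · (a · B)) ≡⟨ trans (sym (assoc _ _ _)) (cong (_· (a · B)) (z⁻-central m (b ⁻))) ⟩
      Z · b ⁻ · (a · B) ≡⟨ group (Z ∷ b ⁻ ∷ a ∷ B ∷ []) (v0 ⊗ v1 ⊗ (v2 ⊗ v3)) (v0 ⊗ (v1 ⊗ v2) ⊗ v3) refl ⟩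
      Z · (b ⁻ · a) · B ≡⟨ cong (λ t → Z · t · B) b⁻a ⟩
      Z · (z ⁻ · (a · b ⁻)) · B ≡⟨ group (Z ∷ b ⁻ ∷ a ∷ B ∷ z ⁻ ∷ []) (v0 ⊗ (v4 ⊗ (v2 ⊗ v1)) ⊗ v3) (v0 ⊗ v4 ⊗ (v2 ⊗ (v1 ⊗ v3))) refl ⟩
      Z · z ⁻ · (a · (b ⁻ · B)) ≡⟨ cong (_· (a · (b ⁻ · B))) (sym (commute-↑ m refl)) ⟩
      z ⁻ · Z · (a · (b ⁻ · B)) ∎
      where
      Z = (z ⁻) ↑ m
      B = (b ⁻) ↑ m

  module Null {ez i j} (q : val (ez , i , j) ≡ e) where
    private
      w : Carrier H
      w = a ↥ i · b ↥ j

      w-central : ∀ x → x · w ≡ w · x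
      w-central x = ·-cancelˡ (z ↥ ez) (trans (sym (assoc _ _ _)) (trans (cong (_· w) (sym (↥-central ez x))) (trans (assoc _ _ _) (trans (cong (x ·_) zw) (trans (identityʳ x)
        (sym (trans (sym (assoc _ _ _)) (trans (cong (_· x) zw) (identityˡ x)))))))))
        where
        zw : z ↥ ez · w ≡ e
        zw = trans (sym (assoc _ _ _)) q

    opaque
      -- The product a^i b^j is inverse to a power of `z` and hence central, but moving it past `b`
      -- costs the factor z^i. Likewise moving it past `a` gives z^j = 1.
      zi : z ↥ i ≡ e
      zi = ·-cancelʳ (w · b) (begin
        z ↥ i · (a ↥ i · b ↥ j · b) ≡⟨ cong (z ↥ i ·_) (trans (assoc _ _ _) (trans (cong (a ↥ i ·_) (sym (b-self j))) (sym (assoc _ _ _)))) ⟩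
        z ↥ i · (a ↥ i · b · b ↥ j) ≡⟨ sym (assoc _ _ _) ⟩
        z ↥ i · (a ↥ i · b) · b ↥ j ≡⟨ cong (_· b ↥ j) (sym (b-a↥ i)) ⟩
        b · a ↥ i · b ↥ j ≡⟨ assoc _ _ _ ⟩
        b · w ≡⟨ w-central b ⟩
        w · b ≡⟨ sym (identityˡ _) ⟩
        e · (w · b) ∎)
        where
        open ≡-Reasoning
        b-self : ∀ j → b · b ↥ j ≡ b ↥ j · b
        b-self (+ m) = commute-↑ m refl
        b-self -[1+ m ] = commute-↑ (suc m) (sym (⁻-commute refl))

    opaque
      zj : z ↥ j ≡ e
      zj = ·-cancelʳ (a · b ↥ j) (trans (sym (b↥-a j)) (trans (sym ab) (sym (identityˡ _))))
        where
        a-self : ∀ i → a · a ↥ i ≡ a ↥ i · a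
        a-self (+ m) = commute-↑ m refl
        a-self -[1+ m ] = commute-↑ (suc m) (sym (⁻-commute refl))
        ab : a · b ↥ j ≡ b ↥ j · a
        ab = ·-cancelˡ (a ↥ i) (trans (sym (assoc _ _ _)) (trans (cong (_· b ↥ j) (sym (a-self i))) (trans (assoc _ _ _) (trans (w-central a) (assoc _ _ _)))))

  opaque
    z-order : ∀ i → z ↥ i ≡ e → 3 ∣ ∣ i ∣
    z-order i q = ↑≡e⇒∣ z≢e ∣ i ∣ (↥≡e⇒ i q)

  val-00 : ∀ ez → val (ez , + 0 , + 0) ≡ z ↥ ez
  val-00 ez = trans (identityʳ _) (identityʳ _)

  caseI : z ↑ 3 ≢ e → NormalBiCayley A
  caseI z³≢e = normal-of-criterion criterionI separatesI necessary sufficient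
    where
    opaque
      z-order₉ : ∀ i → z ↥ i ≡ e → 9 ∣ ∣ i ∣
      z-order₉ i q with z-order i q
      ... | divides m r with ↑≡e⇒∣ z³≢e m (trans (sym (↑-*′ z m 3)) (trans (cong (z ↑_) (sym r)) (↥≡e⇒ i q)))
      ...   | divides m' r' = divides m' (trans r (trans (cong (_* 3) r') (*-assoc m' 3 3)))
    last : ∀ ez i j → val (ez , i , j) ≡ e → (not (isZero i ∧ isZero j) ∨ divisible 9 ez) ≡ true
    last ez (+ zero) (+ zero) q = ∣⇒divisible 9 ez (z-order₉ ez (trans (sym (val-00 ez)) q))
    last ez (+ zero) (+ suc _) q = refl
    last ez (+ zero) -[1+ _ ] q = refl
    last ez (+ suc _) j q = refl
    last ez -[1+ _ ] j q = refl
    necessary : ∀ t → val t ≡ e → Criterion.P criterionI t ≡ true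
    necessary (ez , i , j) q = and₃ {divisible 9 i} {divisible 9 j} {not (isZero i ∧ isZero j) ∨ divisible 9 ez}
      (∣⇒divisible 9 i (z-order₉ i (Null.zi {ez} {i} {j} q))) (∣⇒divisible 9 j (z-order₉ j (Null.zj {ez} {i} {j} q))) (last ez i j q)
    sufficient : ∀ t → Criterion.Q criterionI t ≡ true → val t ≡ e
    sufficient (ez , i , j) h with ∧-true {isZero i} h
    ... | zi , h' with ∧-true {isZero j} h'
    ...   | zj , ze = trans (cong₂ (λ i j → val (ez , i , j)) (isZero⇒ i zi) (isZero⇒ j zj)) (trans (val-00 ez) (cong (z ↥_) (isZero⇒ ez ze)))

  module Exponent3 (z³ : z ↑ 3 ≡ e) where
    X Y : Carrier H
    X = a ↑ 3
    Y = b ↑ 3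

    z-kills : ∀ i → 3 ∣ ∣ i ∣ → z ↥ i ≡ e
    z-kills i d with third i d
    ... | i' , refl = trans (↥-·3 z i') (trans (cong (_↥ i') z³) (e-↥ i'))

    ∈z-cube : ∀ {x} → x ∈⟨ z ⟩ → x ↑ 3 ≡ e
    ∈z-cube (k , refl) = trans (↑-swap z k 3) (trans (cong (_↑ k) z³) (e-↑ k))

    ∈z-central : ∀ {x} → x ∈⟨ z ⟩ → ∀ y → y · x ≡ x · y
    ∈z-central (k , refl) y = commute-↑ k (z-central y)

    -- H has class 2, so collecting gives x³ y³ m³ with a commutator m; and m is a power of `z`,
    -- which has cube 1.
    cube-∙ : ∀ x y → (x · y) ↑ 3 ≡ x ↑ 3 · y ↑ 3
    cube-∙ x y = go (y · x · (x · y) ⁻) (Mz.≋⇒∈ (abelian-mod-z y x)) (group (x ∷ y ∷ []) (v1 ⊗ v0) (v1 ⊗ v0 ⊗ (v0 ⊗ v1) ⊖ ⊗ (v0 ⊗ v1)) refl)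
      where
      go : ∀ m → m ∈⟨ z ⟩ → y · x ≡ m · (x · y) → (x · y) ↑ 3 ≡ x ↑ 3 · y ↑ 3
      go m h q = begin
        (x · y) ↑ 3 ≡⟨ group (x ∷ y ∷ []) (v0 ⊗ v1 ⊗ (v0 ⊗ v1 ⊗ (v0 ⊗ v1 ⊗ one))) (v0 ⊗ (v1 ⊗ v0) ⊗ (v1 ⊗ v0) ⊗ v1) refl ⟩
        x · (y · x) · (y · x) · y ≡⟨ cong₂ (λ s t → x · s · t · y) q q ⟩
        x · (m · (x · y)) · (m · (x · y)) · y ≡⟨ cong₂ (λ s t → x · s · t · y) (sym (∈z-central h (x · y))) (sym (∈z-central h (x · y))) ⟩
        x · (x · y · m) · (x · y · m) · y ≡⟨ group (x ∷ y ∷ m ∷ []) (v0 ⊗ (v0 ⊗ v1 ⊗ v2) ⊗ (v0 ⊗ v1 ⊗ v2) ⊗ v1) (v0 ⊗ (v0 ⊗ v1 ⊗ (v2 ⊗ (v0 ⊗ v1)) ⊗ (v2 ⊗ v1))) refl ⟩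
        x · (x · y · (m · (x · y)) · (m · y)) ≡⟨ cong₂ (λ s t → x · (x · y · s · t)) (sym (∈z-central h (x · y))) (sym (∈z-central h y)) ⟩
        x · (x · y · (x · y · m) · (y · m)) ≡⟨ group (x ∷ y ∷ m ∷ []) (v0 ⊗ (v0 ⊗ v1 ⊗ (v0 ⊗ v1 ⊗ v2) ⊗ (v1 ⊗ v2))) (v0 ⊗ v0 ⊗ (v1 ⊗ v0) ⊗ v1 ⊗ (v2 ⊗ v1) ⊗ v2) refl ⟩
        x · x · (y · x) · y · (m · y) · m ≡⟨ cong₂ (λ s t → x · x · s · y · t · m) (trans q (sym (∈z-central h (x · y)))) (sym (∈z-central h y)) ⟩
        x · x · (x · y · m) · y · (y · m) · m ≡⟨ group (x ∷ y ∷ m ∷ []) (v0 ⊗ v0 ⊗ (v0 ⊗ v1 ⊗ v2) ⊗ v1 ⊗ (v1 ⊗ v2) ⊗ v2) (v0 ⊗ v0 ⊗ (v0 ⊗ v1) ⊗ (v2 ⊗ (v1 ⊗ v1)) ⊗ (v2 ⊗ v2)) refl ⟩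
        x · x · (x · y) · (m · (y · y)) · (m · m) ≡⟨ cong (λ t → x · x · (x · y) · t · (m · m)) (sym (∈z-central h (y · y))) ⟩
        x · x · (x · y) · (y · y · m) · (m · m) ≡⟨ group (x ∷ y ∷ m ∷ []) (v0 ⊗ v0 ⊗ (v0 ⊗ v1) ⊗ (v1 ⊗ v1 ⊗ v2) ⊗ (v2 ⊗ v2)) (v0 ⊗ (v0 ⊗ (v0 ⊗ one)) ⊗ (v1 ⊗ (v1 ⊗ (v1 ⊗ one))) ⊗ (v2 ⊗ (v2 ⊗ (v2 ⊗ one)))) refl ⟩
        x ↑ 3 · y ↑ 3 · m ↑ 3 ≡⟨ trans (cong (x ↑ 3 · y ↑ 3 ·_) (∈z-cube h)) (identityʳ _) ⟩
        x ↑ 3 · y ↑ 3 ∎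
        where open ≡-Reasoning

    cube-central : ∀ x y → x ↑ 3 · y ≡ y · x ↑ 3
    cube-central x y = ·-cancelʳ (y ⁻) (trans (group (x ↑ 3 ∷ y ∷ []) (v0 ⊗ v1 ⊗ v1 ⊖) v0 refl) (sym (trans (conj-↑ y x 3) (trans (cong (_↑ 3) (group (x ∷ y ∷ []) (v1 ⊗ v0 ⊗ v1 ⊖) (v1 ⊗ v0 ⊗ (v0 ⊗ v1) ⊖ ⊗ v0) refl))
      (trans (cube-∙ _ x) (trans (cong (_· x ↑ 3) (∈z-cube (Mz.≋⇒∈ (abelian-mod-z y x)))) (identityˡ _)))))))

    XY : X · Y ≡ Y · X
    XY = cube-central a Y

    α-X : α X ≡ X ⁻ · Y
    α-X = trans (α-↑ a 3) (trans (cong (_↑ 3) α-a) (trans (cube-∙ (a ⁻) b) (cong (_· Y) (↑-⁻ a 3))))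

    α-Y : α Y ≡ X ⁻
    α-Y = trans (α-↑ b 3) (trans (cong (_↑ 3) α-b) (↑-⁻ a 3))

    α-∈z : ∀ {x} → x ∈⟨ z ⟩ → α x ≡ x
    α-∈z (k , refl) = trans (α-↑ z k) (cong (_↑ k) α-fixes-z)

    opaque
      normal-form : ∀ h → ∃[ t ] h ≡ val t
      normal-form = H-induction _ (origin , sym (trans (val-00 (+ 0)) refl)) (λ c h (t , q) → move false c t , trans (cong (colour H a b c ·_) q) (move-val false c t))
        (λ c h (t , q) → move true c t , trans (cong (colour H a b c ⁻ ·_) q) (move-val true c t))

    opaque
      -- Here the metacyclic structure enters: `z` is the cube of a power of `g`, and cubing is a
      -- homomorphism that kills the powers of `z`.
      z-cube : ∃[ i ] ∃[ j ] z ≡ X ↥ i · Y ↥ j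
      z-cube with z-exponent
      ... | k , q with normal-form (g ↑ k)
      ...   | (ez , i , j) , r = i , j , trans q (trans (↑-* g k 3) (trans (cong (_↑ 3) r) (trans (cube-∙ (z ↥ ez · a ↥ i) (b ↥ j)) (cong₂ _·_
          (trans (cube-∙ (z ↥ ez) (a ↥ i)) (trans (cong₂ _·_ (∈z-cube (↥-∈ ez)) (↥-↑3 a i)) (identityˡ _))) (↥-↑3 b j)))))

    -- α fixes `z`, hence also `X` if `X` is a power of `z`. But α X = X⁻¹ Y, so Y = X².
    X∈z⇒Y : ∀ c → X ≡ z ↑ c → Y ≡ z ↑ (c + c)
    X∈z⇒Y c q = begin
      Y ≡⟨ group (X ∷ Y ∷ []) v1 (v0 ⊗ (v0 ⊖ ⊗ v1)) refl ⟩
      X · (X ⁻ · Y) ≡⟨ cong (X ·_) (sym α-X) ⟩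
      X · α X ≡⟨ cong₂ _·_ q (trans (α-∈z (c , q)) q) ⟩
      z ↑ c · z ↑ c ≡⟨ sym (↑-+ z c c) ⟩
      z ↑ (c + c) ∎
      where open ≡-Reasoning

    X≢e : X ≢ e
    X≢e q with z-cube
    ... | i , j , r = z≢e (trans r (trans (cong₂ (λ s t → s ↥ i · t ↥ j) q (X∈z⇒Y 0 q)) (trans (cong₂ _·_ (e-↥ i) (e-↥ j)) (identityˡ e))))

    X-outside : ∀ i → ¬ X ∈⟨ z ⟩ → X ↥ i ∈⟨ z ⟩ → 3 ∣ ∣ i ∣
    X-outside i X∉ h with 3 ∣? ∣ i ∣
    ... | yes d = d
    ... | no d = contradiction (∈-root ∣ i ∣ d (↥-∣∣∈ i h)) X∉

    module CaseIII (X∉z : ¬ X ∈⟨ z ⟩) (d : ℕ) (XYd : X · Y ≡ z ↑ d) where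
      private
        Y≡ : Y ≡ z ↑ d · X ⁻
        Y≡ = trans (group (X ∷ Y ∷ []) v1 (v1 ⊗ v0 ⊗ v0 ⊖) refl) (cong (_· X ⁻) (trans (sym XY) XYd))

        -- Applying α to X Y = z^d shows that X⁻¹ Y X⁻¹ equals z^d as well; the quotient of the two
        -- equations is X³ = 1.
        X³ : X ↑ 3 ≡ e
        X³ = begin
          X · (X · (X · e)) ≡⟨ group (X ∷ Y ∷ []) (v0 ⊗ (v0 ⊗ (v0 ⊗ one))) (v0 ⊗ v1 ⊗ (v1 ⊖ ⊗ v0 ⊗ v0)) refl ⟩
          X · Y · (Y ⁻ · X · X) ≡⟨ cong₂ (λ s t → s · (t · X)) XYd (⁻-commute (sym XY)) ⟩
          z ↑ d · (X · Y ⁻ · X) ≡⟨ cong (z ↑ d ·_) (group (X ∷ Y ∷ []) (v0 ⊗ v1 ⊖ ⊗ v0) ((v0 ⊖ ⊗ v1 ⊗ v0 ⊖) ⊖) refl) ⟩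
          z ↑ d · (X ⁻ · Y · X ⁻) ⁻ ≡⟨ cong (λ t → z ↑ d · t ⁻) (trans (sym (trans (α-∙ X Y) (cong₂ _·_ α-X α-Y))) (trans (cong α XYd) (α-∈z (d , refl)))) ⟩
          z ↑ d · (z ↑ d) ⁻ ≡⟨ inverseʳ _ ⟩
          e ∎
          where open ≡-Reasoning

        X-kills : ∀ i → 3 ∣ ∣ i ∣ → X ↥ i ≡ e
        X-kills i h with third i h
        ... | i' , refl = trans (↥-·3 X i') (trans (cong (_↥ i') X³) (e-↥ i'))

        XY↥ : ∀ i j → X ↥ i · Y ↥ j ≡ z ↥ (+ d ℤ.* j) · X ↥ (i ℤ.- j)
        XY↥ i j = begin
          X ↥ i · Y ↥ j ≡⟨ cong (λ t → X ↥ i · t ↥ j) Y≡ ⟩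
          X ↥ i · (z ↑ d · X ⁻) ↥ j ≡⟨ cong (X ↥ i ·_) (trans (↥-· j (sym (∈z-central (d , refl) (X ⁻)))) (cong₂ _·_ (↥-scale z d j) (↥-neg X j))) ⟩
          X ↥ i · (z ↥ (+ d ℤ.* j) · X ↥ (ℤ.- j)) ≡⟨ trans (sym (assoc _ _ _)) (trans (cong (_· X ↥ (ℤ.- j)) (↥-central (+ d ℤ.* j) (X ↥ i))) (assoc _ _ _)) ⟩
          z ↥ (+ d ℤ.* j) · (X ↥ i · X ↥ (ℤ.- j)) ≡⟨ cong (z ↥ (+ d ℤ.* j) ·_) (sym (↥-+ X i (ℤ.- j))) ⟩
          z ↥ (+ d ℤ.* j) · X ↥ (i ℤ.- j) ∎
          where open ≡-Reasoning

        val-thirds : ∀ ez i j → val (ez , i ℤ.* + 3 , j ℤ.* + 3) ≡ z ↥ (ez ℤ.+ + d ℤ.* j) · X ↥ (i ℤ.- j)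
        val-thirds ez i j = begin
          z ↥ ez · a ↥ (i ℤ.* + 3) · b ↥ (j ℤ.* + 3) ≡⟨ cong₂ (λ s t → z ↥ ez · s · t) (↥-·3 a i) (↥-·3 b j) ⟩
          z ↥ ez · X ↥ i · Y ↥ j ≡⟨ trans (assoc _ _ _) (cong (z ↥ ez ·_) (XY↥ i j)) ⟩
          z ↥ ez · (z ↥ (+ d ℤ.* j) · X ↥ (i ℤ.- j)) ≡⟨ trans (sym (assoc _ _ _)) (cong (_· X ↥ (i ℤ.- j)) (sym (↥-+ z ez (+ d ℤ.* j)))) ⟩
          z ↥ (ez ℤ.+ + d ℤ.* j) · X ↥ (i ℤ.- j) ∎
          where open ≡-Reasoning

        factor₁ : ∀ i j → i ℤ.* + 3 ℤ.- j ℤ.* + 3 ≡ (i ℤ.- j) ℤ.* + 3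
        factor₁ = ℤSolver.+-*-Solver.solve 2 (λ i j → i :* con (+ 3) :- j :* con (+ 3) := (i :- j) :* con (+ 3)) refl
          where open ℤSolver.+-*-Solver

        factor₂ : ∀ ez j → + d ℤ.* (j ℤ.* + 3) ℤ.+ + 3 ℤ.* ez ≡ (ez ℤ.+ + d ℤ.* j) ℤ.* + 3
        factor₂ ez j = ℤSolver.+-*-Solver.solve 3 (λ d ez j → d :* (j :* con (+ 3)) :+ con (+ 3) :* ez := (ez :+ d :* j) :* con (+ 3)) refl (+ d) ez j
          where open ℤSolver.+-*-Solver

        necessary′ : ∀ ez i' j' → val (ez , i' ℤ.* + 3 , j' ℤ.* + 3) ≡ e → divisible 3 (i' ℤ.* + 3) ∧ (divisible 3 (j' ℤ.* + 3) ∧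
          (divisible 9 (i' ℤ.* + 3 ℤ.- j' ℤ.* + 3) ∧ divisible 9 (+ d ℤ.* (j' ℤ.* + 3) ℤ.+ + 3 ℤ.* ez))) ≡ true
        necessary′ ez i' j' q = and₄ {divisible 3 (i' ℤ.* + 3)} {divisible 3 (j' ℤ.* + 3)} {divisible 9 (i' ℤ.* + 3 ℤ.- j' ℤ.* + 3)} {divisible 9 (+ d ℤ.* (j' ℤ.* + 3) ℤ.+ + 3 ℤ.* ez)}
            (∣⇒divisible 3 (i' ℤ.* + 3) (z-order (i' ℤ.* + 3) (Null.zi {ez} {i' ℤ.* + 3} {j' ℤ.* + 3} q))) (∣⇒divisible 3 (j' ℤ.* + 3) (z-order (j' ℤ.* + 3) (Null.zj {ez} {i' ℤ.* + 3} {j' ℤ.* + 3} q)))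
            (∣⇒divisible 9 (i' ℤ.* + 3 ℤ.- j' ℤ.* + 3) (subst (λ t → 9 ∣ ∣ t ∣) (sym (factor₁ i' j')) (third∣9 (i' ℤ.- j') dij)))
            (∣⇒divisible 9 (+ d ℤ.* (j' ℤ.* + 3) ℤ.+ + 3 ℤ.* ez) (subst (λ t → 9 ∣ ∣ t ∣) (sym (factor₂ ez j')) (third∣9 (ez ℤ.+ + d ℤ.* j') (z-order (ez ℤ.+ + d ℤ.* j') ze))))
          where
          q' : z ↥ (ez ℤ.+ + d ℤ.* j') · X ↥ (i' ℤ.- j') ≡ e
          q' = trans (sym (val-thirds ez i' j')) q
          dij : 3 ∣ ∣ i' ℤ.- j' ∣
          dij = X-outside (i' ℤ.- j') X∉z (subst (_∈⟨ z ⟩) (sym (inv-unique _ _ q')) (∈-⁻ (↥-∈ (ez ℤ.+ + d ℤ.* j'))))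
          ze : z ↥ (ez ℤ.+ + d ℤ.* j') ≡ e
          ze = trans (sym (identityʳ _)) (trans (cong (z ↥ (ez ℤ.+ + d ℤ.* j') ·_) (sym (X-kills (i' ℤ.- j') dij))) q')

        necessary : ∀ t → val t ≡ e → Criterion.P (criterionIII d) t ≡ true
        necessary (ez , i , j) q = go i j q (third i (z-order i (Null.zi {ez} {i} {j} q))) (third j (z-order j (Null.zj {ez} {i} {j} q)))
          where
          go : ∀ i j → val (ez , i , j) ≡ e → ∃[ i' ] i ≡ i' ℤ.* + 3 → ∃[ j' ] j ≡ j' ℤ.* + 3 → Criterion.P (criterionIII d) (ez , i , j) ≡ true
          go i j q (i' , refl) (j' , refl) = necessary′ ez i' j' q

        sufficient : ∀ t → Criterion.Q (criterionIII d) t ≡ true → val t ≡ e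
        sufficient (ez , i , j) h = go i j (third i (divisible⇒∣ 3 i (proj₁ h₁))) (third j (divisible⇒∣ 3 j (proj₁ h₂))) (proj₁ h₃) (proj₂ h₃)
          where
          h₁ = ∧-true {divisible 3 i} h
          h₂ = ∧-true {divisible 3 j} (proj₂ h₁)
          h₃ = ∧-true {divisible 9 (i ℤ.- j)} (proj₂ h₂)
          go : ∀ i j → ∃[ i' ] i ≡ i' ℤ.* + 3 → ∃[ j' ] j ≡ j' ℤ.* + 3 → divisible 9 (i ℤ.- j) ≡ true → divisible 9 (+ d ℤ.* j ℤ.+ + 3 ℤ.* ez) ≡ true → val (ez , i , j) ≡ e
          go i j (i' , refl) (j' , refl) hij he = trans (val-thirds ez i' j') (trans (cong₂ _·_
            (z-kills (ez ℤ.+ + d ℤ.* j') (3∣third (ez ℤ.+ + d ℤ.* j') (subst (λ t → 9 ∣ ∣ t ∣) (factor₂ ez j') (divisible⇒∣ 9 (+ d ℤ.* (j' ℤ.* + 3) ℤ.+ + 3 ℤ.* ez) he))))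
            (X-kills (i' ℤ.- j') (3∣third (i' ℤ.- j') (subst (λ t → 9 ∣ ∣ t ∣) (factor₁ i' j') (divisible⇒∣ 9 (i' ℤ.* + 3 ℤ.- j' ℤ.* + 3) hij))))) (identityˡ e))

      -- With X Y = 1, `z-cube` would make `z` a power of `X`. The exponent is divisible by 3
      -- because `X` is outside ⟨z⟩, and then X³ = 1 gives z = 1.
      d≢0 : d ≢ 0
      d≢0 refl with z-cube
      ... | i , j , r = impossible (3 ∣? ∣ i ℤ.- j ∣)
        where
        zX : z ≡ X ↥ (i ℤ.- j)
        zX = trans r (trans (XY↥ i j) (trans (cong (λ t → z ↥ t · X ↥ (i ℤ.- j)) (ℤₚ.*-zeroˡ j)) (identityˡ _)))
        impossible : Dec (3 ∣ ∣ i ℤ.- j ∣) → ⊥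
        impossible (yes q) = z≢e (trans zX (X-kills (i ℤ.- j) q))
        impossible (no q) = q (X-outside (i ℤ.- j) X∉z (1 , trans (sym zX) (sym (↑-1 z))))

      normalIII : Separates (criterionIII d) → NormalBiCayley A
      normalIII ok = normal-of-criterion (criterionIII d) ok necessary sufficient

    module CaseII (X∉z : ¬ X ∈⟨ z ⟩) (XY∉z : ¬ X · Y ∈⟨ z ⟩) where
      open Mz

      private
        opaque
          -- In additive notation modulo z, α acts as a cube root of unity ω: Y = (1 + ω) X and X Y
          -- becomes (2 + ω) X, where 2 + ω is the prime above 3. A relation multiplied by its
          -- conjugate gives the norm i² + i j + j², congruent to (i - j)² modulo 3, whence i ≡ j.
          -- If 3 did not divide j, then (2 + ω) X would vanish.
          lattice : ∀ i j → X ↑ i · Y ↑ j ≋ e → (3 ∣ i) × (3 ∣ j)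
          lattice i j q = both
            where
            open +-*-Solver
            α-≋ : ∀ {x y} → x ≋ y → α x ≋ α y
            α-≋ {x} {y} (mod m) = mod (subst (_∈⟨ z ⟩) (trans (sym (α-∈z m)) (trans (α-∙ x (y ⁻)) (cong (α x ·_) (α-⁻ y)))) m)
            Yi : Y ↑ i ≋ X ↑ (i + j)
            Yi = ≋-trans (≋-reflexive (group (X ↑ i ∷ Y ↑ i ∷ X ↑ j ∷ []) v1 (v0 ⊗ (v0 ⊖ ⊗ v1 ⊗ v2 ⊖) ⊗ v2) refl))
              (≋-trans (≋-· (≋-· (≋-refl {X ↑ i}) αq) (≋-refl {X ↑ j})) (≋-reflexive (trans (cong (_· X ↑ j) (identityʳ _)) (sym (↑-+ X i j)))))
              where
              αq : (X ↑ i) ⁻ · Y ↑ i · (X ↑ j) ⁻ ≋ e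
              αq = ≋-trans (≋-reflexive (sym (trans (α-∙ _ _) (cong₂ _·_
                (trans (α-↑ X i) (trans (cong (_↑ i) α-X) (trans (↑-· i (⁻-commute XY)) (cong (_· Y ↑ i) (↑-⁻ X i))))) (trans (α-↑ Y j) (trans (cong (_↑ j) α-Y) (↑-⁻ X j))))))) (≋-trans (α-≋ q) (≋-reflexive α-e))
            norm : X ↑ (i * i + (i + j) * j) ≋ e
            norm = ≋-trans (≋-reflexive (trans (↑-+ X (i * i) _) (cong₂ _·_ (↑-* X i i) (↑-* X (i + j) j))))
              (≋-trans (≋-· ≋-refl (≋-trans (≋-↑ j (≋-sym Yi)) (≋-reflexive (↑-swap Y i j))))
              (≋-trans (≋-reflexive (sym (↑-· i (commute-↑↑ i j XY)))) (≋-trans (≋-↑ i q) (≋-reflexive (e-↑ i)))))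
            3∣norm : 3 ∣ i * i + (i + j) * j
            3∣norm with 3 ∣? (i * i + (i + j) * j)
            ... | yes d = d
            ... | no d = contradiction (∈-root (i * i + (i + j) * j) d (≋e⇒∈ norm)) X∉z
            -- i² + i j + j² ≡ (i - j)² mod 3
            sq : ∀ i j → j ≤ i → 3 ∣ i * i + (i + j) * j → 3 ∣ i ∸ j
            sq i j le d = [ id , id ]′ (euclidsLemma (i ∸ j) (i ∸ j) pp (∣m+n∣m⇒∣n (subst (3 ∣_) (trans (cong (λ t → t * t + (t + j) * j) (sym (m+[n∸m]≡n le)))
              (solve 2 (λ j t → (j :+ t) :* (j :+ t) :+ (j :+ t :+ j) :* j := con 3 :* (j :* j :+ j :* t) :+ t :* t) refl j (i ∸ j))) d) (m∣m*n (j * j + j * (i ∸ j)))))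
            -- The multipliers `c₁` and `t` of the relation and of its image under α are chosen so
            -- that `X` and `Y` receive the same exponent `n'`. It is congruent to j² modulo 3, so a
            -- root can be taken and X Y lies in ⟨z⟩.
            unit-case : ∀ j t → X ↑ (j + t * 3) · Y ↑ j ≋ e → Y ↑ (j + t * 3) ≋ X ↑ (j + t * 3 + j) → ¬ 3 ∣ j → ⊥
            unit-case j t q Yi nd = XY∉z (∈-root n' unit (≋e⇒∈ (≋-trans (≋-reflexive (↑-· n' XY)) XYn)))
              where
              i' c₁ n' : ℕ
              i' = j + t * 3
              c₁ = j + 2 * t
              n' = j * j + 3 * (j * t + t * t)
              unit : ¬ 3 ∣ n'
              unit d with euclidsLemma j j pp (∣m+n∣m⇒∣n (subst (3 ∣_) (+-comm (j * j) _) d) (m∣m*n (j * t + t * t)))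
              ... | inj₁ d' = nd d'
              ... | inj₂ d' = nd d'
              XYn : X ↑ n' · Y ↑ n' ≋ e
              XYn = ≋-cancelʳ (X ↑ ((i' + j) * t)) (≋-trans (≋-reflexive (trans (assoc _ _ _) (trans (cong (X ↑ n' ·_) (sym (commute-↑↑ ((i' + j) * t) n' XY))) (trans (sym (assoc _ _ _)) (cong (_· Y ↑ n') (sym (↑-+ X n' _)))))))
                (≋-trans (≋-reflexive (cong₂ (λ s t → X ↑ s · Y ↑ t)
                   (solve 2 (λ j t → j :* j :+ con 3 :* (j :* t :+ t :* t) :+ (j :+ t :* con 3 :+ j) :* t := (j :+ t :* con 3) :* (j :+ con 2 :* t)) refl j t)
                   (solve 2 (λ j t → j :* j :+ con 3 :* (j :* t :+ t :* t) := j :* (j :+ con 2 :* t) :+ (j :+ t :* con 3) :* t) refl j t)))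
                (≋-trans (≋-reflexive (trans (cong₂ _·_ (↑-* X i' c₁) (trans (↑-+ Y (j * c₁) (i' * t)) (cong₂ _·_ (↑-* Y j c₁) (↑-* Y i' t)))) (sym (assoc _ _ _))))
                (≋-trans (≋-· (≋-reflexive (sym (↑-· c₁ (commute-↑↑ i' j XY)))) ≋-refl)
                (≋-trans (≋-· (≋-trans (≋-↑ c₁ q) (≋-reflexive (e-↑ c₁))) (≋-↑ t Yi)) (≋-reflexive (cong (e ·_) (sym (↑-* X (i' + j) t)))))))))
            -- Adding multiples of the orders of X and Y to i makes i ∸ j an honest difference.
            big : ℕ
            big = j * 3 ^ K
            i⁺ : ℕ
            i⁺ = i + big
            j≤i⁺ : j ≤ i⁺
            j≤i⁺ = ≤-trans (m≤m*n j (3 ^ K) {{≢-nonZero (m<n⇒n≢0 (0<p^ K))}}) (m≤n+m big i)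
            enlarge : ∀ (x : Carrier H) m → x ↑ (m + big) ≡ x ↑ m
            enlarge x m = trans (↑-+ x m big) (trans (cong (x ↑ m ·_) (↑-multiple x j)) (identityʳ _))
            diff : 3 ∣ i⁺ ∸ j
            diff = sq i⁺ j j≤i⁺ 3∣norm⁺
              where
              norm⁺ : X ↑ (i⁺ * i⁺ + (i⁺ + j) * j) ≋ e
              norm⁺ = ≋-trans (≋-reflexive (begin
                X ↑ (i⁺ * i⁺ + (i⁺ + j) * j) ≡⟨ ↑-+ X (i⁺ * i⁺) _ ⟩
                X ↑ (i⁺ * i⁺) · X ↑ ((i⁺ + j) * j) ≡⟨ cong₂ _·_ (trans (↑-* X i⁺ i⁺) (trans (enlarge _ i) (trans (cong (_↑ i) (enlarge X i)) (sym (↑-* X i i)))))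
                     (trans (↑-* X (i⁺ + j) j) (trans (cong (_↑ j) (trans (cong (X ↑_) (trans (+-assoc i big j) (trans (cong (λ t → i + t) (+-comm big j)) (sym (+-assoc i j big))))) (enlarge X (i + j)))) (sym (↑-* X (i + j) j)))) ⟩
                X ↑ (i * i) · X ↑ ((i + j) * j) ≡⟨ sym (↑-+ X (i * i) _) ⟩
                X ↑ (i * i + (i + j) * j) ∎)) norm
                where open ≡-Reasoning
              3∣norm⁺ : 3 ∣ i⁺ * i⁺ + (i⁺ + j) * j
              3∣norm⁺ with 3 ∣? (i⁺ * i⁺ + (i⁺ + j) * j)
              ... | yes d = d
              ... | no d = contradiction (∈-root (i⁺ * i⁺ + (i⁺ + j) * j) d (≋e⇒∈ norm⁺)) X∉z
            3∣j : 3 ∣ j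
            3∣j = go (3 ∣? j) diff
              where
              go : Dec (3 ∣ j) → 3 ∣ i⁺ ∸ j → 3 ∣ j
              go (yes d) _ = d
              go (no d) (divides t r) = ⊥-elim (unit-case j t
                (subst (λ s → X ↑ s · Y ↑ j ≋ e) i⁺≡ (≋-trans (≋-reflexive (cong (_· Y ↑ j) (enlarge X i))) q))
                (subst (λ s → Y ↑ s ≋ X ↑ (s + j)) i⁺≡ (≋-trans (≋-reflexive (enlarge Y i)) (≋-trans Yi (≋-reflexive (sym (trans (cong (X ↑_) (trans (+-assoc i big j) (trans (cong (λ t → i + t) (+-comm big j)) (sym (+-assoc i j big))))) (enlarge X (i + j))))))))
                d)
                where
                i⁺≡ : i⁺ ≡ j + t * 3
                i⁺≡ = trans (sym (m+[n∸m]≡n j≤i⁺)) (cong (λ s → j + s) r)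
            both : (3 ∣ i) × (3 ∣ j)
            both = [ id , id ]′ (euclidsLemma i i pp (∣m+n∣m⇒∣n (subst (3 ∣_) (+-comm (i * i) _) 3∣norm) (∣n⇒∣m*n (i + j) 3∣j))) , 3∣j

        rep : ℤ → ℕ
        rep (+ m) = m
        -- The additional factor 3 makes the multiplier congruent to -1 modulo 3 even for K = 0, so
        -- divisibility by 3 is preserved.
        rep -[1+ m ] = (3 * 3 ^ K ∸ 1) * suc m

        ↥-rep : ∀ x i → x ↥ i ≡ x ↑ rep i
        ↥-rep x (+ m) = refl
        ↥-rep x -[1+ m ] = trans (cong (_↑ suc m) (sym (inv-unique x _ (trans (cong (x ↑_) (m+[n∸m]≡n pos)) (trans (↑-* x 3 (3 ^ K)) (↑-p^K _)))))) (sym (↑-* x (3 * 3 ^ K ∸ 1) (suc m)))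
          where
          pos : 1 ≤ 3 * 3 ^ K
          pos = 0<p^ (suc K)

        rep-∣ : ∀ i → 3 ∣ rep i → 3 ∣ ∣ i ∣
        rep-∣ (+ m) d = d
        rep-∣ -[1+ m ] d = ∣m+n∣m⇒∣n (subst (3 ∣_) (trans (cong (_* suc m) (sym (m+[n∸m]≡n (0<p^ (suc K))))) (+-comm (suc m) _)) (∣m⇒∣m*n (suc m) (m∣m*n (3 ^ K)))) d

        opaque
          thirds : ∀ ez i j → val (ez , i , j) ≡ e → (9 ∣ ∣ i ∣) × (9 ∣ ∣ j ∣)
          thirds ez i j q = go i j q (third i (z-order i (Null.zi {ez} {i} {j} q))) (third j (z-order j (Null.zj {ez} {i} {j} q)))
            where
            go : ∀ i j → val (ez , i , j) ≡ e → ∃[ i' ] i ≡ i' ℤ.* + 3 → ∃[ j' ] j ≡ j' ℤ.* + 3 → (9 ∣ ∣ i ∣) × (9 ∣ ∣ j ∣)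
            go i j q (i' , refl) (j' , refl) = third∣9 i' (rep-∣ i' (proj₁ both)) , third∣9 j' (rep-∣ j' (proj₂ both))
              where
              q' : z ↥ ez · (X ↥ i' · Y ↥ j') ≡ e
              q' = trans (sym (assoc _ _ _)) (trans (cong₂ (λ s t → z ↥ ez · s · t) (sym (↥-·3 a i')) (sym (↥-·3 b j'))) q)
              both : (3 ∣ rep i') × (3 ∣ rep j')
              both = lattice (rep i') (rep j') (∈⇒≋e (subst (_∈⟨ z ⟩) (trans (sym (inv-unique _ _ q')) (cong₂ _·_ (↥-rep X i') (↥-rep Y j'))) (∈-⁻ (↥-∈ ez))))

        last : ∀ ez i j → val (ez , i , j) ≡ e → (not (isZero i ∧ isZero j) ∨ divisible 3 ez) ≡ true
        last ez (+ zero) (+ zero) q = ∣⇒divisible 3 ez (z-order ez (trans (sym (val-00 ez)) q))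
        last ez (+ zero) (+ suc _) q = refl
        last ez (+ zero) -[1+ _ ] q = refl
        last ez (+ suc _) j q = refl
        last ez -[1+ _ ] j q = refl

      normalII : NormalBiCayley A
      normalII = normal-of-criterion criterionII separatesII necessary sufficient
        where
        necessary : ∀ t → val t ≡ e → Criterion.P criterionII t ≡ true
        necessary (ez , i , j) q = and₃ {divisible 9 i} {divisible 9 j} {not (isZero i ∧ isZero j) ∨ divisible 3 ez}
          (∣⇒divisible 9 i (proj₁ (thirds ez i j q))) (∣⇒divisible 9 j (proj₂ (thirds ez i j q))) (last ez i j q)
        sufficient : ∀ t → Criterion.Q criterionII t ≡ true → val t ≡ e
        sufficient (ez , i , j) h with ∧-true {isZero i} h
        ... | zi , h' with ∧-true {isZero j} h'
        ...   | zj , ze = trans (cong₂ (λ i j → val (ez , i , j)) (isZero⇒ i zi) (isZero⇒ j zj)) (trans (val-00 ez) (z-kills ez (divisible⇒∣ 3 ez ze)))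

    private
      power? : ∀ x → x ∈⟨ z ⟩ → x ≡ e ⊎ x ≡ z ⊎ x ≡ z ↑ 2
      power? x (k , q) = go (k % 3) (m%n<n k 3) (trans q (trans (cong (z ↑_) (m≡m%n+[m/n]*n k 3)) (trans (↑-+ z (k % 3) (k / 3 * 3)) (trans (cong (z ↑ (k % 3) ·_) (trans (↑-*′ z (k / 3) 3) (trans (cong (_↑ (k / 3)) z³) (e-↑ (k / 3))))) (identityʳ _)))))
        where
        go : ∀ r → r < 3 → x ≡ z ↑ r → x ≡ e ⊎ x ≡ z ⊎ x ≡ z ↑ 2
        go 0 _ q = inj₁ q
        go 1 _ q = inj₂ (inj₁ (trans q (↑-1 z)))
        go 2 _ q = inj₂ (inj₂ q)
        go (suc (suc (suc r))) (s≤s (s≤s (s≤s ()))) q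

      ∈z? : ∀ x → Dec (x ∈⟨ z ⟩)
      ∈z? x with x ≟ e | x ≟ z | x ≟ z ↑ 2
      ... | yes q | _ | _ = yes (0 , q)
      ... | no _ | yes q | _ = yes (1 , trans q (sym (↑-1 z)))
      ... | no _ | no _ | yes q = yes (2 , q)
      ... | no p | no q | no r = no λ h → [ p , [ q , r ]′ ]′ (power? x h)

    cases : (X ≡ z ⊎ X ≡ z ↑ 2) ⊎ NormalBiCayley A
    cases = outer (∈z? X)
      where
      nontrivial : X ≡ e ⊎ X ≡ z ⊎ X ≡ z ↑ 2 → X ≡ z ⊎ X ≡ z ↑ 2
      nontrivial (inj₁ q) = contradiction q X≢e
      nontrivial (inj₂ q) = q
      finish : ¬ X ∈⟨ z ⟩ → X · Y ≡ e ⊎ X · Y ≡ z ⊎ X · Y ≡ z ↑ 2 → NormalBiCayley A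
      finish X∉z (inj₁ q) = contradiction refl (CaseIII.d≢0 X∉z 0 q)
      finish X∉z (inj₂ (inj₁ q)) = CaseIII.normalIII X∉z 1 (trans q (sym (↑-1 z))) separatesIII₁
      finish X∉z (inj₂ (inj₂ q)) = CaseIII.normalIII X∉z 2 q separatesIII₂
      inner : ¬ X ∈⟨ z ⟩ → Dec (X · Y ∈⟨ z ⟩) → NormalBiCayley A
      inner X∉z (no XY∉z) = CaseII.normalII X∉z XY∉z
      inner X∉z (yes h) = finish X∉z (power? (X · Y) h)
      outer : Dec (X ∈⟨ z ⟩) → (X ≡ z ⊎ X ≡ z ↑ 2) ⊎ NormalBiCayley A
      outer (yes h) = inj₁ (nontrivial (power? X h))
      outer (no X∉z) = inj₂ (inner X∉z (∈z? (X · Y)))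

-- The Gray graph

Coordinates : Set
Coordinates = Fin 3 × Fin 3 × Fin 3

_≟ᶜ_ : (m m' : Coordinates) → Dec (m ≡ m')
_≟ᶜ_ = ≡-dec _≟_ (≡-dec _≟_ _≟_)

shift₃ : Fin 3 → ℕ → Fin 3
shift₃ x k = (toℕ x + k) mod 3

-- Left multiplication on z^e a^i b^j when a³ = z^c, b³ = z^2c and z³ = 1.
multiply : ℕ → Fin 3 → Bool → Coordinates → Coordinates
multiply c 0F s m = m
multiply c 1F false (e , 2F , j) = shift₃ e c , 0F , j
multiply c 1F false (e , i , j) = e , shift₃ i 1 , j
multiply c 2F false (e , i , 2F) = shift₃ e (toℕ i + (c + c)) , i , 0F
multiply c 2F false (e , i , j) = shift₃ e (toℕ i) , i , shift₃ j 1
multiply c 1F true (e , 0F , j) = shift₃ e (c + c) , 2F , j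
multiply c 1F true (e , i , j) = e , shift₃ i 2 , j
multiply c 2F true (e , i , 0F) = shift₃ e (toℕ i + toℕ i + c) , i , 2F
multiply c 2F true (e , i , j) = shift₃ e (toℕ i + toℕ i) , i , shift₃ j 2

Vertex : Set
Vertex = Bool × Coordinates

neighbourᵐ : ℕ → Fin 3 → Vertex → Vertex
neighbourᵐ c d (s , m) = not s , multiply c d s m

position : Vertex → Fin 54
position (s , e , i , j) = (27 * ⟦ s ⟧ + 9 * toℕ e + 3 * toℕ i + toℕ j) mod 54

vertexAt : ℕ → Vertex
vertexAt k = not (k <ᵇ 27) , ((k % 27) / 9) mod 3 , ((k % 9) / 3) mod 3 , k mod 3

-- An isomorphism of the coordinate graph onto the Gray graph and its inverse, for c = 1 and c = 2, found by computer search.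
encodeTable decodeTable : Bool → Vec ℕ 54
encodeTable false = 0 ∷ 1 ∷ 7 ∷ 3 ∷ 19 ∷ 6 ∷ 5 ∷ 22 ∷ 24 ∷ 23 ∷ 21 ∷ 18 ∷ 26 ∷ 12 ∷ 20 ∷ 25 ∷ 15 ∷ 11 ∷ 16 ∷ 17 ∷ 14 ∷ 10 ∷ 8 ∷ 13 ∷ 9 ∷ 2 ∷ 4 ∷ 27 ∷ 45 ∷ 37 ∷ 36 ∷ 28 ∷ 47 ∷ 46 ∷ 43 ∷ 33 ∷ 32 ∷ 52 ∷ 42 ∷ 44 ∷ 30 ∷ 51 ∷ 53 ∷ 39 ∷ 29 ∷ 34 ∷ 50 ∷ 41 ∷ 40 ∷ 35 ∷ 49 ∷ 48 ∷ 38 ∷ 31 ∷ []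
encodeTable true = 27 ∷ 42 ∷ 52 ∷ 48 ∷ 33 ∷ 43 ∷ 40 ∷ 47 ∷ 28 ∷ 32 ∷ 41 ∷ 50 ∷ 46 ∷ 29 ∷ 39 ∷ 36 ∷ 51 ∷ 30 ∷ 34 ∷ 37 ∷ 45 ∷ 53 ∷ 31 ∷ 38 ∷ 44 ∷ 49 ∷ 35 ∷ 0 ∷ 18 ∷ 21 ∷ 9 ∷ 24 ∷ 22 ∷ 10 ∷ 6 ∷ 19 ∷ 23 ∷ 14 ∷ 17 ∷ 5 ∷ 11 ∷ 15 ∷ 3 ∷ 20 ∷ 12 ∷ 16 ∷ 7 ∷ 1 ∷ 25 ∷ 4 ∷ 2 ∷ 26 ∷ 13 ∷ 8 ∷ []
decodeTable false = 0 ∷ 1 ∷ 25 ∷ 3 ∷ 26 ∷ 6 ∷ 5 ∷ 2 ∷ 22 ∷ 24 ∷ 21 ∷ 17 ∷ 13 ∷ 23 ∷ 20 ∷ 16 ∷ 18 ∷ 19 ∷ 11 ∷ 4 ∷ 14 ∷ 10 ∷ 7 ∷ 9 ∷ 8 ∷ 15 ∷ 12 ∷ 27 ∷ 31 ∷ 44 ∷ 40 ∷ 53 ∷ 36 ∷ 35 ∷ 45 ∷ 49 ∷ 30 ∷ 29 ∷ 52 ∷ 43 ∷ 48 ∷ 47 ∷ 38 ∷ 34 ∷ 39 ∷ 28 ∷ 33 ∷ 32 ∷ 51 ∷ 50 ∷ 46 ∷ 41 ∷ 37 ∷ 42 ∷ []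
decodeTable true = 27 ∷ 47 ∷ 50 ∷ 42 ∷ 49 ∷ 39 ∷ 34 ∷ 46 ∷ 53 ∷ 30 ∷ 33 ∷ 40 ∷ 44 ∷ 52 ∷ 37 ∷ 41 ∷ 45 ∷ 38 ∷ 28 ∷ 35 ∷ 43 ∷ 29 ∷ 32 ∷ 36 ∷ 31 ∷ 48 ∷ 51 ∷ 0 ∷ 8 ∷ 13 ∷ 17 ∷ 22 ∷ 9 ∷ 4 ∷ 18 ∷ 26 ∷ 15 ∷ 19 ∷ 23 ∷ 14 ∷ 6 ∷ 10 ∷ 1 ∷ 5 ∷ 24 ∷ 20 ∷ 12 ∷ 7 ∷ 3 ∷ 25 ∷ 11 ∷ 16 ∷ 2 ∷ 21 ∷ []

cubeExponent : Bool → ℕ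
cubeExponent false = 1
cubeExponent true = 2

encode : Bool → Vertex → Fin 54
encode t v = lookup (encodeTable t) (position v) mod 54

decode : Bool → Fin 54 → Vertex
decode t x = vertexAt (lookup (decodeTable t) x)

neighbourᵍ : Bool → Fin 3 → Fin 54 → Fin 54
neighbourᵍ t d x = encode t (neighbourᵐ (cubeExponent t) d (decode t x))

isNeighbour : Bool → Fin 54 → Fin 54 → Bool
isNeighbour t x y = does (neighbourᵍ t 0F x ≟ y) ∨ does (neighbourᵍ t 1F x ≟ y) ∨ does (neighbourᵍ t 2F x ≟ y)

-- The neighbours are arguments so that they are evaluated once for the whole row.
row? : ∀ x y₀ y₁ y₂ → Dec (∀ y → grayAdj x y ≡ does (y₀ ≟ y) ∨ does (y₁ ≟ y) ∨ does (y₂ ≟ y))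
row? x y₀ y₁ y₂ = all? λ y → grayAdj x y Boolₚ.≟ (does (y₀ ≟ y) ∨ does (y₁ ≟ y) ∨ does (y₂ ≟ y))

opaque
  decode-encode : ∀ t s e i j → decode t (encode t (s , e , i , j)) ≡ (s , e , i , j)
  decode-encode false false = toWitness {a? = all? λ e → all? λ i → all? λ j → ≡-dec Boolₚ._≟_ _≟ᶜ_ (decode false (encode false (false , e , i , j))) (false , e , i , j)} tt
  decode-encode false true = toWitness {a? = all? λ e → all? λ i → all? λ j → ≡-dec Boolₚ._≟_ _≟ᶜ_ (decode false (encode false (true , e , i , j))) (true , e , i , j)} tt
  decode-encode true false = toWitness {a? = all? λ e → all? λ i → all? λ j → ≡-dec Boolₚ._≟_ _≟ᶜ_ (decode true (encode true (false , e , i , j))) (false , e , i , j)} tt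
  decode-encode true true = toWitness {a? = all? λ e → all? λ i → all? λ j → ≡-dec Boolₚ._≟_ _≟ᶜ_ (decode true (encode true (true , e , i , j))) (true , e , i , j)} tt

  encode-decode : ∀ t x → encode t (decode t x) ≡ x
  encode-decode false = toWitness {a? = all? λ x → encode false (decode false x) ≟ x} tt
  encode-decode true = toWitness {a? = all? λ x → encode true (decode true x) ≟ x} tt

  gray-neighbours : ∀ t x y → grayAdj x y ≡ isNeighbour t x y
  gray-neighbours false = toWitness {a? = all? λ x → row? x (neighbourᵍ false 0F x) (neighbourᵍ false 1F x) (neighbourᵍ false 2F x)} tt
  gray-neighbours true = toWitness {a? = all? λ x → row? x (neighbourᵍ true 0F x) (neighbourᵍ true 1F x) (neighbourᵍ true 2F x)} tt

  multiply-inverse : ∀ t d e i j → multiply (cubeExponent t) d false (multiply (cubeExponent t) d true (e , i , j)) ≡ (e , i , j)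
  multiply-inverse false = toWitness {a? = all? λ d → all? λ e → all? λ i → all? λ j → multiply 1 d false (multiply 1 d true (e , i , j)) ≟ᶜ (e , i , j)} tt
  multiply-inverse true = toWitness {a? = all? λ d → all? λ e → all? λ i → all? λ j → multiply 2 d false (multiply 2 d true (e , i , j)) ≟ᶜ (e , i , j)} tt

module Gray (pp : Prime 3) (H : FiniteGroup) (pg : IsPGroup 3 H) (nonabelian : NonAbelian H)
    (Γ : Graph) (A : BiCayleyAction H Γ) (conn : Connected Γ) (haar : HaarGraph H Γ A)
    (g b₀ : Carrier H) (N : Metacyclics.Normal 3 pp H pg g) (G : Metacyclics.Generate 3 pp H pg g b₀) where
  open Metacyclics 3 pp H pg
  open Commutator pp H pg nonabelian Γ A conn haar g b₀ N G

  module Order27 (t : Bool) (z³ : z ↑ 3 ≡ e) (a³ : a ↑ 3 ≡ z ↑ cubeExponent t) (b³ : b ↑ 3 ≡ z ↑ (cubeExponent t + cubeExponent t)) where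
    c : ℕ
    c = cubeExponent t

    private
      monomial : ℕ → ℕ → ℕ → Carrier H
      monomial ez i j = z ↑ ez · (a ↑ i · b ↑ j)

      z-central-↑ : ∀ k x → x · z ↑ k ≡ z ↑ k · x
      z-central-↑ k x = commute-↑ k (z-central x)

      conj-b-a↑ : ∀ i → conj b (a ↑ i) ≡ z ↑ i · a ↑ i
      conj-b-a↑ i = trans (conj-↑ b a i) (trans (cong (_↑ i) (trans (cong (_· b ⁻) ba) (group (a ∷ b ∷ z ∷ []) (v2 ⊗ (v0 ⊗ v1) ⊗ v1 ⊖) (v2 ⊗ v0) refl))) (↑-· i (sym (z-central a))))

      conj-a⁻-b↑ : ∀ j → conj (a ⁻) (b ↑ j) ≡ z ↑ j · b ↑ j
      conj-a⁻-b↑ j = trans (conj-↑ (a ⁻) b j) (trans (cong (_↑ j) q) (↑-· j (sym (z-central b))))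
        where
        q : conj (a ⁻) b ≡ z · b
        q = trans (group (a ∷ b ∷ []) (v0 ⊖ ⊗ v1 ⊗ v0 ⊖ ⊖) (v0 ⊖ ⊗ (v1 ⊗ v0)) refl) (trans (cong (a ⁻ ·_) ba)
          (trans (sym (assoc _ _ _)) (trans (cong (_· (a · b)) (z-central (a ⁻))) (group (a ∷ b ∷ z ∷ []) (v2 ⊗ v0 ⊖ ⊗ (v0 ⊗ v1)) (v2 ⊗ v1) refl))))

      a-monomial : ∀ ez i j → a · monomial ez i j ≡ monomial ez (1 + i) j
      a-monomial ez i j = trans (sym (assoc _ _ _)) (trans (cong (_· (a ↑ i · b ↑ j)) (z-central-↑ ez a)) (group (a ∷ z ↑ ez ∷ a ↑ i ∷ b ↑ j ∷ []) (v1 ⊗ v0 ⊗ (v2 ⊗ v3)) (v1 ⊗ (v0 ⊗ v2 ⊗ v3)) refl))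

      b-monomial : ∀ ez i j → b · monomial ez i j ≡ monomial (ez + i) i (1 + j)
      b-monomial ez i j = begin
        b · (z ↑ ez · (a ↑ i · b ↑ j)) ≡⟨ trans (sym (assoc _ _ _)) (cong (_· (a ↑ i · b ↑ j)) (z-central-↑ ez b)) ⟩
        z ↑ ez · b · (a ↑ i · b ↑ j) ≡⟨ group (b ∷ z ↑ ez ∷ a ↑ i ∷ b ↑ j ∷ []) (v1 ⊗ v0 ⊗ (v2 ⊗ v3)) (v1 ⊗ ((v0 ⊗ v2 ⊗ v0 ⊖) ⊗ (v0 ⊗ v3))) refl ⟩
        z ↑ ez · (conj b (a ↑ i) · (b · b ↑ j)) ≡⟨ cong (λ x → z ↑ ez · (x · (b · b ↑ j))) (conj-b-a↑ i) ⟩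
        z ↑ ez · (z ↑ i · a ↑ i · (b · b ↑ j)) ≡⟨ group (z ↑ ez ∷ z ↑ i ∷ a ↑ i ∷ b · b ↑ j ∷ []) (v0 ⊗ (v1 ⊗ v2 ⊗ v3)) (v0 ⊗ v1 ⊗ (v2 ⊗ v3)) refl ⟩
        z ↑ ez · z ↑ i · (a ↑ i · (b · b ↑ j)) ≡⟨ cong (_· (a ↑ i · (b · b ↑ j))) (sym (↑-+ z ez i)) ⟩
        monomial (ez + i) i (1 + j) ∎
        where open ≡-Reasoning

      monomial-a³ : ∀ ez j → monomial ez 3 j ≡ monomial (ez + c) 0 j
      monomial-a³ ez j = trans (cong (λ x → z ↑ ez · (x · b ↑ j)) a³) (trans (group (z ↑ ez ∷ z ↑ c ∷ b ↑ j ∷ []) (v0 ⊗ (v1 ⊗ v2)) (v0 ⊗ v1 ⊗ (one ⊗ v2)) refl) (cong (_· (e · b ↑ j)) (sym (↑-+ z ez c))))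

      monomial-b³ : ∀ ez i → monomial ez i 3 ≡ monomial (ez + (c + c)) i 0
      monomial-b³ ez i = trans (cong (λ x → z ↑ ez · (a ↑ i · x)) b³) (trans (cong (z ↑ ez ·_) (z-central-↑ (c + c) (a ↑ i)))
        (trans (group (z ↑ ez ∷ z ↑ (c + c) ∷ a ↑ i ∷ []) (v0 ⊗ (v1 ⊗ v2)) (v0 ⊗ v1 ⊗ (v2 ⊗ one)) refl) (cong (_· (a ↑ i · e)) (sym (↑-+ z ez (c + c))))))

      element : Coordinates → Carrier H
      element (ez , i , j) = monomial (toℕ ez) (toℕ i) (toℕ j)

      z-mod : ∀ k → z ↑ toℕ (k mod 3) ≡ z ↑ k
      z-mod k = sym (trans (cong (z ↑_) (m≡m%n+[m/n]*n k 3)) (trans (↑-+ z (k % 3) ((k / 3) * 3)) (trans (cong₂ _·_ (cong (z ↑_) (sym (toℕ-fromℕ< (m%n<n k 3))))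
        (trans (↑-*′ z (k / 3) 3) (trans (cong (_↑ (k / 3)) z³) (e-↑ (k / 3))))) (identityʳ _))))

      monomial-shift : ∀ x k i j → monomial (toℕ x + k) i j ≡ monomial (toℕ (shift₃ x k)) i j
      monomial-shift x k i j = cong (_· (a ↑ i · b ↑ j)) (sym (z-mod (toℕ x + k)))

      multiply-sound⁺ : ∀ d m → colour H a b d · element m ≡ element (multiply c d false m)
      multiply-sound⁺ 0F m = identityˡ _
      multiply-sound⁺ 1F (ez , 0F , j) = a-monomial (toℕ ez) 0 (toℕ j)
      multiply-sound⁺ 1F (ez , 1F , j) = a-monomial (toℕ ez) 1 (toℕ j)
      multiply-sound⁺ 1F (ez , 2F , j) = trans (a-monomial (toℕ ez) 2 (toℕ j)) (trans (monomial-a³ (toℕ ez) (toℕ j)) (monomial-shift ez c 0 (toℕ j)))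
      multiply-sound⁺ 2F (ez , i , 0F) = trans (b-monomial (toℕ ez) (toℕ i) 0) (monomial-shift ez (toℕ i) (toℕ i) 1)
      multiply-sound⁺ 2F (ez , i , 1F) = trans (b-monomial (toℕ ez) (toℕ i) 1) (monomial-shift ez (toℕ i) (toℕ i) 2)
      multiply-sound⁺ 2F (ez , i , 2F) = trans (b-monomial (toℕ ez) (toℕ i) 2) (trans (monomial-b³ (toℕ ez + toℕ i) (toℕ i))
        (trans (cong (λ k → monomial k (toℕ i) 0) (+-assoc (toℕ ez) (toℕ i) (c + c))) (monomial-shift ez (toℕ i + (c + c)) (toℕ i) 0)))

      multiply-sound : ∀ d s m → next H a b d s (element m) ≡ element (multiply c d s m)
      multiply-sound d false m = multiply-sound⁺ d m
      multiply-sound d true m@(ez , i , j) = trans (cong (λ m → colour H a b d ⁻ · element m) (sym (multiply-inverse t d ez i j)))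
        (trans (cong (colour H a b d ⁻ ·_) (sym (multiply-sound⁺ d (multiply c d true m)))) (cancelˡ (colour H a b d) _))

      element-surjective : ∀ h → ∃[ m ] element m ≡ h
      element-surjective = H-induction (λ h → ∃[ m ] element m ≡ h) ((0F , 0F , 0F) , trans (identityˡ _) (identityˡ _))
        (λ { d _ (m , refl) → multiply c d false m , sym (multiply-sound d false m) })
        (λ { d _ (m , refl) → multiply c d true m , sym (multiply-sound d true m) })

      z-injective : ∀ (i i' : Fin 3) → z ↑ toℕ i ≡ z ↑ toℕ i' → i ≡ i'
      z-injective 0F 0F q = refl
      z-injective 1F 1F q = refl
      z-injective 2F 2F q = refl
      z-injective 0F 1F q = contradiction (trans (sym (↑-1 z)) (sym q)) z≢e
      z-injective 1F 0F q = contradiction (trans (sym (↑-1 z)) q) z≢e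
      z-injective 0F 2F q = contradiction (↑≡e 2 (λ d → <⇒≱ ≤-refl (∣⇒≤ d)) (sym q)) z≢e
      z-injective 2F 0F q = contradiction (↑≡e 2 (λ d → <⇒≱ ≤-refl (∣⇒≤ d)) q) z≢e
      z-injective 1F 2F q = contradiction (trans (sym (↑-1 z)) (sym (·-cancelˡ z q))) z≢e
      z-injective 2F 1F q = contradiction (trans (sym (↑-1 z)) (·-cancelˡ z q)) z≢e

      conj-z↑ : ∀ x k → conj x (z ↑ k) ≡ z ↑ k
      conj-z↑ x k = commute⇒conj (z-central-↑ k x)

      conj-↑-self : ∀ x k → conj x (x ↑ k) ≡ x ↑ k
      conj-↑-self x k = commute⇒conj (commute-↑ k refl)

      -- The exponents of a and b are read off from the commutators with b and a⁻¹.
      conj-b-monomial : ∀ ez i j → conj b (monomial ez i j) ≡ z ↑ i · monomial ez i j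
      conj-b-monomial ez i j = trans (conj-· b _ _) (trans (cong₂ _·_ (conj-z↑ b ez) (trans (conj-· b _ _) (cong₂ _·_ (conj-b-a↑ i) (conj-↑-self b j))))
        (trans (trans (cong (z ↑ ez ·_) (assoc _ _ _)) (sym (assoc _ _ _))) (trans (cong (_· (a ↑ i · b ↑ j)) (z-central-↑ i (z ↑ ez))) (assoc _ _ _))))

      conj-a⁻-monomial : ∀ ez i j → conj (a ⁻) (monomial ez i j) ≡ z ↑ j · monomial ez i j
      conj-a⁻-monomial ez i j = trans (conj-· (a ⁻) _ _) (trans (cong₂ _·_ (conj-z↑ (a ⁻) ez) (trans (conj-· (a ⁻) _ _) (cong₂ _·_ a-fixed (conj-a⁻-b↑ j))))
        (trans (cong (z ↑ ez ·_) (trans (sym (assoc _ _ _)) (trans (cong (_· b ↑ j) (z-central-↑ j (a ↑ i))) (assoc _ _ _))))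
        (trans (sym (assoc _ _ _)) (trans (cong (_· (a ↑ i · b ↑ j)) (z-central-↑ j (z ↑ ez))) (assoc _ _ _)))))
        where
        a-fixed : conj (a ⁻) (a ↑ i) ≡ a ↑ i
        a-fixed = trans (cong (conj (a ⁻)) (sym (conj-↑-self a i))) (conj-inv′ a (a ↑ i))

      element-injective : ∀ m m' → element m ≡ element m' → m ≡ m'
      element-injective (ez , i , j) (ez' , i' , j') q = go (z-injective i i' i-eq) (z-injective j j' j-eq)
        where
        i-eq : z ↑ toℕ i ≡ z ↑ toℕ i'
        i-eq = ·-cancelʳ (element (ez , i , j)) (trans (sym (conj-b-monomial (toℕ ez) (toℕ i) (toℕ j))) (trans (cong (conj b) q)
          (trans (conj-b-monomial (toℕ ez') (toℕ i') (toℕ j')) (cong (z ↑ toℕ i' ·_) (sym q)))))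
        j-eq : z ↑ toℕ j ≡ z ↑ toℕ j'
        j-eq = ·-cancelʳ (element (ez , i , j)) (trans (sym (conj-a⁻-monomial (toℕ ez) (toℕ i) (toℕ j))) (trans (cong (conj (a ⁻)) q)
          (trans (conj-a⁻-monomial (toℕ ez') (toℕ i') (toℕ j')) (cong (z ↑ toℕ j' ·_) (sym q)))))
        go : i ≡ i' → j ≡ j' → (ez , i , j) ≡ (ez' , i' , j')
        go refl refl = cong (_, i , j) (z-injective ez ez' (·-cancelʳ _ q))

      vertex : Vertex → Fin (n Γ)
      vertex (s , m) = vtx s (element m)

      vertex-injective : ∀ x y → vertex x ≡ vertex y → x ≡ y
      vertex-injective (s , m) (s' , m') q = cong₂ _,_ (proj₁ (vtx-inj q)) (element-injective m m' (proj₂ (vtx-inj q)))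

      opaque
        coordinates : ∀ v → ∃[ x ] vertex x ≡ v
        coordinates v = let s , h , q = vtx-surj v ; m , r = element-surjective h in (s , m) , trans (cong (vtx s) r) q

      coord : Fin (n Γ) → Vertex
      coord v = proj₁ (coordinates v)

      coord-vertex : ∀ x → coord (vertex x) ≡ x
      coord-vertex x = vertex-injective _ _ (proj₂ (coordinates (vertex x)))

      vertex-neighbour : ∀ d x → vertex (neighbourᵐ c d x) ≡ vtx (not (proj₁ x)) (next H a b d (proj₁ x) (element (proj₂ x)))
      vertex-neighbour d (s , m) = cong (vtx (not s)) (sym (multiply-sound d s m))

      adjacent : ∀ d x → adj Γ (vertex x) (vertex (neighbourᵐ c d x)) ≡ true
      adjacent d x = subst (λ w → adj Γ (vertex x) w ≡ true) (sym (vertex-neighbour d x)) (edge (proj₁ x) (element (proj₂ x)) d)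

      decode-encode′ : ∀ x → decode t (encode t x) ≡ x
      decode-encode′ (s , ez , i , j) = decode-encode t s ez i j

      neighbour⇒ : ∀ x y → isNeighbour t (encode t x) (encode t y) ≡ true → ∃[ d ] neighbourᵐ c d x ≡ y
      neighbour⇒ x y h = go (neighbourᵍ t 0F (encode t x) ≟ encode t y) (neighbourᵍ t 1F (encode t x) ≟ encode t y) (neighbourᵍ t 2F (encode t x) ≟ encode t y) h
        where
        by : ∀ d → neighbourᵍ t d (encode t x) ≡ encode t y → ∃[ d ] neighbourᵐ c d x ≡ y
        by d q = d , trans (cong (neighbourᵐ c d) (sym (decode-encode′ x))) (trans (sym (decode-encode′ _)) (trans (cong (decode t) q) (decode-encode′ y)))
        go : (p₀ : Dec (neighbourᵍ t 0F (encode t x) ≡ encode t y)) (p₁ : Dec (neighbourᵍ t 1F (encode t x) ≡ encode t y)) (p₂ : Dec (neighbourᵍ t 2F (encode t x) ≡ encode t y)) →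
          does p₀ ∨ does p₁ ∨ does p₂ ≡ true → ∃[ d ] neighbourᵐ c d x ≡ y
        go (yes q) _ _ _ = by 0F q
        go (no _) (yes q) _ _ = by 1F q
        go (no _) (no _) (yes q) _ = by 2F q
        go (no _) (no _) (no _) ()

      ⇒neighbour : ∀ d x → isNeighbour t (encode t x) (encode t (neighbourᵐ c d x)) ≡ true
      ⇒neighbour d x = go d (neighbourᵍ t 0F (encode t x) ≟ y) (neighbourᵍ t 1F (encode t x) ≟ y) (neighbourᵍ t 2F (encode t x) ≟ y) same
        where
        y : Fin 54
        y = encode t (neighbourᵐ c d x)
        same : neighbourᵍ t d (encode t x) ≡ y
        same = cong (λ x → encode t (neighbourᵐ c d x)) (decode-encode′ x)
        go : ∀ d (p₀ : Dec (neighbourᵍ t 0F (encode t x) ≡ y)) (p₁ : Dec (neighbourᵍ t 1F (encode t x) ≡ y)) (p₂ : Dec (neighbourᵍ t 2F (encode t x) ≡ y)) →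
          neighbourᵍ t d (encode t x) ≡ y → does p₀ ∨ does p₁ ∨ does p₂ ≡ true
        go _ (yes _) _ _ _ = refl
        go _ (no _) (yes _) _ _ = refl
        go _ (no _) (no _) (yes _) _ = refl
        go 0F (no h) (no _) (no _) q = contradiction q h
        go 1F (no _) (no h) (no _) q = contradiction q h
        go 2F (no _) (no _) (no h) q = contradiction q h

      preserves : ∀ u v → grayAdj (encode t (coord u)) (encode t (coord v)) ≡ adj Γ u v
      preserves u v = trans (gray-neighbours t _ _) (bool-iff
        (λ h → let d , q = neighbour⇒ (coord u) (coord v) h in
          trans (cong₂ (adj Γ) (sym (proj₂ (coordinates u))) (trans (sym (proj₂ (coordinates v))) (cong vertex (sym q)))) (adjacent d (coord u)))
        (λ h → let d , q = edge-only (proj₁ (coord u)) (element (proj₂ (coord u))) v (trans (cong (λ u → adj Γ u v) (proj₂ (coordinates u))) h) in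
          subst (λ y → isNeighbour t (encode t (coord u)) (encode t y) ≡ true)
            (vertex-injective (neighbourᵐ c d (coord u)) (coord v) (trans (vertex-neighbour d (coord u)) (trans (sym q) (sym (proj₂ (coordinates v)))))) (⇒neighbour d (coord u))))

    isGray : Iso Γ GrayGraph
    isGray = record
      { to = λ v → encode t (coord v)
      ; from = λ x → vertex (decode t x)
      ; from∘to = λ v → trans (cong vertex (decode-encode′ (coord v))) (proj₂ (coordinates v))
      ; to∘from = λ x → trans (cong (encode t) (coord-vertex (decode t x))) (encode-decode t x)
      ; adj-pres = preserves }

-- The division into p = 3 and p > 3

odd⇒ : ∀ p → ¬ (2 ∣ p) → ∃[ h ] p ≡ 1 + (h + h)
odd⇒ zero ¬2 = contradiction (2 ∣0) ¬2
odd⇒ (suc zero) ¬2 = 0 , refl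
odd⇒ (suc (suc p)) ¬2 with odd⇒ p (λ d → ¬2 (∣m∣n⇒∣m+n ∣-refl d))
... | h , refl = suc h , cong (λ m → suc (suc m)) (sym (+-suc h h))

prime∣prime : ∀ {p q} → Prime p → Prime q → p ∣ q → p ≡ q
prime∣prime pp pq d with prime⇒irreducible pq d
... | inj₁ refl = contradiction pp ¬prime[1]
... | inj₂ q = q

module PrimeThree (H : FiniteGroup) (pg : IsPGroup 3 H) (nonabelian : NonAbelian H) (Γ : Graph) (conn : Connected Γ)
    (cubic : Cubic Γ) (et : EdgeTransitive Γ) (A : BiCayleyAction H Γ) where
  private
    prime₃ : Prime 3
    prime₃ = toWitness {a? = prime? 3} tt

  open Metacyclics 3 prime₃ H pg

  classification : Metacyclic H → Iso Γ GrayGraph ⊎ NormalBiCayley A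
  classification (g , b₀ , N , G) = case-z³ (z ↑ 3 ≟ e)
    where
    Ng : Normal g
    Ng x = let j , q = N x 1 in j , trans (cong (conj x) (sym (↑-1 g))) q
    haar : HaarGraph H Γ A
    haar = Rotation.haarGraph prime₃ H pg Γ conn cubic et A g b₀ Ng G
    open Cases prime₃ H pg nonabelian Γ A conn haar g b₀ Ng G
    module 𝔾 = Gray prime₃ H pg nonabelian Γ A conn haar g b₀ Ng G
    case-z³ : Dec (z ↑ 3 ≡ e) → Iso Γ GrayGraph ⊎ NormalBiCayley A
    case-z³ (no z³≢e) = inj₂ (caseI z³≢e)
    case-z³ (yes z³) = split cases
      where
      open Exponent3 z³
      gray : ∀ t → X ≡ z ↑ cubeExponent t → Iso Γ GrayGraph ⊎ NormalBiCayley A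
      gray t q = inj₁ (𝔾.Order27.isGray t z³ q (X∈z⇒Y (cubeExponent t) q))
      split : (X ≡ z ⊎ X ≡ z ↑ 2) ⊎ NormalBiCayley A → Iso Γ GrayGraph ⊎ NormalBiCayley A
      split (inj₁ (inj₁ q)) = gray false (trans q (sym (↑-1 z)))
      split (inj₁ (inj₂ q)) = gray true q
      split (inj₂ normal) = inj₂ normal

theorem1p1 : (p : ℕ) → Prime p → ¬ (2 ∣ p) →
    (H : FiniteGroup) → IsPGroup p H → NonAbelian H → Metacyclic H →
    (Γ : Graph) → Connected Γ → Cubic Γ → EdgeTransitive Γ →
    (A : BiCayleyAction H Γ) →
    (p ≡ 3) × (Iso Γ GrayGraph ⊎ NormalBiCayley A)
theorem1p1 p pp ¬2∣p H pg nonabelian meta Γ conn cubic et A = go (p ℕ≟ 3)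
  where
  go : Dec (p ≡ 3) → (p ≡ 3) × (Iso Γ GrayGraph ⊎ NormalBiCayley A)
  go (yes refl) = refl , PrimeThree.classification H pg nonabelian Γ conn cubic et A meta
  go (no p≢3) = ⊥-elim (NoBigPrime.contradiction-for p pp (proj₁ (odd⇒ p ¬2∣p)) (proj₂ (odd⇒ p ¬2∣p))
    (λ d → ¬2∣p (subst (2 ∣_) (sym (prime∣prime pp (toWitness {a? = prime? 2} tt) d)) ∣-refl))
    (λ d → p≢3 (prime∣prime pp (toWitness {a? = prime? 3} tt) d)) H pg nonabelian Γ conn cubic et A meta)
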